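{- Let $m\ge2$ and let $\mathcal{H}\in\mathcal{P}(\mathcal{H})$ be a connected unicyclic ($m$-uniform linear) hypergraph with $k$ edges whose cycle has length $l$. Suppose $(k-l-6)(m-1)\ge20$. Then: (i) If $\mathcal{H}\ne UC_l(c_1=k-l)$, then $\lambda_1(\mathcal{H})\le\lambda_1(UC_l(c_1=k-l-1,c_2=1))$, and equality holds only when $\mathcal{H}=UC_l(c_1=k-l-1,c_2=1)$. (ii) $\lambda_1(UC_l(c_1=k-l-1,c_2=1))<\dfrac{m+\sqrt{m^2+4(k-l+1)(m-1)}}{2m-2}$.
   Context: A hypergraph has a finite vertex set and an edge set of non-empty subsets of the vertex set; it is $m$-uniform if all edges have cardinality $m$, and linear if two distinct edges share at most one vertex. The adjacency matrix of a linear $m$-uniform hypergraph has $(i,j)$ entry $\frac{1}{m-1}$ if $i\ne j$ lie in a common edge, and $0$ otherwise; $\lambda_1$ denotes the spectral radius of this matrix. The $m$-th power hypergraph of a graph $G(V,E)$ is the $m$-uniform hypergraph obtained by adding to each edge $e\in E$ $m-2$ new vertices $v_{e,1},\dots,v_{e,m-2}$ (distinct for distinct edges). $\mathcal{P}(\mathcal{H})$ denotes the set of $m$-th power hypergraphs of graphs (this is a fixed notation for the set and does not depend on the particular hypergraph $\mathcal{H}$). A loose cycle of length $l\ge3$, $C_L(l)=v_1e_1v_2e_2\dots v_le_lv_1$, is the $m$-uniform hypergraph with edges $e_1,\dots,e_l$ in which $e_{i-1}\cap e_i=\{v_i\}$ (indices mod $l$, the $v_i$ distinct) and non-consecutive edges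 are disjoint; $v_1,\dots,v_l$ are its core vertices. A linear hypergraph is unicyclic if it contains exactly one loose cycle. Attaching a pendant edge at a vertex $v$ means adding a new edge consisting of $v$ and $m-1$ new vertices. $UC_l(c_1,\dots,c_l)$ is obtained from $C_L(l)$ by attaching $c_i$ pendant edges at $v_i$ for $i=1,\dots,l$; when only some of the $c_i$ are listed, the others are $0$. Equality of hypergraphs means isomorphism. -}

module Defs where

open import Data.Bool.Base using (if_then_else_)
open import Data.Empty using (⊥; ⊥-elim)
open import Data.Fin.Base using (Fin; zero; suc; toℕ)
open import Data.Fin.Properties as Fin using (any?; +↔⊎; *↔×; toℕ<n)
open import Data.Fin.Subset using (∣_∣)
open import Data.Integer.Base as ℤ using (+_)
import Data.Integer.Properties as ℤ
open import Data.Nat.Base as ℕ using (ℕ; zero; suc; _∸_; s≤s; z≤n)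
open import Data.Nat.DivMod using (_mod_; _%_; m%n<n; m<n⇒m%n≡m; n%n≡0)
import Data.Nat.Properties as ℕ
open import Data.Nat.Solver using (module +-*-Solver)
open import Data.Product.Base using (Σ; ∃; _×_; _,_; proj₁; proj₂)
import Data.Product.Function.Dependent.Propositional as ΣP
open import Data.Product.Function.NonDependent.Propositional using (_×-↔_)
open import Data.Rational.Base as ℚ using (ℚ; 0ℚ; 1ℚ)
import Data.Rational.Properties as ℚ
import Data.Rational.Unnormalised.Properties as ℚᵘ
import Data.Rational.Solver as ℚ-Solver
open import Data.Rational.Unnormalised.Base as ℚᵘ using (mkℚᵘ)
open import Data.Sum.Base using (_⊎_; inj₁; inj₂; [_,_]′)
open import Data.Sum.Function.Propositional using (_⊎-↔_)
open import Data.Vec.Base using (tabulate)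
open import Function.Base using (_∘_; const)
open import Function.Bundles using (_↔_; _⇔_; mk↔ₛ′; Inverse; Equivalence)
open import Function.Properties.Inverse using (↔-refl; ↔-trans)
open import Relation.Binary.Construct.Closure.ReflexiveTransitive using (Star)
open import Relation.Binary.Definitions using (Decidable; DecidableEquality)
open import Relation.Binary.PropositionalEquality
  using (_≡_; _≢_; refl; sym; trans; cong; cong₂; subst; subst₂)
open import Relation.Nullary using (¬_; Dec; yes; no; does; contradiction)
open import Relation.Nullary.Decidable using (map′; _×-dec_; _⊎-dec_; ¬?)

IsCauchy : (ℕ → ℚ) → Set
IsCauchy x = ∀ ε → 0ℚ ℚ.< ε →
  ∃ λ N → ∀ i j → N ℕ.≤ i → N ℕ.≤ j → ℚ.∣ x i ℚ.- x j ∣ ℚ.≤ ε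

-- Real numbers are Cauchy sequences, identified up to _≃_.
record ℝ : Set where
  constructor mkℝ
  field
    seq    : ℕ → ℚ
    cauchy : IsCauchy seq

open ℝ public

infix 4 _≃_ _<_ _≤_ _#_

_≃_ : ℝ → ℝ → Set
x ≃ y = ∀ ε → 0ℚ ℚ.< ε →
  ∃ λ N → ∀ i → N ℕ.≤ i → ℚ.∣ seq x i ℚ.- seq y i ∣ ℚ.≤ ε

_<_ : ℝ → ℝ → Set
x < y = ∃ λ ε → 0ℚ ℚ.< ε ×
  ∃ λ N → ∀ i → N ℕ.≤ i → seq x i ℚ.+ ε ℚ.≤ seq y i

_≤_ : ℝ → ℝ → Set
x ≤ y = ¬ (y < x)

-- Apartness, the constructive form of x ≠ y.
_#_ : ℝ → ℝ → Set
x # y = x < y ⊎ y < x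

∣⇄∣ : ∀ p q → ℚ.∣ p ℚ.- q ∣ ≡ ℚ.∣ q ℚ.- p ∣
∣⇄∣ p q = trans (sym (ℚ.∣-p∣≡∣p∣ (p ℚ.- q))) (cong ℚ.∣_∣ (solve 2 (λ a b → :- (a :- b) := b :- a) refl p q))
  where open ℚ-Solver.+-*-Solver

½ε>0 : ∀ {ε} → 0ℚ ℚ.< ε → 0ℚ ℚ.< ε ℚ.* ℚ.½
½ε>0 {ε} 0<ε = ℚ.positive⁻¹ (ε ℚ.* ℚ.½) {{ℚ.pos*pos⇒pos ε {{ℚ.positive 0<ε}} ℚ.½}}

½+½ : ∀ ε → ε ℚ.* ℚ.½ ℚ.+ ε ℚ.* ℚ.½ ≡ ε
½+½ ε = trans (sym (ℚ.*-distribˡ-+ ε ℚ.½ ℚ.½)) (ℚ.*-identityʳ ε)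

const-cauchy : ∀ q → IsCauchy (const q)
const-cauchy q ε 0<ε = 0 , λ _ _ _ _ →
  subst (ℚ._≤ ε) (cong ℚ.∣_∣ (sym (ℚ.+-inverseʳ q))) (ℚ.<⇒≤ 0<ε)

+-cauchy : ∀ x y → IsCauchy (λ n → seq x n ℚ.+ seq y n)
+-cauchy x y ε 0<ε = M ℕ.⊔ N , λ i j p q → begin
    ℚ.∣ (seq x i ℚ.+ seq y i) ℚ.- (seq x j ℚ.+ seq y j) ∣
      ≡⟨ cong ℚ.∣_∣ (solve 4 (λ a b c d → (a :+ b) :- (c :+ d) := (a :- c) :+ (b :- d))
           refl (seq x i) (seq y i) (seq x j) (seq y j)) ⟩
    ℚ.∣ (seq x i ℚ.- seq x j) ℚ.+ (seq y i ℚ.- seq y j) ∣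
      ≤⟨ ℚ.∣p+q∣≤∣p∣+∣q∣ (seq x i ℚ.- seq x j) (seq y i ℚ.- seq y j) ⟩
    ℚ.∣ seq x i ℚ.- seq x j ∣ ℚ.+ ℚ.∣ seq y i ℚ.- seq y j ∣
      ≤⟨ ℚ.+-mono-≤ (hx i j (ℕ.m⊔n≤o⇒m≤o M N p) (ℕ.m⊔n≤o⇒m≤o M N q))
                    (hy i j (ℕ.m⊔n≤o⇒n≤o M N p) (ℕ.m⊔n≤o⇒n≤o M N q)) ⟩
    ε ℚ.* ℚ.½ ℚ.+ ε ℚ.* ℚ.½
      ≡⟨ ½+½ ε ⟩
    ε ∎
  where
  open ℚ.≤-Reasoning
  open ℚ-Solver.+-*-Solver
  cx = cauchy x _ (½ε>0 0<ε)
  cy = cauchy y _ (½ε>0 0<ε)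
  M = proj₁ cx
  N = proj₁ cy
  hx = proj₂ cx
  hy = proj₂ cy

neg-cauchy : ∀ x → IsCauchy (λ n → ℚ.- seq x n)
neg-cauchy x ε 0<ε = proj₁ cx , λ i j p q →
    subst (ℚ._≤ ε)
      (trans (∣⇄∣ (seq x i) (seq x j))
        (cong ℚ.∣_∣ (solve 2 (λ a b → b :- a := (:- a) :- (:- b)) refl (seq x i) (seq x j))))
      (proj₂ cx i j p q)
  where
  open ℚ-Solver.+-*-Solver
  cx = cauchy x ε 0<ε

bounded : ∀ x → ∃ λ K → 0ℚ ℚ.< K × ∃ λ N → ∀ i → N ℕ.≤ i → ℚ.∣ seq x i ∣ ℚ.≤ K
bounded x = K , 0<K , N , λ i N≤i → begin
    ℚ.∣ seq x i ∣
      ≡⟨ cong ℚ.∣_∣ (solve 2 (λ a b → a := b :+ (a :- b)) refl (seq x i) (seq x N)) ⟩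
    ℚ.∣ seq x N ℚ.+ (seq x i ℚ.- seq x N) ∣
      ≤⟨ ℚ.∣p+q∣≤∣p∣+∣q∣ (seq x N) (seq x i ℚ.- seq x N) ⟩
    ℚ.∣ seq x N ∣ ℚ.+ ℚ.∣ seq x i ℚ.- seq x N ∣
      ≤⟨ ℚ.+-monoʳ-≤ ℚ.∣ seq x N ∣ (proj₂ cx i N N≤i ℕ.≤-refl) ⟩
    K ∎
  where
  open ℚ.≤-Reasoning
  open ℚ-Solver.+-*-Solver
  cx = cauchy x 1ℚ (ℚ.positive⁻¹ 1ℚ)
  N = proj₁ cx
  K = ℚ.∣ seq x N ∣ ℚ.+ 1ℚ
  0<K : 0ℚ ℚ.< K
  0<K = ℚ.+-mono-≤-< (ℚ.0≤∣p∣ (seq x N)) (ℚ.positive⁻¹ 1ℚ)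

*-cauchy : ∀ x y → IsCauchy (λ n → seq x n ℚ.* seq y n)
*-cauchy x y ε 0<ε = N , λ i j p q → begin
    ℚ.∣ seq x i ℚ.* seq y i ℚ.- seq x j ℚ.* seq y j ∣
      ≡⟨ cong ℚ.∣_∣ (solve 4 (λ a b c d → a :* b :- c :* d := a :* (b :- d) :+ (a :- c) :* d)
           refl (seq x i) (seq y i) (seq x j) (seq y j)) ⟩
    ℚ.∣ seq x i ℚ.* (seq y i ℚ.- seq y j) ℚ.+ (seq x i ℚ.- seq x j) ℚ.* seq y j ∣
      ≤⟨ ℚ.∣p+q∣≤∣p∣+∣q∣ (seq x i ℚ.* (seq y i ℚ.- seq y j)) ((seq x i ℚ.- seq x j) ℚ.* seq y j) ⟩
    ℚ.∣ seq x i ℚ.* (seq y i ℚ.- seq y j) ∣ ℚ.+ ℚ.∣ (seq x i ℚ.- seq x j) ℚ.* seq y j ∣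
      ≡⟨ cong₂ ℚ._+_ (ℚ.∣p*q∣≡∣p∣*∣q∣ (seq x i) (seq y i ℚ.- seq y j))
                     (ℚ.∣p*q∣≡∣p∣*∣q∣ (seq x i ℚ.- seq x j) (seq y j)) ⟩
    ℚ.∣ seq x i ∣ ℚ.* ℚ.∣ seq y i ℚ.- seq y j ∣ ℚ.+ ℚ.∣ seq x i ℚ.- seq x j ∣ ℚ.* ℚ.∣ seq y j ∣
      ≤⟨ ℚ.+-mono-≤
           (mul (ℚ.0≤∣p∣ (seq x i)) (ℚ.<⇒≤ 0<δ) (hKx i (Mx≤ p)) (proj₂ cy i j (Ny≤ p) (Ny≤ q)))
           (mul (ℚ.0≤∣p∣ (seq x i ℚ.- seq x j)) (ℚ.<⇒≤ 0<Ky)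
                (proj₂ cx i j (Nx≤ p) (Nx≤ q)) (hKy j (My≤ q))) ⟩
    Kx ℚ.* δ ℚ.+ δ ℚ.* Ky
      ≡⟨ solve 3 (λ a b d → a :* d :+ d :* b := d :* (a :+ b)) refl Kx Ky δ ⟩
    δ ℚ.* K
      ≡⟨ ℚ.*-assoc ε (ℚ.1/ K) K ⟩
    ε ℚ.* (ℚ.1/ K ℚ.* K)
      ≡⟨ trans (cong (ε ℚ.*_) (ℚ.*-inverseˡ K)) (ℚ.*-identityʳ ε) ⟩
    ε ∎
  where
  open ℚ.≤-Reasoning
  open ℚ-Solver.+-*-Solver
  bx = bounded x
  by = bounded y
  Kx = proj₁ bx
  Ky = proj₁ by
  Mx = proj₁ (proj₂ (proj₂ bx))
  My = proj₁ (proj₂ (proj₂ by))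
  hKx = proj₂ (proj₂ (proj₂ bx))
  hKy = proj₂ (proj₂ (proj₂ by))
  0<Ky = proj₁ (proj₂ by)
  K = Kx ℚ.+ Ky
  instance
    K>0 : ℚ.Positive K
    K>0 = ℚ.positive (ℚ.+-mono-< (proj₁ (proj₂ bx)) 0<Ky)
    K≢0 : ℚ.NonZero K
    K≢0 = ℚ.pos⇒nonZero K
  δ = ε ℚ.* ℚ.1/ K
  0<δ : 0ℚ ℚ.< δ
  0<δ = ℚ.positive⁻¹ δ {{ℚ.pos*pos⇒pos ε {{ℚ.positive 0<ε}} (ℚ.1/ K) {{ℚ.1/pos⇒pos K}}}}
  cx = cauchy x δ 0<δ
  cy = cauchy y δ 0<δ
  Nx = proj₁ cx
  Ny = proj₁ cy
  N = (Mx ℕ.⊔ My) ℕ.⊔ (Nx ℕ.⊔ Ny)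
  Mx≤ : ∀ {i} → N ℕ.≤ i → Mx ℕ.≤ i
  Mx≤ p = ℕ.m⊔n≤o⇒m≤o Mx My (ℕ.m⊔n≤o⇒m≤o (Mx ℕ.⊔ My) (Nx ℕ.⊔ Ny) p)
  My≤ : ∀ {i} → N ℕ.≤ i → My ℕ.≤ i
  My≤ p = ℕ.m⊔n≤o⇒n≤o Mx My (ℕ.m⊔n≤o⇒m≤o (Mx ℕ.⊔ My) (Nx ℕ.⊔ Ny) p)
  Nx≤ : ∀ {i} → N ℕ.≤ i → Nx ℕ.≤ i
  Nx≤ p = ℕ.m⊔n≤o⇒m≤o Nx Ny (ℕ.m⊔n≤o⇒n≤o (Mx ℕ.⊔ My) (Nx ℕ.⊔ Ny) p)
  Ny≤ : ∀ {i} → N ℕ.≤ i → Ny ℕ.≤ i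
  Ny≤ p = ℕ.m⊔n≤o⇒n≤o Nx Ny (ℕ.m⊔n≤o⇒n≤o (Mx ℕ.⊔ My) (Nx ℕ.⊔ Ny) p)
  mul : ∀ {a b c d} → 0ℚ ℚ.≤ a → 0ℚ ℚ.≤ d → a ℚ.≤ c → b ℚ.≤ d → a ℚ.* b ℚ.≤ c ℚ.* d
  mul {a} {b} {c} {d} 0≤a 0≤d a≤c b≤d = ℚ.≤-trans
    (ℚ.*-monoˡ-≤-nonNeg a {{ℚ.nonNegative 0≤a}} b≤d)
    (ℚ.*-monoʳ-≤-nonNeg d {{ℚ.nonNegative 0≤d}} a≤c)

infixl 6 _+_ _-_
infixl 7 _*_
infix  8 -_

fromℚ : ℚ → ℝ
fromℚ q = mkℝ (const q) (const-cauchy q)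

fromℕ : ℕ → ℝ
fromℕ n = fromℚ (+ n ℚ./ 1)

0ℝ : ℝ
0ℝ = fromℚ 0ℚ

_+_ : ℝ → ℝ → ℝ
x + y = mkℝ (λ n → seq x n ℚ.+ seq y n) (+-cauchy x y)

-_ : ℝ → ℝ
- x = mkℝ (λ n → ℚ.- seq x n) (neg-cauchy x)

_-_ : ℝ → ℝ → ℝ
x - y = x + (- y)

_*_ : ℝ → ℝ → ℝ
x * y = mkℝ (λ n → seq x n ℚ.* seq y n) (*-cauchy x y)

-- 1/n, with the convention 1/0 = 0.
recip : ℕ → ℝ
recip zero    = 0ℝ
recip (suc n) = fromℚ (+ 1 ℚ./ suc n)

∑ : ∀ {n} → (Fin n → ℝ) → ℝ
∑ {zero}  f = 0ℝ
∑ {suc n} f = f zero + ∑ (f ∘ suc)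

-- ⌊√n⌋
isqrt : ℕ → ℕ
isqrt zero = zero
isqrt (suc n) with suc (isqrt n) ℕ.* suc (isqrt n) ℕ.≤? suc n
... | yes _ = suc (isqrt n)
... | no  _ = isqrt n

isqrt-lower : ∀ n → isqrt n ℕ.* isqrt n ℕ.≤ n
isqrt-lower zero = z≤n
isqrt-lower (suc n) with suc (isqrt n) ℕ.* suc (isqrt n) ℕ.≤? suc n
... | yes p = p
... | no  _ = ℕ.m≤n⇒m≤1+n (isqrt-lower n)

isqrt-upper : ∀ n → n ℕ.< suc (isqrt n) ℕ.* suc (isqrt n)
isqrt-upper zero = s≤s z≤n
isqrt-upper (suc n) with suc (isqrt n) ℕ.* suc (isqrt n) ℕ.≤? suc n
... | yes _ = ℕ.≤-<-trans (isqrt-upper n) (ℕ.*-mono-< (ℕ.n<1+n (suc (isqrt n))) (ℕ.n<1+n (suc (isqrt n))))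
... | no  p = ℕ.≰⇒> p

-- ⌊√(n (i+1)²)⌋ / (i+1)
√-seq : ℕ → ℕ → ℚ
√-seq n i = + isqrt (n ℕ.* (suc i ℕ.* suc i)) ℚ./ suc i

√-step : ∀ n i j → √-seq n i ℚ.≤ √-seq n j ℚ.+ (+ 1 ℚ./ suc j)
√-step n i j = ℚ.toℚᵘ-cancel-≤ (begin
    ℚ.toℚᵘ (√-seq n i)                        ≃⟨ ℚ.toℚᵘ-fromℚᵘ (mkℚᵘ (+ a) i) ⟩
    mkℚᵘ (+ a) i                              ≤⟨ ℚᵘ.*≤* cross ⟩
    mkℚᵘ (+ b) j ℚᵘ.+ mkℚᵘ (+ 1) j            ≃⟨ ℚᵘ.+-cong (ℚ.toℚᵘ-fromℚᵘ (mkℚᵘ (+ b) j)) (ℚ.toℚᵘ-fromℚᵘ (mkℚᵘ (+ 1) j)) ⟨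
    ℚ.toℚᵘ (√-seq n j) ℚᵘ.+ ℚ.toℚᵘ (+ 1 ℚ./ J) ≃⟨ ℚ.toℚᵘ-homo-+ (√-seq n j) (+ 1 ℚ./ J) ⟨
    ℚ.toℚᵘ (√-seq n j ℚ.+ (+ 1 ℚ./ J))        ∎)
  where
  open ℚᵘ.≤-Reasoning
  open +-*-Solver
  I J a b : ℕ
  I = suc i
  J = suc j
  a = isqrt (n ℕ.* (I ℕ.* I))
  b = isqrt (n ℕ.* (J ℕ.* J))
  aJ≤bI : a ℕ.* J ℕ.≤ suc b ℕ.* I
  aJ≤bI with a ℕ.* J ℕ.≤? suc b ℕ.* I
  ... | yes p = p
  ... | no  p = contradiction (ℕ.<-≤-trans (ℕ.*-mono-< (ℕ.≰⇒> p) (ℕ.≰⇒> p)) squares) (ℕ.<-irrefl refl)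
    where
    squares : (a ℕ.* J) ℕ.* (a ℕ.* J) ℕ.≤ (suc b ℕ.* I) ℕ.* (suc b ℕ.* I)
    squares = ℕ.≤-trans
      (ℕ.≤-reflexive (solve 2 (λ x y → (x :* y) :* (x :* y) := (x :* x) :* (y :* y)) refl a J))
      (ℕ.≤-trans (ℕ.*-monoˡ-≤ (J ℕ.* J) (isqrt-lower (n ℕ.* (I ℕ.* I))))
      (ℕ.≤-trans (ℕ.≤-reflexive (solve 3 (λ n x y → (n :* (x :* x)) :* (y :* y) := (n :* (y :* y)) :* (x :* x)) refl n I J))
      (ℕ.≤-trans (ℕ.*-monoˡ-≤ (I ℕ.* I) (ℕ.<⇒≤ (isqrt-upper (n ℕ.* (J ℕ.* J)))))
      (ℕ.≤-reflexive (solve 2 (λ x y → (x :* x) :* (y :* y) := (x :* y) :* (x :* y)) refl (suc b) I)))))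
  cross : + a ℤ.* + (J ℕ.* J) ℤ.≤ (+ b ℤ.* + J ℤ.+ + 1 ℤ.* + J) ℤ.* + I
  cross = subst₂ ℤ._≤_ (ℤ.pos-* a (J ℕ.* J))
    (trans (ℤ.pos-* (b ℕ.* J ℕ.+ 1 ℕ.* J) I)
      (cong (ℤ._* + I) (cong₂ ℤ._+_ (ℤ.pos-* b J) (ℤ.pos-* 1 J))))
    (ℤ.+≤+ (ℕ.≤-trans
      (ℕ.≤-reflexive (sym (ℕ.*-assoc a J J)))
      (ℕ.≤-trans (ℕ.*-monoˡ-≤ J aJ≤bI)
      (ℕ.≤-reflexive (solve 3 (λ b x y → ((con 1 :+ b) :* x) :* y := (b :* y :+ con 1 :* y) :* x) refl b I J)))))

archimedean : ∀ ε → 0ℚ ℚ.< ε → ∃ λ N → ∀ j → N ℕ.≤ j → + 1 ℚ./ suc j ℚ.≤ ε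
archimedean (ℚ.mkℚ (+ zero) d c) (ℚ.*<* (ℤ.+<+ ()))
archimedean (ℚ.mkℚ (ℤ.-[1+ _ ]) d c) (ℚ.*<* ())
archimedean ε@(ℚ.mkℚ (+ suc p) d c) _ = d , λ j d≤j → ℚ.toℚᵘ-cancel-≤ (begin
    ℚ.toℚᵘ (+ 1 ℚ./ suc j)  ≃⟨ ℚ.toℚᵘ-fromℚᵘ (mkℚᵘ (+ 1) j) ⟩
    mkℚᵘ (+ 1) j            ≤⟨ ℚᵘ.*≤* (subst₂ ℤ._≤_ (ℤ.pos-* 1 (suc d)) (ℤ.pos-* (suc p) (suc j))
                                 (ℤ.+≤+ (ℕ.*-mono-≤ (s≤s (z≤n {p})) (s≤s d≤j)))) ⟩
    mkℚᵘ (+ suc p) d        ∎)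
  where open ℚᵘ.≤-Reasoning

abs-≤ : ∀ {p q ε} → p ℚ.≤ q ℚ.+ ε → q ℚ.≤ p ℚ.+ ε → ℚ.∣ p ℚ.- q ∣ ℚ.≤ ε
abs-≤ {p} {q} {ε} p≤q+ε q≤p+ε =
    [ (λ eq → subst (ℚ._≤ ε) (sym eq) (shift p q p≤q+ε))
    , (λ eq → subst (ℚ._≤ ε) (trans (solve 2 (λ a b → b :- a := :- (a :- b)) refl p q) (sym eq)) (shift q p q≤p+ε))
    ]′ (ℚ.∣p∣≡p∨∣p∣≡-p (p ℚ.- q))
  where
  open ℚ-Solver.+-*-Solver
  shift : ∀ a b → a ℚ.≤ b ℚ.+ ε → a ℚ.- b ℚ.≤ ε
  shift a b h = subst (a ℚ.- b ℚ.≤_)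
    (solve 2 (λ b e → (b :+ e) :- b := e) refl b ε) (ℚ.+-monoˡ-≤ (ℚ.- b) h)

√-cauchy : ∀ n → IsCauchy (√-seq n)
√-cauchy n ε 0<ε = N , λ i j N≤i N≤j → abs-≤
    (ℚ.≤-trans (√-step n i j) (ℚ.+-monoʳ-≤ (√-seq n j) (small j N≤j)))
    (ℚ.≤-trans (√-step n j i) (ℚ.+-monoʳ-≤ (√-seq n i) (small i N≤i)))
  where
  N = proj₁ (archimedean ε 0<ε)
  small = proj₂ (archimedean ε 0<ε)

infix 9 √_

√_ : ℕ → ℝ
√ n = mkℝ (√-seq n) (√-cauchy n)

record ℂ : Set where
  constructor _+i_
  field
    re im : ℝ

open ℂ public

infix 4 _≃ᶜ_
infixl 7 _*ᶜ_

_≃ᶜ_ : ℂ → ℂ → Set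
z ≃ᶜ w = re z ≃ re w × im z ≃ im w

_*ᶜ_ : ℂ → ℂ → ℂ
z *ᶜ w = (re z * re w - im z * im w) +i (re z * im w + im z * re w)

normSq : ℂ → ℝ
normSq z = re z * re z + im z * im z

Matrix : ℕ → Set
Matrix n = Fin n → Fin n → ℝ

_*ᵛ_ : ∀ {n} → Matrix n → (Fin n → ℂ) → (Fin n → ℂ)
(A *ᵛ x) i = ∑ (λ j → A i j * re (x j)) +i ∑ (λ j → A i j * im (x j))

IsEigenvalue : ∀ {n} → Matrix n → ℂ → Set
IsEigenvalue {n} A z = Σ (Fin n → ℂ) λ x →
  (∃ λ i → re (x i) # 0ℝ ⊎ im (x i) # 0ℝ) ×
  (∀ i → (A *ᵛ x) i ≃ᶜ z *ᶜ x i)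

-- The largest modulus of an eigenvalue; moduli are compared through
-- their squares, as 0 ≤ ρ.
IsSpectralRadius : ∀ {n} → Matrix n → ℝ → Set
IsSpectralRadius A ρ =
  0ℝ ≤ ρ ×
  (∃ λ z → IsEigenvalue A z × normSq z ≃ ρ * ρ) ×
  (∀ z → IsEigenvalue A z → normSq z ≤ ρ * ρ)

record Finite (A : Set) : Set where
  constructor mkFinite
  field
    size : ℕ
    enum : Fin size ↔ A

  element : Fin size → A
  element = Inverse.to enum

  index : A → Fin size
  index = Inverse.from enum

open Finite

Fin-finite : ∀ n → Finite (Fin n)
Fin-finite n = mkFinite n ↔-refl

⊎-finite : ∀ {A B} → Finite A → Finite B → Finite (A ⊎ B)
⊎-finite F G = mkFinite (size F ℕ.+ size G) (↔-trans +↔⊎ (enum F ⊎-↔ enum G))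

×-finite : ∀ {A B} → Finite A → Finite B → Finite (A × B)
×-finite F G = mkFinite (size F ℕ.* size G) (↔-trans *↔× (enum F ×-↔ enum G))

ΣFin-finite : ∀ n {B : Fin n → Set} → (∀ i → Finite (B i)) → Finite (Σ (Fin n) B)
ΣFin-finite zero    F = mkFinite 0 (mk↔ₛ′ (λ ()) (λ { (() , _) }) (λ { (() , _) }) (λ ()))
ΣFin-finite (suc n) {B} F = mkFinite (size rest) (↔-trans (enum rest) split)
  where
  rest = ⊎-finite (F zero) (ΣFin-finite n (F ∘ suc))
  split : (B zero ⊎ Σ (Fin n) (B ∘ suc)) ↔ Σ (Fin (suc n)) B
  split = mk↔ₛ′
    (λ { (inj₁ b) → zero , b ; (inj₂ (i , b)) → suc i , b })
    (λ { (zero , b) → inj₁ b ; (suc i , b) → inj₂ (i , b) })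
    (λ { (zero , b) → refl ; (suc i , b) → refl })
    (λ { (inj₁ b) → refl ; (inj₂ (i , b)) → refl })

Σ-finite : ∀ {A} {B : A → Set} → Finite A → (∀ a → Finite (B a)) → Finite (Σ A B)
Σ-finite {A} {B} F G = mkFinite (size ΣF) (↔-trans (enum ΣF) reindex)
  where
  ΣF = ΣFin-finite (size F) (G ∘ element F)
  reindex : Σ (Fin (size F)) (B ∘ element F) ↔ Σ A B
  reindex = ΣP.Σ-↔ (enum F) ↔-refl

injective : ∀ {A} (F : Finite A) {x y : A} → index F x ≡ index F y → x ≡ y
injective F {x} {y} eq =
  trans (sym (Inverse.strictlyInverseˡ (enum F) x))
    (trans (cong (element F) eq) (Inverse.strictlyInverseˡ (enum F) y))

decEq : ∀ {A} → Finite A → DecidableEquality A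
decEq F x y = map′ (injective F) (cong (index F)) (index F x Fin.≟ index F y)

search : ∀ {A} {P : A → Set} → Finite A → (∀ a → Dec (P a)) → Dec (∃ P)
search {P = P} F P? = map′
  (λ (i , p) → element F i , p)
  (λ (a , p) → index F a , subst P (sym (Inverse.strictlyInverseˡ (enum F) a)) p)
  (any? (P? ∘ element F))

-- Edges are non-empty sets of vertices: an edge is determined by its
-- vertices (`extensional`), so there are no repeated edges.
record Hypergraph : Set₁ where
  infix 4 _∈_ _∈?_
  field
    V E         : Set
    V-finite    : Finite V
    E-finite    : Finite E
    _∈_         : V → E → Set
    _∈?_        : Decidable _∈_
    nonempty    : ∀ e → ∃ λ v → v ∈ e
    extensional : ∀ {e f} → (∀ v → v ∈ e ⇔ v ∈ f) → e ≡ f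

  order : ℕ
  order = size V-finite

  #edges : ℕ
  #edges = size E-finite

  vertex : Fin order → V
  vertex = element V-finite

  cardinality : E → ℕ
  cardinality e = ∣ tabulate (λ i → does (vertex i ∈? e)) ∣

  Adjacent : V → V → Set
  Adjacent u v = u ≢ v × ∃ λ e → u ∈ e × v ∈ e

  adjacent? : Decidable Adjacent
  adjacent? u v =
    ¬? (decEq V-finite u v) ×-dec search E-finite (λ e → (u ∈? e) ×-dec (v ∈? e))

  Uniform : ℕ → Set
  Uniform m = ∀ e → cardinality e ≡ m

  Linear : Set
  Linear = ∀ {e f} → e ≢ f → ∀ {u v} → u ∈ e → u ∈ f → v ∈ e → v ∈ f → u ≡ v

  Connected : Set
  Connected = ∀ u v → Star Adjacent u v

open Hypergraph using (Uniform; Linear; Connected; #edges; order)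

record _≅_ (G H : Hypergraph) : Set where
  private
    module G = Hypergraph G
    module H = Hypergraph H
  field
    onV      : G.V ↔ H.V
    onE      : G.E ↔ H.E
    incident : ∀ v e → v G.∈ e ⇔ Inverse.to onV v H.∈ Inverse.to onE e

infix 4 _≅_

-- Meant for H linear and m-uniform.
adjacencyMatrix : ℕ → (H : Hypergraph) → Matrix (order H)
adjacencyMatrix m H i j = if does (adjacent? (vertex i) (vertex j)) then recip (m ∸ 1) else 0ℝ
  where open Hypergraph H

Isλ₁ : ℕ → Hypergraph → ℝ → Set
Isλ₁ m H ρ = IsSpectralRadius (adjacencyMatrix m H) ρ

-- inj₂ (e , j) is the new vertex v_{e,j}.
power : ℕ → Hypergraph → Hypergraph
power m G = record
  { V           = V ⊎ (E × Fin (m ∸ 2))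
  ; E           = E
  ; V-finite    = ⊎-finite V-finite (×-finite E-finite (Fin-finite (m ∸ 2)))
  ; E-finite    = E-finite
  ; _∈_         = _∈′_
  ; _∈?_        = λ { (inj₁ v) e → v ∈? e ; (inj₂ (f , _)) e → decEq E-finite f e }
  ; nonempty    = λ e → inj₁ (proj₁ (nonempty e)) , proj₂ (nonempty e)
  ; extensional = λ h → extensional (h ∘ inj₁)
  }
  where
  open Hypergraph G
  _∈′_ : V ⊎ (E × Fin (m ∸ 2)) → E → Set
  inj₁ v       ∈′ e = v ∈ e
  inj₂ (f , _) ∈′ e = f ≡ e

-- Graphs are the 2-uniform hypergraphs.
IsPower : ℕ → Hypergraph → Set₁
IsPower m H = ∃ λ G → Uniform G 2 × H ≅ power m G

next : ∀ {l} → Fin l → Fin l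
next {suc l} i = suc (toℕ i) mod suc l

-- A loose cycle contained in H. With v and e for core and edge,
-- e i ∩ e (i+1) = { v (i+1) } and indices are taken modulo l.
record LooseCycleIn (H : Hypergraph) (l : ℕ) : Set where
  open Hypergraph H
  field
    3≤l            : 3 ℕ.≤ l
    core           : Fin l → V
    edge           : Fin l → E
    core-injective : ∀ {i j} → core i ≡ core j → i ≡ j
    consecutive    : ∀ i v → (v ∈ edge i × v ∈ edge (next i)) ⇔ v ≡ core (next i)
    disjoint       : ∀ {i j} → i ≢ j → next i ≢ j → next j ≢ i →
                     ∀ v → ¬ (v ∈ edge i × v ∈ edge j)

-- Cycles are identified with the subhypergraphs they form, that is,
-- with their edge sets.
SameCycle : ∀ {H l l′} → LooseCycleIn H l → LooseCycleIn H l′ → Set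
SameCycle {H} C D = ∀ e → (∃ λ i → LooseCycleIn.edge C i ≡ e) ⇔ (∃ λ i → LooseCycleIn.edge D i ≡ e)

UnicyclicOfLength : Hypergraph → ℕ → Set
UnicyclicOfLength H l =
  Σ (LooseCycleIn H l) λ C → ∀ {l′} (D : LooseCycleIn H l′) → SameCycle C D

toℕ-next : ∀ {l} (i : Fin (suc l)) → toℕ (next i) ≡ suc (toℕ i) % suc l
toℕ-next {l} i = Fin.toℕ-fromℕ< (m%n<n (suc (toℕ i)) (suc l))

next-cases : ∀ {l} (i : Fin (suc l)) →
  toℕ (next i) ≡ suc (toℕ i) ⊎ (toℕ i ≡ l × toℕ (next i) ≡ 0)
next-cases {l} i with ℕ.m≤n⇒m<n∨m≡n (toℕ<n i)
... | inj₁ p  = inj₁ (trans (toℕ-next i) (m<n⇒m%n≡m p))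
... | inj₂ eq = inj₂ (ℕ.suc-injective eq ,
                      trans (toℕ-next i) (trans (cong (_% suc l) eq) (n%n≡0 (suc l))))

next²≢ : ∀ {l} → 3 ℕ.≤ l → (i : Fin l) → next (next i) ≢ i
next²≢ {suc l} (s≤s 2≤l) i eq with next-cases i | next-cases (next i)
... | inj₁ p       | inj₁ q       = ℕ.m≢1+n+m (toℕ i) {1} (trans (sym (cong toℕ eq)) (trans q (cong suc p)))
... | inj₁ p       | inj₂ (q , r) = ℕ.<⇒≢ 2≤l (trans (cong suc (trans (sym r) (cong toℕ eq))) (trans (sym p) q))
... | inj₂ (p , r) | inj₁ q       = ℕ.<⇒≢ 2≤l (trans (sym (trans q (cong suc r))) (trans (cong toℕ eq) p))
... | inj₂ (p , r) | inj₂ (q , _) = ℕ.<⇒≢ (ℕ.<-trans (s≤s z≤n) 2≤l) (trans (sym r) q)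

-- C_L(l) as an m-uniform hypergraph: inj₁ i is the core vertex vᵢ, and
-- the edge eᵢ consists of vᵢ, vᵢ₊₁ and the m-2 vertices inj₂ (i , _).
looseCycle : (m l : ℕ) → 3 ℕ.≤ l → Hypergraph
looseCycle m l 3≤l = record
  { V           = Fin l ⊎ (Fin l × Fin (m ∸ 2))
  ; E           = Fin l
  ; V-finite    = ⊎-finite (Fin-finite l) (×-finite (Fin-finite l) (Fin-finite (m ∸ 2)))
  ; E-finite    = Fin-finite l
  ; _∈_         = _∈′_
  ; _∈?_        = λ { (inj₁ v) e → (v Fin.≟ e) ⊎-dec (v Fin.≟ next e) ; (inj₂ (f , _)) e → f Fin.≟ e }
  ; nonempty    = λ e → inj₁ e , inj₁ refl
  ; extensional = λ {e} {f} h → ext (Equivalence.to (h (inj₁ e)) (inj₁ refl))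
                                    (Equivalence.from (h (inj₁ f)) (inj₁ refl))
  }
  where
  _∈′_ : Fin l ⊎ (Fin l × Fin (m ∸ 2)) → Fin l → Set
  inj₁ v       ∈′ e = v ≡ e ⊎ v ≡ next e
  inj₂ (f , _) ∈′ e = f ≡ e
  ext : ∀ {e f} → e ≡ f ⊎ e ≡ next f → f ≡ e ⊎ f ≡ next e → e ≡ f
  ext (inj₁ p) _        = p
  ext (inj₂ _) (inj₁ q) = sym q
  ext {e} (inj₂ p) (inj₂ q) = contradiction (trans (cong next (sym q)) (sym p)) (next²≢ 3≤l e)

-- Attach c v pendant edges at every vertex v. The edge inj₂ (v , j) is
-- the j-th one at v, and inj₂ (p , _) are the m-1 new vertices of p.
attachPendants : (m : ℕ) → 2 ℕ.≤ m → (H : Hypergraph) → (Hypergraph.V H → ℕ) → Hypergraph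
attachPendants m 2≤m H c = record
  { V           = V ⊎ (P × Fin (m ∸ 1))
  ; E           = E ⊎ P
  ; V-finite    = ⊎-finite V-finite (×-finite P-finite (Fin-finite (m ∸ 1)))
  ; E-finite    = ⊎-finite E-finite P-finite
  ; _∈_         = _∈′_
  ; _∈?_        = _∈′?_
  ; nonempty    = λ { (inj₁ e) → inj₁ (proj₁ (nonempty e)) , proj₂ (nonempty e)
                    ; (inj₂ p) → inj₁ (proj₁ p) , refl }
  ; extensional = ext
  }
  where
  open Hypergraph H
  P : Set
  P = Σ V (Fin ∘ c)
  P-finite : Finite P
  P-finite = Σ-finite V-finite (Fin-finite ∘ c)
  _∈′_ : V ⊎ (P × Fin (m ∸ 1)) → E ⊎ P → Set
  inj₁ v       ∈′ inj₁ e = v ∈ e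
  inj₁ v       ∈′ inj₂ p = v ≡ proj₁ p
  inj₂ _       ∈′ inj₁ _ = ⊥
  inj₂ (q , _) ∈′ inj₂ p = q ≡ p
  _∈′?_ : Decidable _∈′_
  inj₁ v       ∈′? inj₁ e = v ∈? e
  inj₁ v       ∈′? inj₂ p = decEq V-finite v (proj₁ p)
  inj₂ _       ∈′? inj₁ _ = no λ ()
  inj₂ (q , _) ∈′? inj₂ p = decEq P-finite q p
  new : ∀ {m} → 2 ℕ.≤ m → Fin (m ∸ 1)
  new (s≤s (s≤s _)) = zero
  ext : ∀ {e f} → (∀ v → v ∈′ e ⇔ v ∈′ f) → e ≡ f
  ext {inj₁ e} {inj₁ f} h = cong inj₁ (extensional (h ∘ inj₁))
  ext {inj₁ e} {inj₂ q} h = ⊥-elim (Equivalence.from (h (inj₂ (q , new 2≤m))) refl)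
  ext {inj₂ p} {inj₁ f} h = ⊥-elim (Equivalence.to (h (inj₂ (p , new 2≤m))) refl)
  ext {inj₂ p} {inj₂ q} h = cong inj₂ (Equivalence.to (h (inj₂ (p , new 2≤m))) refl)

UC : (m l : ℕ) → 2 ℕ.≤ m → 3 ℕ.≤ l → (Fin l → ℕ) → Hypergraph
UC m l 2≤m 3≤l c = attachPendants m 2≤m (looseCycle m l 3≤l) [ c , const 0 ]′

-- c₁ = a, c₂ = b and all other cᵢ = 0.
c₁₂ : ∀ {l} → ℕ → ℕ → Fin l → ℕ
c₁₂ a b zero          = a
c₁₂ a b (suc zero)    = b
c₁₂ a b (suc (suc _)) = 0

-- Truncated subtraction is exact here for l ≤ k and 1 ≤ m.
bound : (m k l : ℕ) → ℝ
bound m k l =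
  (fromℕ m + √ (m ℕ.* m ℕ.+ 4 ℕ.* (k ∸ l ℕ.+ 1) ℕ.* (m ∸ 1))) * recip (2 ℕ.* m ∸ 2)

-- Eliminating the new vertices of the power hypergraph of a graph G turns a bound λ₁ ≤ (ν + m − 2) / (m − 1) into a
-- bound of the form Σ κ (w a² + w b²) + 2 w a w b over the edges ab of G by (ν + κ) Σ w v², where κ (ν + m − 1) = m − 2.
-- For w ≥ 0 this form does not decrease when the trees of G are re-attached as pendant edges at a vertex M of maximal
-- weight. Keeping one edge away from M leads to the graph of U₂, unless all edges outside the cycle already end at M;
-- then either M lies on the cycle, which is U₁, or it does not, and an explicit supersolution bounds the form.
-- The Perron vector of U₂ is explicit except for the equation at the centre, whose defect changes sign at the right ν.
-- Bisection encloses that ν, which gives the two-sided estimates of λ₁(U₂) and part (ii). If G is not the graph of U₂,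
-- the moves gain a fixed amount on normalised weights, so that ν can be lowered and the inequality of part (i) is strict.

module Submission where

open import Data.Bool.Base using (Bool; true; false; if_then_else_)
import Data.Bool.Properties as Bool
open import Data.Empty using (⊥; ⊥-elim)
open import Data.Fin.Base as Fin using (Fin; zero; suc; toℕ)
import Data.Fin.Properties as Fin
open import Data.Integer.Base as ℤ using (+_)
import Data.Integer.Properties as ℤ
open import Data.List.Base as List using (List; []; _∷_; _++_; map; length; reverse; [_])
import Data.List.Properties as List
open import Data.List.Membership.Propositional using (find) renaming (_∈_ to _∈ˡ_; _∉_ to _∉ˡ_)
import Data.List.Membership.Propositional.Properties as ∈ˡ
open import Data.List.Membership.Propositional.Properties.WithK using (unique∧set⇒bag)
open import Data.List.Relation.Binary.BagAndSetEquality using (∼bag⇒↭)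
open import Data.List.Relation.Binary.Permutation.Propositional using (_↭_; ↭-refl; ↭-sym; ↭-trans; ↭-prep; ↭-swap)
import Data.List.Relation.Binary.Permutation.Propositional as ↭
import Data.List.Relation.Binary.Permutation.Propositional.Properties as ↭
open import Data.List.Relation.Unary.All as All using (All; []; _∷_)
import Data.List.Relation.Unary.All.Properties as All
open import Data.List.Relation.Unary.AllPairs using ([]; _∷_)
open import Data.List.Relation.Unary.Any as Any using (Any; here; there)
import Data.List.Relation.Unary.Any.Properties as Any
open import Data.List.Relation.Unary.Unique.Propositional using (Unique)
import Data.List.Relation.Unary.Unique.Propositional.Properties as Unique
open import Data.Nat.Base as ℕ using (ℕ; zero; suc; _∸_; s≤s; z≤n)
import Data.Nat.Properties as ℕ
open import Data.Product.Base using (Σ; ∃; ∃₂; _×_; _,_; proj₁; proj₂)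
open import Data.Rational.Base as ℚ using (ℚ; 0ℚ; 1ℚ; _+_; _*_; _-_; -_)
import Data.Rational.Properties as ℚ
import Data.Rational.Unnormalised.Base as ℚᵘ
import Data.Rational.Unnormalised.Properties as ℚᵘ
open import Data.Sum.Base using (_⊎_; inj₁; inj₂; [_,_]′)
open import Data.Sum.Properties using (inj₁-injective)
open import Data.Unit.Base using (⊤; tt)
open import Defs hiding (_+_; _*_; _-_; -_; ∑)
import Defs
open import Function.Base using (_∘_; const; id)
open import Function.Bundles using (_↔_; _⇔_; mk↔ₛ′; mk⇔; Inverse; Equivalence)
open import Function.Properties.Inverse using (↔-sym; ↔-trans)
open import Relation.Binary.Construct.Closure.ReflexiveTransitive as Star using (Star; _◅_; _◅◅_) renaming (ε to stop)
open import Relation.Binary.Definitions using (DecidableEquality)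
open import Relation.Binary.PropositionalEquality
  using (_≡_; _≢_; refl; sym; trans; cong; cong₂; subst; subst₂; module ≡-Reasoning)
open import Relation.Nullary using (¬_; Dec; yes; no; does; contradiction)
open import Relation.Nullary.Decidable using (_×-dec_; _⊎-dec_; ¬?; dec⇒maybe; dec-true; dec-false)
open import Tactic.RingSolver using (solve-∀)
open import Tactic.RingSolver.Core.AlmostCommutativeRing using (AlmostCommutativeRing; fromCommutativeRing)
open import Level using (0ℓ)

-- Reals are Cauchy sequences, so no Perron vector or spectral decomposition is at hand, and all
-- estimates use rational weights and a rational ν. An upper bound for λ₁ starts from the quadratic
-- form on non-negative vectors, becomes an operator norm bound, and is applied index by index to
-- the sequences of a complex eigenvector. A lower bound needs a true eigenvector: it is the limit
-- of explicit rational vectors whose residual tends to 0. The equality case must produce an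
-- isomorphism from ρ ≃ σ, so strictness has to be quantitative. A move may leave the form
-- unchanged, but then it increases a partial derivative; where the form nearly attains its bound,
-- connectedness keeps all weights away from 0, so this increase has a fixed size and a small change
-- of one weight exposes it. All constants are independent of ν, since they are used along a whole
-- bisection. With b = k - l - 1 the numerical hypothesis is (b - 5)(m - 1) ≥ 20; it gives (b + 2)(m
-- - 1) ≥ 5 (m + 3), which puts the critical ν of U₂ above 5. There the recurrences along the cycle
-- grow and the supersolution for M off the cycle exists.

private variable
  A B : Set

-- Rational numbers

ℚring : AlmostCommutativeRing 0ℓ 0ℓ
ℚring = fromCommutativeRing ℚ.+-*-commutativeRing (λ x → dec⇒maybe (0ℚ ℚ.≟ x))

2ℚ 3ℚ 4ℚ 5ℚ 9ℚ/2 : ℚ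
2ℚ = + 2 ℚ./ 1
3ℚ = + 3 ℚ./ 1
4ℚ = + 4 ℚ./ 1
5ℚ = + 5 ℚ./ 1
9ℚ/2 = + 9 ℚ./ 2

0≤1 : 0ℚ ℚ.≤ 1ℚ
0≤1 = ℚ.nonNegative⁻¹ 1ℚ

0<1 : 0ℚ ℚ.< 1ℚ
0<1 = ℚ.positive⁻¹ 1ℚ

0≤2 : 0ℚ ℚ.≤ 2ℚ
0≤2 = ℚ.nonNegative⁻¹ 2ℚ

0<½ : 0ℚ ℚ.< ℚ.½
0<½ = ℚ.positive⁻¹ ℚ.½

0<2 : 0ℚ ℚ.< 2ℚ
0<2 = ℚ.positive⁻¹ 2ℚ

-- The format of most inequalities below: the difference is exhibited as a sum of visibly
-- non-negative terms, and the ring solver checks the identity.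
≤-by : ∀ {a b} e → b ≡ a + e → 0ℚ ℚ.≤ e → a ℚ.≤ b
≤-by {a} e eq 0≤e = subst₂ ℚ._≤_ (ℚ.+-identityʳ a) (sym eq) (ℚ.+-monoʳ-≤ a 0≤e)

<-by : ∀ {a b} e → b ≡ a + e → 0ℚ ℚ.< e → a ℚ.< b
<-by {a} e eq 0<e = subst₂ ℚ._<_ (ℚ.+-identityʳ a) (sym eq) (ℚ.+-monoʳ-< a 0<e)

≤⇒0≤- : ∀ {a b} → a ℚ.≤ b → 0ℚ ℚ.≤ b - a
≤⇒0≤- {a} {b} a≤b = subst (ℚ._≤ b - a) (ℚ.+-inverseʳ a) (ℚ.+-monoˡ-≤ (- a) a≤b)

a≡b+[a-b] : ∀ a b → a ≡ b + (a - b)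
a≡b+[a-b] = solve-∀ ℚring

0≤-⇒≤ : ∀ {a b} → 0ℚ ℚ.≤ b - a → a ℚ.≤ b
0≤-⇒≤ {a} {b} = ≤-by (b - a) (a≡b+[a-b] b a)

infixl 6 _⟨+⟩_
infixl 7 _⟨*⟩_ _⟨*⟩⁺_

_⟨+⟩_ : ∀ {a b} → 0ℚ ℚ.≤ a → 0ℚ ℚ.≤ b → 0ℚ ℚ.≤ a + b
_⟨+⟩_ = ℚ.+-mono-≤

_⟨*⟩_ : ∀ {a b} → 0ℚ ℚ.≤ a → 0ℚ ℚ.≤ b → 0ℚ ℚ.≤ a * b
_⟨*⟩_ {a} {b} p q = ℚ.nonNegative⁻¹ (a * b)
  {{ℚ.nonNeg*nonNeg⇒nonNeg a {{ℚ.nonNegative p}} b {{ℚ.nonNegative q}}}}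

_⟨*⟩⁺_ : ∀ {a b} → 0ℚ ℚ.< a → 0ℚ ℚ.< b → 0ℚ ℚ.< a * b
_⟨*⟩⁺_ {a} {b} p q = ℚ.positive⁻¹ (a * b) {{ℚ.pos*pos⇒pos a {{ℚ.positive p}} b {{ℚ.positive q}}}}

0≤p² : ∀ p → 0ℚ ℚ.≤ p * p
0≤p² p with ℚ.≤-total 0ℚ p
... | inj₁ 0≤p = 0≤p ⟨*⟩ 0≤p
... | inj₂ p≤0 = subst (0ℚ ℚ.≤_) (neg² p) (0≤-p ⟨*⟩ 0≤-p)
  where
  0≤-p = ℚ.neg-antimono-≤ p≤0
  neg² : ∀ p → - p * - p ≡ p * p
  neg² = solve-∀ ℚring

*-monoˡ : ∀ {c a b} → 0ℚ ℚ.≤ c → a ℚ.≤ b → c * a ℚ.≤ c * b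
*-monoˡ {c} 0≤c = ℚ.*-monoˡ-≤-nonNeg c {{ℚ.nonNegative 0≤c}}

*-monoʳ : ∀ {c a b} → 0ℚ ℚ.≤ c → a ℚ.≤ b → a * c ℚ.≤ b * c
*-monoʳ {c} 0≤c = ℚ.*-monoʳ-≤-nonNeg c {{ℚ.nonNegative 0≤c}}

*-mono : ∀ {a b c d} → 0ℚ ℚ.≤ a → 0ℚ ℚ.≤ d → a ℚ.≤ b → c ℚ.≤ d → a * c ℚ.≤ b * d
*-mono 0≤a 0≤d a≤b c≤d = ℚ.≤-trans (*-monoˡ 0≤a c≤d) (*-monoʳ 0≤d a≤b)

*-cancelˡ : ∀ {c a b} → 0ℚ ℚ.< c → c * a ℚ.≤ c * b → a ℚ.≤ b
*-cancelˡ {c} 0<c = ℚ.*-cancelˡ-≤-pos c {{ℚ.positive 0<c}}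

0≤-cancel : ∀ {c a} → 0ℚ ℚ.< c → 0ℚ ℚ.≤ c * a → 0ℚ ℚ.≤ a
0≤-cancel {c} {a} 0<c h = *-cancelˡ 0<c (subst (ℚ._≤ c * a) (sym (ℚ.*-zeroʳ c)) h)

p≤∣p∣ : ∀ p → p ℚ.≤ ℚ.∣ p ∣
p≤∣p∣ p with ℚ.∣p∣≡p∨∣p∣≡-p p
... | inj₁ eq = ℚ.≤-reflexive (sym eq)
... | inj₂ eq with ℚ.≤-total 0ℚ p
...   | inj₁ 0≤p = ℚ.≤-reflexive (sym (ℚ.0≤p⇒∣p∣≡p 0≤p))
...   | inj₂ p≤0 = ℚ.≤-trans p≤0 (ℚ.0≤∣p∣ p)

-p≤∣p∣ : ∀ p → - p ℚ.≤ ℚ.∣ p ∣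
-p≤∣p∣ p = subst (- p ℚ.≤_) (ℚ.∣-p∣≡∣p∣ p) (p≤∣p∣ (- p))

∣p∣²≡p² : ∀ p → ℚ.∣ p ∣ * ℚ.∣ p ∣ ≡ p * p
∣p∣²≡p² p = trans (sym (ℚ.∣p*q∣≡∣p∣*∣q∣ p p)) (ℚ.0≤p⇒∣p∣≡p (0≤p² p))

∣-∣≤⁻ : ∀ p q {e} → ℚ.∣ p - q ∣ ℚ.≤ e → p ℚ.≤ q + e
∣-∣≤⁻ p q {e} h = subst (ℚ._≤ q + e) (eq p q) (ℚ.+-monoʳ-≤ q (ℚ.≤-trans (p≤∣p∣ (p - q)) h))
  where
  eq : ∀ p q → q + (p - q) ≡ p
  eq = solve-∀ ℚring

inv : (a : ℚ) → 0ℚ ℚ.< a → ℚ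
inv a 0<a = ℚ.1/_ a {{ℚ.pos⇒nonZero a {{ℚ.positive 0<a}}}}

inv-* : ∀ a (0<a : 0ℚ ℚ.< a) → inv a 0<a * a ≡ 1ℚ
inv-* a 0<a = ℚ.*-inverseˡ a {{ℚ.pos⇒nonZero a {{ℚ.positive 0<a}}}}

0<inv : ∀ a (0<a : 0ℚ ℚ.< a) → 0ℚ ℚ.< inv a 0<a
0<inv a 0<a = ℚ.positive⁻¹ _ {{ℚ.1/pos⇒pos a {{ℚ.positive 0<a}}}}

opaque
  -- Opaque, so that type checking never unfolds the normalisation of a fraction; it is used only
  -- through the laws below.
  fromℕ′ : ℕ → ℚ
  fromℕ′ n = + n ℚ./ 1

opaque
  unfolding fromℕ′

  fromℕ′-def : ∀ n → fromℕ′ n ≡ + n ℚ./ 1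
  fromℕ′-def n = refl

  fromℕ′-0 : fromℕ′ 0 ≡ 0ℚ
  fromℕ′-0 = refl

  fromℕ′-1 : fromℕ′ 1 ≡ 1ℚ
  fromℕ′-1 = refl

  fromℕ′-0≤ : ∀ n → 0ℚ ℚ.≤ fromℕ′ n
  fromℕ′-0≤ n = ℚ.nonNegative⁻¹ (fromℕ′ n) {{ℚ.normalize-nonNeg n 1}}

  toℚᵘ-fromℕ′ : ∀ n → ℚ.toℚᵘ (fromℕ′ n) ℚᵘ.≃ ℚᵘ.mkℚᵘ (+ n) 0
  toℚᵘ-fromℕ′ n = ℚ.toℚᵘ-fromℚᵘ (ℚᵘ.mkℚᵘ (+ n) 0)

  fromℕ′-+ : ∀ m n → fromℕ′ (m ℕ.+ n) ≡ fromℕ′ m + fromℕ′ n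
  fromℕ′-+ m n = ℚ.toℚᵘ-injective (begin
    ℚ.toℚᵘ (fromℕ′ (m ℕ.+ n))                  ≈⟨ toℚᵘ-fromℕ′ (m ℕ.+ n) ⟩
    ℚᵘ.mkℚᵘ (+ (m ℕ.+ n)) 0                    ≈⟨ ℚᵘ.*≡* (cong (ℤ._* + 1) (sym (cong₂ ℤ._+_ (ℤ.*-identityʳ (+ m)) (ℤ.*-identityʳ (+ n))))) ⟩
    ℚᵘ.mkℚᵘ (+ m) 0 ℚᵘ.+ ℚᵘ.mkℚᵘ (+ n) 0       ≈⟨ ℚᵘ.+-cong (toℚᵘ-fromℕ′ m) (toℚᵘ-fromℕ′ n) ⟨
    ℚ.toℚᵘ (fromℕ′ m) ℚᵘ.+ ℚ.toℚᵘ (fromℕ′ n)   ≈⟨ ℚ.toℚᵘ-homo-+ (fromℕ′ m) (fromℕ′ n) ⟨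
    ℚ.toℚᵘ (fromℕ′ m + fromℕ′ n)               ∎)
    where open ℚᵘ.≃-Reasoning

  fromℕ′-* : ∀ m n → fromℕ′ (m ℕ.* n) ≡ fromℕ′ m * fromℕ′ n
  fromℕ′-* m n = ℚ.toℚᵘ-injective (begin
    ℚ.toℚᵘ (fromℕ′ (m ℕ.* n))                  ≈⟨ toℚᵘ-fromℕ′ (m ℕ.* n) ⟩
    ℚᵘ.mkℚᵘ (+ (m ℕ.* n)) 0                    ≈⟨ ℚᵘ.*≡* (cong (ℤ._* + 1) (ℤ.pos-* m n)) ⟩
    ℚᵘ.mkℚᵘ (+ m) 0 ℚᵘ.* ℚᵘ.mkℚᵘ (+ n) 0       ≈⟨ ℚᵘ.*-cong (toℚᵘ-fromℕ′ m) (toℚᵘ-fromℕ′ n) ⟨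
    ℚ.toℚᵘ (fromℕ′ m) ℚᵘ.* ℚ.toℚᵘ (fromℕ′ n)   ≈⟨ ℚ.toℚᵘ-homo-* (fromℕ′ m) (fromℕ′ n) ⟨
    ℚ.toℚᵘ (fromℕ′ m * fromℕ′ n)               ∎)
    where open ℚᵘ.≃-Reasoning

  /-fromℕ′ : ∀ k n → (+ k ℚ./ suc n) * fromℕ′ (suc n) ≡ fromℕ′ k
  /-fromℕ′ k n = ℚ.toℚᵘ-injective (begin
    ℚ.toℚᵘ ((+ k ℚ./ suc n) * fromℕ′ (suc n))                ≈⟨ ℚ.toℚᵘ-homo-* (+ k ℚ./ suc n) (fromℕ′ (suc n)) ⟩
    ℚ.toℚᵘ (+ k ℚ./ suc n) ℚᵘ.* ℚ.toℚᵘ (fromℕ′ (suc n))      ≈⟨ ℚᵘ.*-cong (ℚ.toℚᵘ-fromℚᵘ (ℚᵘ.mkℚᵘ (+ k) n)) (toℚᵘ-fromℕ′ (suc n)) ⟩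
    ℚᵘ.mkℚᵘ (+ k) n ℚᵘ.* ℚᵘ.mkℚᵘ (+ suc n) 0                 ≈⟨ ℚᵘ.*≡* (ℤ.*-assoc (+ k) (+ suc n) (+ 1)) ⟩
    ℚᵘ.mkℚᵘ (+ k) 0                                          ≈⟨ toℚᵘ-fromℕ′ k ⟨
    ℚ.toℚᵘ (fromℕ′ k)                                        ∎)
    where open ℚᵘ.≃-Reasoning

fromℕ′-suc : ∀ n → fromℕ′ (suc n) ≡ 1ℚ + fromℕ′ n
fromℕ′-suc n = trans (fromℕ′-+ 1 n) (cong (_+ fromℕ′ n) fromℕ′-1)

fromℕ′-mono : ∀ {m n} → m ℕ.≤ n → fromℕ′ m ℚ.≤ fromℕ′ n
fromℕ′-mono {m} {n} m≤n = ≤-by (fromℕ′ (n ∸ m))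
  (trans (cong fromℕ′ (sym (ℕ.m+[n∸m]≡n m≤n))) (fromℕ′-+ m (n ∸ m))) (fromℕ′-0≤ (n ∸ m))

0<fromℕ′-suc : ∀ n → 0ℚ ℚ.< fromℕ′ (suc n)
0<fromℕ′-suc n = ℚ.<-≤-trans 0<1 (subst (ℚ._≤ fromℕ′ (suc n)) fromℕ′-1 (fromℕ′-mono (s≤s (z≤n {n}))))

1/-fromℕ′ : ∀ n → (+ 1 ℚ./ suc n) * fromℕ′ (suc n) ≡ 1ℚ
1/-fromℕ′ n = trans (/-fromℕ′ 1 n) fromℕ′-1

-- Finite sums and enumerations

∑ : List A → (A → ℚ) → ℚ
∑ []       f = 0ℚ
∑ (x ∷ xs) f = f x + ∑ xs f

infix 5 ∑
syntax ∑ xs (λ x → e) = ∑[ x ∈ xs ] e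

∑-cong : ∀ (xs : List A) {f g : A → ℚ} → (∀ x → f x ≡ g x) → ∑ xs f ≡ ∑ xs g
∑-cong []       eq = refl
∑-cong (x ∷ xs) eq = cong₂ _+_ (eq x) (∑-cong xs eq)

∑-++ : ∀ (xs ys : List A) f → ∑ (xs ++ ys) f ≡ ∑ xs f + ∑ ys f
∑-++ []       ys f = sym (ℚ.+-identityˡ (∑ ys f))
∑-++ (x ∷ xs) ys f = trans (cong (_+_ (f x)) (∑-++ xs ys f)) (sym (ℚ.+-assoc (f x) (∑ xs f) (∑ ys f)))

∑-map : ∀ (g : A → B) xs f → ∑ (map g xs) f ≡ ∑ xs (f ∘ g)
∑-map g []       f = refl
∑-map g (x ∷ xs) f = cong (_+_ (f (g x))) (∑-map g xs f)

∑-distrib-+ : ∀ (xs : List A) f g → (∑[ x ∈ xs ] f x + g x) ≡ ∑ xs f + ∑ xs g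
∑-distrib-+ []       f g = refl
∑-distrib-+ (x ∷ xs) f g = trans (cong (_+_ (f x + g x)) (∑-distrib-+ xs f g)) (eq (f x) (g x) (∑ xs f) (∑ xs g))
  where
  eq : ∀ a b c d → a + b + (c + d) ≡ a + c + (b + d)
  eq = solve-∀ ℚring

*-distribˡ-∑ : ∀ c (xs : List A) f → c * ∑ xs f ≡ ∑[ x ∈ xs ] c * f x
*-distribˡ-∑ c []       f = ℚ.*-zeroʳ c
*-distribˡ-∑ c (x ∷ xs) f = trans (ℚ.*-distribˡ-+ c (f x) (∑ xs f)) (cong (_+_ (c * f x)) (*-distribˡ-∑ c xs f))

*-distribʳ-∑ : ∀ c (xs : List A) f → ∑ xs f * c ≡ ∑[ x ∈ xs ] f x * c
*-distribʳ-∑ c []       f = ℚ.*-zeroˡ c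
*-distribʳ-∑ c (x ∷ xs) f = trans (ℚ.*-distribʳ-+ c (f x) (∑ xs f)) (cong (_+_ (f x * c)) (*-distribʳ-∑ c xs f))

∑-distrib-- : ∀ (xs : List A) f g → (∑[ x ∈ xs ] f x - g x) ≡ ∑ xs f - ∑ xs g
∑-distrib-- []       f g = refl
∑-distrib-- (x ∷ xs) f g = trans (cong (_+_ (f x - g x)) (∑-distrib-- xs f g)) (eq (f x) (g x) (∑ xs f) (∑ xs g))
  where
  eq : ∀ a b c d → a - b + (c - d) ≡ a + c - (b + d)
  eq = solve-∀ ℚring

∑-zero : ∀ (xs : List A) → (∑[ x ∈ xs ] 0ℚ) ≡ 0ℚ
∑-zero []       = refl
∑-zero (x ∷ xs) = trans (ℚ.+-identityˡ (∑[ x ∈ xs ] 0ℚ)) (∑-zero xs)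

∑-swap : ∀ (xs : List A) (ys : List B) (f : A → B → ℚ) → (∑[ x ∈ xs ] ∑[ y ∈ ys ] f x y) ≡ (∑[ y ∈ ys ] ∑[ x ∈ xs ] f x y)
∑-swap []       ys f = sym (∑-zero ys)
∑-swap (x ∷ xs) ys f = trans (cong (_+_ (∑ ys (f x))) (∑-swap xs ys f)) (sym (∑-distrib-+ ys (f x) (λ y → ∑[ x ∈ xs ] f x y)))

∑-mono : ∀ (xs : List A) {f g} → (∀ x → f x ℚ.≤ g x) → ∑ xs f ℚ.≤ ∑ xs g
∑-mono []       h = ℚ.≤-refl
∑-mono (x ∷ xs) h = ℚ.+-mono-≤ (h x) (∑-mono xs h)

∑-0≤ : ∀ (xs : List A) {f} → (∀ x → 0ℚ ℚ.≤ f x) → 0ℚ ℚ.≤ ∑ xs f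
∑-0≤ []       h = ℚ.≤-refl
∑-0≤ (x ∷ xs) h = h x ⟨+⟩ ∑-0≤ xs h

∑-∈ : ∀ {xs : List A} {f x} → (∀ x → 0ℚ ℚ.≤ f x) → x ∈ˡ xs → f x ℚ.≤ ∑ xs f
∑-∈ {xs = _ ∷ xs} {f} {x} h (here refl) = ≤-by (∑ xs f) refl (∑-0≤ xs h)
∑-∈ {xs = y ∷ xs} {f} {x} h (there x∈) = ℚ.≤-trans (∑-∈ h x∈) (≤-by (f y) (ℚ.+-comm (f y) (∑ xs f)) (h y))

∑-↭ : ∀ {xs ys : List A} f → xs ↭ ys → ∑ xs f ≡ ∑ ys f
∑-↭ f ↭.refl         = refl
∑-↭ f (↭.prep x p)   = cong (_+_ (f x)) (∑-↭ f p)
∑-↭ f (↭.swap x y p) = trans (cong (λ s → f x + (f y + s)) (∑-↭ f p)) (eq (f x) (f y) _)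
  where
  eq : ∀ a b c → a + (b + c) ≡ b + (a + c)
  eq = solve-∀ ℚring
∑-↭ f (↭.trans p q)  = trans (∑-↭ f p) (∑-↭ f q)

-- Sums range over lists. Two duplicate-free complete lists of a type are permutations of each
-- other, so a sum over the type may be computed along whichever list suits.
record Enumerates (xs : List A) : Set where
  constructor enumerates
  field
    unique   : Unique xs
    complete : ∀ x → x ∈ˡ xs

open Enumerates public

enumerations-↭ : ∀ {xs ys : List A} → Enumerates xs → Enumerates ys → xs ↭ ys
enumerations-↭ X Y = ∼bag⇒↭ (unique∧set⇒bag (unique X) (unique Y)
  (mk⇔ (λ _ → complete Y _) (λ _ → complete X _)))

∑-enumerations : ∀ {xs ys : List A} → Enumerates xs → Enumerates ys → ∀ f → ∑ xs f ≡ ∑ ys f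
∑-enumerations X Y f = ∑-↭ f (enumerations-↭ X Y)

map-enumerates : ∀ {xs} (b : A ↔ B) → Enumerates xs → Enumerates (map (Inverse.to b) xs)
map-enumerates b X = enumerates
  (Unique.map⁺ (λ eq → trans (sym (Inverse.strictlyInverseʳ b _)) (trans (cong (Inverse.from b) eq) (Inverse.strictlyInverseʳ b _))) (unique X))
  (λ y → subst (_∈ˡ _) (Inverse.strictlyInverseˡ b y) (∈ˡ.∈-map⁺ (Inverse.to b) (complete X _)))

⊎-enumerates : ∀ {xs ys} → Enumerates xs → Enumerates ys → Enumerates {A ⊎ B} (map inj₁ xs ++ map inj₂ ys)
⊎-enumerates X Y = enumerates
  (Unique.++⁺ (Unique.map⁺ (λ { refl → refl }) (unique X)) (Unique.map⁺ (λ { refl → refl }) (unique Y)) disj)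
  λ { (inj₁ x) → ∈ˡ.∈-++⁺ˡ (∈ˡ.∈-map⁺ inj₁ (complete X x))
    ; (inj₂ y) → ∈ˡ.∈-++⁺ʳ _ (∈ˡ.∈-map⁺ inj₂ (complete Y y)) }
  where
  disj : ∀ {z} → ¬ (z ∈ˡ map inj₁ _ × z ∈ˡ map inj₂ _)
  disj (p , q) with ∈ˡ.∈-map⁻ inj₁ p | ∈ˡ.∈-map⁻ inj₂ q
  ... | _ , _ , refl | _ , _ , ()

×-enumerates : ∀ {xs ys} → Enumerates xs → Enumerates ys → Enumerates {A × B} (List.cartesianProduct xs ys)
×-enumerates X Y = enumerates (Unique.cartesianProduct⁺ (unique X) (unique Y))
  (λ { (x , y) → ∈ˡ.∈-cartesianProduct⁺ (complete X x) (complete Y y) })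

∑-cartesianProduct : ∀ (xs : List A) (ys : List B) f → ∑ (List.cartesianProduct xs ys) f ≡ ∑[ x ∈ xs ] ∑[ y ∈ ys ] f (x , y)
∑-cartesianProduct []       ys f = refl
∑-cartesianProduct (x ∷ xs) ys f = trans (∑-++ (map (x ,_) ys) _ f)
  (cong₂ _+_ (∑-map (x ,_) ys f) (∑-cartesianProduct xs ys f))

elements : Finite A → List A
elements F = map (Finite.element F) (List.allFin (Finite.size F))

allFin-enumerates : ∀ n → Enumerates (List.allFin n)
allFin-enumerates n = enumerates (Unique.allFin⁺ n) ∈ˡ.∈-allFin

elements-enumerates : (F : Finite A) → Enumerates (elements F)
elements-enumerates F = map-enumerates (Finite.enum F) (allFin-enumerates _)

length-elements : (F : Finite A) → length (elements F) ≡ Finite.size F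
length-elements F = trans (List.length-map _ (List.allFin (Finite.size F))) (List.length-tabulate id)

𝟙 : ∀ {P : Set} → Dec P → ℚ
𝟙 d = if does d then 1ℚ else 0ℚ

0≤𝟙 : ∀ {P : Set} (d : Dec P) → 0ℚ ℚ.≤ 𝟙 d
0≤𝟙 (yes _) = 0≤1
0≤𝟙 (no _)  = ℚ.≤-refl

𝟙-yes : ∀ {P : Set} (d : Dec P) → P → 𝟙 d ≡ 1ℚ
𝟙-yes d p rewrite dec-true d p = refl

𝟙-no : ∀ {P : Set} (d : Dec P) → ¬ P → 𝟙 d ≡ 0ℚ
𝟙-no d p rewrite dec-false d p = refl

𝟙-⇔ : ∀ {P Q : Set} (d : Dec P) (e : Dec Q) → (P → Q) → (Q → P) → 𝟙 d ≡ 𝟙 e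
𝟙-⇔ (yes p) e f g = sym (𝟙-yes e (f p))
𝟙-⇔ (no ¬p) e f g = sym (𝟙-no e (¬p ∘ g))

∑-absent : ∀ {P : A → Set} (d : ∀ x → Dec (P x)) (f : A → ℚ) {xs} → All (λ x → ¬ P x) xs →
  (∑[ x ∈ xs ] 𝟙 (d x) * f x) ≡ 0ℚ
∑-absent d f []                = refl
∑-absent d f (_∷_ {x} ¬p ¬ps) = trans (cong₂ _+_ (trans (cong (_* f x) (𝟙-no (d x) ¬p)) (ℚ.*-zeroˡ (f x))) (∑-absent d f ¬ps)) (ℚ.+-identityˡ 0ℚ)

∑-point : ∀ {P : A → Set} (d : ∀ x → Dec (P x)) (f : A → ℚ) {xs x} → Unique xs → x ∈ˡ xs →
  P x → (∀ {y} → P y → x ≡ y) → (∑[ y ∈ xs ] 𝟙 (d y) * f y) ≡ f x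
∑-point d f {x = x} (x≢ ∷ _) (here refl) px only = trans
  (cong₂ _+_ (trans (cong (_* f x) (𝟙-yes (d x) px)) (ℚ.*-identityˡ (f x))) (∑-absent d f (All.map (λ ≢ py → ≢ (only py)) x≢)))
  (ℚ.+-identityʳ (f x))
∑-point d f {y ∷ _} {x} (y≢ ∷ u) (there x∈) px only = trans
  (cong₂ _+_ (trans (cong (_* f y) (𝟙-no (d y) (λ py → All.lookup y≢ x∈ (sym (only py))))) (ℚ.*-zeroˡ (f y))) (∑-point d f u x∈ px only))
  (ℚ.+-identityˡ (f x))

∑-pair : ∀ {P : A → Set} (_≟_ : DecidableEquality A) (d : ∀ x → Dec (P x)) (f : A → ℚ) {xs a b} → Enumerates xs →
  a ≢ b → (∀ y → P y ⇔ (y ≡ a ⊎ y ≡ b)) → (∑[ y ∈ xs ] 𝟙 (d y) * f y) ≡ f a + f b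
∑-pair _≟_ d f {xs} {a} {b} X a≢b P⇔ = trans (∑-cong xs split)
  (trans (∑-distrib-+ xs _ _) (cong₂ _+_
    (∑-point (_≟ a) f (unique X) (complete X a) refl sym)
    (∑-point (_≟ b) f (unique X) (complete X b) refl sym)))
  where
  split : ∀ y → 𝟙 (d y) * f y ≡ 𝟙 (y ≟ a) * f y + 𝟙 (y ≟ b) * f y
  split y with y ≟ a | y ≟ b
  ... | yes refl | yes refl = contradiction refl a≢b
  ... | yes refl | no _     = trans (cong (_* f y) (𝟙-yes (d y) (Equivalence.from (P⇔ y) (inj₁ refl))))
                                (trans (sym (ℚ.+-identityʳ (1ℚ * f y))) (cong (_+_ (1ℚ * f y)) (sym (ℚ.*-zeroˡ (f y)))))
  ... | no _     | yes refl = trans (cong (_* f y) (𝟙-yes (d y) (Equivalence.from (P⇔ y) (inj₂ refl))))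
                                (trans (sym (ℚ.+-identityˡ (1ℚ * f y))) (cong (_+ (1ℚ * f y)) (sym (ℚ.*-zeroˡ (f y)))))
  ... | no ¬a    | no ¬b    = trans (cong (_* f y) (𝟙-no (d y) ([ ¬a , ¬b ]′ ∘ Equivalence.to (P⇔ y))))
                                (trans (ℚ.*-zeroˡ (f y)) (sym (cong₂ _+_ (ℚ.*-zeroˡ (f y)) (ℚ.*-zeroˡ (f y)))))

Unique-↭ : ∀ {xs ys : List A} → xs ↭ ys → Unique xs → Unique ys
Unique-↭ ↭.refl         u                      = u
Unique-↭ (↭.prep x p)   (x≢ ∷ u)              = ↭.All-resp-↭ p x≢ ∷ Unique-↭ p u
Unique-↭ (↭.swap x y p) ((x≢y ∷ x≢) ∷ y≢ ∷ u) = ((x≢y ∘ sym) ∷ ↭.All-resp-↭ p y≢) ∷ ↭.All-resp-↭ p x≢ ∷ Unique-↭ p u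
Unique-↭ (↭.trans p q)  u                      = Unique-↭ q (Unique-↭ p u)

Enumerates-↭ : ∀ {xs ys : List A} → xs ↭ ys → Enumerates xs → Enumerates ys
Enumerates-↭ p X = enumerates (Unique-↭ p (unique X)) (λ x → ↭.∈-resp-↭ p (complete X x))

-- Symmetric kernels and linear hypergraphs

module SymmetricKernel {A : Set} (xs : List A) (K : A → A → ℚ)
  (K-sym : ∀ u v → K u v ≡ K v u) (0≤K : ∀ u v → 0ℚ ℚ.≤ K u v) where

  apply : (A → ℚ) → A → ℚ
  apply X u = ∑[ v ∈ xs ] K u v * X v

  ‖_‖² : (A → ℚ) → ℚ
  ‖ X ‖² = ∑[ u ∈ xs ] X u * X u

  pair : (A → ℚ) → (A → ℚ) → ℚ
  pair X Y = ∑[ u ∈ xs ] X u * apply Y u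

  pair-∑∑ : ∀ X Y → pair X Y ≡ (∑[ u ∈ xs ] ∑[ v ∈ xs ] X u * (K u v * Y v))
  pair-∑∑ X Y = ∑-cong xs (λ u → *-distribˡ-∑ (X u) xs (λ v → K u v * Y v))

  pair-sym : ∀ X Y → pair X Y ≡ pair Y X
  pair-sym X Y = begin
    pair X Y                                          ≡⟨ pair-∑∑ X Y ⟩
    (∑[ u ∈ xs ] ∑[ v ∈ xs ] X u * (K u v * Y v))     ≡⟨ ∑-swap xs xs (λ u v → X u * (K u v * Y v)) ⟩
    (∑[ v ∈ xs ] ∑[ u ∈ xs ] X u * (K u v * Y v))     ≡⟨ ∑-cong xs (λ v → ∑-cong xs (λ u → trans (eq (X u) (K u v) (Y v)) (cong (λ k → Y v * (k * X u)) (K-sym u v)))) ⟩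
    (∑[ v ∈ xs ] ∑[ u ∈ xs ] Y v * (K v u * X u))     ≡⟨ pair-∑∑ Y X ⟨
    pair Y X                                          ∎
    where
    open ≡-Reasoning
    eq : ∀ x k y → x * (k * y) ≡ y * (k * x)
    eq = solve-∀ ℚring

  ∣_∣ᵛ : (A → ℚ) → A → ℚ
  ∣ X ∣ᵛ u = ℚ.∣ X u ∣

  -- The entries of K are non-negative, so absolute values can only increase the form. This confines
  -- the assumption `form-≤` to non-negative vectors, for which moving edges towards a heavy vertex
  -- is monotone.
  ∣pair∣ : ∀ X → ℚ.∣ pair X X ∣ ℚ.≤ pair ∣ X ∣ᵛ ∣ X ∣ᵛ
  ∣pair∣ X = ℚ.≤-trans (∣∑∣ xs (λ u → X u * apply X u)) (∑-mono xs row)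
    where
    ∣∑∣ : ∀ (ys : List A) f → ℚ.∣ ∑ ys f ∣ ℚ.≤ ∑ ys (ℚ.∣_∣ ∘ f)
    ∣∑∣ []       f = ℚ.≤-refl
    ∣∑∣ (y ∷ ys) f = ℚ.≤-trans (ℚ.∣p+q∣≤∣p∣+∣q∣ (f y) (∑ ys f)) (ℚ.+-monoʳ-≤ ℚ.∣ f y ∣ (∣∑∣ ys f))
    row : ∀ u → ℚ.∣ X u * apply X u ∣ ℚ.≤ ℚ.∣ X u ∣ * apply ∣ X ∣ᵛ u
    row u = subst (ℚ._≤ ℚ.∣ X u ∣ * apply ∣ X ∣ᵛ u) (sym (ℚ.∣p*q∣≡∣p∣*∣q∣ (X u) (apply X u)))
      (*-monoˡ (ℚ.0≤∣p∣ (X u)) (ℚ.≤-trans (∣∑∣ xs (λ v → K u v * X v))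
        (ℚ.≤-reflexive (∑-cong xs (λ v → trans (ℚ.∣p*q∣≡∣p∣*∣q∣ (K u v) (X v)) (cong (_* ℚ.∣ X v ∣) (ℚ.0≤p⇒∣p∣≡p (0≤K u v))))))))

  module _ (μ : ℚ) (0<μ : 0ℚ ℚ.< μ)
    (form-≤ : ∀ X → (∀ u → 0ℚ ℚ.≤ X u) → pair X X ℚ.≤ μ * ‖ X ‖²) where

    ∣pair∣≤ : ∀ X → ℚ.∣ pair X X ∣ ℚ.≤ μ * ‖ X ‖²
    ∣pair∣≤ X = ℚ.≤-trans (∣pair∣ X) (ℚ.≤-trans (form-≤ ∣ X ∣ᵛ (λ u → ℚ.0≤∣p∣ (X u)))
      (ℚ.≤-reflexive (cong (_*_ μ) (∑-cong xs (λ u → ∣p∣²≡p² (X u))))))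

    -- 2μ(μ² − K²) = (μ − K)(μ + K)(μ − K) + (μ + K)(μ − K)(μ + K), where μ ± K are positive semidefinite.
    norm-≤ : ∀ X → ‖ apply X ‖² ℚ.≤ μ * μ * ‖ X ‖²
    norm-≤ X = 0≤-⇒≤
      (0≤-cancel (0<2 ⟨*⟩⁺ 0<μ) (subst (0ℚ ℚ.≤_) total (≤⇒0≤- minus ⟨+⟩ ≤⇒0≤- plus)))
      where
      y z s t : A → ℚ
      y = apply X
      z = apply y
      s u = μ * X u - y u
      t u = μ * X u + y u
      minus : - pair s s ℚ.≤ μ * ‖ s ‖²
      minus = ℚ.≤-trans (-p≤∣p∣ (pair s s)) (∣pair∣≤ s)
      plus : pair t t ℚ.≤ μ * ‖ t ‖²
      plus = ℚ.≤-trans (p≤∣p∣ (pair t t)) (∣pair∣≤ t)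
      apply-lin : ∀ c u → apply (λ v → μ * X v + c * y v) u ≡ μ * y u + c * z u
      apply-lin c u = begin
        (∑[ v ∈ xs ] K u v * (μ * X v + c * y v))                   ≡⟨ ∑-cong xs (λ v → eq (K u v) μ (X v) c (y v)) ⟩
        (∑[ v ∈ xs ] μ * (K u v * X v) + c * (K u v * y v))         ≡⟨ ∑-distrib-+ xs (λ v → μ * (K u v * X v)) (λ v → c * (K u v * y v)) ⟩
        (∑[ v ∈ xs ] μ * (K u v * X v)) + (∑[ v ∈ xs ] c * (K u v * y v)) ≡⟨ cong₂ _+_ (*-distribˡ-∑ μ xs (λ v → K u v * X v)) (*-distribˡ-∑ c xs (λ v → K u v * y v)) ⟨
        μ * y u + c * z u                                           ∎
        where
        open ≡-Reasoning
        eq : ∀ k m x c y → k * (m * x + c * y) ≡ m * (k * x) + c * (k * y)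
        eq = solve-∀ ℚring
      apply-s : ∀ u → apply s u ≡ μ * y u - z u
      apply-s u = trans (∑-cong xs (λ v → cong (_*_ (K u v)) (eq (μ * X v) (y v)))) (trans (apply-lin (- 1ℚ) u) (sym (eq (μ * y u) (z u))))
        where
        eq : ∀ a b → a - b ≡ a + - 1ℚ * b
        eq = solve-∀ ℚring
      apply-t : ∀ u → apply t u ≡ μ * y u + z u
      apply-t u = trans (∑-cong xs (λ v → cong (_*_ (K u v)) (eq (μ * X v) (y v)))) (trans (apply-lin 1ℚ u) (sym (eq (μ * y u) (z u))))
        where
        eq : ∀ a b → a + b ≡ a + 1ℚ * b
        eq = solve-∀ ℚring
      pointwise : ∀ u → (μ * (s u * s u) + s u * apply s u) + (μ * (t u * t u) - t u * apply t u)
        ≡ (2ℚ * μ * (μ * μ)) * (X u * X u) - (2ℚ * μ) * (X u * z u)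
      pointwise u = trans (cong₂ (λ p q → (μ * (s u * s u) + s u * p) + (μ * (t u * t u) - t u * q)) (apply-s u) (apply-t u)) (eq μ (X u) (y u) (z u))
        where
        eq : ∀ m x y z → (m * ((m * x - y) * (m * x - y)) + (m * x - y) * (m * y - z)) + (m * ((m * x + y) * (m * x + y)) - (m * x + y) * (m * y + z))
          ≡ (2ℚ * m * (m * m)) * (x * x) - (2ℚ * m) * (x * z)
        eq = solve-∀ ℚring
      total : (μ * ‖ s ‖² - - pair s s) + (μ * ‖ t ‖² - pair t t) ≡ (2ℚ * μ) * (μ * μ * ‖ X ‖² - ‖ y ‖²)
      total = begin
        (μ * ‖ s ‖² - - pair s s) + (μ * ‖ t ‖² - pair t t)
          ≡⟨ eq₁ (μ * ‖ s ‖²) (pair s s) (μ * ‖ t ‖²) (pair t t) ⟩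
        (μ * ‖ s ‖² + pair s s) + (μ * ‖ t ‖² - pair t t)
          ≡⟨ cong₂ (λ a b → (a + pair s s) + (b - pair t t)) (*-distribˡ-∑ μ xs (λ u → s u * s u)) (*-distribˡ-∑ μ xs (λ u → t u * t u)) ⟩
        ((∑[ u ∈ xs ] μ * (s u * s u)) + pair s s) + ((∑[ u ∈ xs ] μ * (t u * t u)) - pair t t)
          ≡⟨ cong₂ _+_ (∑-distrib-+ xs (λ u → μ * (s u * s u)) (λ u → s u * apply s u)) (∑-distrib-- xs (λ u → μ * (t u * t u)) (λ u → t u * apply t u)) ⟨
        (∑[ u ∈ xs ] μ * (s u * s u) + s u * apply s u) + (∑[ u ∈ xs ] μ * (t u * t u) - t u * apply t u)
          ≡⟨ ∑-distrib-+ xs (λ u → μ * (s u * s u) + s u * apply s u) (λ u → μ * (t u * t u) - t u * apply t u) ⟨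
        (∑[ u ∈ xs ] (μ * (s u * s u) + s u * apply s u) + (μ * (t u * t u) - t u * apply t u))
          ≡⟨ ∑-cong xs pointwise ⟩
        (∑[ u ∈ xs ] (2ℚ * μ * (μ * μ)) * (X u * X u) - (2ℚ * μ) * (X u * z u))
          ≡⟨ ∑-distrib-- xs (λ u → (2ℚ * μ * (μ * μ)) * (X u * X u)) (λ u → (2ℚ * μ) * (X u * z u)) ⟩
        (∑[ u ∈ xs ] (2ℚ * μ * (μ * μ)) * (X u * X u)) - (∑[ u ∈ xs ] (2ℚ * μ) * (X u * z u))
          ≡⟨ cong₂ _-_ (*-distribˡ-∑ (2ℚ * μ * (μ * μ)) xs (λ u → X u * X u)) (*-distribˡ-∑ (2ℚ * μ) xs (λ u → X u * z u)) ⟨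
        (2ℚ * μ * (μ * μ)) * ‖ X ‖² - (2ℚ * μ) * pair X y
          ≡⟨ cong (λ p → (2ℚ * μ * (μ * μ)) * ‖ X ‖² - (2ℚ * μ) * p) (pair-sym X y) ⟩
        (2ℚ * μ * (μ * μ)) * ‖ X ‖² - (2ℚ * μ) * ‖ y ‖²
          ≡⟨ eq₂ μ ‖ X ‖² ‖ y ‖² ⟩
        (2ℚ * μ) * (μ * μ * ‖ X ‖² - ‖ y ‖²) ∎
        where
        open ≡-Reasoning
        eq₁ : ∀ a p b q → (a - - p) + (b - q) ≡ (a + p) + (b - q)
        eq₁ = solve-∀ ℚring
        eq₂ : ∀ m a b → (2ℚ * m * (m * m)) * a - (2ℚ * m) * b ≡ (2ℚ * m) * (m * m * a - b)
        eq₂ = solve-∀ ℚring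

module LinearHypergraph (H : Hypergraph) (linear : Hypergraph.Linear H)
  (vs : List (Hypergraph.V H)) (es : List (Hypergraph.E H))
  (VS : Enumerates vs) (ES : Enumerates es) where

  open Hypergraph H

  adj : V → V → ℚ
  adj u v = 𝟙 (adjacent? u v)

  inc : V → E → ℚ
  inc v e = 𝟙 (v ∈? e)

  adj-sym : ∀ u v → adj u v ≡ adj v u
  adj-sym u v = 𝟙-⇔ (adjacent? u v) (adjacent? v u) flip′ flip′
    where
    flip′ : ∀ {u v} → Adjacent u v → Adjacent v u
    flip′ (u≢v , e , u∈e , v∈e) = u≢v ∘ sym , e , v∈e , u∈e

  open SymmetricKernel vs adj adj-sym (λ u v → 0≤𝟙 (adjacent? u v)) public

  edgeSum : (V → ℚ) → E → ℚ
  edgeSum X e = ∑[ v ∈ vs ] inc v e * X v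

  _≟_ : DecidableEquality V
  _≟_ = decEq V-finite

  -- The identity A + D = B Bᵀ for the incidence matrix B and the degree matrix D. Off the diagonal
  -- it expresses linearity: two distinct vertices lie in at most one common edge.
  adj-inc : ∀ u v → adj u v + 𝟙 (v ≟ u) * (∑[ e ∈ es ] inc u e) ≡ (∑[ e ∈ es ] inc u e * inc v e)
  adj-inc u v = by-cases (v ≟ u)
    where
    idem : ∀ {P : Set} (d : Dec P) → 𝟙 d ≡ 𝟙 d * 𝟙 d
    idem (yes _) = refl
    idem (no _)  = refl
    by-cases : (d : Dec (v ≡ u)) → adj u v + 𝟙 d * (∑[ e ∈ es ] inc u e) ≡ (∑[ e ∈ es ] inc u e * inc v e)
    by-cases (yes refl) = trans (cong₂ _+_ (𝟙-no (adjacent? u u) (λ p → proj₁ p refl)) (ℚ.*-identityˡ (∑[ e ∈ es ] inc u e)))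
                     (trans (ℚ.+-identityˡ (∑[ e ∈ es ] inc u e)) (∑-cong es (λ e → idem (u ∈? e))))
    by-cases (no v≢u) = trans (cong (_+_ (adj u v)) (ℚ.*-zeroˡ (∑[ e ∈ es ] inc u e))) (trans (ℚ.+-identityʳ (adj u v)) (common (adjacent? u v)))
      where
      both : ∀ e → Dec (u ∈ e × v ∈ e)
      both e = (u ∈? e) ×-dec (v ∈? e)
      product : ∀ {P Q : Set} (d : Dec P) (e : Dec Q) → 𝟙 (d ×-dec e) * 1ℚ ≡ 𝟙 d * 𝟙 e
      product (yes _) (yes _) = refl
      product (yes _) (no _)  = refl
      product (no _)  (yes _) = refl
      product (no _)  (no _)  = refl
      common : (d : Dec (Adjacent u v)) → 𝟙 d ≡ (∑[ e ∈ es ] inc u e * inc v e)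
      common (yes (_ , e , p)) = sym (trans (∑-cong es (λ e → sym (product (u ∈? e) (v ∈? e))))
        (∑-point both (const 1ℚ) (unique ES) (complete ES e) p only))
        where
        only : ∀ {f} → u ∈ f × v ∈ f → e ≡ f
        only {f} (u∈f , v∈f) with decEq E-finite e f
        ... | yes e≡f = e≡f
        ... | no  e≢f = contradiction (sym (linear e≢f (proj₁ p) u∈f (proj₂ p) v∈f)) v≢u
      common (no ¬a) = sym (trans (∑-cong es (λ e → sym (product (u ∈? e) (v ∈? e))))
        (∑-absent both (const 1ℚ) (All.universal (λ e p → ¬a (v≢u ∘ sym , e , p)) es)))

  apply-edges : ∀ X u → apply X u ≡ (∑[ e ∈ es ] inc u e * (edgeSum X e - X u))
  apply-edges X u = trans (eq₀ (apply X u) (X u * d)) (trans (cong (_- (X u * d)) sums) fold)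
    where
    d = ∑[ e ∈ es ] inc u e
    eq₀ : ∀ a b → a ≡ a + b - b
    eq₀ = solve-∀ ℚring
    eq₁ : ∀ a t d x → a * x + t * (x * d) ≡ (a + t * d) * x
    eq₁ = solve-∀ ℚring
    eq₂ : ∀ i s x → i * (s - x) ≡ i * s - x * i
    eq₂ = solve-∀ ℚring
    open ≡-Reasoning
    sums : apply X u + X u * d ≡ (∑[ e ∈ es ] inc u e * edgeSum X e)
    sums = begin
      apply X u + X u * d
        ≡⟨ cong (_+_ (apply X u)) (∑-point (_≟ u) (λ v → X v * d) (unique VS) (complete VS u) refl sym) ⟨
      apply X u + (∑[ v ∈ vs ] 𝟙 (v ≟ u) * (X v * d))
        ≡⟨ ∑-distrib-+ vs (λ v → adj u v * X v) (λ v → 𝟙 (v ≟ u) * (X v * d)) ⟨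
      (∑[ v ∈ vs ] adj u v * X v + 𝟙 (v ≟ u) * (X v * d))
        ≡⟨ ∑-cong vs (λ v → trans (eq₁ (adj u v) (𝟙 (v ≟ u)) d (X v)) (trans (cong (_* X v) (adj-inc u v)) (*-distribʳ-∑ (X v) es (λ e → inc u e * inc v e)))) ⟩
      (∑[ v ∈ vs ] ∑[ e ∈ es ] inc u e * inc v e * X v)
        ≡⟨ ∑-swap vs es (λ v e → inc u e * inc v e * X v) ⟩
      (∑[ e ∈ es ] ∑[ v ∈ vs ] inc u e * inc v e * X v)
        ≡⟨ ∑-cong es (λ e → trans (∑-cong vs (λ v → ℚ.*-assoc (inc u e) (inc v e) (X v))) (sym (*-distribˡ-∑ (inc u e) vs (λ v → inc v e * X v)))) ⟩
      (∑[ e ∈ es ] inc u e * edgeSum X e) ∎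
    fold : (∑[ e ∈ es ] inc u e * edgeSum X e) - X u * d ≡ (∑[ e ∈ es ] inc u e * (edgeSum X e - X u))
    fold = begin
      (∑[ e ∈ es ] inc u e * edgeSum X e) - X u * d
        ≡⟨ cong (_-_ (∑[ e ∈ es ] inc u e * edgeSum X e)) (*-distribˡ-∑ (X u) es (inc u)) ⟩
      (∑[ e ∈ es ] inc u e * edgeSum X e) - (∑[ e ∈ es ] X u * inc u e)
        ≡⟨ ∑-distrib-- es (λ e → inc u e * edgeSum X e) (λ e → X u * inc u e) ⟨
      (∑[ e ∈ es ] inc u e * edgeSum X e - X u * inc u e)
        ≡⟨ ∑-cong es (λ e → sym (eq₂ (inc u e) (edgeSum X e) (X u))) ⟩
      (∑[ e ∈ es ] inc u e * (edgeSum X e - X u)) ∎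

  pair-edges : ∀ X → pair X X ≡ (∑[ e ∈ es ] edgeSum X e * edgeSum X e - edgeSum (λ v → X v * X v) e)
  pair-edges X = begin
    pair X X
      ≡⟨ ∑-cong vs (λ u → trans (cong (_*_ (X u)) (apply-edges X u)) (*-distribˡ-∑ (X u) es (λ e → inc u e * (edgeSum X e - X u)))) ⟩
    (∑[ u ∈ vs ] ∑[ e ∈ es ] X u * (inc u e * (edgeSum X e - X u)))
      ≡⟨ ∑-swap vs es (λ u e → X u * (inc u e * (edgeSum X e - X u))) ⟩
    (∑[ e ∈ es ] ∑[ u ∈ vs ] X u * (inc u e * (edgeSum X e - X u)))
      ≡⟨ ∑-cong es (λ e → trans (∑-cong vs (λ u → eq (X u) (inc u e) (edgeSum X e)))
           (trans (∑-distrib-- vs (λ u → inc u e * X u * edgeSum X e) (λ u → inc u e * (X u * X u)))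
                  (cong (_- edgeSum (λ v → X v * X v) e) (sym (*-distribʳ-∑ (edgeSum X e) vs (λ u → inc u e * X u)))))) ⟩
    (∑[ e ∈ es ] edgeSum X e * edgeSum X e - edgeSum (λ v → X v * X v) e) ∎
    where
    open ≡-Reasoning
    eq : ∀ x i s → x * (i * (s - x)) ≡ i * x * s - i * (x * x)
    eq = solve-∀ ℚring

-- Power hypergraphs of graphs

record Ends (G : Hypergraph) : Set where
  open Hypergraph G
  field
    src tgt : E → V
    src≢tgt : ∀ e → src e ≢ tgt e
    ends    : ∀ e v → v ∈ e ⇔ (v ≡ src e ⊎ v ≡ tgt e)

  src∈ : ∀ e → src e ∈ e
  src∈ e = Equivalence.from (ends e _) (inj₁ refl)

  tgt∈ : ∀ e → tgt e ∈ e
  tgt∈ e = Equivalence.from (ends e _) (inj₂ refl)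

  two : ∀ {e u v w} → u ≢ v → u ∈ e → v ∈ e → w ∈ e → w ≡ u ⊎ w ≡ v
  two {e} u≢v u∈e v∈e w∈e with Equivalence.to (ends e _) u∈e | Equivalence.to (ends e _) v∈e | Equivalence.to (ends e _) w∈e
  ... | inj₁ p | inj₁ q | _      = contradiction (trans p (sym q)) u≢v
  ... | inj₂ p | inj₂ q | _      = contradiction (trans p (sym q)) u≢v
  ... | inj₁ p | inj₂ q | inj₁ r = inj₁ (trans r (sym p))
  ... | inj₁ p | inj₂ q | inj₂ r = inj₂ (trans r (sym q))
  ... | inj₂ p | inj₁ q | inj₁ r = inj₂ (trans r (sym q))
  ... | inj₂ p | inj₁ q | inj₂ r = inj₁ (trans r (sym p))

  edge-unique : ∀ {e f u v} → u ≢ v → u ∈ e → v ∈ e → u ∈ f → v ∈ f → e ≡ f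
  edge-unique u≢v u∈e v∈e u∈f v∈f = extensional λ w → mk⇔
    (λ w∈e → [ (λ { refl → u∈f }) , (λ { refl → v∈f }) ]′ (two u≢v u∈e v∈e w∈e))
    (λ w∈f → [ (λ { refl → u∈e }) , (λ { refl → v∈e }) ]′ (two u≢v u∈f v∈f w∈f))

  power-linear : ∀ m → Hypergraph.Linear (power m G)
  power-linear m e≢f {inj₂ _}          refl q _    _ = contradiction q e≢f
  power-linear m e≢f {inj₁ _} {inj₂ _} _    _ refl s = contradiction s e≢f
  power-linear m e≢f {inj₁ u} {inj₁ v} p    q r    s with decEq V-finite u v
  ... | yes u≡v = cong inj₁ u≡v
  ... | no  u≢v = contradiction (edge-unique u≢v p r q s) e≢f

∑-const : ∀ (xs : List A) c → (∑[ x ∈ xs ] c) ≡ fromℕ′ (length xs) * c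
∑-const []       c = sym (trans (cong (_* c) fromℕ′-0) (ℚ.*-zeroˡ c))
∑-const (x ∷ xs) c = trans (cong (_+_ c) (∑-const xs c)) (trans (eq c (fromℕ′ (length xs))) (cong (_* c) (sym (fromℕ′-suc (length xs)))))
  where
  eq : ∀ c n → c + n * c ≡ (1ℚ + n) * c
  eq = solve-∀ ℚring

∑-square : ∀ (xs : List A) (f : A → ℚ) c d → (∑[ x ∈ xs ] (c - d * f x) * (c - d * f x))
  ≡ fromℕ′ (length xs) * (c * c) - 2ℚ * c * d * ∑ xs f + d * d * (∑[ x ∈ xs ] f x * f x)
∑-square xs f c d = trans (∑-cong xs (λ x → eq c d (f x)))
  (trans (∑-distrib-+ xs (λ x → c * c - 2ℚ * c * d * f x) (λ x → d * d * (f x * f x))) (cong₂ _+_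
    (trans (∑-distrib-- xs (const (c * c)) (λ x → 2ℚ * c * d * f x)) (cong₂ _-_ (∑-const xs (c * c)) (sym (*-distribˡ-∑ (2ℚ * c * d) xs f))))
    (sym (*-distribˡ-∑ (d * d) xs (λ x → f x * f x)))))
  where
  eq : ∀ c d y → (c - d * y) * (c - d * y) ≡ c * c - 2ℚ * c * d * y + d * d * (y * y)
  eq = solve-∀ ℚring

-- Cauchy-Schwarz against the constant vector, by induction: adding x increases the difference of
-- the two sides by the sum of the squares (f x - f y)².
square-≤ : ∀ (xs : List A) (f : A → ℚ) → ∑ xs f * ∑ xs f ℚ.≤ fromℕ′ (length xs) * (∑[ x ∈ xs ] f x * f x)
square-≤ []       f = ℚ.≤-reflexive (sym (ℚ.*-zeroʳ (fromℕ′ 0)))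
square-≤ (x ∷ xs) f = subst (λ n → ∑ (x ∷ xs) f * ∑ (x ∷ xs) f ℚ.≤ n * (∑[ x ∈ x ∷ xs ] f x * f x)) (sym (fromℕ′-suc (length xs)))
  (≤-by (n * r - s * s + (∑[ y ∈ xs ] (f x - 1ℚ * f y) * (f x - 1ℚ * f y))) (trans (eq (f x) n s r) (cong (λ t → (f x + s) * (f x + s) + (n * r - s * s + t)) (sym (∑-square xs f (f x) 1ℚ))))
    (≤⇒0≤- (square-≤ xs f) ⟨+⟩ ∑-0≤ xs (λ y → 0≤p² (f x - 1ℚ * f y))))
  where
  n = fromℕ′ (length xs)
  s = ∑ xs f
  r = ∑[ y ∈ xs ] f y * f y
  eq : ∀ x n s r → (1ℚ + n) * (x * x + r) ≡ (x + s) * (x + s) + (n * r - s * s + (n * (x * x) - 2ℚ * x * 1ℚ * s + 1ℚ * 1ℚ * r))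
  eq = solve-∀ ℚring

-- Up to a common factor, what an edge with end weights a and b contributes once the weights of its
-- m - 2 new vertices are maximised out.
qForm : ℚ → ℚ → ℚ → ℚ
qForm κ a b = κ * (a * a + b * b) + 2ℚ * (a * b)

-- The coefficient of 2s in qForm κ (w a) (w b) when w v is increased by s.
qRow : DecidableEquality A → ℚ → (A → ℚ) → A → A → A → ℚ
qRow _≟_ κ w v a b = 𝟙 (a ≟ v) * (κ * w a + w b) + 𝟙 (b ≟ v) * (κ * w b + w a)

module PowerGraph (G : Hypergraph) (G-ends : Ends G) (r : ℕ)
  (vs : List (Hypergraph.V G)) (es : List (Hypergraph.E G)) (VS : Enumerates vs) (ES : Enumerates es) where

  open Hypergraph G
  open Ends G-ends

  H : Hypergraph
  H = power (suc (suc r)) G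

  js : List (Fin r)
  js = List.allFin r

  ws : List (Hypergraph.V H)
  ws = map inj₁ vs ++ map inj₂ (List.cartesianProduct es js)

  WS : Enumerates ws
  WS = ⊎-enumerates VS (×-enumerates ES (allFin-enumerates r))

  open LinearHypergraph H (power-linear (suc (suc r))) ws es WS ES public

  ∑-ws : ∀ f → ∑ ws f ≡ (∑[ v ∈ vs ] f (inj₁ v)) + (∑[ e ∈ es ] ∑[ j ∈ js ] f (inj₂ (e , j)))
  ∑-ws f = trans (∑-++ (map inj₁ vs) _ f) (cong₂ _+_ (∑-map inj₁ vs f)
    (trans (∑-map inj₂ (List.cartesianProduct es js) f) (∑-cartesianProduct es js (f ∘ inj₂))))

  new : (Hypergraph.V H → ℚ) → E → ℚ
  new X e = ∑[ j ∈ js ] X (inj₂ (e , j))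

  edgeSum-new : ∀ X e → edgeSum X e ≡ X (inj₁ (src e)) + X (inj₁ (tgt e)) + new X e
  edgeSum-new X e = trans (∑-ws (λ v → inc v e * X v)) (cong₂ _+_
    (∑-pair (decEq V-finite) (_∈? e) (λ v → X (inj₁ v)) VS (src≢tgt e) (ends e))
    (trans (∑-cong es (λ f → sym (*-distribˡ-∑ (𝟙 (decEq E-finite f e)) js (λ j → X (inj₂ (f , j))))))
           (∑-point (λ f → decEq E-finite f e) (new X) (unique ES) (complete ES e) refl sym)))

  module _ (ν κ : ℚ) (0<ν : 0ℚ ℚ.< ν) (κ-eq : κ * (ν + (1ℚ + fromℕ′ r)) ≡ fromℕ′ r) where

    μ : ℚ
    μ = ν + fromℕ′ r

    -- Completing the square in the new vertices. The difference is the Cauchy-Schwarz defect of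
    -- their weights x j plus the sum of (t - (ν + 1) x j)², so equality holds when every x j is (a
    -- + b)/(ν + 1).
    edge-form : ∀ X e → (ν + 1ℚ) * (edgeSum X e * edgeSum X e - edgeSum (λ v → X v * X v) e)
      ℚ.≤ (ν + (1ℚ + fromℕ′ r)) * qForm κ (X (inj₁ (src e))) (X (inj₁ (tgt e))) + (ν + 1ℚ) * (μ * new (λ v → X v * X v) e)
    edge-form X e = ≤-by ((ν + 1ℚ) * (n * R - s * s) + (∑[ j ∈ js ] (t - (ν + 1ℚ) * x j) * (t - (ν + 1ℚ) * x j)))
      identity
      (0<ν+1 ⟨*⟩ ≤⇒0≤- (subst (λ k → s * s ℚ.≤ fromℕ′ k * R) (List.length-tabulate id) (square-≤ js x)) ⟨+⟩ ∑-0≤ js (λ j → 0≤p² (t - (ν + 1ℚ) * x j)))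
      where
      0<ν+1 : 0ℚ ℚ.≤ ν + 1ℚ
      0<ν+1 = ℚ.<⇒≤ 0<ν ⟨+⟩ 0≤1
      n = fromℕ′ r
      a = X (inj₁ (src e))
      b = X (inj₁ (tgt e))
      t = a + b
      x : Fin r → ℚ
      x j = X (inj₂ (e , j))
      s = ∑ js x
      R = ∑[ j ∈ js ] x j * x j
      identity : (ν + (1ℚ + n)) * qForm κ a b + (ν + 1ℚ) * (μ * R)
        ≡ (ν + 1ℚ) * (edgeSum X e * edgeSum X e - edgeSum (λ v → X v * X v) e)
          + ((ν + 1ℚ) * (n * R - s * s) + (∑[ j ∈ js ] (t - (ν + 1ℚ) * x j) * (t - (ν + 1ℚ) * x j)))
      identity = trans (eq₁ ν n κ a b s R) (cong₂ _+_
        (cong (_*_ (ν + 1ℚ)) (sym (cong₂ _-_ (cong₂ _*_ (edgeSum-new X e) (edgeSum-new X e)) (edgeSum-new (λ v → X v * X v) e))))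
        (cong (_+_ ((ν + 1ℚ) * (n * R - s * s))) tail))
        where
        eq₁ : ∀ ν n κ a b s R → (ν + (1ℚ + n)) * (κ * (a * a + b * b) + 2ℚ * (a * b)) + (ν + 1ℚ) * ((ν + n) * R)
          ≡ (ν + 1ℚ) * ((a + b + s) * (a + b + s) - (a * a + b * b + R))
          + ((ν + 1ℚ) * (n * R - s * s) + (κ * (ν + (1ℚ + n)) * (a * a + b * b) + 2ℚ * n * (a * b) - 2ℚ * (ν + 1ℚ) * (a + b) * s + (ν + 1ℚ) * (ν + 1ℚ) * R))
        eq₁ = solve-∀ ℚring
        eq₂ : ∀ ν n a b s R → n * (a * a + b * b) + 2ℚ * n * (a * b) - 2ℚ * (ν + 1ℚ) * (a + b) * s + (ν + 1ℚ) * (ν + 1ℚ) * R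
          ≡ n * ((a + b) * (a + b)) - 2ℚ * (a + b) * (ν + 1ℚ) * s + (ν + 1ℚ) * (ν + 1ℚ) * R
        eq₂ = solve-∀ ℚring
        tail : κ * (ν + (1ℚ + n)) * (a * a + b * b) + 2ℚ * n * (a * b) - 2ℚ * (ν + 1ℚ) * (a + b) * s + (ν + 1ℚ) * (ν + 1ℚ) * R
          ≡ (∑[ j ∈ js ] (t - (ν + 1ℚ) * x j) * (t - (ν + 1ℚ) * x j))
        tail = trans (cong (λ k → k * (a * a + b * b) + 2ℚ * n * (a * b) - 2ℚ * (ν + 1ℚ) * (a + b) * s + (ν + 1ℚ) * (ν + 1ℚ) * R) κ-eq)
          (trans (eq₂ ν n a b s R) (trans
            (cong (λ k → fromℕ′ k * (t * t) - 2ℚ * t * (ν + 1ℚ) * s + (ν + 1ℚ) * (ν + 1ℚ) * R) (sym (List.length-tabulate {n = r} id)))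
            (sym (∑-square js x t (ν + 1ℚ)))))

    -- By `κ-eq`, (ν + 1 + r)(ν + κ) = (ν + 1)(ν + r). Hence the factor ν + κ on the graph
    -- corresponds exactly to μ = ν + r on the power hypergraph.
    form-lift : (∀ w → (∀ v → 0ℚ ℚ.≤ w v) → (∑[ e ∈ es ] qForm κ (w (src e)) (w (tgt e))) ℚ.≤ (ν + κ) * (∑[ v ∈ vs ] w v * w v)) →
      ∀ X → (∀ u → 0ℚ ℚ.≤ X u) → pair X X ℚ.≤ μ * ‖ X ‖²
    form-lift bound X 0≤X = *-cancelˡ (ℚ.+-mono-< 0<ν 0<1) (begin
      (ν + 1ℚ) * pair X X
        ≡⟨ trans (cong (_*_ (ν + 1ℚ)) (pair-edges X)) (*-distribˡ-∑ (ν + 1ℚ) es (λ e → edgeSum X e * edgeSum X e - edgeSum X² e)) ⟩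
      (∑[ e ∈ es ] (ν + 1ℚ) * (edgeSum X e * edgeSum X e - edgeSum X² e))
        ≤⟨ ∑-mono es (edge-form X) ⟩
      (∑[ e ∈ es ] (ν + (1ℚ + n)) * Q e + (ν + 1ℚ) * (μ * new X² e))
        ≡⟨ trans (∑-distrib-+ es (λ e → (ν + (1ℚ + n)) * Q e) (λ e → (ν + 1ℚ) * (μ * new X² e)))
             (cong₂ _+_ (sym (*-distribˡ-∑ (ν + (1ℚ + n)) es Q))
               (trans (∑-cong es (λ e → sym (ℚ.*-assoc (ν + 1ℚ) μ (new X² e)))) (sym (*-distribˡ-∑ ((ν + 1ℚ) * μ) es (new X²))))) ⟩
      (ν + (1ℚ + n)) * ∑ es Q + (ν + 1ℚ) * μ * ∑ es (new X²)
        ≤⟨ ℚ.+-monoˡ-≤ ((ν + 1ℚ) * μ * ∑ es (new X²)) (*-monoˡ (ℚ.<⇒≤ 0<ν ⟨+⟩ (0≤1 ⟨+⟩ fromℕ′-0≤ r)) (bound (X ∘ inj₁) (0≤X ∘ inj₁))) ⟩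
      (ν + (1ℚ + n)) * ((ν + κ) * V²) + (ν + 1ℚ) * μ * ∑ es (new X²)
        ≡⟨ eq₁ ν n κ V² (∑ es (new X²)) ⟩
      ((ν + (1ℚ + n)) * ν + κ * (ν + (1ℚ + n))) * V² + (ν + 1ℚ) * (ν + n) * ∑ es (new X²)
        ≡⟨ cong (λ k → ((ν + (1ℚ + n)) * ν + k) * V² + (ν + 1ℚ) * (ν + n) * ∑ es (new X²)) κ-eq ⟩
      ((ν + (1ℚ + n)) * ν + n) * V² + (ν + 1ℚ) * (ν + n) * ∑ es (new X²)
        ≡⟨ eq₂ ν n V² (∑ es (new X²)) ⟩
      (ν + 1ℚ) * (μ * (V² + ∑ es (new X²)))
        ≡⟨ cong (λ s → (ν + 1ℚ) * (μ * s)) (∑-ws X²) ⟨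
      (ν + 1ℚ) * (μ * ‖ X ‖²) ∎)
      where
      open ℚ.≤-Reasoning
      n = fromℕ′ r
      X² : Hypergraph.V H → ℚ
      X² u = X u * X u
      Q : E → ℚ
      Q e = qForm κ (X (inj₁ (src e))) (X (inj₁ (tgt e)))
      V² = ∑[ v ∈ vs ] X² (inj₁ v)
      eq₁ : ∀ ν n κ V W → (ν + (1ℚ + n)) * ((ν + κ) * V) + (ν + 1ℚ) * (ν + n) * W
        ≡ ((ν + (1ℚ + n)) * ν + κ * (ν + (1ℚ + n))) * V + (ν + 1ℚ) * (ν + n) * W
      eq₁ = solve-∀ ℚring
      eq₂ : ∀ ν n V W → ((ν + (1ℚ + n)) * ν + n) * V + (ν + 1ℚ) * (ν + n) * W ≡ (ν + 1ℚ) * ((ν + n) * (V + W))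
      eq₂ = solve-∀ ℚring

    -- The equality case of `edge-form`, cleared of the denominator ν + 1. With it the eigenvalue
    -- equation holds exactly at new vertices and has the error `residual` at old ones.
    lift : (V → ℚ) → Hypergraph.V H → ℚ
    lift Y (inj₁ v)       = (ν + 1ℚ) * Y v
    lift Y (inj₂ (e , _)) = Y (src e) + Y (tgt e)

    residual : (V → ℚ) → V → ℚ
    residual Y v = (ν + κ) * Y v - (∑[ e ∈ es ] qRow (decEq V-finite) κ Y v (src e) (tgt e))

    edgeSum-lift : ∀ Y e → edgeSum (lift Y) e ≡ (ν + (1ℚ + fromℕ′ r)) * (Y (src e) + Y (tgt e))
    edgeSum-lift Y e = trans (edgeSum-new (lift Y) e) (trans
      (cong (_+_ ((ν + 1ℚ) * Y (src e) + (ν + 1ℚ) * Y (tgt e))) (trans (∑-const js (Y (src e) + Y (tgt e)))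
        (cong (λ k → fromℕ′ k * (Y (src e) + Y (tgt e))) (List.length-tabulate {n = r} id))))
      (eq ν (fromℕ′ r) (Y (src e)) (Y (tgt e))))
      where
      eq : ∀ ν n a b → (ν + 1ℚ) * a + (ν + 1ℚ) * b + n * (a + b) ≡ (ν + (1ℚ + n)) * (a + b)
      eq = solve-∀ ℚring

    apply-lift-new : ∀ Y e j → apply (lift Y) (inj₂ (e , j)) ≡ μ * lift Y (inj₂ (e , j))
    apply-lift-new Y e j = trans (apply-edges (lift Y) (inj₂ (e , j))) (trans
      (∑-point (λ f → decEq E-finite e f) (λ f → edgeSum (lift Y) f - t) (unique ES) (complete ES e) refl id)
      (trans (cong (_- t) (edgeSum-lift Y e)) (eq ν (fromℕ′ r) t)))
      where
      t = Y (src e) + Y (tgt e)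
      eq : ∀ ν n t → (ν + (1ℚ + n)) * t - t ≡ (ν + n) * t
      eq = solve-∀ ℚring

    apply-lift-old : ∀ Y v → apply (lift Y) (inj₁ v) ≡ μ * lift Y (inj₁ v) - (ν + (1ℚ + fromℕ′ r)) * residual Y v
    apply-lift-old Y v = trans (apply-edges (lift Y) (inj₁ v)) (trans
      (∑-cong es (λ e → trans (cong (λ s → 𝟙 (v ∈? e) * (s - (ν + 1ℚ) * Y v)) (edgeSum-lift Y e)) (row e)))
      (trans (sym (*-distribˡ-∑ (ν + (1ℚ + n)) es (λ e → qRow (decEq V-finite) κ Y v (src e) (tgt e))))
        (trans (eq₁ ν n κ (Y v) (∑[ e ∈ es ] qRow (decEq V-finite) κ Y v (src e) (tgt e)))
          (trans (cong (λ k → ((ν + (1ℚ + n)) * ν + k) * Y v - (ν + (1ℚ + n)) * residual Y v) κ-eq) (eq₂ ν n (Y v) (residual Y v))))))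
      where
      n = fromℕ′ r
      eq₁ : ∀ ν n κ y s → (ν + (1ℚ + n)) * s ≡ ((ν + (1ℚ + n)) * ν + κ * (ν + (1ℚ + n))) * y - (ν + (1ℚ + n)) * ((ν + κ) * y - s)
      eq₁ = solve-∀ ℚring
      eq₂ : ∀ ν n y s → ((ν + (1ℚ + n)) * ν + n) * y - (ν + (1ℚ + n)) * s ≡ (ν + n) * ((ν + 1ℚ) * y) - (ν + (1ℚ + n)) * s
      eq₂ = solve-∀ ℚring
      eq-src : ∀ ν n κ a b → 1ℚ * ((ν + (1ℚ + n)) * (a + b) - (ν + 1ℚ) * a)
        ≡ (ν + (1ℚ + n)) * (1ℚ * (κ * a + b) + 0ℚ * (κ * b + a)) + (n - κ * (ν + (1ℚ + n))) * a
      eq-src = solve-∀ ℚring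
      eq-tgt : ∀ ν n κ a b → 1ℚ * ((ν + (1ℚ + n)) * (a + b) - (ν + 1ℚ) * b)
        ≡ (ν + (1ℚ + n)) * (0ℚ * (κ * a + b) + 1ℚ * (κ * b + a)) + (n - κ * (ν + (1ℚ + n))) * b
      eq-tgt = solve-∀ ℚring
      eq-none : ∀ c d s t → 0ℚ * c ≡ d * (0ℚ * s + 0ℚ * t)
      eq-none = solve-∀ ℚring
      vanish : ∀ s y → s + (n - κ * (ν + (1ℚ + n))) * y ≡ s
      vanish s y = trans (cong (λ k → s + (n - k) * y) κ-eq) (eq s n y)
        where
        eq : ∀ s n y → s + (n - n) * y ≡ s
        eq = solve-∀ ℚring
      row : ∀ e → 𝟙 (v ∈? e) * ((ν + (1ℚ + n)) * (Y (src e) + Y (tgt e)) - (ν + 1ℚ) * Y v)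
        ≡ (ν + (1ℚ + n)) * qRow (decEq V-finite) κ Y v (src e) (tgt e)
      row e = by-cases (v ∈? e) (decEq V-finite (src e) v) (decEq V-finite (tgt e) v)
        where
        a = Y (src e)
        b = Y (tgt e)
        by-cases : (d : Dec (v ∈ e)) (d₁ : Dec (src e ≡ v)) (d₂ : Dec (tgt e ≡ v)) →
          𝟙 d * ((ν + (1ℚ + n)) * (a + b) - (ν + 1ℚ) * Y v) ≡ (ν + (1ℚ + n)) * (𝟙 d₁ * (κ * a + b) + 𝟙 d₂ * (κ * b + a))
        by-cases (yes _) (yes refl) (no _) = trans (eq-src ν n κ a b) (vanish ((ν + (1ℚ + n)) * (1ℚ * (κ * a + b) + 0ℚ * (κ * b + a))) a)
        by-cases (yes _) (no _) (yes refl) = trans (eq-tgt ν n κ a b) (vanish ((ν + (1ℚ + n)) * (0ℚ * (κ * a + b) + 1ℚ * (κ * b + a))) b)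
        by-cases _ (yes p) (yes q) = contradiction (trans p (sym q)) (src≢tgt e)
        by-cases (no v∉) (yes refl) _ = contradiction (src∈ e) v∉
        by-cases (no v∉) _ (yes refl) = contradiction (tgt∈ e) v∉
        by-cases (no _) (no _) (no _) = eq-none ((ν + (1ℚ + n)) * (a + b) - (ν + 1ℚ) * Y v) (ν + (1ℚ + n)) (κ * a + b) (κ * b + a)
        by-cases (yes v∈) (no ¬a) (no ¬b) = contradiction (Equivalence.to (ends e v) v∈) [ (¬a ∘ sym) , (¬b ∘ sym) ]′

-- Null sequences and inequalities of reals

Null : (ℕ → ℚ) → Set
Null s = ∀ ε → 0ℚ ℚ.< ε → ∃ λ N → ∀ i → N ℕ.≤ i → ℚ.∣ s i ∣ ℚ.≤ ε

Eventually : (ℕ → Set) → Set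
Eventually P = ∃ λ N → ∀ i → N ℕ.≤ i → P i

Eventually-map₂ : ∀ {P Q R : ℕ → Set} → (∀ {i} → P i → Q i → R i) → Eventually P → Eventually Q → Eventually R
Eventually-map₂ f (M , p) (N , q) = M ℕ.⊔ N , λ i h → f (p i (ℕ.m⊔n≤o⇒m≤o M N h)) (q i (ℕ.m⊔n≤o⇒n≤o M N h))

Null-+ : ∀ {s t} → Null s → Null t → Null (λ i → s i + t i)
Null-+ {s} {t} S T ε 0<ε = Eventually-map₂
  (λ {i} p q → ℚ.≤-trans (ℚ.∣p+q∣≤∣p∣+∣q∣ (s i) (t i)) (ℚ.≤-trans (ℚ.+-mono-≤ p q) (ℚ.≤-reflexive (½+½ ε))))
  (S _ (½ε>0 0<ε)) (T _ (½ε>0 0<ε))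

Null-* : ∀ {s} → Null s → (x : ℝ) → Null (λ i → s i * seq x i)
Null-* {s} S x ε 0<ε = Eventually-map₂ (λ {i} p q → begin
    ℚ.∣ s i * seq x i ∣        ≡⟨ ℚ.∣p*q∣≡∣p∣*∣q∣ (s i) (seq x i) ⟩
    ℚ.∣ s i ∣ * ℚ.∣ seq x i ∣  ≤⟨ *-mono (ℚ.0≤∣p∣ (s i)) (ℚ.<⇒≤ 0<K) p q ⟩
    ε * inv K 0<K * K          ≡⟨ ℚ.*-assoc ε (inv K 0<K) K ⟩
    ε * (inv K 0<K * K)        ≡⟨ cong (_*_ ε) (inv-* K 0<K) ⟩
    ε * 1ℚ                     ≡⟨ ℚ.*-identityʳ ε ⟩
    ε                          ∎)
  (S _ (0<ε ⟨*⟩⁺ 0<inv K 0<K)) (proj₂ (proj₂ (bounded x)))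
  where
  open ℚ.≤-Reasoning
  K = proj₁ (bounded x)
  0<K = proj₁ (proj₂ (bounded x))

Null-cong : ∀ {s t} → (∀ i → s i ≡ t i) → Null s → Null t
Null-cong eq S ε 0<ε = proj₁ (S ε 0<ε) , λ i h → subst (λ a → ℚ.∣ a ∣ ℚ.≤ ε) (eq i) (proj₂ (S ε 0<ε) i h)

Null-0 : Null (const 0ℚ)
Null-0 ε 0<ε = 0 , λ _ _ → ℚ.<⇒≤ 0<ε

Null-∑ : ∀ (xs : List A) {s : A → ℕ → ℚ} → (∀ x → Null (s x)) → Null (λ i → ∑[ x ∈ xs ] s x i)
Null-∑ []       S = Null-0
Null-∑ (x ∷ xs) S = Null-+ (S x) (Null-∑ xs S)

Null-squares : ∀ (x y : ℝ) → x ≃ y → Null (λ i → seq x i * seq x i - seq y i * seq y i)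
Null-squares x y x≃y = Null-cong (λ i → eq (seq x i) (seq y i)) (Null-* x≃y (x Defs.+ y))
  where
  eq : ∀ a b → (a - b) * (a + b) ≡ a * a - b * b
  eq = solve-∀ ℚring

½<1 : ∀ {ε} → 0ℚ ℚ.< ε → ε * ℚ.½ ℚ.< ε
½<1 {ε} 0<ε = <-by (ε * ℚ.½) (sym (½+½ ε)) (½ε>0 0<ε)

-- Beyond a modulus of convergence an order relation can be tested at one index.
≤⇒eventually : ∀ x y → x ≤ y → ∀ ε → 0ℚ ℚ.< ε → Eventually (λ i → seq x i ℚ.≤ seq y i + ε)
≤⇒eventually x y x≤y ε 0<ε = at (proj₁ d) (proj₂ d) (_ ℚ.≤? _)
  where
  δ = ε * ℚ.½ * ℚ.½
  0<δ = ½ε>0 (½ε>0 0<ε)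
  d = cauchy (x Defs.- y) δ 0<δ
  ε≡ : ε ≡ (δ + δ) + (δ + δ)
  ε≡ = trans (sym (½+½ ε)) (sym (cong₂ _+_ (½+½ (ε * ℚ.½)) (½+½ (ε * ℚ.½))))
  at : ∀ N → (∀ i j → N ℕ.≤ i → N ℕ.≤ j → ℚ.∣ (seq x i - seq y i) - (seq x j - seq y j) ∣ ℚ.≤ δ) →
    Dec (seq x N ℚ.≤ seq y N + (δ + δ)) → Eventually (λ i → seq x i ℚ.≤ seq y i + ε)
  at N near (yes h) = N , λ i N≤i → ≤-by (δ + (seq y N + (δ + δ) - seq x N + (seq x N - seq y N + δ - (seq x i - seq y i))))
    (trans (cong (_+_ (seq y i)) ε≡) (eq (seq x i) (seq y i) (seq x N) (seq y N) δ))
    (ℚ.<⇒≤ 0<δ ⟨+⟩ (≤⇒0≤- h ⟨+⟩ ≤⇒0≤- (∣-∣≤⁻ (seq x i - seq y i) (seq x N - seq y N) (near i N N≤i ℕ.≤-refl))))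
    where
    eq : ∀ a b c d e → b + ((e + e) + (e + e)) ≡ a + (e + (d + (e + e) - c + (c - d + e - (a - b))))
    eq = solve-∀ ℚring
  at N near (no ¬h) = contradiction (δ , 0<δ , N , λ i N≤i → ≤-by (seq x N - (seq y N + (δ + δ)) + (seq x i - seq y i + δ - (seq x N - seq y N)))
    (eq (seq x i) (seq y i) (seq x N) (seq y N) δ)
    (≤⇒0≤- (ℚ.<⇒≤ (ℚ.≰⇒> ¬h)) ⟨+⟩ ≤⇒0≤- (∣-∣≤⁻ (seq x N - seq y N) (seq x i - seq y i) (near N i ℕ.≤-refl N≤i)))) x≤y
    where
    eq : ∀ a b c d e → a ≡ b + e + (c - (d + (e + e)) + (a - b + e - (c - d)))
    eq = solve-∀ ℚring

-- The spectral radius of a power hypergraph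

#0⇒bounded-below : ∀ x → x # 0ℝ → ∃ λ δ → 0ℚ ℚ.< δ × Eventually (λ i → δ ℚ.≤ seq x i * seq x i)
#0⇒bounded-below x (inj₁ (δ , 0<δ , N , h)) = δ * δ , 0<δ ⟨*⟩⁺ 0<δ , N , λ i N≤i →
  subst (δ * δ ℚ.≤_) (neg² (seq x i)) (*-mono (ℚ.<⇒≤ 0<δ) (ℚ.≤-trans (ℚ.<⇒≤ 0<δ) (below i N≤i)) (below i N≤i) (below i N≤i))
  where
  neg² : ∀ a → - a * - a ≡ a * a
  neg² = solve-∀ ℚring
  below : ∀ i → N ℕ.≤ i → δ ℚ.≤ - seq x i
  below i N≤i = ≤-by (0ℚ - (seq x i + δ)) (eq (seq x i) δ) (≤⇒0≤- (h i N≤i))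
    where
    eq : ∀ a d → - a ≡ d + (0ℚ - (a + d))
    eq = solve-∀ ℚring
#0⇒bounded-below x (inj₂ (δ , 0<δ , N , h)) = δ * δ , 0<δ ⟨*⟩⁺ 0<δ , N , λ i N≤i →
  *-mono (ℚ.<⇒≤ 0<δ) (ℚ.≤-trans (ℚ.<⇒≤ 0<δ) (above i N≤i)) (above i N≤i) (above i N≤i)
  where
  above : ∀ i → N ℕ.≤ i → δ ℚ.≤ seq x i
  above i N≤i = subst (ℚ._≤ seq x i) (ℚ.+-identityˡ δ) (h i N≤i)

seq-∑ : ∀ {n} (f : Fin n → ℝ) t → seq (Defs.∑ f) t ≡ (∑[ i ∈ List.allFin n ] seq (f i) t)
seq-∑ {zero}  f t = refl
seq-∑ {suc n} f t = cong (_+_ (seq (f zero) t)) (trans (seq-∑ (f ∘ suc) t)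
  (sym (trans (cong (λ xs → ∑[ i ∈ xs ] seq (f i) t) (sym (List.map-tabulate id suc))) (∑-map suc (List.allFin n) (λ i → seq (f i) t)))))

-- `Isλ₁` gives access to the square of ρ only. A value of at least d + ε would have a square of at
-- least d² + ε², and half of ε² pays for the error in `y ≃ x * x`.
sqrt-≤ : ∀ x y {d} → 0ℚ ℚ.≤ d → y ≃ x Defs.* x → y ≤ fromℚ (d * d) → x ≤ fromℚ d
sqrt-≤ x y {d} 0≤d y≃x² y≤d² (ε , 0<ε , x-large) = y≤d²
  (η , 0<η , Eventually-map₂ {P = λ t → d + ε ℚ.≤ seq x t} {Q = λ t → ℚ.∣ seq y t - seq x t * seq x t ∣ ℚ.≤ η} {R = λ t → d * d + η ℚ.≤ seq y t}
    (λ {t} → step (seq x t) (seq y t)) x-large (y≃x² η 0<η))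
  where
  η = ε * ε * ℚ.½
  0<η : 0ℚ ℚ.< η
  0<η = ½ε>0 (0<ε ⟨*⟩⁺ 0<ε)
  step : ∀ ρ z² → d + ε ℚ.≤ ρ → ℚ.∣ z² - ρ * ρ ∣ ℚ.≤ η → d * d + η ℚ.≤ z²
  step ρ z² d+ε≤ρ near = ≤-by ((ρ * ρ - (d + ε) * (d + ε)) + (η - - (z² - ρ * ρ)) + 2ℚ * (d * ε) + (ε * ε - (η + η)))
    (eq d ε ρ z² η)
    (≤⇒0≤- (*-mono 0≤d+ε (ℚ.≤-trans 0≤d+ε d+ε≤ρ) d+ε≤ρ d+ε≤ρ) ⟨+⟩ ≤⇒0≤- (ℚ.≤-trans (-p≤∣p∣ (z² - ρ * ρ)) near)
      ⟨+⟩ 0≤2 ⟨*⟩ (0≤d ⟨*⟩ ℚ.<⇒≤ 0<ε) ⟨+⟩ ≤⇒0≤- (ℚ.≤-reflexive (½+½ (ε * ε))))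
    where
    0≤d+ε = 0≤d ⟨+⟩ ℚ.<⇒≤ 0<ε
    eq : ∀ d e r z h → z ≡ d * d + h + ((r * r - (d + e) * (d + e)) + (h - - (z - r * r)) + 2ℚ * (d * e) + (e * e - (h + h)))
    eq = solve-∀ ℚring

module PowerSpectrum (H G : Hypergraph) (G-ends : Ends G) (r : ℕ) (iso : H ≅ power (suc (suc r)) G)
  (vs : List (Hypergraph.V G)) (es : List (Hypergraph.E G)) (VS : Enumerates vs) (ES : Enumerates es) where

  private
    module H = Hypergraph H
    module P = PowerGraph G G-ends r vs es VS ES
  open P using (ws; WS; apply; adj; ‖_‖²)
  open _≅_ iso

  W : Set
  W = Hypergraph.V P.H

  vertices : Fin H.order ↔ W
  vertices = ↔-trans (Finite.enum H.V-finite) onV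

  at : Fin H.order → W
  at = Inverse.to vertices

  index : W → Fin H.order
  index = Inverse.from vertices

  s : ℚ
  s = + 1 ℚ./ suc r

  ∑-vertices : ∀ f → ∑ ws f ≡ (∑[ i ∈ List.allFin H.order ] f (at i))
  ∑-vertices f = trans (∑-enumerations WS (map-enumerates vertices (allFin-enumerates H.order)) f)
    (∑-map at (List.allFin H.order) f)

  seq-matrix : ∀ i j t → seq (adjacencyMatrix (suc (suc r)) H i j) t ≡ s * adj (at i) (at j)
  seq-matrix i j t = trans (by-cases (H.adjacent? (H.vertex i) (H.vertex j)))
    (cong (_*_ s) (𝟙-⇔ (H.adjacent? (H.vertex i) (H.vertex j)) (Hypergraph.adjacent? P.H (at i) (at j)) to′ from′))
    where
    by-cases : (d : Dec (H.Adjacent (H.vertex i) (H.vertex j))) → seq (if does d then recip (suc r) else 0ℝ) t ≡ s * 𝟙 d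
    by-cases (yes _) = sym (ℚ.*-identityʳ s)
    by-cases (no _)  = sym (ℚ.*-zeroʳ s)
    injective′ : ∀ {u v} → Inverse.to onV u ≡ Inverse.to onV v → u ≡ v
    injective′ eq = trans (sym (Inverse.strictlyInverseʳ onV _)) (trans (cong (Inverse.from onV) eq) (Inverse.strictlyInverseʳ onV _))
    to′ : H.Adjacent (H.vertex i) (H.vertex j) → Hypergraph.Adjacent P.H (at i) (at j)
    to′ (u≢v , e , u∈e , v∈e) = u≢v ∘ injective′ , Inverse.to onE e ,
      Equivalence.to (incident _ e) u∈e , Equivalence.to (incident _ e) v∈e
    from′ : Hypergraph.Adjacent P.H (at i) (at j) → H.Adjacent (H.vertex i) (H.vertex j)
    from′ (u≢v , e , u∈e , v∈e) = u≢v ∘ cong (Inverse.to onV) , Inverse.from onE e , back _ u∈e , back _ v∈e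
      where
      back : ∀ u → Hypergraph._∈_ P.H (Inverse.to onV u) e → u H.∈ Inverse.from onE e
      back u p = Equivalence.from (incident u _) (subst (Hypergraph._∈_ P.H (Inverse.to onV u)) (sym (Inverse.strictlyInverseˡ onE e)) p)

  seq-row : ∀ (x : Fin H.order → ℝ) i t →
    seq (Defs.∑ (λ j → adjacencyMatrix (suc (suc r)) H i j Defs.* x j)) t ≡ s * apply (λ w → seq (x (index w)) t) (at i)
  seq-row x i t = trans (seq-∑ (λ j → adjacencyMatrix (suc (suc r)) H i j Defs.* x j) t) (trans
    (∑-cong (List.allFin H.order) (λ j → trans (cong (_* seq (x j) t) (seq-matrix i j t)) (trans (ℚ.*-assoc s (adj (at i) (at j)) (seq (x j) t))
      (cong (λ k → s * (adj (at i) (at j) * seq (x k) t)) (sym (Inverse.strictlyInverseʳ vertices j))))))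
    (trans (sym (*-distribˡ-∑ s (List.allFin H.order) (λ j → adj (at i) (at j) * seq (x (index (at j))) t)))
      (cong (_*_ s) (sym (∑-vertices (λ w → adj (at i) w * seq (x (index w)) t))))))

  module _ (c : ℚ) (norm-≤ : ∀ X → ‖ apply X ‖² ℚ.≤ c * c * ‖ X ‖²) where

    -- The squared eigenvalue equations, summed over all rows at a single index t, say that T t =
    -- s²‖Ax‖² - |z|²‖x‖² is null. With |z|² ≥ (s c)² + ε and ‖x‖² ≥ δ the norm bound would keep it
    -- below -ε δ.
    eigenvalue-≤ : ∀ z → IsEigenvalue (adjacencyMatrix (suc (suc r)) H) z → normSq z ≤ fromℚ ((s * c) * (s * c))
    eigenvalue-≤ z (x , (i₀ , x#0) , Ax≃zx) (ε , 0<ε , z-large) = absurd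
      (Eventually-map₂ (λ p q → p , q) (Eventually-map₂ (λ p q → p , q) z-large (proj₂ (proj₂ norm>0))) (T→0 η 0<η))
      where
      a b : ℕ → W → ℚ
      a t w = seq (re (x (index w))) t
      b t w = seq (im (x (index w))) t
      zr zi : ℕ → ℚ
      zr t = seq (re z) t
      zi t = seq (im z) t
      norm : ℕ → ℚ
      norm t = ‖ a t ‖² + ‖ b t ‖²
      norm>0 : ∃ λ δ → 0ℚ ℚ.< δ × Eventually (λ t → δ ℚ.≤ norm t)
      norm>0 = [ (λ p → from-coordinate (#0⇒bounded-below (re (x i₀)) p) (λ t → ℚ.≤-trans (coordinate (re ∘ x) t) (≤-by ‖ b t ‖² refl (∑-0≤ ws (λ w → 0≤p² (b t w))))))
               , (λ p → from-coordinate (#0⇒bounded-below (im (x i₀)) p) (λ t → ℚ.≤-trans (coordinate (im ∘ x) t) (≤-by ‖ a t ‖² (ℚ.+-comm ‖ a t ‖² ‖ b t ‖²) (∑-0≤ ws (λ w → 0≤p² (a t w)))))) ]′ x#0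
        where
        coordinate : ∀ (y : Fin H.order → ℝ) t → seq (y i₀) t * seq (y i₀) t ℚ.≤ ‖ (λ w → seq (y (index w)) t) ‖²
        coordinate y t = subst (λ i → seq (y i) t * seq (y i) t ℚ.≤ ‖ (λ w → seq (y (index w)) t) ‖²) (Inverse.strictlyInverseʳ vertices i₀)
          (∑-∈ {f = λ w → seq (y (index w)) t * seq (y (index w)) t} (λ w → 0≤p² (seq (y (index w)) t)) (complete WS (at i₀)))
        from-coordinate : ∀ {f : ℕ → ℚ} → (∃ λ δ → 0ℚ ℚ.< δ × Eventually (λ t → δ ℚ.≤ f t)) → (∀ t → f t ℚ.≤ norm t) →
          ∃ λ δ → 0ℚ ℚ.< δ × Eventually (λ t → δ ℚ.≤ norm t)
        from-coordinate (δ , 0<δ , N , h) f≤ = δ , 0<δ , N , λ t N≤t → ℚ.≤-trans (h t N≤t) (f≤ t)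
      δ = proj₁ norm>0
      η = ε * δ * ℚ.½
      0<η : 0ℚ ℚ.< η
      0<η = ½ε>0 (0<ε ⟨*⟩⁺ proj₁ (proj₂ norm>0))
      T : ℕ → ℚ
      T t = s * s * (‖ apply (a t) ‖² + ‖ apply (b t) ‖²) - (zr t * zr t + zi t * zi t) * norm t
      T→0 : Null T
      T→0 = Null-cong total (Null-∑ (List.allFin H.order) (λ i → Null-+
          (Null-squares (re ((adjacencyMatrix (suc (suc r)) H *ᵛ x) i)) (re (z *ᶜ x i)) (proj₁ (Ax≃zx i)))
          (Null-squares (im ((adjacencyMatrix (suc (suc r)) H *ᵛ x) i)) (im (z *ᶜ x i)) (proj₂ (Ax≃zx i)))))
        where
        sq : ℚ → ℚ
        sq p = p * p
        f : ℕ → W → ℚ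
        f t w = (sq (s * apply (a t) w) - sq (zr t * a t w - zi t * b t w)) + (sq (s * apply (b t) w) - sq (zr t * b t w + zi t * a t w))
        term : ∀ t i → (sq (seq (re ((adjacencyMatrix (suc (suc r)) H *ᵛ x) i)) t) - sq (seq (re (z *ᶜ x i)) t)) + (sq (seq (im ((adjacencyMatrix (suc (suc r)) H *ᵛ x) i)) t) - sq (seq (im (z *ᶜ x i)) t)) ≡ f t (at i)
        term t i = cong₂ _+_
          (cong₂ _-_ (cong sq (seq-row (re ∘ x) i t)) (cong (λ k → sq (zr t * seq (re (x k)) t - zi t * seq (im (x k)) t)) (sym (Inverse.strictlyInverseʳ vertices i))))
          (cong₂ _-_ (cong sq (seq-row (im ∘ x) i t)) (cong (λ k → sq (zr t * seq (im (x k)) t + zi t * seq (re (x k)) t)) (sym (Inverse.strictlyInverseʳ vertices i))))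
        eq : ∀ s pa pb zr zi a b → ((s * pa) * (s * pa) - (zr * a - zi * b) * (zr * a - zi * b)) + ((s * pb) * (s * pb) - (zr * b + zi * a) * (zr * b + zi * a))
          ≡ s * s * (pa * pa + pb * pb) - (zr * zr + zi * zi) * (a * a + b * b)
        eq = solve-∀ ℚring
        total : ∀ t → (∑[ i ∈ List.allFin H.order ] (sq (seq (re ((adjacencyMatrix (suc (suc r)) H *ᵛ x) i)) t) - sq (seq (re (z *ᶜ x i)) t)) + (sq (seq (im ((adjacencyMatrix (suc (suc r)) H *ᵛ x) i)) t) - sq (seq (im (z *ᶜ x i)) t))) ≡ T t
        total t = begin
          (∑[ i ∈ List.allFin H.order ] (sq (seq (re ((adjacencyMatrix (suc (suc r)) H *ᵛ x) i)) t) - sq (seq (re (z *ᶜ x i)) t)) + (sq (seq (im ((adjacencyMatrix (suc (suc r)) H *ᵛ x) i)) t) - sq (seq (im (z *ᶜ x i)) t)))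
            ≡⟨ ∑-cong (List.allFin H.order) (term t) ⟩
          (∑[ i ∈ List.allFin H.order ] f t (at i))
            ≡⟨ ∑-vertices (f t) ⟨
          ∑ ws (f t)
            ≡⟨ ∑-cong ws (λ w → eq s (apply (a t) w) (apply (b t) w) (zr t) (zi t) (a t w) (b t w)) ⟩
          (∑[ w ∈ ws ] s * s * (pa w * pa w + pb w * pb w) - z² * (a t w * a t w + b t w * b t w))
            ≡⟨ ∑-distrib-- ws (λ w → s * s * (pa w * pa w + pb w * pb w)) (λ w → z² * (a t w * a t w + b t w * b t w)) ⟩
          (∑[ w ∈ ws ] s * s * (pa w * pa w + pb w * pb w)) - (∑[ w ∈ ws ] z² * (a t w * a t w + b t w * b t w))
            ≡⟨ cong₂ _-_ (*-distribˡ-∑ (s * s) ws (λ w → pa w * pa w + pb w * pb w)) (*-distribˡ-∑ z² ws (λ w → a t w * a t w + b t w * b t w)) ⟨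
          s * s * (∑[ w ∈ ws ] pa w * pa w + pb w * pb w) - z² * (∑[ w ∈ ws ] a t w * a t w + b t w * b t w)
            ≡⟨ cong₂ (λ p q → s * s * p - z² * q) (∑-distrib-+ ws (λ w → pa w * pa w) (λ w → pb w * pb w)) (∑-distrib-+ ws (λ w → a t w * a t w) (λ w → b t w * b t w)) ⟩
          T t ∎
          where
          open ≡-Reasoning
          pa pb : W → ℚ
          pa = apply (a t)
          pb = apply (b t)
          z² = zr t * zr t + zi t * zi t
      absurd : Eventually (λ t → (((s * c) * (s * c) + ε ℚ.≤ zr t * zr t + zi t * zi t) × δ ℚ.≤ norm t) × ℚ.∣ T t ∣ ℚ.≤ η) → ⊥
      absurd (N , h) = ℚ.<-irrefl refl (ℚ.<-≤-trans (½<1 (0<ε ⟨*⟩⁺ 0<δ)) εδ≤η)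
        where
        z²≥ = proj₁ (proj₁ (h N ℕ.≤-refl))
        norm≥ = proj₂ (proj₁ (h N ℕ.≤-refl))
        ∣T∣≤η = proj₂ (h N ℕ.≤-refl)
        0<δ = proj₁ (proj₂ norm>0)
        n = norm N
        z² = zr N * zr N + zi N * zi N
        p = ‖ apply (a N) ‖² + ‖ apply (b N) ‖²
        0≤n : 0ℚ ℚ.≤ n
        0≤n = ℚ.≤-trans (ℚ.<⇒≤ 0<δ) norm≥
        eq : ∀ ε δ n z² s c p η → η ≡ ε * δ + (ε * (n - δ) + ((z² - ((s * c) * (s * c) + ε)) * n + ((s * s) * (c * c * n - p) + (η - - (s * s * p - z² * n)))))
        eq = solve-∀ ℚring
        p≤ : p ℚ.≤ c * c * n
        p≤ = ℚ.≤-trans (ℚ.+-mono-≤ (norm-≤ (a N)) (norm-≤ (b N))) (ℚ.≤-reflexive (sym (ℚ.*-distribˡ-+ (c * c) ‖ a N ‖² ‖ b N ‖²)))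
        εδ≤η : ε * δ ℚ.≤ η
        εδ≤η = ≤-by (ε * (n - δ) + ((z² - ((s * c) * (s * c) + ε)) * n + ((s * s) * (c * c * n - p) + (η - - (s * s * p - z² * n)))))
          (eq ε δ n z² s c p η)
          (ℚ.<⇒≤ 0<ε ⟨*⟩ ≤⇒0≤- norm≥ ⟨+⟩ (≤⇒0≤- z²≥ ⟨*⟩ 0≤n ⟨+⟩ (0≤p² s ⟨*⟩ ≤⇒0≤- p≤ ⟨+⟩ ≤⇒0≤- (ℚ.≤-trans (-p≤∣p∣ (T N)) ∣T∣≤η))))

    λ₁-≤ : ∀ ρ → Isλ₁ (suc (suc r)) H ρ → 0ℚ ℚ.≤ s * c → ρ ≤ fromℚ (s * c)
    λ₁-≤ ρ (_ , (z , z-eigen , z²≃ρ²) , _) 0≤sc = sqrt-≤ ρ (normSq z) 0≤sc z²≃ρ² (eigenvalue-≤ z z-eigen)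

  module _ (ν κ : ℕ → ℚ) (0<ν : ∀ t → 0ℚ ℚ.< ν t) (κ-eq : ∀ t → κ t * (ν t + (1ℚ + fromℕ′ r)) ≡ fromℕ′ r)
    (ν-cauchy : IsCauchy ν) (Y : ℕ → Hypergraph.V G → ℚ) (Y-cauchy : ∀ v → IsCauchy (λ t → Y t v))
    (residual→0 : ∀ v → Null (λ t → P.residual (ν t) (κ t) (0<ν t) (κ-eq t) (Y t) v)) where

    private
      νℝ : ℝ
      νℝ = mkℝ ν ν-cauchy
      Yℝ : Hypergraph.V G → ℝ
      Yℝ v = mkℝ (λ t → Y t v) (Y-cauchy v)

    liftℝ : W → ℝ
    liftℝ (inj₁ v)       = (νℝ Defs.+ fromℚ 1ℚ) Defs.* Yℝ v
    liftℝ (inj₂ (e , _)) = Yℝ (Ends.src G-ends e) Defs.+ Yℝ (Ends.tgt G-ends e)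

    λℝ : ℝ
    λℝ = fromℚ s Defs.* (νℝ Defs.+ fromℚ (fromℕ′ r))

    seq-lift : ∀ w t → seq (liftℝ w) t ≡ P.lift (ν t) (κ t) (0<ν t) (κ-eq t) (Y t) w
    seq-lift (inj₁ v) t = refl
    seq-lift (inj₂ _) t = refl

    -- Rows of new vertices hold exactly at every index. The row of an old vertex errs by the
    -- residual times a convergent factor.
    row-defect : ∀ w → Null (λ t → s * apply (λ w → seq (liftℝ w) t) w - s * (ν t + fromℕ′ r) * seq (liftℝ w) t)
    row-defect (inj₁ v) = Null-cong (λ t → trans (eq s (ν t) (fromℕ′ r) (res t v) (seq (liftℝ (inj₁ v)) t))
        (cong (λ a → s * a - s * (ν t + fromℕ′ r) * seq (liftℝ (inj₁ v)) t)
          (sym (trans (∑-cong ws (λ w → cong (_*_ (adj (inj₁ v) w)) (seq-lift w t))) (P.apply-lift-old (ν t) (κ t) (0<ν t) (κ-eq t) (Y t) v)))))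
      (Null-* (residual→0 v) (fromℚ (- s) Defs.* (νℝ Defs.+ fromℚ (1ℚ + fromℕ′ r))))
      where
      res : ∀ t v → ℚ
      res t v = P.residual (ν t) (κ t) (0<ν t) (κ-eq t) (Y t) v
      eq : ∀ s ν r ρ y → ρ * (- s * (ν + (1ℚ + r))) ≡ s * ((ν + r) * y - (ν + (1ℚ + r)) * ρ) - s * (ν + r) * y
      eq = solve-∀ ℚring
    row-defect (inj₂ (e , j)) = Null-cong (λ t → trans (eq s (ν t) (fromℕ′ r) (seq (liftℝ (inj₂ (e , j))) t))
        (cong (λ a → s * a - s * (ν t + fromℕ′ r) * seq (liftℝ (inj₂ (e , j))) t)
          (sym (trans (∑-cong ws (λ w → cong (_*_ (adj (inj₂ (e , j)) w)) (seq-lift w t))) (P.apply-lift-new (ν t) (κ t) (0<ν t) (κ-eq t) (Y t) e j)))))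
      Null-0
      where
      eq : ∀ s ν r y → 0ℚ ≡ s * ((ν + r) * y) - s * (ν + r) * y
      eq = solve-∀ ℚring

    lift-eigenvalue : (∃ λ v → ∀ t → 1ℚ ℚ.≤ Y t v) → IsEigenvalue (adjacencyMatrix (suc (suc r)) H) (λℝ +i 0ℝ)
    lift-eigenvalue (v₀ , 1≤Y) = x , (index (inj₁ v₀) , inj₁ (inj₂ nonzero)) , λ i → real i , imaginary i
      where
      x : Fin H.order → ℂ
      x i = liftℝ (at i) +i 0ℝ
      nonzero : 0ℝ < re (x (index (inj₁ v₀)))
      nonzero = 1ℚ , 0<1 , 0 , λ t _ → subst (λ w → 0ℚ + 1ℚ ℚ.≤ seq (liftℝ w) t) (sym (Inverse.strictlyInverseˡ vertices (inj₁ v₀)))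
        (≤-by (Y t v₀ - 1ℚ + ν t * Y t v₀) (eq (ν t) (Y t v₀)) (≤⇒0≤- (1≤Y t) ⟨+⟩ ℚ.<⇒≤ (0<ν t) ⟨*⟩ ℚ.≤-trans 0≤1 (1≤Y t)))
        where
        eq : ∀ ν y → (ν + 1ℚ) * y ≡ 0ℚ + 1ℚ + (y - 1ℚ + ν * y)
        eq = solve-∀ ℚring
      real : ∀ i → re ((adjacencyMatrix (suc (suc r)) H *ᵛ x) i) ≃ re ((λℝ +i 0ℝ) *ᶜ x i)
      real i = Null-cong (λ t → trans (eq (s * apply (λ w → seq (liftℝ w) t) (at i)) (s * (ν t + fromℕ′ r) * seq (liftℝ (at i)) t))
          (cong (_- (s * (ν t + fromℕ′ r) * seq (liftℝ (at i)) t - 0ℚ * 0ℚ)) (sym (trans (seq-row (re ∘ x) i t)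
            (cong (_*_ s) (∑-cong ws (λ w → cong (λ u → adj (at i) w * seq (liftℝ u) t) (Inverse.strictlyInverseˡ vertices w))))))))
        (row-defect (at i))
        where
        eq : ∀ a b → a - b ≡ a - (b - 0ℚ * 0ℚ)
        eq = solve-∀ ℚring
      imaginary : ∀ i → im ((adjacencyMatrix (suc (suc r)) H *ᵛ x) i) ≃ im ((λℝ +i 0ℝ) *ᶜ x i)
      imaginary i = Null-cong (λ t → trans (eq s (s * (ν t + fromℕ′ r)) (seq (liftℝ (at i)) t))
          (cong (_- (s * (ν t + fromℕ′ r) * 0ℚ + 0ℚ * seq (liftℝ (at i)) t)) (sym (trans (seq-row (im ∘ x) i t)
            (cong (_*_ s) (trans (∑-cong ws (λ w → ℚ.*-zeroʳ (adj (at i) w))) (∑-zero ws)))))))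
        Null-0
        where
        eq : ∀ s l y → 0ℚ ≡ s * 0ℚ - (l * 0ℚ + 0ℚ * y)
        eq = solve-∀ ℚring

    -- One coordinate stays at least 1, so the limit vector is non-zero and its eigenvalue competes
    -- for the maximum σ. The relations 0 ≤ σ and λ² ≤ σ² are used with errors δ/2 and δ²/2, which
    -- leaves δ²/4 in the comparison of the squares.
    λ₁-> : (∃ λ v → ∀ t → 1ℚ ℚ.≤ Y t v) → ∀ σ → Isλ₁ (suc (suc r)) H σ → ∀ c δ → 0ℚ ℚ.≤ c → 0ℚ ℚ.< δ →
      Eventually (λ t → c + δ ℚ.≤ s * (ν t + fromℕ′ r)) → fromℚ c < σ
    λ₁-> nonzero σ (0≤σ , _ , σ-max) c δ 0≤c 0<δ large = half , ½ε>0 0<δ ,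
      Eventually-map₂ (λ {t} h (p , q) → above (seq σ t) (s * (ν t + fromℕ′ r)) h p q) large (Eventually-map₂ _,_
        (≤⇒eventually 0ℝ σ 0≤σ half (½ε>0 0<δ))
        (≤⇒eventually (normSq (λℝ +i 0ℝ)) (σ Defs.* σ) (σ-max (λℝ +i 0ℝ) (lift-eigenvalue nonzero)) (half * δ) (½ε>0 0<δ ⟨*⟩⁺ 0<δ)))
      where
      half = δ * ℚ.½
      above : ∀ σ l → c + δ ℚ.≤ l → 0ℚ ℚ.≤ σ + half → l * l + 0ℚ * 0ℚ ℚ.≤ σ * σ + half * δ → c + half ℚ.≤ σ
      above σ l c+δ≤l 0≤σ+h l²≤ = at-least (c + half ℚ.≤? σ)
        where
        h = half
        c+δ′≤l : c + (h + h) ℚ.≤ l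
        c+δ′≤l = subst (λ d → c + d ℚ.≤ l) (sym (½+½ δ)) c+δ≤l
        l²≤′ : l * l + 0ℚ * 0ℚ ℚ.≤ σ * σ + h * (h + h)
        l²≤′ = subst (λ d → l * l + 0ℚ * 0ℚ ℚ.≤ σ * σ + h * d) (sym (½+½ δ)) l²≤
        0≤c+2h : 0ℚ ℚ.≤ c + (h + h)
        0≤c+2h = subst (λ d → 0ℚ ℚ.≤ c + d) (sym (½+½ δ)) (0≤c ⟨+⟩ ℚ.<⇒≤ 0<δ)
        eq₁ : ∀ c h σ l → 0ℚ ≡ h * h + (2ℚ * (c * h) + ((c + h - σ) * (c + (h + σ)) + (σ * σ + h * (h + h) - (l * l + 0ℚ * 0ℚ)) + (l * l - (c + (h + h)) * (c + (h + h)))))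
        eq₁ = solve-∀ ℚring
        at-least : Dec (c + h ℚ.≤ σ) → c + h ℚ.≤ σ
        at-least (yes p) = p
        at-least (no ¬p) = contradiction (ℚ.<-≤-trans (½ε>0 0<δ ⟨*⟩⁺ ½ε>0 0<δ)
          (≤-by (2ℚ * (c * h) + ((c + h - σ) * (c + (h + σ)) + (σ * σ + h * (h + h) - (l * l + 0ℚ * 0ℚ)) + (l * l - (c + (h + h)) * (c + (h + h)))))
            (eq₁ c h σ l)
            (0≤2 ⟨*⟩ (0≤c ⟨*⟩ ℚ.<⇒≤ (½ε>0 0<δ)) ⟨+⟩ (≤⇒0≤- (ℚ.<⇒≤ (ℚ.≰⇒> ¬p)) ⟨*⟩ (0≤c ⟨+⟩ subst (0ℚ ℚ.≤_) (ℚ.+-comm σ h) 0≤σ+h)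
              ⟨+⟩ ≤⇒0≤- l²≤′ ⟨+⟩ ≤⇒0≤- (*-mono 0≤c+2h (ℚ.≤-trans 0≤c+2h c+δ′≤l) c+δ′≤l c+δ′≤l))))) (ℚ.<-irrefl refl)

-- Moving edges

pathE : A → List A → A → List (A × A)
pathE a []       b = [ (a , b) ]
pathE a (c ∷ cs) b = (a , c) ∷ pathE c cs b

swap : A × A → A × A
swap (a , b) = b , a

pathE-++ : ∀ (a : A) xs y ys b → pathE a (xs ++ y ∷ ys) b ≡ pathE a xs y ++ pathE y ys b
pathE-++ a []       y ys b = refl
pathE-++ a (x ∷ xs) y ys b = cong ((a , x) ∷_) (pathE-++ x xs y ys b)

pathE-reverse : ∀ (a : A) cs b → pathE b (reverse cs) a ↭ map swap (pathE a cs b)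
pathE-reverse a []       b = ↭-refl
pathE-reverse a (c ∷ cs) b = subst (_↭ map swap (pathE a (c ∷ cs) b))
  (sym (trans (cong (λ xs → pathE b xs a) (List.unfold-reverse c cs)) (pathE-++ b (reverse cs) c [] a)))
  (↭-trans (↭.++-comm (pathE b (reverse cs) c) [ (c , a) ]) (↭-prep (c , a) (pathE-reverse c cs b)))

rotate : ∀ (c : A) xs y ys → pathE c (xs ++ y ∷ ys) c ↭ pathE y (ys ++ c ∷ xs) y
rotate c xs y ys = subst₂ _↭_ (sym (pathE-++ c xs y ys c)) (sym (pathE-++ y ys c xs y)) (↭.++-comm (pathE c xs y) (pathE y ys c))

-- Graphs are compared through `val φ` for all symmetric φ at once: φ = `q` gives the form and φ =
-- `row v` half of its partial derivative at v. Symmetry of φ makes the orientation of the listed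
-- pairs immaterial.
val : (A → A → ℚ) → List (A × A) → ℚ
val φ L = ∑ L (λ (a , b) → φ a b)

val-++ : ∀ (φ : A → A → ℚ) L L′ → val φ (L ++ L′) ≡ val φ L + val φ L′
val-++ φ L L′ = ∑-++ L L′ (λ (a , b) → φ a b)

val-↭ : ∀ (φ : A → A → ℚ) {L L′} → L ↭ L′ → val φ L ≡ val φ L′
val-↭ φ = ∑-↭ (λ (a , b) → φ a b)

Symmetric : (A → A → ℚ) → Set
Symmetric φ = ∀ a b → φ a b ≡ φ b a

val-swap : ∀ {φ : A → A → ℚ} → Symmetric φ → ∀ L → val φ (map swap L) ≡ val φ L
val-swap {φ = φ} φ-sym L = trans (∑-map swap L (λ (a , b) → φ a b)) (∑-cong L (λ (a , b) → φ-sym b a))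

val-reverse : ∀ {φ : A → A → ℚ} → Symmetric φ → ∀ a cs b → val φ (pathE b (reverse cs) a) ≡ val φ (pathE a cs b)
val-reverse {φ = φ} φ-sym a cs b = trans (val-↭ φ (pathE-reverse a cs b)) (val-swap φ-sym (pathE a cs b))

val-end-mono : ∀ (φ : A → A → ℚ) c cs {u v} → (∀ x → φ x u ℚ.≤ φ x v) → val φ (pathE c cs u) ℚ.≤ val φ (pathE c cs v)
val-end-mono φ c []       h = ℚ.+-monoˡ-≤ 0ℚ (h c)
val-end-mono φ c (x ∷ cs) h = ℚ.+-monoʳ-≤ (φ c x) (val-end-mono φ x cs h)

∑-mono-All : ∀ {xs : List A} {f g : A → ℚ} → All (λ x → f x ℚ.≤ g x) xs → ∑ xs f ℚ.≤ ∑ xs g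
∑-mono-All []       = ℚ.≤-refl
∑-mono-All (p ∷ ps) = ℚ.+-mono-≤ p (∑-mono-All ps)

module Weights (V : Set) (_≟_ : DecidableEquality V) (κ : ℚ) (0≤κ : 0ℚ ℚ.≤ κ) (w : V → ℚ) (0≤w : ∀ v → 0ℚ ℚ.≤ w v) where

  q : V → V → ℚ
  q a b = qForm κ (w a) (w b)

  row : V → V → V → ℚ
  row = qRow _≟_ κ w

  q-sym : Symmetric q
  q-sym a b = eq κ (w a) (w b)
    where
    eq : ∀ k a b → k * (a * a + b * b) + 2ℚ * (a * b) ≡ k * (b * b + a * a) + 2ℚ * (b * a)
    eq = solve-∀ ℚring

  row-sym : ∀ v → Symmetric (row v)
  row-sym v a b = ℚ.+-comm (𝟙 (a ≟ v) * (κ * w a + w b)) (𝟙 (b ≟ v) * (κ * w b + w a))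

  0≤half-row : ∀ a b → 0ℚ ℚ.≤ κ * w a + w b
  0≤half-row a b = 0≤κ ⟨*⟩ 0≤w a ⟨+⟩ 0≤w b

  0≤row : ∀ v a b → 0ℚ ℚ.≤ row v a b
  0≤row v a b = 0≤𝟙 (a ≟ v) ⟨*⟩ 0≤half-row a b ⟨+⟩ 0≤𝟙 (b ≟ v) ⟨*⟩ 0≤half-row b a

  q-mono : ∀ x {u v} → w u ℚ.≤ w v → q x u ℚ.≤ q x v
  q-mono x {u} {v} u≤v = ≤-by (κ * ((w v - w u) * (w v + w u)) + 2ℚ * (w x * (w v - w u))) (eq κ (w x) (w u) (w v))
    (0≤κ ⟨*⟩ (≤⇒0≤- u≤v ⟨*⟩ (0≤w v ⟨+⟩ 0≤w u)) ⟨+⟩ 0≤2 ⟨*⟩ (0≤w x ⟨*⟩ ≤⇒0≤- u≤v))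
    where
    eq : ∀ k x u v → k * (x * x + v * v) + 2ℚ * (x * v) ≡ k * (x * x + u * u) + 2ℚ * (x * u) + (k * ((v - u) * (v + u)) + 2ℚ * (x * (v - u)))
    eq = solve-∀ ℚring

  q-exchange : ∀ {a b c d} → w b ℚ.≤ w a → w d ℚ.≤ w c → q a d + q b c ℚ.≤ q a c + q b d
  q-exchange {a} {b} {c} {d} b≤a d≤c = ≤-by (2ℚ * ((w a - w b) * (w c - w d))) (eq κ (w a) (w b) (w c) (w d))
    (0≤2 ⟨*⟩ (≤⇒0≤- b≤a ⟨*⟩ ≤⇒0≤- d≤c))
    where
    eq : ∀ k a b c d → k * (a * a + c * c) + 2ℚ * (a * c) + (k * (b * b + d * d) + 2ℚ * (b * d))
      ≡ k * (a * a + d * d) + 2ℚ * (a * d) + (k * (b * b + c * c) + 2ℚ * (b * c)) + 2ℚ * ((a - b) * (c - d))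
    eq = solve-∀ ℚring

  row-at : ∀ {v x} → x ≢ v → row v v x ≡ κ * w v + w x
  row-at {v} {x} x≢v = trans (cong₂ (λ i j → i * (κ * w v + w x) + j * (κ * w x + w v)) (𝟙-yes (v ≟ v) refl) (𝟙-no (x ≟ v) x≢v))
    (eq (κ * w v + w x) (κ * w x + w v))
    where
    eq : ∀ a b → 1ℚ * a + 0ℚ * b ≡ a
    eq = solve-∀ ℚring

  row-away : ∀ {v a} b → a ≢ v → row v a b ≡ 𝟙 (b ≟ v) * (κ * w b + w a)
  row-away {v} {a} b a≢v = trans (cong (λ i → i * (κ * w a + w b) + 𝟙 (b ≟ v) * (κ * w b + w a)) (𝟙-no (a ≟ v) a≢v))
    (eq (κ * w a + w b) (𝟙 (b ≟ v) * (κ * w b + w a)))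
    where
    eq : ∀ a b → 0ℚ * a + b ≡ b
    eq = solve-∀ ℚring

  row-off : ∀ {v a b} → a ≢ v → b ≢ v → row v a b ≡ 0ℚ
  row-off {v} {a} {b} a≢v b≢v = trans (row-away b a≢v) (trans (cong (_* (κ * w b + w a)) (𝟙-no (b ≟ v) b≢v)) (ℚ.*-zeroˡ (κ * w b + w a)))

  row-at-≥ : ∀ {v x} → x ≢ v → w x ℚ.≤ row v v x
  row-at-≥ {v} {x} x≢v = subst (w x ℚ.≤_) (sym (row-at x≢v)) (≤-by (κ * w v) (ℚ.+-comm (κ * w v) (w x)) (0≤κ ⟨*⟩ 0≤w v))

  row-mono : ∀ {v a b} → a ≢ v → b ≢ v → w a ℚ.≤ w b → ∀ x → row v a x ℚ.≤ row v b x
  row-mono {v} {a} {b} a≢v b≢v a≤b x = subst₂ ℚ._≤_ (sym (row-away x a≢v)) (sym (row-away x b≢v))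
    (*-monoˡ (0≤𝟙 (x ≟ v)) (ℚ.+-monoʳ-≤ (κ * w x) a≤b))

  row-end-mono : ∀ {u v} → u ≢ v → w u ℚ.≤ w v → ∀ x → row v x u ℚ.≤ row v x v
  row-end-mono {u} {v} u≢v u≤v x = ≤-by (𝟙 (x ≟ v) * (w v - w u) + (κ * w v + w x))
    (trans (cong (λ j → 𝟙 (x ≟ v) * (κ * w x + w v) + j * (κ * w v + w x)) (𝟙-yes (v ≟ v) refl))
      (trans (eq (𝟙 (x ≟ v)) κ (w x) (w u) (w v))
        (cong (λ j → 𝟙 (x ≟ v) * (κ * w x + w u) + j * (κ * w u + w x) + (𝟙 (x ≟ v) * (w v - w u) + (κ * w v + w x))) (sym (𝟙-no (u ≟ v) u≢v)))))
    (0≤𝟙 (x ≟ v) ⟨*⟩ ≤⇒0≤- u≤v ⟨+⟩ 0≤half-row v x)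
    where
    eq : ∀ i k x u v → i * (k * x + v) + 1ℚ * (k * v + x) ≡ i * (k * x + u) + 0ℚ * (k * u + x) + (i * (v - u) + (k * v + x))
    eq = solve-∀ ℚring

record Labelled (V : Set) : Set where
  constructor labelled
  field
    centre head : V
    rim leaves  : List V
    foot        : V

-- The graph of UC 2 l (a , 1): cycle centre ∷ head ∷ rim, pendant leaves at centre, and pendant foot at head.
edgesU : ∀ {V} → Labelled V → List (V × V)
edgesU (labelled M c cs os t) = pathE M (c ∷ cs) M ++ map (_, M) os ++ [ (t , c) ]

vertsU : ∀ {V} → Labelled V → List V
vertsU (labelled M c cs os t) = M ∷ c ∷ cs ++ os ++ [ t ]

val-X : ∀ {V : Set} (φ : V → V → ℚ) M cs os t s →
  val φ (pathE M cs M ++ map (_, M) os ++ [ (t , s) ]) ≡ val φ (pathE M cs M) + ((∑[ o ∈ os ] φ o M) + φ t s)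
val-X φ M cs os t s = trans (val-++ φ (pathE M cs M) _) (cong (_+_ (val φ (pathE M cs M)))
  (trans (val-++ φ (map (_, M) os) [ (t , s) ]) (cong₂ _+_ (∑-map (_, M) os (λ (a , b) → φ a b)) (ℚ.+-identityʳ (φ t s)))))

-- The situation after re-attaching all tree edges but one: the kept foot t hangs at an arbitrary s.
-- For s next to M on the cycle this is `edgesU`.
edgesX : ∀ {V : Set} → V → List V → List V → V → V → List (V × V)
edgesX M cs os t s = pathE M cs M ++ map (_, M) os ++ [ (t , s) ]

-- `first` and `last` are the two neighbours of M on the cycle; in these positions the graph already
-- is that of U₂, up to reading the cycle backwards.
data Position {V : Set} (s : V) : List V → List V → Set where
  first  : ∀ {cs os} → Position s (s ∷ cs) os
  last   : ∀ {c cs os} → Position s ((c ∷ cs) ++ [ s ]) os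
  middle : ∀ {c xs z ys os} → Position s (c ∷ xs ++ s ∷ z ∷ ys) os
  leaf   : ∀ {c z ys os os′} → os ↭ s ∷ os′ → Position s (c ∷ z ∷ ys) os

near? : ∀ {V : Set} {s : V} {cs os} → Position s cs os → Bool
near? first    = true
near? last     = true
near? middle   = false
near? (leaf _) = false

module Moves (V : Set) (_≟_ : DecidableEquality V) (κ : ℚ) (0≤κ : 0ℚ ℚ.≤ κ) (κ≤1 : κ ℚ.≤ 1ℚ)
  (w : V → ℚ) (0≤w : ∀ v → 0ℚ ℚ.≤ w v) (w≤1 : ∀ v → w v ℚ.≤ 1ℚ) (M : V) (w≤M : ∀ v → w v ℚ.≤ w M)
  (δ δ₁ : ℚ) (0≤δ : 0ℚ ℚ.≤ δ) (δ≤δ₁ : δ ℚ.≤ δ₁) (δ₁≤w : ∀ v → δ₁ ℚ.≤ w v) where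

  open Weights V _≟_ κ 0≤κ w 0≤w public

  -- The field `row-≤` is carried along because moves are chained: what an earlier move gains in the
  -- row of M has to survive the later one.
  record Towards (L : List (V × V)) (n : ℕ) (vs : List V) (tol : ℚ) : Set where
    constructor towards
    field
      target     : Labelled V
      vertices   : vertsU target ↭ vs
      rim-length : length (Labelled.rim target) ≡ n
      q-≤        : val q L ℚ.≤ val q (edgesU target) + tol
      row-≤      : val (row M) L ℚ.≤ val (row M) (edgesU target)

  -- A gain in a row rather than in the form: the values of the form may agree at w, but with
  -- different partial derivatives a change of w v tells the two graphs apart.
  Gain : ∀ {L n vs tol} → Towards L n vs tol → ℚ → Set
  Gain {L} T g = ∃ λ v → val (row v) L + g ℚ.≤ val (row v) (edgesU (Towards.target T))

  -- Either an exact move with the small row gain δ, or a move that may lose 4 δ of the form but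
  -- gains the larger δ₁ in a row. Later δ is chosen of the order of δ₁² so that both kinds win.
  Improved : List (V × V) → ℕ → List V → Set
  Improved L n vs = (Σ (Towards L n vs 0ℚ) λ T → Gain T δ) ⊎ (Σ (Towards L n vs (4ℚ * δ)) λ T → Gain T δ₁)

  vertsX : List V → List V → V → List V
  vertsX cs os t = M ∷ cs ++ os ++ [ t ]

  private
    +0 : ∀ {a b} → a ℚ.≤ b → a ℚ.≤ b + 0ℚ
    +0 {a} {b} = subst (a ℚ.≤_) (sym (ℚ.+-identityʳ b))

  near-first : ∀ s cs os t → Towards (edgesX M (s ∷ cs) os t s) (length cs) (vertsX (s ∷ cs) os t) 0ℚ
  near-first s cs os t = towards (labelled M s cs os t) ↭-refl refl (+0 ℚ.≤-refl) ℚ.≤-refl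

  near-last : ∀ s cs os t → Towards (edgesX M (cs ++ [ s ]) os t s) (length cs) (vertsX (cs ++ [ s ]) os t) 0ℚ
  near-last s cs os t = towards (labelled M s (reverse cs) os t)
    (↭-prep M (↭.++⁺ʳ (os ++ [ t ]) (subst (_↭ cs ++ [ s ]) (List.reverse-++ cs [ s ]) (↭.↭-reverse (cs ++ [ s ])))))
    (List.length-reverse cs) (+0 (ℚ.≤-reflexive (same q q-sym))) (ℚ.≤-reflexive (same (row M) (row-sym M)))
    where
    same : ∀ φ → Symmetric φ → val φ (edgesX M (cs ++ [ s ]) os t s) ≡ val φ (edgesX M (s ∷ reverse cs) os t s)
    same φ φ-sym = trans (val-X φ M (cs ++ [ s ]) os t s) (trans
      (cong (_+ ((∑[ o ∈ os ] φ o M) + φ t s)) (trans (sym (val-reverse φ-sym M (cs ++ [ s ]) M)) (cong (λ xs → val φ (pathE M xs M)) (List.reverse-++ cs [ s ]))))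
      (sym (val-X φ M (s ∷ reverse cs) os t s)))

  -- Lowering the second weight from w s to w c costs at most the factor κ (w s + w c) + 2 w t per
  -- unit, which is at most 4 when κ and the weights are at most 1.
  tolerance : ∀ t s c → w s ℚ.≤ w c + δ → q t s ℚ.≤ q t c + 4ℚ * δ
  tolerance t s c s≤c+δ = ≤-by ((δ - (w s - w c)) * (κ * (w s + w c) + 2ℚ * w t) + δ * (κ * ((1ℚ - w s) + (1ℚ - w c)) + 2ℚ * (1ℚ - w t) + 2ℚ * (1ℚ - κ)))
    (eq κ δ (w t) (w s) (w c))
    (subst (0ℚ ℚ.≤_) (eq′ (w s) (w c) δ) (≤⇒0≤- s≤c+δ) ⟨*⟩ (0≤κ ⟨*⟩ (0≤w s ⟨+⟩ 0≤w c) ⟨+⟩ 0≤2 ⟨*⟩ 0≤w t)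
      ⟨+⟩ 0≤δ ⟨*⟩ (0≤κ ⟨*⟩ (≤⇒0≤- (w≤1 s) ⟨+⟩ ≤⇒0≤- (w≤1 c)) ⟨+⟩ 0≤2 ⟨*⟩ ≤⇒0≤- (w≤1 t) ⟨+⟩ 0≤2 ⟨*⟩ ≤⇒0≤- κ≤1))
    where
    eq′ : ∀ s c d → c + d - s ≡ d - (s - c)
    eq′ = solve-∀ ℚring
    eq : ∀ k d t s c → k * (t * t + c * c) + 2ℚ * (t * c) + 4ℚ * d ≡ k * (t * t + s * s) + 2ℚ * (t * s)
      + ((d - (s - c)) * (k * (s + c) + 2ℚ * t) + d * (k * ((1ℚ - s) + (1ℚ - c)) + 2ℚ * (1ℚ - t) + 2ℚ * (1ℚ - k)))
    eq = solve-∀ ℚring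

  module Foot {s t c : V} (t≢M : t ≢ M) (s≢M : s ≢ M) (c≢M : c ≢ M) (t≢c : t ≢ c) (s≢c : s ≢ c) where

    -- Only the edge at t changes. It is new in the row of c, where it adds at least w t ≥ δ₁, and
    -- it is invisible in the row of M since t, s and c all differ from M.
    move-foot : ∀ cs os {tol} → q t s ℚ.≤ q t c + tol →
      Σ (Towards (edgesX M (c ∷ cs) os t s) (length cs) (vertsX (c ∷ cs) os t) tol) λ T → Gain T δ₁
    move-foot cs os {tol} qts≤ = towards (labelled M c cs os t) ↭-refl refl
        (subst₂ ℚ._≤_ (sym (val-X q M (c ∷ cs) os t s)) (sym (cong (_+ tol) (val-X q M (c ∷ cs) os t c)))
          (≤-by (q t c + tol - q t s) (eq (val q (pathE M (c ∷ cs) M)) (∑[ o ∈ os ] q o M) (q t s) (q t c) tol) (≤⇒0≤- qts≤)))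
        (ℚ.≤-reflexive (trans (val-X (row M) M (c ∷ cs) os t s) (trans
          (cong (λ x → val (row M) (pathE M (c ∷ cs) M) + ((∑[ o ∈ os ] row M o M) + x)) (trans (row-off t≢M s≢M) (sym (row-off t≢M c≢M))))
          (sym (val-X (row M) M (c ∷ cs) os t c)))))
      , c , subst₂ ℚ._≤_ (cong (_+ δ₁) (sym (val-X (row c) M (c ∷ cs) os t s))) (sym (val-X (row c) M (c ∷ cs) os t c))
          (≤-by (row c t c - δ₁) (trans (eq₁ (val (row c) (pathE M (c ∷ cs) M)) (∑[ o ∈ os ] row c o M) (row c t c) δ₁)
              (cong (λ x → val (row c) (pathE M (c ∷ cs) M) + ((∑[ o ∈ os ] row c o M) + x) + δ₁ + (row c t c - δ₁)) (sym (row-off t≢c s≢c))))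
            (≤⇒0≤- (ℚ.≤-trans (δ₁≤w t) (subst (w t ℚ.≤_) (row-sym c c t) (row-at-≥ t≢c)))))
      where
      eq : ∀ p o a b e → p + (o + b) + e ≡ p + (o + a) + (b + e - a)
      eq = solve-∀ ℚring
      eq₁ : ∀ p o a d → p + (o + a) ≡ p + (o + 0ℚ) + d + (a - d)
      eq₁ = solve-∀ ℚring

    δ≤w : ∀ v → δ ℚ.≤ w v
    δ≤w v = ℚ.≤-trans δ≤δ₁ (δ₁≤w v)

    -- Both s and c are neighbours of M. If w s ≤ w c, the foot moves to c. Otherwise s and c
    -- exchange places, which only turns the cycle edge c z into s z.
    move-leaf : ∀ z ys os → z ≢ s → Improved (edgesX M (c ∷ z ∷ ys) (s ∷ os) t s) (length (z ∷ ys)) (vertsX (c ∷ z ∷ ys) (s ∷ os) t)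
    move-leaf z ys os z≢s = by-cases (w s ℚ.≤? w c)
      where
      L = edgesX M (c ∷ z ∷ ys) (s ∷ os) t s
      U = labelled M s (z ∷ ys) (c ∷ os) t
      shifted : ∀ φ → Symmetric φ → val φ (edgesU U) ≡ val φ L + (φ s z - φ c z)
      shifted φ φ-sym = trans (val-X φ M (s ∷ z ∷ ys) (c ∷ os) t s) (trans
        (cong₂ (λ a b → a + (φ s z + val φ (pathE z ys M)) + (b + (∑[ o ∈ os ] φ o M) + φ t s)) (φ-sym M s) (φ-sym c M))
        (trans (eq (φ s M) (φ s z) (val φ (pathE z ys M)) (φ M c) (∑[ o ∈ os ] φ o M) (φ t s) (φ c z))
          (cong (_+ (φ s z - φ c z)) (sym (val-X φ M (c ∷ z ∷ ys) (s ∷ os) t s)))))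
        where
        eq : ∀ sm sz p mc o ts cz → sm + (sz + p) + (mc + o + ts) ≡ mc + (cz + p) + (sm + o + ts) + (sz - cz)
        eq = solve-∀ ℚring
      by-cases : Dec (w s ℚ.≤ w c) → Improved L (length (z ∷ ys)) (vertsX (c ∷ z ∷ ys) (s ∷ os) t)
      by-cases (yes s≤c) = inj₁ (proj₁ T , proj₁ (proj₂ T) , ℚ.≤-trans (ℚ.+-monoʳ-≤ (val (row (proj₁ (proj₂ T))) L) δ≤δ₁) (proj₂ (proj₂ T)))
        where T = move-foot (z ∷ ys) (s ∷ os) (+0 (q-mono t s≤c))
      by-cases (no s≰c) = inj₁ (towards U (↭-prep M (↭-trans (↭-prep s (↭.shift c (z ∷ ys) (os ++ [ t ])))
            (↭-trans (↭-swap s c ↭-refl) (↭-prep c (↭-sym (↭.shift s (z ∷ ys) (os ++ [ t ]))))))) refl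
          (+0 (≤-by (q s z - q c z) (shifted q q-sym) (≤⇒0≤- (subst₂ ℚ._≤_ (q-sym z c) (q-sym z s) (q-mono z c≤s)))))
          (≤-by (row M s z - row M c z) (shifted (row M) (row-sym M)) (≤⇒0≤- (row-mono c≢M s≢M c≤s z)))
        , s , ≤-by (row s s z - δ) (trans (shifted (row s) (row-sym s)) (trans (cong (λ x → val (row s) L + (row s s z - x)) (row-off (s≢c ∘ sym) z≢s)) (eq (val (row s) L) (row s s z) δ)))
            (≤⇒0≤- (ℚ.≤-trans (δ≤w z) (row-at-≥ z≢s))))
        where
        c≤s = ℚ.<⇒≤ (ℚ.≰⇒> s≰c)
        eq : ∀ l r d → l + (r - 0ℚ) ≡ l + d + (r - d)
        eq = solve-∀ ℚring

    -- Reversing the segment of the cycle from c to s turns the edges M c and s z into M s and c z,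
    -- an exchange that gains because w z ≤ w M. Its gain in the row of M is w s - w c, so a
    -- threshold δ is needed to keep it away from 0; below the threshold the foot moves from s to c
    -- instead, at a cost of at most 4 δ.
    move-middle : ∀ xs z ys os → z ≢ M → Improved (edgesX M (c ∷ xs ++ s ∷ z ∷ ys) os t s) (length (xs ++ s ∷ z ∷ ys)) (vertsX (c ∷ xs ++ s ∷ z ∷ ys) os t)
    move-middle xs z ys os z≢M = by-cases (w s ℚ.≤? w c + δ)
      where
      L = edgesX M (c ∷ xs ++ s ∷ z ∷ ys) os t s
      U = labelled M s (reverse xs ++ c ∷ z ∷ ys) os t
      path-val : ∀ φ a xs b → val φ (pathE M (a ∷ xs ++ b ∷ z ∷ ys) M) ≡ φ M a + (val φ (pathE a xs b) + (φ b z + val φ (pathE z ys M)))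
      path-val φ a xs b = cong (_+_ (φ M a)) (trans (cong (val φ) (pathE-++ a xs b (z ∷ ys) M)) (val-++ φ (pathE a xs b) (pathE b (z ∷ ys) M)))
      shifted : ∀ φ → Symmetric φ → val φ (edgesU U) ≡ val φ L + (φ M s - φ M c + (φ c z - φ s z))
      shifted φ φ-sym = trans (val-X φ M (s ∷ reverse xs ++ c ∷ z ∷ ys) os t s) (trans
        (cong (_+ ((∑[ o ∈ os ] φ o M) + φ t s)) (trans (path-val φ s (reverse xs) c)
          (cong (λ p → φ M s + (p + (φ c z + val φ (pathE z ys M)))) (val-reverse φ-sym c xs s))))
        (trans (eq (φ M s) (val φ (pathE c xs s)) (φ c z) (val φ (pathE z ys M)) ((∑[ o ∈ os ] φ o M) + φ t s) (φ M c) (φ s z))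
          (cong (_+ (φ M s - φ M c + (φ c z - φ s z))) (sym (trans (val-X φ M (c ∷ xs ++ s ∷ z ∷ ys) os t s)
            (cong (_+ ((∑[ o ∈ os ] φ o M) + φ t s)) (path-val φ c xs s)))))))
        where
        eq : ∀ ms p cz z o mc sz → ms + (p + (cz + z)) + o ≡ mc + (p + (sz + z)) + o + (ms - mc + (cz - sz))
        eq = solve-∀ ℚring
      by-cases : Dec (w s ℚ.≤ w c + δ) → Improved L (length (xs ++ s ∷ z ∷ ys)) (vertsX (c ∷ xs ++ s ∷ z ∷ ys) os t)
      by-cases (yes s≤c+δ) = inj₂ (move-foot (xs ++ s ∷ z ∷ ys) os (tolerance t s c s≤c+δ))
      by-cases (no s≰c+δ) = inj₁ (towards U
            (↭-prep M (subst₂ _↭_ (sym (List.++-assoc (s ∷ reverse xs) (c ∷ z ∷ ys) (os ++ [ t ]))) (sym (List.++-assoc (c ∷ xs) (s ∷ z ∷ ys) (os ++ [ t ])))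
              (↭-trans (↭-prep s (↭.++⁺ʳ (c ∷ z ∷ ys ++ os ++ [ t ]) (↭.↭-reverse xs))) (↭-trans (↭-prep s (↭.shift c xs (z ∷ ys ++ os ++ [ t ])))
                (↭-trans (↭-swap s c ↭-refl) (↭-prep c (↭-sym (↭.shift s xs (z ∷ ys ++ os ++ [ t ])))))))))
            (trans (List.length-++ (reverse xs)) (trans (cong (ℕ._+ length (c ∷ z ∷ ys)) (List.length-reverse xs)) (sym (List.length-++ xs))))
            (+0 (≤-by (q M s + q z c - (q M c + q z s)) (trans (shifted q q-sym) (trans (eq₁ (val q L) (q M s) (q M c) (q c z) (q s z))
              (cong₂ (λ a b → val q L + (q M s + a - (q M c + b))) (q-sym c z) (q-sym s z)))) (≤⇒0≤- (q-exchange (w≤M z) c≤s))))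
            (ℚ.≤-trans (≤-by δ refl 0≤δ) gain)
          , M , gain)
        where
        c+δ≤s = ℚ.<⇒≤ (ℚ.≰⇒> s≰c+δ)
        c≤s = ℚ.≤-trans (≤-by δ refl 0≤δ) c+δ≤s
        eq₁ : ∀ l a b c d → l + (a - b + (c - d)) ≡ l + (a + c - (b + d))
        eq₁ = solve-∀ ℚring
        eq₂ : ∀ l k s c d → l + (k + s - (k + c) + (0ℚ - 0ℚ)) ≡ l + d + (s - (c + d))
        eq₂ = solve-∀ ℚring
        gain : val (row M) L + δ ℚ.≤ val (row M) (edgesU U)
        gain = ≤-by (w s - (w c + δ)) (trans (shifted (row M) (row-sym M)) (trans
          (cong₂ (λ a b → val (row M) L + (a + b)) (cong₂ _-_ (row-at s≢M) (row-at c≢M)) (cong₂ _-_ (row-off c≢M z≢M) (row-off s≢M z≢M)))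
          (eq₂ (val (row M) L) (κ * w M) (w s) (w c) δ))) (≤⇒0≤- c+δ≤s)

  transport : ∀ {L L′ n vs vs′ tol} → (∀ φ → Symmetric φ → val φ L ≡ val φ L′) → vs ↭ vs′ →
    (T : Towards L n vs tol) → Towards L′ n vs′ tol
  transport same vs↭ T = towards target (↭-trans vertices vs↭) rim-length
    (subst (ℚ._≤ val q (edgesU target) + _) (same q q-sym) q-≤) (subst (ℚ._≤ val (row M) (edgesU target)) (same (row M) (row-sym M)) row-≤)
    where open Towards T

  transport-Improved : ∀ {L L′ n vs vs′} → (∀ φ → Symmetric φ → val φ L ≡ val φ L′) → vs ↭ vs′ → Improved L n vs → Improved L′ n vs′
  transport-Improved {L} {L′} same vs↭ = [ (λ (T , v , g) → inj₁ (transport same vs↭ T , v , move v g)) , (λ (T , v , g) → inj₂ (transport same vs↭ T , v , move v g)) ]′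
    where
    move : ∀ v {d x} → val (row v) L + d ℚ.≤ x → val (row v) L′ + d ℚ.≤ x
    move v {d} {x} = subst (λ a → a + d ℚ.≤ x) (same (row v) (row-sym v))

  extend : ∀ {L X n vs tol} → val q L ℚ.≤ val q X → val (row M) L + δ₁ ℚ.≤ val (row M) X →
    Towards X n vs tol → Σ (Towards L n vs tol) λ T → Gain T δ₁
  extend {L} {tol = tol} L≤X gain T = towards target vertices rim-length (ℚ.≤-trans L≤X q-≤)
      (ℚ.≤-trans (≤-by δ₁ refl (ℚ.≤-trans 0≤δ δ≤δ₁)) (ℚ.≤-trans gain row-≤)) , M , ℚ.≤-trans gain row-≤
    where open Towards T

  Progress : List (V × V) → ℕ → List V → Set
  Progress L n vs = Towards L n vs 0ℚ ⊎ Improved L n vs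

  extend-Improved : ∀ {L X n vs} → val q L ℚ.≤ val q X → val (row M) L + δ₁ ℚ.≤ val (row M) X → Towards X n vs 0ℚ → Improved L n vs
  extend-Improved {L} L≤X gain T₀ with extend L≤X gain T₀
  ... | T , v , g = inj₁ (T , v , ℚ.≤-trans (ℚ.+-monoʳ-≤ (val (row v) L) δ≤δ₁) g)

  extend-Progress : ∀ {L X n vs} → val q L ℚ.≤ val q X → val (row M) L + δ₁ ℚ.≤ val (row M) X → Progress X n vs → Improved L n vs
  extend-Progress L≤X gain (inj₁ T)              = extend-Improved L≤X gain T
  extend-Progress L≤X gain (inj₂ (inj₁ (T , _))) = extend-Improved L≤X gain T
  extend-Progress L≤X gain (inj₂ (inj₂ (T , _))) = inj₂ (extend L≤X gain T)

  ∈≢ : ∀ {x y : V} {xs} → All (x ≢_) xs → y ∈ˡ xs → y ≢ x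
  ∈≢ x≢ y∈ = All.lookup x≢ y∈ ∘ sym

  step₂-near : ∀ {cs os s} t (pos : Position s cs os) → near? pos ≡ true → Towards (edgesX M cs os t s) (ℕ.pred (length cs)) (vertsX cs os t) 0ℚ
  step₂-near t (first {cs} {os}) _ = near-first _ cs os t
  step₂-near {s = s} t (last {c} {cs} {os}) _ = subst (λ n → Towards (edgesX M (c ∷ cs ++ [ s ]) os t s) n (vertsX (c ∷ cs ++ [ s ]) os t) 0ℚ)
    (trans (sym (ℕ.+-comm (length cs) 1)) (sym (List.length-++ cs))) (near-last s (c ∷ cs) os t)

  step₂ : ∀ {cs os s} t → s ≢ t → Unique (vertsX cs os t) → Position s cs os → Progress (edgesX M cs os t s) (ℕ.pred (length cs)) (vertsX cs os t)
  step₂ {s = s} t _ u pos@(first {cs} {os})    = inj₁ (step₂-near {s ∷ cs} {os} t pos refl)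
  step₂ {s = s} t _ u pos@(last {c} {cs} {os}) = inj₁ (step₂-near {c ∷ cs ++ [ s ]} {os} t pos refl)
  step₂ {s = s} t s≢t (M≢ ∷ c≢ ∷ _) (middle {c} {xs} {z} {ys} {os}) = inj₂ (Foot.move-middle
    (∈≢ M≢ (there t∈)) (∈≢ M≢ (there s∈)) (∈≢ M≢ (here refl)) (∈≢ c≢ t∈) (∈≢ c≢ s∈) xs z ys os (∈≢ M≢ (there z∈)))
    where
    t∈ : t ∈ˡ (xs ++ s ∷ z ∷ ys) ++ os ++ [ t ]
    t∈ = ∈ˡ.∈-++⁺ʳ (xs ++ s ∷ z ∷ ys) (∈ˡ.∈-++⁺ʳ os (here refl))
    s∈ : s ∈ˡ (xs ++ s ∷ z ∷ ys) ++ os ++ [ t ]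
    s∈ = ∈ˡ.∈-++⁺ˡ (∈ˡ.∈-++⁺ʳ xs (here refl))
    z∈ : z ∈ˡ (xs ++ s ∷ z ∷ ys) ++ os ++ [ t ]
    z∈ = ∈ˡ.∈-++⁺ˡ (∈ˡ.∈-++⁺ʳ xs (there (here refl)))
  step₂ {s = s} t s≢t (M≢ ∷ c≢ ∷ z≢ ∷ _) (leaf {c} {z} {ys} {os} {os′} os↭) = inj₂ (transport-Improved same perm (Foot.move-leaf
    (∈≢ M≢ (there (there t∈))) (∈≢ M≢ (there (there s∈))) (∈≢ M≢ (here refl)) (∈≢ c≢ (there t∈)) (∈≢ c≢ (there s∈)) z ys os′ (∈≢ z≢ s∈ ∘ sym)))
    where
    t∈ : t ∈ˡ ys ++ os ++ [ t ]
    t∈ = ∈ˡ.∈-++⁺ʳ ys (∈ˡ.∈-++⁺ʳ os (here refl))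
    s∈ : s ∈ˡ ys ++ os ++ [ t ]
    s∈ = ∈ˡ.∈-++⁺ʳ ys (∈ˡ.∈-++⁺ˡ (↭.∈-resp-↭ (↭-sym os↭) (here refl)))
    perm : vertsX (c ∷ z ∷ ys) (s ∷ os′) t ↭ vertsX (c ∷ z ∷ ys) os t
    perm = ↭.++⁺ˡ (M ∷ c ∷ z ∷ ys) (↭.++⁺ʳ [ t ] (↭-sym os↭))
    same : ∀ φ → Symmetric φ → val φ (edgesX M (c ∷ z ∷ ys) (s ∷ os′) t s) ≡ val φ (edgesX M (c ∷ z ∷ ys) os t s)
    same φ _ = val-↭ φ (↭.++⁺ˡ (pathE M (c ∷ z ∷ ys) M) (↭.++⁺ʳ [ (t , s) ] (↭.map⁺ (_, M) (↭-sym os↭))))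

  step₂-far : ∀ {cs os s} t (s≢t : s ≢ t) (u : Unique (vertsX cs os t)) (pos : Position s cs os) → near? pos ≡ false →
    Improved (edgesX M cs os t s) (ℕ.pred (length cs)) (vertsX cs os t)
  step₂-far t s≢t u pos far with step₂ t s≢t u pos in eq
  ... | inj₂ improved = improved
  step₂-far t s≢t (M≢ ∷ c≢ ∷ _)      middle   _ | inj₁ _ = contradiction eq λ ()
  step₂-far t s≢t (M≢ ∷ c≢ ∷ z≢ ∷ _) (leaf _) _ | inj₁ _ = contradiction eq λ ()

  -- Pairs are (child, parent). Each child trades its parent for the vertex M of maximal weight, and
  -- the form is monotone in that end.
  attach-q : ∀ ts → val q ts ℚ.≤ (∑[ o ∈ map proj₁ ts ] q o M)
  attach-q []             = ℚ.≤-refl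
  attach-q ((v , p) ∷ ts) = ℚ.+-mono-≤ (q-mono v (w≤M p)) (attach-q ts)

  attach-edge : ∀ v p → row M v p ℚ.≤ row M v M
  attach-edge v p = by-cases (p ≟ M)
    where
    by-cases : Dec (p ≡ M) → row M v p ℚ.≤ row M v M
    by-cases (yes p≡M) = ℚ.≤-reflexive (cong (row M v) p≡M)
    by-cases (no  p≢M) = row-end-mono p≢M (w≤M p) v

  attach-row : ∀ ts → val (row M) ts ℚ.≤ (∑[ o ∈ map proj₁ ts ] row M o M)
  attach-row []             = ℚ.≤-refl
  attach-row ((v , p) ∷ ts) = ℚ.+-mono-≤ (attach-edge v p) (attach-row ts)

  attach-row-gain : ∀ {ts} → All (λ (v , _) → v ≢ M) ts → Any (λ (_ , p) → p ≢ M) ts → val (row M) ts + δ₁ ℚ.≤ (∑[ o ∈ map proj₁ ts ] row M o M)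
  attach-row-gain {(v , p) ∷ ts} (v≢M ∷ _) (here p≢M) = ≤-by ((row M v M - δ₁) + ((∑[ o ∈ map proj₁ ts ] row M o M) - val (row M) ts))
    (trans (eq (row M v M) δ₁ (∑[ o ∈ map proj₁ ts ] row M o M) (val (row M) ts))
      (cong (λ x → x + val (row M) ts + δ₁ + ((row M v M - δ₁) + ((∑[ o ∈ map proj₁ ts ] row M o M) - val (row M) ts))) (sym (row-off v≢M p≢M))))
    (≤⇒0≤- (ℚ.≤-trans (δ₁≤w v) (subst (w v ℚ.≤_) (row-sym M M v) (row-at-≥ v≢M))) ⟨+⟩ ≤⇒0≤- (attach-row ts))
    where
    eq : ∀ a d o r → a + o ≡ 0ℚ + r + d + ((a - d) + (o - r))
    eq = solve-∀ ℚring
  attach-row-gain {(v , p) ∷ ts} (_ ∷ all) (there any) = ℚ.≤-trans (ℚ.≤-reflexive (ℚ.+-assoc (row M v p) (val (row M) ts) δ₁))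
    (ℚ.+-mono-≤ (attach-edge v p) (attach-row-gain all any))

  0≤val-row : ∀ v L → 0ℚ ℚ.≤ val (row v) L
  0≤val-row v L = ∑-0≤ L (λ (a , b) → 0≤row v a b)

  row-path-off : ∀ a cs b → a ≢ M → All (_≢ M) cs → b ≢ M → val (row M) (pathE a cs b) ≡ 0ℚ
  row-path-off a []       b a≢ _ b≢         = trans (ℚ.+-identityʳ (row M a b)) (row-off a≢ b≢)
  row-path-off a (c ∷ cs) b a≢ (c≢ ∷ cs≢) b≢ = trans (cong₂ _+_ (row-off a≢ c≢) (row-path-off c cs b c≢ cs≢ b≢)) (ℚ.+-identityˡ 0ℚ)

  gain-on-cycle : ∀ {L cs ts t s} → (∀ φ → Symmetric φ → val φ L ≡ val φ (pathE M cs M) + (val φ ts + φ t s)) →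
    All (λ (v , _) → v ≢ M) ts → Any (λ (_ , p) → p ≢ M) ts →
    val q L ℚ.≤ val q (edgesX M cs (map proj₁ ts) t s) × val (row M) L + δ₁ ℚ.≤ val (row M) (edgesX M cs (map proj₁ ts) t s)
  gain-on-cycle {L} {cs} {ts} {t} {s} L≡ v≢ p≢ =
      subst₂ ℚ._≤_ (sym (L≡ q q-sym)) (sym (val-X q M cs (map proj₁ ts) t s))
        (ℚ.+-monoʳ-≤ (val q (pathE M cs M)) (ℚ.+-monoˡ-≤ (q t s) (attach-q ts)))
    , subst₂ ℚ._≤_ (trans (eq (val (row M) (pathE M cs M)) (val (row M) ts) (row M t s) δ₁) (cong (_+ δ₁) (sym (L≡ (row M) (row-sym M))))) (sym (val-X (row M) M cs (map proj₁ ts) t s))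
        (ℚ.+-monoʳ-≤ (val (row M) (pathE M cs M)) (ℚ.+-monoˡ-≤ (row M t s) (attach-row-gain v≢ p≢)))
    where
    eq : ∀ a b c d → a + (b + d + c) ≡ a + (b + c) + d
    eq = solve-∀ ℚring

  -- Here M also takes over the place of u on the cycle. The old cycle avoids M, so the new cycle
  -- edge from M to c alone brings w c ≥ δ₁ into the row of M.
  gain-off-cycle : ∀ {L u c cs ts t s} → (∀ φ → Symmetric φ → val φ L ≡ val φ (pathE u (c ∷ cs) u) + (val φ ts + φ t s)) →
    u ≢ M → All (_≢ M) (c ∷ cs) →
    val q L ℚ.≤ val q (edgesX M (c ∷ cs) (map proj₁ ts) t s) × val (row M) L + δ₁ ℚ.≤ val (row M) (edgesX M (c ∷ cs) (map proj₁ ts) t s)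
  gain-off-cycle {L} {u} {c} {cs} {ts} {t} {s} L≡ u≢M cs≢M@(c≢M ∷ _) =
      subst₂ ℚ._≤_ (sym (L≡ q q-sym)) (sym (val-X q M (c ∷ cs) (map proj₁ ts) t s))
        (ℚ.+-mono-≤ (ℚ.+-mono-≤ (subst₂ ℚ._≤_ (q-sym c u) (q-sym c M) (q-mono c (w≤M u))) (val-end-mono q c cs (λ x → q-mono x (w≤M u))))
          (ℚ.+-monoˡ-≤ (q t s) (attach-q ts)))
    , subst₂ ℚ._≤_ (trans (eq δ₁ (val (row M) ts + row M t s)) (cong (_+ δ₁) (trans (cong (_+ (val (row M) ts + row M t s)) (sym (row-path-off u (c ∷ cs) u u≢M cs≢M u≢M))) (sym (L≡ (row M) (row-sym M))))))
        (sym (val-X (row M) M (c ∷ cs) (map proj₁ ts) t s))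
        (ℚ.+-mono-≤ (ℚ.≤-trans (ℚ.≤-trans (δ₁≤w c) (row-at-≥ c≢M)) (≤-by (val (row M) (pathE c cs M)) refl (0≤val-row M (pathE c cs M))))
          (ℚ.+-monoˡ-≤ (row M t s) (attach-row ts)))
    where
    eq : ∀ d x → d + x ≡ 0ℚ + x + d
    eq = solve-∀ ℚring

-- Unicyclic graphs seen from a vertex

children : ∀ {V : Set} → List (V × V) → List V
children = map proj₁

data Forest {V : Set} (cycle : List V) : List (V × V) → Set where
  []   : Forest cycle []
  grow : ∀ {v p ts} → v ≢ p → p ∈ˡ cycle ⊎ p ∈ˡ children ts → Forest cycle ts → Forest cycle ((v , p) ∷ ts)

-- Reversing the tree path from M to the vertex u where it meets the cycle. The edges keep their
-- ends, but M loses its parent and u acquires one; thus u replaces M among the children.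
record Rerooted {V : Set} (cycle : List V) (ts : List (V × V)) (M : V) : Set where
  constructor rerooted
  field
    {u}        : V
    {ts′}      : List (V × V)
    {rest}     : List V
    u∈cycle    : u ∈ˡ cycle
    children↭  : children ts ↭ M ∷ rest
    children′↭ : children ts′ ↭ u ∷ rest
    val≡       : ∀ φ → Symmetric φ → val φ ts ≡ val φ ts′
    proper     : All (λ (v , p) → v ≢ p) ts′

forest-proper : ∀ {V : Set} {cycle : List V} {ts} → Forest cycle ts → All (λ (v , p) → v ≢ p) ts
forest-proper []               = []
forest-proper (grow v≢p _ F) = v≢p ∷ forest-proper F

reroot : ∀ {V : Set} {cycle : List V} {ts} {M} → Forest cycle ts → M ∈ˡ children ts → Rerooted cycle ts M
reroot (grow {v} {p} {ts} v≢p (inj₁ p∈) F) (here refl) = rerooted p∈ ↭-refl ↭-refl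
  (λ φ φ-sym → cong (_+ val φ ts) (φ-sym v p)) ((v≢p ∘ sym) ∷ forest-proper F)
reroot (grow {v} {p} v≢p (inj₂ p∈) F) (here refl) with reroot F p∈
... | rerooted u∈ ch ch′ val≡ proper = rerooted u∈ ↭-refl (↭-trans (↭-prep p ch′) (↭-trans (↭-swap p _ ↭-refl) (↭-prep _ (↭-sym ch))))
  (λ φ φ-sym → cong₂ _+_ (φ-sym v p) (val≡ φ φ-sym)) ((v≢p ∘ sym) ∷ proper)
reroot (grow {v} {p} v≢p _ F) (there M∈) with reroot F M∈
... | rerooted u∈ ch ch′ val≡ proper = rerooted u∈ (↭-trans (↭-prep v ch) (↭-swap v _ ↭-refl)) (↭-trans (↭-prep v ch′) (↭-swap v _ ↭-refl))
  (λ φ φ-sym → cong (_+_ (φ v p)) (val≡ φ φ-sym)) (v≢p ∷ proper)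

module Classify (V : Set) (_≟_ : DecidableEquality V) (c₀ : V) (cs₀ : List V) (ts₀ : List (V × V))
  (forest : Forest (c₀ ∷ cs₀) ts₀) (2≤ : 2 ℕ.≤ length cs₀) (uniq : Unique (c₀ ∷ cs₀ ++ children ts₀)) (full : ∀ v → v ∈ˡ c₀ ∷ cs₀ ++ children ts₀) where

  L₀ : List (V × V)
  L₀ = pathE c₀ cs₀ c₀ ++ ts₀

  vs₀ : List V
  vs₀ = c₀ ∷ cs₀ ++ children ts₀

  vertsX′ : V → List V → List V → V → List V
  vertsX′ M cs os t = M ∷ cs ++ os ++ [ t ]

  Away : V → V × V → Set
  Away M (_ , p) = p ≢ M

  -- Sorted by the place of M and by the tree edges that avoid M: none (`isU₁` with M on the cycle,
  -- `isO` off it), exactly one with M on the cycle (`isX`), several with M on it (`moreOn`), at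
  -- least one with M off it (`moreOff`). In the last three cases one avoiding edge (t , s) is
  -- singled out as the future foot.
  data Class (M : V) : Set where
    isU₁  : ∀ cs os → L₀ ↭ pathE M cs M ++ map (_, M) os → M ∷ cs ++ os ↭ vs₀ → length cs ≡ length cs₀ → Class M
    isO   : ∀ u cs os → (∀ φ → Symmetric φ → val φ L₀ ≡ val φ (pathE u cs u) + (φ u M + (∑[ o ∈ os ] φ o M))) →
      M ∷ u ∷ cs ++ os ↭ vs₀ → length cs ≡ length cs₀ → Class M
    isX   : ∀ cs os t s → L₀ ↭ edgesX M cs os t s → vertsX′ M cs os t ↭ vs₀ → length cs ≡ length cs₀ → s ≢ t → Position s cs os → Class M
    moreOn : ∀ cs ts t s → (∀ φ → Symmetric φ → val φ L₀ ≡ val φ (pathE M cs M) + (val φ ts + φ t s)) →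
      vertsX′ M cs (children ts) t ↭ vs₀ → length cs ≡ length cs₀ → s ≢ t → Position s cs (children ts) → Any (Away M) ts → Class M
    moreOff : ∀ u c cs ts t s → (∀ φ → Symmetric φ → val φ L₀ ≡ val φ (pathE u (c ∷ cs) u) + (val φ ts + φ t s)) → u ≢ M →
      vertsX′ M (c ∷ cs) (children ts) t ↭ vs₀ → length (c ∷ cs) ≡ length cs₀ → s ≢ t → Position s (c ∷ cs) (children ts) → Class M

  vs₀-enumerates : Enumerates vs₀
  vs₀-enumerates = enumerates uniq full

  ∈-split : ∀ {A : Set} {x : A} {xs} → x ∈ˡ xs → ∃ λ ys → xs ↭ x ∷ ys
  ∈-split x∈ with ∈ˡ.∈-∃++ x∈
  ... | as , bs , refl = as ++ bs , ↭.shift _ as bs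

  position : ∀ {s M t} cs os → 2 ℕ.≤ length cs → s ∈ˡ vertsX′ M cs os t → s ≢ M → s ≢ t → Position s cs os
  position {s} {M} {t} cs os 2≤cs s∈ s≢M s≢t with s∈
  ... | here s≡M = contradiction s≡M s≢M
  ... | there s∈′ with ∈ˡ.∈-++⁻ cs s∈′
  ...   | inj₂ s∈″ with ∈ˡ.∈-++⁻ os s∈″
  ...     | inj₂ (here s≡t) = contradiction s≡t s≢t
  ...     | inj₁ s∈os = on-leaf cs 2≤cs
    where
    on-leaf : ∀ cs → 2 ℕ.≤ length cs → Position s cs os
    on-leaf (_ ∷ _ ∷ _) _ = leaf (proj₂ (∈-split s∈os))
    on-leaf (_ ∷ []) (s≤s ())
  position {s} {M} {t} cs os 2≤cs s∈ s≢M s≢t | there s∈′ | inj₁ s∈cs with ∈ˡ.∈-∃++ s∈cs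
  ... | []     , bs     , refl = first
  ... | a ∷ as , []     , refl = last
  ... | a ∷ as , b ∷ bs , refl = middle

  ≢M? : ∀ M (ts : List (V × V)) → Dec (Any (Away M) ts)
  ≢M? M ts = Any.any? (λ e → ¬? (proj₂ e ≟ M)) ts

  all-at : ∀ {M} (ts : List (V × V)) → ¬ Any (Away M) ts → ts ≡ map (_, M) (children ts)
  all-at []             _ = refl
  all-at {M} ((v , p) ∷ ts) ¬any with p ≟ M
  ... | yes refl = cong ((v , p) ∷_) (all-at ts (¬any ∘ there))
  ... | no  p≢M  = contradiction (here p≢M) ¬any

  pick : ∀ {M} {ts : List (V × V)} → Any (Away M) ts → ∃₂ λ t s → ∃ λ ts′ → s ≢ M × ts ↭ (t , s) ∷ ts′
  pick any with find any
  ... | (t , s) , ts∈ , s≢M = t , s , proj₁ (∈-split ts∈) , s≢M , proj₂ (∈-split ts∈)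

  record Rotated (u : V) : Set where
    constructor rotated
    field
      {cs}     : List V
      edges↭   : pathE c₀ cs₀ c₀ ↭ pathE u cs u
      cycle↭   : u ∷ cs ↭ c₀ ∷ cs₀

    length≡ : length cs ≡ length cs₀
    length≡ = ℕ.suc-injective (↭.↭-length cycle↭)

  rotateTo : ∀ {u} → u ∈ˡ c₀ ∷ cs₀ → Rotated u
  rotateTo (here refl) = rotated ↭-refl ↭-refl
  rotateTo {u} (there u∈) with ∈ˡ.∈-∃++ u∈
  ... | xs , ys , eq = rotated
    (subst (λ cs → pathE c₀ cs c₀ ↭ pathE u (ys ++ c₀ ∷ xs) u) (sym eq) (rotate c₀ xs u ys))
    (subst (λ cs → u ∷ ys ++ c₀ ∷ xs ↭ c₀ ∷ cs) (sym eq) (↭.++-comm (u ∷ ys) (c₀ ∷ xs)))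

  foot-last : ∀ M cs {ts t s ts′} → ts ↭ (t , s) ∷ ts′ → vertsX′ M cs (children ts′) t ↭ M ∷ cs ++ children ts
  foot-last M cs {ts} {t} {s} {ts′} ts↭ = ↭-prep M (↭.++⁺ˡ cs (↭-trans (↭-sym (↭.∷↭∷ʳ t (children ts′))) (↭-sym (↭.map⁺ proj₁ ts↭))))

  proper-head : ∀ {ts ts′ : List (V × V)} {t s} → All (λ (v , p) → v ≢ p) ts → ts ↭ (t , s) ∷ ts′ → s ≢ t
  proper-head proper ts↭ with ↭.All-resp-↭ ts↭ proper
  ... | t≢s ∷ _ = t≢s ∘ sym

  val-pick : ∀ (φ : V → V → ℚ) {ts t s ts′} → ts ↭ (t , s) ∷ ts′ → val φ ts ≡ val φ ts′ + φ t s
  val-pick φ {t = t} {s} {ts′} ts↭ = trans (val-↭ φ ts↭) (ℚ.+-comm (φ t s) (val φ ts′))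

  onCycle : ∀ {M} → Rotated M → Class M
  onCycle {M} R = go (≢M? M ts₀)
    where
    open Rotated R
    vs↭ : M ∷ cs ++ children ts₀ ↭ vs₀
    vs↭ = ↭.++⁺ʳ (children ts₀) cycle↭
    go : Dec (Any (Away M) ts₀) → Class M
    go (no none) = isU₁ cs (children ts₀) (subst (λ ts → L₀ ↭ pathE M cs M ++ ts) (all-at ts₀ none) (↭.++⁺ʳ ts₀ edges↭)) vs↭ length≡
    go (yes some) with pick some
    ... | t , s , ts′ , s≢M , ts↭ = pick₂ (≢M? M ts′)
      where
      s≢t = proper-head (forest-proper forest) ts↭
      vsX↭ : vertsX′ M cs (children ts′) t ↭ vs₀
      vsX↭ = ↭-trans (foot-last M cs ts↭) vs↭
      pos : Position s cs (children ts′)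
      pos = position cs (children ts′) (subst (2 ℕ.≤_) (sym length≡) 2≤) (↭.∈-resp-↭ (↭-sym vsX↭) (full s)) s≢M s≢t
      pick₂ : Dec (Any (Away M) ts′) → Class M
      pick₂ (yes more) = moreOn cs ts′ t s
        (λ φ _ → trans (val-++ φ (pathE c₀ cs₀ c₀) ts₀) (cong₂ _+_ (val-↭ φ edges↭) (val-pick φ ts↭)))
        vsX↭ length≡ s≢t pos more
      pick₂ (no none) = isX cs (children ts′) t s
        (↭.++⁺ edges↭ (↭-trans ts↭ (↭-trans (↭.∷↭∷ʳ (t , s) ts′) (subst (λ ts → ts′ ++ [ (t , s) ] ↭ ts ++ [ (t , s) ]) (all-at ts′ none) ↭-refl))))
        vsX↭ length≡ s≢t pos

  offCycle : ∀ {M} → M ∈ˡ children ts₀ → Rerooted (c₀ ∷ cs₀) ts₀ M → Class M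
  offCycle {M} M∈ (rerooted {u} {ts} {rest} u∈ ch ch′ val≡ proper) = go (rotateTo u∈) (≢M? M ts)
    where
    u≢M : u ≢ M
    u≢M refl = Unique⇒disjoint uniq u∈ M∈
      where
      Unique⇒disjoint : ∀ {xs ys : List V} {x} → Unique (xs ++ ys) → x ∈ˡ xs → x ∈ˡ ys → ⊥
      Unique⇒disjoint {x ∷ xs} (x≢ ∷ _) (here refl) x∈ys = All.lookup x≢ (∈ˡ.∈-++⁺ʳ xs x∈ys) refl
      Unique⇒disjoint (_ ∷ u) (there x∈) x∈ys = Unique⇒disjoint u x∈ x∈ys
    go : Rotated u → Dec (Any (Away M) ts) → Class M
    go (rotated {[]} _ c↭) _ = contradiction (subst (2 ℕ.≤_) (sym (ℕ.suc-injective (↭.↭-length c↭))) 2≤) λ ()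
    go R@(rotated {c ∷ cs} e↭ c↭) (no none) = isO u (c ∷ cs) rest
        (λ φ φ-sym → trans (L₀≡ φ φ-sym) (cong (_+_ (val φ (pathE u (c ∷ cs) u)))
          (trans (cong (val φ) (all-at ts none)) (trans (∑-map (_, M) (children ts) (λ (a , b) → φ a b)) (∑-↭ (λ o → φ o M) ch′)))))
        (↭-trans (↭-sym (↭.shift M (u ∷ c ∷ cs) rest)) (↭-trans (↭.++⁺ˡ (u ∷ c ∷ cs) (↭-sym ch)) (↭.++⁺ʳ (children ts₀) c↭)))
        (Rotated.length≡ R)
      where
      L₀≡ : ∀ φ → Symmetric φ → val φ L₀ ≡ val φ (pathE u (c ∷ cs) u) + val φ ts
      L₀≡ φ φ-sym = trans (val-++ φ (pathE c₀ cs₀ c₀) ts₀) (cong₂ _+_ (val-↭ φ e↭) (val≡ φ φ-sym))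
    go R@(rotated {c ∷ cs} e↭ c↭) (yes some) with pick some
    ... | t , s , ts′ , s≢M , ts↭ = moreOff u c cs ts′ t s
        (λ φ φ-sym → trans (val-++ φ (pathE c₀ cs₀ c₀) ts₀) (cong₂ _+_ (val-↭ φ e↭) (trans (val≡ φ φ-sym) (val-pick φ ts↭))))
        u≢M vsX↭ (Rotated.length≡ R) s≢t
        (position (c ∷ cs) (children ts′) (subst (2 ℕ.≤_) (sym (Rotated.length≡ R)) 2≤) (↭.∈-resp-↭ (↭-sym vsX↭) (full s)) s≢M s≢t)
      where
      s≢t = proper-head proper ts↭
      vsX↭ : vertsX′ M (c ∷ cs) (children ts′) t ↭ vs₀
      vsX↭ = ↭-trans (foot-last M (c ∷ cs) ts↭) (↭-trans (↭-prep M (↭-trans (↭.++⁺ˡ (c ∷ cs) ch′) (↭.shift u (c ∷ cs) rest)))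
        (↭-trans (↭-swap M u ↭-refl) (↭-trans (↭-prep u (↭-sym (↭.shift M (c ∷ cs) rest)))
        (↭-trans (↭.++⁺ˡ (u ∷ c ∷ cs) (↭-sym ch)) (↭.++⁺ʳ (children ts₀) c↭)))))

  classify : ∀ M → Class M
  classify M = [ (λ M∈ → onCycle (rotateTo M∈)) , (λ M∈ → offCycle M∈ (reroot forest M∈)) ]′ (∈ˡ.∈-++⁻ (c₀ ∷ cs₀) (full M))

-- Supersolutions

module Supersolution (V : Set) (_≟_ : DecidableEquality V) (κ : ℚ) (0≤κ : 0ℚ ℚ.≤ κ)
  (w : V → ℚ) (0≤w : ∀ v → 0ℚ ℚ.≤ w v) where

  open Weights V _≟_ κ 0≤κ w 0≤w using (q)

  w² : V → ℚ
  w² v = w v * w v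

  -- Weighted AM-GM: 2 w a w b ≤ u (w a)² + d (w b)² when u d = 1. With u = Y b / Y a for a positive
  -- Y, the coefficients collected at a vertex are its row of Y divided by the value of Y there. So
  -- a supersolution Y bounds the form.
  edge-≤ : ∀ a b u d → 0ℚ ℚ.≤ d → u * d ≡ 1ℚ → q a b ℚ.≤ (κ + u) * w² a + (κ + d) * w² b
  edge-≤ a b u d 0≤d ud≡1 = ≤-by (d * ((u * w a - w b) * (u * w a - w b)))
    (trans (eq₁ κ u d (w a) (w b)) (trans (cong (λ x → κ * (w a * w a + w b * w b) + 2ℚ * (w a * w b) * x + d * ((u * w a - w b) * (u * w a - w b)) + u * (w a * w a) * (1ℚ - x)) ud≡1)
      (eq₂ κ u d (w a) (w b)))) (0≤d ⟨*⟩ 0≤p² (u * w a - w b))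
    where
    eq₁ : ∀ k u d a b → (k + u) * (a * a) + (k + d) * (b * b)
      ≡ k * (a * a + b * b) + 2ℚ * (a * b) * (u * d) + d * ((u * a - b) * (u * a - b)) + u * (a * a) * (1ℚ - u * d)
    eq₁ = solve-∀ ℚring
    eq₂ : ∀ k u d a b → k * (a * a + b * b) + 2ℚ * (a * b) * 1ℚ + d * ((u * a - b) * (u * a - b)) + u * (a * a) * (1ℚ - 1ℚ)
      ≡ k * (a * a + b * b) + 2ℚ * (a * b) + d * ((u * a - b) * (u * a - b))
    eq₂ = solve-∀ ℚring

  module _ (N : ℚ) (up dn : ℕ → ℚ) (0≤dn : ∀ i → 0ℚ ℚ.≤ dn i) (updn : ∀ i → up i * dn i ≡ 1ℚ) where

    path-≤ : ∀ i a cs b → (∀ j → i ℕ.≤ j → j ℕ.< i ℕ.+ length cs → 2ℚ * κ + (up (suc j) + dn j) ℚ.≤ N) →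
      val q (pathE a cs b) ℚ.≤ (κ + up i) * w² a + N * ∑ cs w² + (κ + dn (i ℕ.+ length cs)) * w² b
    path-≤ i a [] b _ = ℚ.≤-trans (ℚ.≤-reflexive (ℚ.+-identityʳ (q a b))) (ℚ.≤-trans (edge-≤ a b (up i) (dn i) (0≤dn i) (updn i))
      (ℚ.≤-reflexive (trans (eq ((κ + up i) * w² a) N ((κ + dn i) * w² b)) (cong (λ j → (κ + up i) * w² a + N * 0ℚ + (κ + dn j) * w² b) (sym (ℕ.+-identityʳ i))))))
      where
      eq : ∀ a n b → a + b ≡ a + n * 0ℚ + b
      eq = solve-∀ ℚring
    path-≤ i a (c ∷ cs) b ok = ℚ.≤-trans (ℚ.+-mono-≤ (edge-≤ a c (up i) (dn i) (0≤dn i) (updn i))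
        (path-≤ (suc i) c cs b (λ j i<j j< → ok j (ℕ.≤-trans (ℕ.n≤1+n i) i<j) (subst (j ℕ.<_) (sym (ℕ.+-suc i (length cs))) j<))))
      (subst (λ k → (κ + up i) * w² a + (κ + dn i) * w² c + ((κ + up (suc i)) * w² c + N * ∑ cs w² + (κ + dn (suc (i ℕ.+ length cs))) * w² b)
          ℚ.≤ (κ + up i) * w² a + N * (w² c + ∑ cs w²) + (κ + dn k) * w² b) (sym (ℕ.+-suc i (length cs)))
        (≤-by ((N - (2ℚ * κ + (up (suc i) + dn i))) * w² c)
          (eq κ (up i) (dn i) (up (suc i)) N (w² a) (w² c) (∑ cs w²) ((κ + dn (suc (i ℕ.+ length cs))) * w² b))
          (≤⇒0≤- (ok i ℕ.≤-refl (subst (i ℕ.<_) (sym (ℕ.+-suc i (length cs))) (s≤s (ℕ.m≤m+n i (length cs))))) ⟨*⟩ 0≤p² (w c))))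
      where
      eq : ∀ k u d u′ n a c s b → (k + u) * a + n * (c + s) + b
        ≡ (k + u) * a + (k + d) * c + ((k + u′) * c + n * s + b) + (n - (2ℚ * k + (u′ + d))) * c
      eq = solve-∀ ℚring

  leaves-≤ : ∀ ν p → 0ℚ ℚ.≤ p → ν * p ≡ 1ℚ → ∀ M os → (∑[ o ∈ os ] q o M) ℚ.≤ (ν + κ) * ∑ os w² + fromℕ′ (length os) * ((κ + p) * w² M)
  leaves-≤ ν p 0≤p νp≡1 M os = ℚ.≤-trans (∑-mono os (λ o → edge-≤ o M ν p 0≤p νp≡1))
    (ℚ.≤-reflexive (trans (∑-distrib-+ os (λ o → (κ + ν) * w² o) (λ o → (κ + p) * w² M)) (cong₂ _+_
      (trans (sym (*-distribˡ-∑ (κ + ν) os w²)) (cong (_* ∑ os w²) (ℚ.+-comm κ ν))) (∑-const os ((κ + p) * w² M)))))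

  module _ (ν p : ℚ) (0<p : 0ℚ ℚ.< p) (νp≡1 : ν * p ≡ 1ℚ) where

    private
      N = ν + κ
      0≤p = ℚ.<⇒≤ 0<p

    -- Y i is the value at the i-th vertex of the cycle, which returns to its start at i = l.
    U-≤ : ∀ (U : Labelled V) (Y : ℕ → ℚ) → let open Labelled U; l = suc (suc (length rim)) in
      (∀ i → 0ℚ ℚ.< Y i) → Y l ≡ Y 0 →
      Y 0 + Y 2 ℚ.≤ (ν - 2ℚ * κ - p) * Y 1 →
      (∀ j → 1 ℕ.≤ j → suc j ℕ.< l → Y j + Y (2 ℕ.+ j) ℚ.≤ (ν - κ) * Y (suc j)) →
      Y 1 + Y (suc (length rim)) ℚ.≤ (ν - κ - fromℕ′ (length leaves) * (κ + p)) * Y 0 →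
      val q (edgesU U) ℚ.≤ N * ∑ (vertsU U) w²
    U-≤ (labelled M c cs os t) Y 0<Y Yl≡Y0 at-head interior at-centre = subst₂ ℚ._≤_ (sym (val-X q M (c ∷ cs) os t c)) (sym total)
      (ℚ.≤-trans (ℚ.+-mono-≤ (ℚ.+-mono-≤ (edge-≤ M c (up 0) (dn 0) (0≤dn 0) (updn 0)) (path-≤ N up dn 0≤dn updn 1 c cs M inner))
          (ℚ.+-mono-≤ (leaves-≤ ν p 0≤p νp≡1 M os) (edge-≤ t c ν p 0≤p νp≡1)))
        (≤-by ((ν - κ - b * (κ + p) - (up 0 + dn (suc (length cs)))) * w² M + (ν - 2ℚ * κ - p - (up 1 + dn 0)) * w² c)
          (eq ν κ p b (up 0) (dn 0) (up 1) (dn (suc (length cs))) (w² M) (w² c) (∑ cs w²) (∑ os w²) (w² t))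
          (≤⇒0≤- centre-ok ⟨*⟩ 0≤p² (w M) ⟨+⟩ ≤⇒0≤- head-ok ⟨*⟩ 0≤p² (w c))))
      where
      b = fromℕ′ (length os)
      up dn : ℕ → ℚ
      up i = Y (suc i) * inv (Y i) (0<Y i)
      dn i = Y i * inv (Y (suc i)) (0<Y (suc i))
      0≤dn : ∀ i → 0ℚ ℚ.≤ dn i
      0≤dn i = ℚ.<⇒≤ (0<Y i ⟨*⟩⁺ 0<inv (Y (suc i)) (0<Y (suc i)))
      updn : ∀ i → up i * dn i ≡ 1ℚ
      updn i = trans (eq′ (Y (suc i)) (inv (Y i) (0<Y i)) (Y i) (inv (Y (suc i)) (0<Y (suc i))))
        (trans (cong₂ _*_ (inv-* (Y (suc i)) (0<Y (suc i))) (inv-* (Y i) (0<Y i))) (ℚ.*-identityˡ 1ℚ))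
        where
        eq′ : ∀ a b c d → a * b * (c * d) ≡ d * a * (b * c)
        eq′ = solve-∀ ℚring
      divide : ∀ x y z c → (0<z : 0ℚ ℚ.< z) → x + y ℚ.≤ c * z → y * inv z 0<z + x * inv z 0<z ℚ.≤ c
      divide x y z c 0<z h = subst₂ ℚ._≤_ (eq₁ x y (inv z 0<z)) (trans (eq₂ c z (inv z 0<z)) (trans (cong (_*_ c) (inv-* z 0<z)) (ℚ.*-identityʳ c)))
        (*-monoʳ (ℚ.<⇒≤ (0<inv z 0<z)) h)
        where
        eq₁ : ∀ x y i → (x + y) * i ≡ y * i + x * i
        eq₁ = solve-∀ ℚring
        eq₂ : ∀ c z i → c * z * i ≡ c * (i * z)
        eq₂ = solve-∀ ℚring
      head-ok : up 1 + dn 0 ℚ.≤ ν - 2ℚ * κ - p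
      head-ok = divide (Y 0) (Y 2) (Y 1) (ν - 2ℚ * κ - p) (0<Y 1) at-head
      centre-ok : up 0 + dn (suc (length cs)) ℚ.≤ ν - κ - b * (κ + p)
      centre-ok = subst (λ x → up 0 + x ℚ.≤ ν - κ - b * (κ + p)) (sym (inv-cong Yl≡Y0 (0<Y (suc (suc (length cs)))) (0<Y 0)))
        (divide (Y (suc (length cs))) (Y 1) (Y 0) (ν - κ - b * (κ + p)) (0<Y 0) (subst (ℚ._≤ (ν - κ - b * (κ + p)) * Y 0) (ℚ.+-comm (Y 1) (Y (suc (length cs)))) at-centre))
        where
        inv-cong : ∀ {a c} → a ≡ c → (0<a : 0ℚ ℚ.< a) (0<c : 0ℚ ℚ.< c) → Y (suc (length cs)) * inv a 0<a ≡ Y (suc (length cs)) * inv c 0<c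
        inv-cong refl _ _ = refl
      inner : ∀ j → 1 ℕ.≤ j → j ℕ.< 1 ℕ.+ length cs → 2ℚ * κ + (up (suc j) + dn j) ℚ.≤ N
      inner j 1≤j j< = ℚ.≤-trans (ℚ.+-monoʳ-≤ (2ℚ * κ) (divide (Y j) (Y (2 ℕ.+ j)) (Y (suc j)) (ν - κ) (0<Y (suc j)) (interior j 1≤j (s≤s j<)))) (ℚ.≤-reflexive (eq′ κ ν))
        where
        eq′ : ∀ k n → 2ℚ * k + (n - k) ≡ n + k
        eq′ = solve-∀ ℚring
      total : N * ∑ (vertsU (labelled M c cs os t)) w² ≡ N * (w² M + (w² c + (∑ cs w² + (∑ os w² + (w² t + 0ℚ)))))
      total = cong (λ s → N * (w² M + (w² c + s))) (trans (∑-++ cs (os ++ [ t ]) w²) (cong (_+_ (∑ cs w²)) (∑-++ os [ t ] w²)))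
      eq : ∀ ν κ p b u₀ d₀ u₁ dₗ M c C O t → (ν + κ) * (M + (c + (C + (O + (t + 0ℚ)))))
        ≡ (κ + u₀) * M + (κ + d₀) * c + ((κ + u₁) * c + (ν + κ) * C + (κ + dₗ) * M) + ((ν + κ) * O + b * ((κ + p) * M) + ((κ + ν) * t + (κ + p) * c))
          + ((ν - κ - b * (κ + p) - (u₀ + dₗ)) * M + (ν - 2ℚ * κ - p - (u₁ + d₀)) * c)
      eq = solve-∀ ℚring

    -- The supersolution takes the value 1 at the centre M, p at the leaves, β = (3p + κ)/2 at u and β/2 on the rest of the cycle.
    O-≤ : 9ℚ/2 ℚ.≤ ν → κ ℚ.≤ 1ℚ → ∀ u c d cs M os → (fromℕ′ (length os) + 3ℚ * ℚ.½) * (κ + p) ℚ.≤ N →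
      val q (pathE u (c ∷ d ∷ cs) u) + (q u M + (∑[ o ∈ os ] q o M)) ℚ.≤ N * (w² M + (w² u + (∑ (c ∷ d ∷ cs) w² + ∑ os w²)))
    O-≤ 9/2≤ν κ≤1 u c d cs M os at-centre = ℚ.≤-trans
        (ℚ.+-mono-≤ (path-≤ N up dn 0≤dn updn 0 u (c ∷ d ∷ cs) u inner) (ℚ.+-mono-≤ (edge-≤ u M β⁻¹ β (ℚ.<⇒≤ 0<β) (inv-* β 0<β)) (leaves-≤ ν p 0≤p νp≡1 M os)))
        (≤-by ((N - (b + 3ℚ * ℚ.½) * (κ + p)) * w² M + β⁻¹ * ((ν - 2ℚ * κ - 1ℚ) * β - 1ℚ) * w² u)
          (trans (eq ν κ p b β⁻¹ (w² M) (w² u) (∑ (c ∷ d ∷ cs) w²) (∑ os w²))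
            (cong₂ (λ x y → (κ + x) * w² u + N * ∑ (c ∷ d ∷ cs) w² + (κ + y) * w² u + ((κ + β⁻¹) * w² u + (κ + β) * w² M + ((ν + κ) * ∑ os w² + b * ((κ + p) * w² M)))
               + ((N - (b + 3ℚ * ℚ.½) * (κ + p)) * w² M + (ν - 2ℚ * κ - 1ℚ - β⁻¹) * w² u)) (sym up0) (sym dn-last)
             ⟨≡⟩ cong (λ x → (κ + up 0) * w² u + N * ∑ (c ∷ d ∷ cs) w² + (κ + dn (suc (suc (length cs)))) * w² u + ((κ + β⁻¹) * w² u + (κ + β) * w² M + ((ν + κ) * ∑ os w² + b * ((κ + p) * w² M)))
               + ((N - (b + 3ℚ * ℚ.½) * (κ + p)) * w² M + x * w² u)) β-eq))
          (≤⇒0≤- at-centre ⟨*⟩ 0≤p² (w M) ⟨+⟩ ℚ.<⇒≤ (0<inv β 0<β) ⟨*⟩ ≤⇒0≤- β-ok ⟨*⟩ 0≤p² (w u)))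
      where
      infixl 1 _⟨≡⟩_
      _⟨≡⟩_ : ∀ {x y z : ℚ} → x ≡ y → y ≡ z → x ≡ z
      _⟨≡⟩_ = trans
      b = fromℕ′ (length os)
      -- Chosen so that κ + β = (3/2)(κ + p): at M the edge to u then counts as one and a half
      -- leaves.
      β : ℚ
      β = (3ℚ * p + κ) * ℚ.½
      0<β : 0ℚ ℚ.< β
      0<β = ℚ.<-≤-trans (0<p ⟨*⟩⁺ 0<½) (≤-by (p * ℚ.½ + (p + κ) * ℚ.½) (eqβ p κ) (0≤p ⟨*⟩ ℚ.<⇒≤ 0<½ ⟨+⟩ (0≤p ⟨+⟩ 0≤κ) ⟨*⟩ ℚ.<⇒≤ 0<½))
        where
        eqβ : ∀ p k → (3ℚ * p + k) * ℚ.½ ≡ p * ℚ.½ + (p * ℚ.½ + (p + k) * ℚ.½)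
        eqβ = solve-∀ ℚring
      β⁻¹ = inv β 0<β
      up dn : ℕ → ℚ
      up i = if i ℕ.≡ᵇ 0 then ℚ.½ else (if i ℕ.≡ᵇ suc (suc (length cs)) then 2ℚ else 1ℚ)
      dn i = if i ℕ.≡ᵇ 0 then 2ℚ else (if i ℕ.≡ᵇ suc (suc (length cs)) then ℚ.½ else 1ℚ)
      up0 : up 0 ≡ ℚ.½
      up0 = refl
      dn-last : dn (suc (suc (length cs))) ≡ ℚ.½
      dn-last = cong (λ t → if t then ℚ.½ else 1ℚ) (≡ᵇ-refl (length cs))
        where
        ≡ᵇ-refl : ∀ n → (n ℕ.≡ᵇ n) ≡ true
        ≡ᵇ-refl zero    = refl
        ≡ᵇ-refl (suc n) = ≡ᵇ-refl n
      0≤dn : ∀ i → 0ℚ ℚ.≤ dn i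
      0≤dn zero = 0≤2
      0≤dn (suc i) with i ℕ.≡ᵇ suc (length cs)
      ... | true  = ℚ.<⇒≤ 0<½
      ... | false = 0≤1
      updn : ∀ i → up i * dn i ≡ 1ℚ
      updn zero = refl
      updn (suc i) with i ℕ.≡ᵇ suc (length cs)
      ... | true  = refl
      ... | false = refl
      inner : ∀ j → 0 ℕ.≤ j → j ℕ.< suc (suc (length cs)) → 2ℚ * κ + (up (suc j) + dn j) ℚ.≤ N
      inner j _ _ = ℚ.≤-trans (ℚ.+-monoʳ-≤ (2ℚ * κ) (three j)) (≤-by (ν - 9ℚ/2 + (1ℚ - κ) + ℚ.½) (eqn κ ν) (≤⇒0≤- 9/2≤ν ⟨+⟩ ≤⇒0≤- κ≤1 ⟨+⟩ ℚ.<⇒≤ 0<½))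
        where
        eqn : ∀ k n → n + k ≡ 2ℚ * k + 3ℚ + (n - 9ℚ/2 + (1ℚ - k) + ℚ.½)
        eqn = solve-∀ ℚring
        up≤2 : ∀ i → up (suc i) ℚ.≤ 2ℚ
        up≤2 i with i ℕ.≡ᵇ suc (length cs)
        ... | true  = ℚ.≤-refl
        ... | false = ≤-by 1ℚ refl 0≤1
        dn≤1 : ∀ i → dn (suc i) ℚ.≤ 1ℚ
        dn≤1 i with i ℕ.≡ᵇ suc (length cs)
        ... | true  = ≤-by ℚ.½ refl (ℚ.<⇒≤ 0<½)
        ... | false = ℚ.≤-refl
        -- The ratio 2 occurs only next to u. Since at least two further vertices c and d lie on the
        -- cycle, no vertex has it on both sides, and the sum is 2 + 1 at most.
        three : ∀ j → up (suc j) + dn j ℚ.≤ 3ℚ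
        three zero    = ℚ.≤-refl
        three (suc j) = ℚ.+-mono-≤ (up≤2 (suc j)) (dn≤1 j)
      β-ok : 1ℚ ℚ.≤ (ν - 2ℚ * κ - 1ℚ) * β
      β-ok = ≤-by (ℚ.½ * ((ν - 9ℚ/2) * κ + 4ℚ/3 * κ * (1ℚ - 9ℚ/2 * p) + 2ℚ/3 * (1ℚ - 9ℚ/2 * p) + 2ℚ * κ * (1ℚ - κ) + 1ℚ/6 * κ + 1ℚ/3))
          (trans (eqn ν κ p) (trans (cong (λ x → (3ℚ * x + ν * κ - (2ℚ * κ + 1ℚ) * (3ℚ * p + κ)) * ℚ.½) νp≡1) (eqm ν κ p)))
          (ℚ.<⇒≤ 0<½ ⟨*⟩ (≤⇒0≤- 9/2≤ν ⟨*⟩ 0≤κ ⟨+⟩ ℚ.nonNegative⁻¹ 4ℚ/3 ⟨*⟩ 0≤κ ⟨*⟩ ≤⇒0≤- p-small ⟨+⟩ ℚ.nonNegative⁻¹ 2ℚ/3 ⟨*⟩ ≤⇒0≤- p-small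
            ⟨+⟩ 0≤2 ⟨*⟩ 0≤κ ⟨*⟩ ≤⇒0≤- κ≤1 ⟨+⟩ ℚ.nonNegative⁻¹ 1ℚ/6 ⟨*⟩ 0≤κ ⟨+⟩ ℚ.nonNegative⁻¹ 1ℚ/3))
        where
        4ℚ/3 2ℚ/3 1ℚ/6 1ℚ/3 : ℚ
        4ℚ/3 = + 4 ℚ./ 3
        2ℚ/3 = + 2 ℚ./ 3
        1ℚ/6 = + 1 ℚ./ 6
        1ℚ/3 = + 1 ℚ./ 3
        p-small : 9ℚ/2 * p ℚ.≤ 1ℚ
        p-small = subst (9ℚ/2 * p ℚ.≤_) νp≡1 (*-monoʳ 0≤p 9/2≤ν)
        eqn : ∀ n k p → (n - 2ℚ * k - 1ℚ) * ((3ℚ * p + k) * ℚ.½) ≡ (3ℚ * (n * p) + n * k - (2ℚ * k + 1ℚ) * (3ℚ * p + k)) * ℚ.½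
        eqn = solve-∀ ℚring
        eqm : ∀ n k p → (3ℚ * 1ℚ + n * k - (2ℚ * k + 1ℚ) * (3ℚ * p + k)) * ℚ.½ ≡ 1ℚ +
          (ℚ.½ * ((n - 9ℚ/2) * k + 4ℚ/3 * k * (1ℚ - 9ℚ/2 * p) + 2ℚ/3 * (1ℚ - 9ℚ/2 * p) + 2ℚ * k * (1ℚ - k) + 1ℚ/6 * k + 1ℚ/3))
        eqm = solve-∀ ℚring
      β-eq : ν - 2ℚ * κ - 1ℚ - β⁻¹ ≡ β⁻¹ * ((ν - 2ℚ * κ - 1ℚ) * β - 1ℚ)
      β-eq = sym (trans (eqn (ν - 2ℚ * κ - 1ℚ) β β⁻¹) (trans (cong (λ x → (ν - 2ℚ * κ - 1ℚ) * x - β⁻¹) (inv-* β 0<β)) (cong (_- β⁻¹) (ℚ.*-identityʳ (ν - 2ℚ * κ - 1ℚ)))))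
        where
        eqn : ∀ a b i → i * (a * b - 1ℚ) ≡ a * (i * b) - i
        eqn = solve-∀ ℚring
      eq : ∀ ν κ p b i M u C O → (ν + κ) * (M + (u + (C + O)))
        ≡ (κ + ℚ.½) * u + (ν + κ) * C + (κ + ℚ.½) * u + ((κ + i) * u + (κ + (3ℚ * p + κ) * ℚ.½) * M + ((ν + κ) * O + b * ((κ + p) * M)))
          + (((ν + κ) - (b + 3ℚ * ℚ.½) * (κ + p)) * M + (ν - 2ℚ * κ - 1ℚ - i) * u)
      eq = solve-∀ ℚring

-- The Perron vector of U₂

record Point : Set where
  constructor point
  field
    ν   : ℚ
    5≤ν : 5ℚ ℚ.≤ ν

  0<ν : 0ℚ ℚ.< ν
  0<ν = ℚ.<-≤-trans (ℚ.positive⁻¹ 5ℚ) 5≤ν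

  p : ℚ
  p = inv ν 0<ν

  0<p : 0ℚ ℚ.< p
  0<p = 0<inv ν 0<ν

  νp≡1 : ν * p ≡ 1ℚ
  νp≡1 = trans (ℚ.*-comm ν p) (inv-* ν 0<ν)

module Coefficient (r : ℕ) (P : Point) where
  open Point P

  private
    n = fromℕ′ r

  0<D : 0ℚ ℚ.< ν + (1ℚ + fromℕ′ r)
  0<D = ℚ.<-≤-trans 0<ν (≤-by (1ℚ + n) refl (0≤1 ⟨+⟩ fromℕ′-0≤ r))

  κ : ℚ
  κ = n * inv (ν + (1ℚ + n)) 0<D

  κ-eq : κ * (ν + (1ℚ + n)) ≡ n
  κ-eq = trans (ℚ.*-assoc n (inv (ν + (1ℚ + n)) 0<D) (ν + (1ℚ + n))) (trans (cong (_*_ n) (inv-* (ν + (1ℚ + n)) 0<D)) (ℚ.*-identityʳ n))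

  0≤κ : 0ℚ ℚ.≤ κ
  0≤κ = fromℕ′-0≤ r ⟨*⟩ ℚ.<⇒≤ (0<inv (ν + (1ℚ + n)) 0<D)

  κ≤1 : κ ℚ.≤ 1ℚ
  κ≤1 = *-cancelˡ 0<D (subst₂ ℚ._≤_ (trans (sym κ-eq) (ℚ.*-comm κ (ν + (1ℚ + n)))) (sym (ℚ.*-identityʳ (ν + (1ℚ + n))))
    (≤-by (ν + 1ℚ) (eq ν n) (ℚ.<⇒≤ 0<ν ⟨+⟩ 0≤1)))
    where
    eq : ∀ a b → a + (1ℚ + b) ≡ b + (a + 1ℚ)
    eq = solve-∀ ℚring

recurrence : ℚ → ℚ → ℚ → ℕ → ℚ
recurrence T x₀ x₁ zero          = x₀
recurrence T x₀ x₁ (suc zero)    = x₁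
recurrence T x₀ x₁ (suc (suc j)) = T * recurrence T x₀ x₁ (suc j) - recurrence T x₀ x₁ j

module Growth (T x₀ x₁ : ℚ) (2≤T : 2ℚ ℚ.≤ T) (0≤x₀ : 0ℚ ℚ.≤ x₀) (x₀+1≤x₁ : x₀ + 1ℚ ℚ.≤ x₁) where

  private
    x = recurrence T x₀ x₁

  -- For T ≥ 2 a non-negative solution is convex in j, so its increments never fall below the first
  -- one.
  step : ∀ j → 0ℚ ℚ.≤ x j × x j + 1ℚ ℚ.≤ x (suc j)
  step zero    = 0≤x₀ , x₀+1≤x₁
  step (suc j) = 0≤x , ≤-by ((T - 2ℚ) * x (suc j) + (x (suc j) - (x j + 1ℚ))) (eq T (x (suc j)) (x j)) (≤⇒0≤- 2≤T ⟨*⟩ 0≤x ⟨+⟩ ≤⇒0≤- (proj₂ (step j)))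
    where
    0≤x = ℚ.≤-trans (proj₁ (step j) ⟨+⟩ 0≤1) (proj₂ (step j))
    eq : ∀ T a b → T * a - b ≡ a + 1ℚ + ((T - 2ℚ) * a + (a - (b + 1ℚ)))
    eq = solve-∀ ℚring

  0≤x : ∀ j → 0ℚ ℚ.≤ x j
  0≤x j = proj₁ (step j)

  x+1≤x : ∀ j → x j + 1ℚ ℚ.≤ x (suc j)
  x+1≤x j = proj₂ (step j)

  x≤Tx : ∀ j → x (suc (suc j)) ℚ.≤ T * x (suc j)
  x≤Tx j = ≤-by (x j) (eq (T * x (suc j)) (x j)) (0≤x j)
    where
    eq : ∀ a b → a ≡ a - b + b
    eq = solve-∀ ℚring

-- The vertex equations of the graph of UC 2 l (b , 1) for l = l′ + 3, solved except at the centre of the pendant edges.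
module Profile (r b l′ : ℕ) (P : Point) where
  open Point P public
  open Coefficient r P public

  -- At a vertex of degree d the equation is (ν + κ - d κ) y = sum over the neighbours, and a
  -- pendant vertex carries p = 1/ν times its neighbour. Eliminating the pendant vertices leaves
  -- these coefficients at a rim vertex, at the head and at the centre.
  T T₂ T₁ : ℚ
  T  = ν - κ
  T₂ = ν - 2ℚ * κ - p
  T₁ = ν - κ - fromℕ′ b * (κ + p)

  S R : ℕ → ℚ
  S = recurrence T 0ℚ 1ℚ
  R = recurrence T 1ℚ T₂

  -- Cut the cycle open at the centre, with copies at 0 and l. The solution R (i - 1) starts at the
  -- head and vanishes at the copy 0, the solution S (l - i) vanishes at the copy l. By `R-S` each
  -- has the value R (l - 1) at the other copy, so their sum closes up.
  Y : ℕ → ℚ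
  Y zero    = R (2 ℕ.+ l′)
  Y (suc i) = R i + S (2 ℕ.+ l′ ∸ i)

  defect : ℚ
  defect = T₁ * Y 0 - (Y 1 + Y (2 ℕ.+ l′))

  p≤1/5 : 5ℚ * p ℚ.≤ 1ℚ
  p≤1/5 = subst (5ℚ * p ℚ.≤_) νp≡1 (*-monoʳ (ℚ.<⇒≤ 0<p) 5≤ν)

  2≤T : 2ℚ ℚ.≤ T
  2≤T = ≤-by (ν - 5ℚ + (1ℚ - κ) + 2ℚ) (eq ν κ) (≤⇒0≤- 5≤ν ⟨+⟩ ≤⇒0≤- κ≤1 ⟨+⟩ 0≤2)
    where
    eq : ∀ n k → n - k ≡ 2ℚ + (n - 5ℚ + (1ℚ - k) + 2ℚ)
    eq = solve-∀ ℚring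

  2≤T₂ : 2ℚ ℚ.≤ T₂
  2≤T₂ = ≤-by (ν - 5ℚ + 2ℚ * (1ℚ - κ) + (1ℚ - 5ℚ * p) + 4ℚ * p) (eq ν κ p)
      (≤⇒0≤- 5≤ν ⟨+⟩ 0≤2 ⟨*⟩ ≤⇒0≤- κ≤1 ⟨+⟩ ≤⇒0≤- p≤1/5 ⟨+⟩ ℚ.nonNegative⁻¹ 4ℚ ⟨*⟩ ℚ.<⇒≤ 0<p)
    where
    eq : ∀ n k p → n - 2ℚ * k - p ≡ 2ℚ + (n - 5ℚ + 2ℚ * (1ℚ - k) + (1ℚ - 5ℚ * p) + 4ℚ * p)
    eq = solve-∀ ℚring

  module S = Growth T 0ℚ 1ℚ 2≤T ℚ.≤-refl ℚ.≤-refl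
  module R = Growth T 1ℚ T₂ 2≤T 0≤1 2≤T₂

  R-S : ∀ j → R (suc j) ≡ T₂ * S (suc j) - S j
  R-S zero          = eq T₂
    where
    eq : ∀ t → t ≡ t * 1ℚ - 0ℚ
    eq = solve-∀ ℚring
  R-S (suc zero)    = eq T T₂
    where
    eq : ∀ T t → T * t - 1ℚ ≡ t * (T * 1ℚ - 0ℚ) - 1ℚ
    eq = solve-∀ ℚring
  R-S (suc (suc j)) = trans (cong₂ (λ a b → T * a - b) (R-S (suc j)) (R-S j)) (eq T T₂ (S (suc (suc j))) (S (suc j)) (S j))
    where
    eq : ∀ T t a b c → T * (t * a - b) - (t * b - c) ≡ t * (T * a - b) - (T * b - c)
    eq = solve-∀ ℚring

  1≤R : ∀ j → 1ℚ ℚ.≤ R j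
  1≤R zero    = ℚ.≤-refl
  1≤R (suc j) = ℚ.≤-trans (ℚ.≤-trans (1≤R j) (≤-by 1ℚ refl 0≤1)) (R.x+1≤x j)

  1≤Y : ∀ i → 1ℚ ℚ.≤ Y i
  1≤Y zero    = 1≤R (2 ℕ.+ l′)
  1≤Y (suc i) = ℚ.≤-trans (1≤R i) (≤-by (S (2 ℕ.+ l′ ∸ i)) refl (S.0≤x (2 ℕ.+ l′ ∸ i)))

  0<Y : ∀ i → 0ℚ ℚ.< Y i
  0<Y i = ℚ.<-≤-trans 0<1 (1≤Y i)

  Y-cycle : Y (3 ℕ.+ l′) ≡ Y 0
  Y-cycle = trans (cong (λ k → R (2 ℕ.+ l′) + S k) (ℕ.n∸n≡0 l′)) (ℚ.+-identityʳ (R (2 ℕ.+ l′)))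

  Y-head : Y 0 + Y 2 ≡ T₂ * Y 1
  Y-head = trans (cong (_+ (T₂ + S (1 ℕ.+ l′))) (R-S (1 ℕ.+ l′))) (eq T₂ (S (2 ℕ.+ l′)) (S (1 ℕ.+ l′)))
    where
    eq : ∀ t a b → t * a - b + (t + b) ≡ t * (1ℚ + a)
    eq = solve-∀ ℚring

  Y-interior : ∀ i → i ℕ.≤ l′ → Y (1 ℕ.+ i) + Y (3 ℕ.+ i) ≡ T * Y (2 ℕ.+ i)
  Y-interior i i≤l′ = subst₂ (λ a b → R i + S a + (R (2 ℕ.+ i) + S (l′ ∸ i)) ≡ T * (R (1 ℕ.+ i) + S b)) (sym (ℕ.+-∸-assoc 2 i≤l′)) (sym (ℕ.+-∸-assoc 1 i≤l′))
    (eq T (R i) (R (1 ℕ.+ i)) (S (l′ ∸ i)) (S (1 ℕ.+ (l′ ∸ i))))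
    where
    eq : ∀ T a b c d → a + (T * d - c) + (T * b - a + c) ≡ T * (b + d)
    eq = solve-∀ ℚring

  S+1≤R : S (2 ℕ.+ l′) + 1ℚ ℚ.≤ R (2 ℕ.+ l′)
  S+1≤R = ≤-by ((T₂ - 2ℚ) * S (2 ℕ.+ l′) + (S (2 ℕ.+ l′) - (S (1 ℕ.+ l′) + 1ℚ))) (trans (R-S (1 ℕ.+ l′)) (eq T₂ (S (2 ℕ.+ l′)) (S (1 ℕ.+ l′))))
    (≤⇒0≤- 2≤T₂ ⟨*⟩ S.0≤x (2 ℕ.+ l′) ⟨+⟩ ≤⇒0≤- (S.x+1≤x (1 ℕ.+ l′)))
    where
    eq : ∀ t a b → t * a - b ≡ a + 1ℚ + ((t - 2ℚ) * a + (a - (b + 1ℚ)))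
    eq = solve-∀ ℚring

  S₁ : S (2 ℕ.+ l′ ∸ (1 ℕ.+ l′)) ≡ 1ℚ
  S₁ = cong S (ℕ.m+n∸n≡m 1 l′)

  defect≡ : defect ≡ T₁ * R (2 ℕ.+ l′) - (1ℚ + S (2 ℕ.+ l′) + (R (1 ℕ.+ l′) + 1ℚ))
  defect≡ = cong (λ s → T₁ * R (2 ℕ.+ l′) - (1ℚ + S (2 ℕ.+ l′) + (R (1 ℕ.+ l′) + s))) S₁

  defect-0≤ : 2ℚ ℚ.≤ T₁ → 0ℚ ℚ.≤ defect
  defect-0≤ 2≤T₁ = subst (0ℚ ℚ.≤_) (sym (trans defect≡ (eq T₁ (R (2 ℕ.+ l′)) (S (2 ℕ.+ l′)) (R (1 ℕ.+ l′)))))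
    (≤⇒0≤- 2≤T₁ ⟨*⟩ R.0≤x (2 ℕ.+ l′) ⟨+⟩ (≤⇒0≤- S+1≤R ⟨+⟩ ≤⇒0≤- (R.x+1≤x (1 ℕ.+ l′))))
    where
    eq : ∀ t R S R′ → t * R - (1ℚ + S + (R′ + 1ℚ)) ≡ (t - 2ℚ) * R + ((R - (S + 1ℚ)) + (R - (R′ + 1ℚ)))
    eq = solve-∀ ℚring

  -- The assumption says T₁ ≤ 2 p, while each cycle neighbour of the centre exceeds p `Y 0`, because
  -- one step of the recurrence multiplies by at most ν. Thus a cycle neighbour outweighs a pendant
  -- vertex.
  defect-<0 : ν + κ ℚ.≤ (fromℕ′ b + 2ℚ) * (κ + p) → defect ℚ.< 0ℚ
  defect-<0 h = <-by (2ℚ + (((fromℕ′ b + 2ℚ) * (κ + p) - (ν + κ)) * R (2 ℕ.+ l′) + ((R (1 ℕ.+ l′) - p * R (2 ℕ.+ l′)) + (S (2 ℕ.+ l′) - p * R (2 ℕ.+ l′)))))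
    (trans (eq ν κ p (fromℕ′ b) (R (2 ℕ.+ l′)) (S (2 ℕ.+ l′)) (R (1 ℕ.+ l′))) (cong (_+ (2ℚ + (((fromℕ′ b + 2ℚ) * (κ + p) - (ν + κ)) * R (2 ℕ.+ l′)
      + ((R (1 ℕ.+ l′) - p * R (2 ℕ.+ l′)) + (S (2 ℕ.+ l′) - p * R (2 ℕ.+ l′)))))) (sym defect≡)))
    (ℚ.+-mono-<-≤ 0<2 (≤⇒0≤- h ⟨*⟩ R.0≤x (2 ℕ.+ l′) ⟨+⟩ (≤⇒0≤- (shrink T (R (1 ℕ.+ l′)) T≤ν (R.0≤x (1 ℕ.+ l′)) (R.x≤Tx l′)) ⟨+⟩ ≤⇒0≤- (shrink T₂ (S (2 ℕ.+ l′)) T₂≤ν (S.0≤x (2 ℕ.+ l′)) R≤T₂S))))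
    where
    eq : ∀ ν κ p b R S R′ → 0ℚ ≡ (ν - κ - b * (κ + p)) * R - (1ℚ + S + (R′ + 1ℚ)) + (2ℚ + (((b + 2ℚ) * (κ + p) - (ν + κ)) * R + ((R′ - p * R) + (S - p * R))))
    eq = solve-∀ ℚring
    T≤ν : T ℚ.≤ ν
    T≤ν = ≤-by κ (eq′ ν κ) 0≤κ
      where
      eq′ : ∀ n k → n ≡ n - k + k
      eq′ = solve-∀ ℚring
    T₂≤ν : T₂ ℚ.≤ ν
    T₂≤ν = ≤-by (2ℚ * κ + p) (eq′ ν κ p) (0≤2 ⟨*⟩ 0≤κ ⟨+⟩ ℚ.<⇒≤ 0<p)
      where
      eq′ : ∀ n k p → n ≡ n - 2ℚ * k - p + (2ℚ * k + p)
      eq′ = solve-∀ ℚring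
    R≤T₂S : R (2 ℕ.+ l′) ℚ.≤ T₂ * S (2 ℕ.+ l′)
    R≤T₂S = ≤-by (S (1 ℕ.+ l′)) (trans (eq′ (T₂ * S (2 ℕ.+ l′)) (S (1 ℕ.+ l′))) (cong (_+ S (1 ℕ.+ l′)) (sym (R-S (1 ℕ.+ l′))))) (S.0≤x (1 ℕ.+ l′))
      where
      eq′ : ∀ a b → a ≡ a - b + b
      eq′ = solve-∀ ℚring
    shrink : ∀ t x {y} → t ℚ.≤ ν → 0ℚ ℚ.≤ x → y ℚ.≤ t * x → p * y ℚ.≤ x
    shrink t x {y} t≤ν 0≤x y≤tx = ℚ.≤-trans (*-monoˡ (ℚ.<⇒≤ 0<p) (ℚ.≤-trans y≤tx (*-monoʳ 0≤x t≤ν)))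
      (ℚ.≤-reflexive (trans (eq′ p ν x) (trans (cong (_* x) νp≡1) (ℚ.*-identityˡ x))))
      where
      eq′ : ∀ p n x → p * (n * x) ≡ n * p * x
      eq′ = solve-∀ ℚring

  module _ (V : Set) (_≟_ : DecidableEquality V) (w : V → ℚ) (0≤w : ∀ v → 0ℚ ℚ.≤ w v) where
    open Weights V _≟_ κ 0≤κ w 0≤w using (q)

    U-form : 0ℚ ℚ.≤ defect → ∀ U → length (Labelled.rim U) ≡ suc l′ → length (Labelled.leaves U) ≡ b →
      val q (edgesU U) ℚ.≤ (ν + κ) * (∑[ v ∈ vertsU U ] w v * w v)
    U-form 0≤defect U rim≡ leaves≡ = Supersolution.U-≤ V _≟_ κ 0≤κ w 0≤w ν p 0<p νp≡1 U Y 0<Y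
      (subst (λ n → Y (2 ℕ.+ n) ≡ Y 0) (sym rim≡) Y-cycle) (ℚ.≤-reflexive Y-head) interior
      (subst₂ (λ n k → Y 1 + Y (suc n) ℚ.≤ (ν - κ - fromℕ′ k * (κ + p)) * Y 0) (sym rim≡) (sym leaves≡)
        (≤-by defect (a≡b+[a-b] (T₁ * Y 0) (Y 1 + Y (2 ℕ.+ l′))) 0≤defect))
      where
      interior : ∀ j → 1 ℕ.≤ j → suc j ℕ.< 2 ℕ.+ length (Labelled.rim U) → Y j + Y (2 ℕ.+ j) ℚ.≤ T * Y (suc j)
      interior (suc i) _ i< = ℚ.≤-reflexive (Y-interior i (ℕ.≤-pred (ℕ.≤-pred (ℕ.≤-pred (subst (λ n → 2 ℕ.+ i ℕ.< 2 ℕ.+ n) rim≡ i<)))))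

module Scale (r : ℕ) (P : Point) where
  open Point P
  open Coefficient r P

  private
    n = fromℕ′ r
    D = ν + (1ℚ + n)

  0<Dν : 0ℚ ℚ.< D * ν
  0<Dν = ℚ.<-≤-trans 0<ν (≤-by (1ℚ + n) refl (0≤1 ⟨+⟩ fromℕ′-0≤ r)) ⟨*⟩⁺ 0<ν

  -- Clears the denominators of κ and of p = 1/ν: comparing x (κ + p) with ν + κ becomes comparing x
  -- (m - 1) with ν (ν + m - 2).
  scale : ∀ x → D * ν * (x * (κ + p) - (ν + κ)) ≡ (ν + 1ℚ) * (x * (1ℚ + n) - ν * (ν + n))
  scale x = trans (eq₁ ν κ p n x) (trans (cong₂ (λ a b → x * (ν * a + D * b) - (D * ν * ν + ν * a)) κ-eq νp≡1) (eq₂ ν n x))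
    where
    eq₁ : ∀ ν κ p n x → (ν + (1ℚ + n)) * ν * (x * (κ + p) - (ν + κ))
      ≡ x * (ν * (κ * (ν + (1ℚ + n))) + (ν + (1ℚ + n)) * (ν * p)) - ((ν + (1ℚ + n)) * ν * ν + ν * (κ * (ν + (1ℚ + n))))
    eq₁ = solve-∀ ℚring
    eq₂ : ∀ ν n x → x * (ν * n + (ν + (1ℚ + n)) * 1ℚ) - ((ν + (1ℚ + n)) * ν * ν + ν * n) ≡ (ν + 1ℚ) * (x * (1ℚ + n) - ν * (ν + n))
    eq₂ = solve-∀ ℚring

  0<ν+1 : 0ℚ ℚ.< ν + 1ℚ
  0<ν+1 = ℚ.+-mono-< 0<ν 0<1

  ≤-scale : ∀ x → ν * (ν + n) ℚ.≤ x * (1ℚ + n) → ν + κ ℚ.≤ x * (κ + p)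
  ≤-scale x h = 0≤-⇒≤
    (0≤-cancel 0<Dν (subst (0ℚ ℚ.≤_) (sym (scale x)) (ℚ.<⇒≤ 0<ν+1 ⟨*⟩ ≤⇒0≤- h)))

  ≥-scale : ∀ x → x * (1ℚ + n) ℚ.≤ ν * (ν + n) → x * (κ + p) ℚ.≤ ν + κ
  ≥-scale x h = 0≤-⇒≤
    (0≤-cancel 0<Dν (subst (0ℚ ℚ.≤_) (trans (eq₁ (ν + 1ℚ) (x * (1ℚ + n)) (ν * (ν + n))) (trans (cong -_ (sym (scale x))) (eq₂ (D * ν) (x * (κ + p)) (ν + κ))))
      (ℚ.<⇒≤ 0<ν+1 ⟨*⟩ ≤⇒0≤- h)))
    where
    eq₁ : ∀ a b c → a * (c - b) ≡ - (a * (b - c))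
    eq₁ = solve-∀ ℚring
    eq₂ : ∀ a b c → - (a * (b - c)) ≡ a * (c - b)
    eq₂ = solve-∀ ℚring

-- Bracketing the critical ν by bisection of the defect

module Sign (r b l′ : ℕ) (P : Point) where
  open Profile r b l′ P
  open Scale r P

  private
    n = fromℕ′ r
    bℚ = fromℕ′ b

  -- With c = ν + m - 2 the assumption reads c (c - m) ≥ (k - l + 1)(m - 1) - 1. Equality without
  -- the -1 would define the bound of part (ii), so the -1 is the margin that makes that part
  -- strict.
  positive-defect : (bℚ + 2ℚ) * (1ℚ + n) - 1ℚ ℚ.≤ (ν - 2ℚ) * (ν + n) → 0ℚ ℚ.≤ defect
  positive-defect h = defect-0≤ (≤-by (T₁ - 2ℚ) (eq T₁) (0≤-cancel 0<Dν (subst (0ℚ ℚ.≤_) (sym identity)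
      (ℚ.<⇒≤ 0<ν+1 ⟨*⟩ ≤⇒0≤- h ⟨+⟩ ℚ.<⇒≤ 0<ν ⟨+⟩ ℚ.nonNegative⁻¹ 4ℚ ⟨*⟩ fromℕ′-0≤ r ⟨+⟩ 0≤1))))
    where
    eq : ∀ a → a ≡ 2ℚ + (a - 2ℚ)
    eq = solve-∀ ℚring
    eq₁ : ∀ ν κ p n b → (ν + (1ℚ + n)) * ν * (ν - κ - b * (κ + p) - 2ℚ)
      ≡ - ((ν + (1ℚ + n)) * ν * (b * (κ + p) - (ν + κ))) - 2ℚ * ν * (κ * (ν + (1ℚ + n))) - 2ℚ * ν * (ν + (1ℚ + n))
    eq₁ = solve-∀ ℚring
    eq₂ : ∀ ν n b → - ((ν + 1ℚ) * (b * (1ℚ + n) - ν * (ν + n))) - 2ℚ * ν * n - 2ℚ * ν * (ν + (1ℚ + n))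
      ≡ (ν + 1ℚ) * ((ν - 2ℚ) * (ν + n) - ((b + 2ℚ) * (1ℚ + n) - 1ℚ)) + ν + 4ℚ * n + 1ℚ
    eq₂ = solve-∀ ℚring
    identity : (ν + (1ℚ + n)) * ν * (T₁ - 2ℚ) ≡ (ν + 1ℚ) * ((ν - 2ℚ) * (ν + n) - ((bℚ + 2ℚ) * (1ℚ + n) - 1ℚ)) + ν + 4ℚ * n + 1ℚ
    identity = trans (eq₁ ν κ p n bℚ) (trans (cong₂ (λ x y → - x - 2ℚ * ν * y - 2ℚ * ν * (ν + (1ℚ + n))) (scale bℚ) κ-eq) (eq₂ ν n bℚ))

  negative-defect : ν * (ν + n) ℚ.≤ (bℚ + 2ℚ) * (1ℚ + n) → defect ℚ.< 0ℚ
  negative-defect h = defect-<0 (≤-scale (bℚ + 2ℚ) h)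

module Bisection (r b l′ : ℕ) (20≤ : 5ℚ * 4ℚ ℚ.≤ (fromℕ′ b - 5ℚ) * (1ℚ + fromℕ′ r)) where
  open Point using (ν; 5≤ν)

  private
    n = fromℕ′ r
    bℚ = fromℕ′ b

  defect : Point → ℚ
  defect = Profile.defect r b l′

  record Bracket : Set where
    constructor bracket
    field
      lo hi : Point
      lo≤hi : ν lo ℚ.≤ ν hi
      lo<0  : defect lo ℚ.< 0ℚ
      0≤hi  : 0ℚ ℚ.≤ defect hi

    width : ℚ
    width = ν hi - ν lo

  open Bracket

  -- At ν = 5 the numerical hypothesis gives (b + 2)(1 + n) ≥ 27 + 7 n, more than the 5 (5 + n) that
  -- makes the defect negative. The upper end b + 4 is crude; it bounds every ν that occurs later.
  initial : Bracket
  initial = bracket lo₀ hi₀ (≤-by (bℚ - 1ℚ) (eq₁ bℚ) 0≤B-1) (Sign.negative-defect r b l′ lo₀ (≤-by ((bℚ - 5ℚ) * (1ℚ + n) - 5ℚ * 4ℚ + 2ℚ * n + 2ℚ) (eq₂ bℚ n) (≤⇒0≤- 20≤ ⟨+⟩ 0≤2 ⟨*⟩ 0≤n ⟨+⟩ 0≤2)))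
    (Sign.positive-defect r b l′ hi₀ (≤-by (bℚ * bℚ + 5ℚ * bℚ + 2ℚ * 4ℚ - 1ℚ) (eq₃ bℚ n) (subst (0ℚ ℚ.≤_) (eq₅ bℚ) (0≤p² bℚ ⟨+⟩ ℚ.nonNegative⁻¹ 5ℚ ⟨*⟩ fromℕ′-0≤ b ⟨+⟩ (ℚ.nonNegative⁻¹ 5ℚ ⟨+⟩ 0≤2)))))
    where
    0≤n = fromℕ′-0≤ r
    0<1+n = ℚ.+-mono-<-≤ 0<1 0≤n
    0≤B-5 : 0ℚ ℚ.≤ bℚ - 5ℚ
    0≤B-5 = 0≤-cancel 0<1+n (ℚ.≤-trans (ℚ.nonNegative⁻¹ (5ℚ * 4ℚ)) (ℚ.≤-trans 20≤ (ℚ.≤-reflexive (ℚ.*-comm (bℚ - 5ℚ) (1ℚ + n)))))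
    0≤B-1 : 0ℚ ℚ.≤ bℚ - 1ℚ
    0≤B-1 = subst (0ℚ ℚ.≤_) (eq₄ bℚ) (0≤B-5 ⟨+⟩ ℚ.nonNegative⁻¹ 4ℚ)
      where
      eq₄ : ∀ b → b - 5ℚ + 4ℚ ≡ b - 1ℚ
      eq₄ = solve-∀ ℚring
    eq₁ : ∀ b → b + 4ℚ ≡ 5ℚ + (b - 1ℚ)
    eq₁ = solve-∀ ℚring
    lo₀ hi₀ : Point
    lo₀ = point 5ℚ ℚ.≤-refl
    hi₀ = point (bℚ + 4ℚ) (≤-by (bℚ - 1ℚ) (eq₁ bℚ) 0≤B-1)
    eq₂ : ∀ b n → (b + 2ℚ) * (1ℚ + n) ≡ 5ℚ * (5ℚ + n) + ((b - 5ℚ) * (1ℚ + n) - 5ℚ * 4ℚ + 2ℚ * n + 2ℚ)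
    eq₂ = solve-∀ ℚring
    eq₃ : ∀ b n → (b + 4ℚ - 2ℚ) * (b + 4ℚ + n) ≡ (b + 2ℚ) * (1ℚ + n) - 1ℚ + (b * b + 5ℚ * b + 2ℚ * 4ℚ - 1ℚ)
    eq₃ = solve-∀ ℚring
    eq₅ : ∀ b → b * b + 5ℚ * b + (5ℚ + 2ℚ) ≡ b * b + 5ℚ * b + 2ℚ * 4ℚ - 1ℚ
    eq₅ = solve-∀ ℚring

  middle-point : Bracket → Point
  middle-point s = point ((ν (lo s) + ν (hi s)) * ℚ.½)
    (≤-by ((ν (lo s) - 5ℚ + (ν (lo s) - 5ℚ) + (ν (hi s) - ν (lo s))) * ℚ.½) (eq (ν (lo s)) (ν (hi s)))
      ((≤⇒0≤- (5≤ν (lo s)) ⟨+⟩ ≤⇒0≤- (5≤ν (lo s)) ⟨+⟩ ≤⇒0≤- (lo≤hi s)) ⟨*⟩ ℚ.<⇒≤ 0<½))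
    where
    eq : ∀ a b → (a + b) * ℚ.½ ≡ 5ℚ + (a - 5ℚ + (a - 5ℚ) + (b - a)) * ℚ.½
    eq = solve-∀ ℚring

  record Halved (s s′ : Bracket) : Set where
    constructor halved
    field
      lo-mono : ν (lo s) ℚ.≤ ν (lo s′)
      hi-mono : ν (hi s′) ℚ.≤ ν (hi s)
      width≡  : width s′ ≡ width s * ℚ.½

  halve : ∀ s → Σ Bracket (Halved s)
  halve s = by-cases (defect (middle-point s) ℚ.<? 0ℚ)
    where
    a = ν (lo s)
    c = ν (hi s)
    m = (a + c) * ℚ.½
    a≤m : a ℚ.≤ m
    a≤m = ≤-by ((c - a) * ℚ.½) (eq a c) (≤⇒0≤- (lo≤hi s) ⟨*⟩ ℚ.<⇒≤ 0<½)
      where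
      eq : ∀ a b → (a + b) * ℚ.½ ≡ a + (b - a) * ℚ.½
      eq = solve-∀ ℚring
    m≤c : m ℚ.≤ c
    m≤c = ≤-by ((c - a) * ℚ.½) (eq a c) (≤⇒0≤- (lo≤hi s) ⟨*⟩ ℚ.<⇒≤ 0<½)
      where
      eq : ∀ a b → b ≡ (a + b) * ℚ.½ + (b - a) * ℚ.½
      eq = solve-∀ ℚring
    by-cases : Dec (defect (middle-point s) ℚ.< 0ℚ) → Σ Bracket (Halved s)
    by-cases (yes neg) = bracket (middle-point s) (hi s) m≤c neg (0≤hi s) , halved a≤m ℚ.≤-refl (eq a c)
      where
      eq : ∀ a b → b - (a + b) * ℚ.½ ≡ (b - a) * ℚ.½
      eq = solve-∀ ℚring
    by-cases (no ¬neg) = bracket (lo s) (middle-point s) a≤m (lo<0 s) (ℚ.≮⇒≥ ¬neg) , halved ℚ.≤-refl m≤c (eq a c)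
      where
      eq : ∀ a b → (a + b) * ℚ.½ - a ≡ (b - a) * ℚ.½
      eq = solve-∀ ℚring

  brackets : ℕ → Bracket
  brackets zero    = initial
  brackets (suc t) = proj₁ (halve (brackets t))

  loₜ hiₜ : ℕ → ℚ
  loₜ t = ν (lo (brackets t))
  hiₜ t = ν (hi (brackets t))

  lo-mono : ∀ s d → loₜ s ℚ.≤ loₜ (d ℕ.+ s)
  lo-mono s zero    = ℚ.≤-refl
  lo-mono s (suc d) = ℚ.≤-trans (lo-mono s d) (Halved.lo-mono (proj₂ (halve (brackets (d ℕ.+ s)))))

  hi-mono : ∀ s d → hiₜ (d ℕ.+ s) ℚ.≤ hiₜ s
  hi-mono s zero    = ℚ.≤-refl
  hi-mono s (suc d) = ℚ.≤-trans (Halved.hi-mono (proj₂ (halve (brackets (d ℕ.+ s))))) (hi-mono s d)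

  -- Repeated halving enters only through the weaker rate 1/(t + 1), the one that `archimedean`
  -- handles.
  width-bound : ∀ t → width (brackets t) * fromℕ′ (suc t) ℚ.≤ width initial
  width-bound zero    = ℚ.≤-reflexive (trans (cong (_*_ (width initial)) fromℕ′-1) (ℚ.*-identityʳ (width initial)))
  width-bound (suc t) = ℚ.≤-trans (≤-by (width (brackets t) * ℚ.½ * fromℕ′ t)
      (trans (cong (_*_ (width (brackets t))) (fromℕ′-suc t)) (trans (eq (width (brackets t)) (fromℕ′ t))
        (cong (_+ (width (brackets t) * ℚ.½ * fromℕ′ t)) (sym (cong₂ _*_ (Halved.width≡ (proj₂ (halve (brackets t)))) (trans (fromℕ′-suc (suc t)) (cong (_+_ 1ℚ) (fromℕ′-suc t))))))))
      (≤⇒0≤- (lo≤hi (brackets t)) ⟨*⟩ ℚ.<⇒≤ 0<½ ⟨*⟩ fromℕ′-0≤ t)) (width-bound t)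
    where
    eq : ∀ w t → w * (1ℚ + t) ≡ w * ℚ.½ * (1ℚ + (1ℚ + t)) + w * ℚ.½ * t
    eq = solve-∀ ℚring

  narrow : ∀ ε → 0ℚ ℚ.< ε → ∃ λ t → width (brackets t) ℚ.≤ ε
  narrow ε 0<ε = t , *-cancelˡ (0<fromℕ′-suc t) (ℚ.≤-trans (ℚ.≤-reflexive (ℚ.*-comm (fromℕ′ (suc t)) (width (brackets t))))
      (ℚ.≤-trans (width-bound t) (ℚ.≤-trans (≤-by 1ℚ refl 0≤1) W≤)))
    where
    W = width initial + 1ℚ
    0<W : 0ℚ ℚ.< W
    0<W = ℚ.+-mono-≤-< (≤⇒0≤- (lo≤hi initial)) 0<1
    arch = archimedean (ε * inv W 0<W) (0<ε ⟨*⟩⁺ 0<inv W 0<W)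
    t = proj₁ arch
    W≤ : W ℚ.≤ fromℕ′ (suc t) * ε
    W≤ = subst₂ ℚ._≤_ (trans (eq₁ W (+ 1 ℚ./ suc t) (fromℕ′ (suc t))) (trans (cong (_*_ W) (1/-fromℕ′ t)) (ℚ.*-identityʳ W)))
        (trans (eq₂ W (fromℕ′ (suc t)) ε (inv W 0<W)) (trans (cong (_*_ (fromℕ′ (suc t) * ε)) (inv-* W 0<W)) (ℚ.*-identityʳ (fromℕ′ (suc t) * ε))))
        (*-monoˡ (ℚ.<⇒≤ 0<W ⟨*⟩ fromℕ′-0≤ (suc t)) (proj₂ arch t ℕ.≤-refl))
      where
      eq₁ : ∀ w i n → w * n * i ≡ w * (i * n)
      eq₁ = solve-∀ ℚring
      eq₂ : ∀ w n e i → w * n * (e * i) ≡ n * e * (i * w)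
      eq₂ = solve-∀ ℚring

  even? : ℕ → Bool
  even? zero    = true
  even? (suc zero) = false
  even? (suc (suc t)) = even? t

  -- The sequence alternates between the two ends of the brackets, so the defect along it changes sign at every step.
  points : ℕ → Point
  points t = if even? t then lo (brackets t) else hi (brackets t)

  ν-bounds : ∀ s t → s ℕ.≤ t → loₜ s ℚ.≤ ν (points t) × ν (points t) ℚ.≤ hiₜ s
  ν-bounds s t s≤t = by-cases (even? t)
    where
    lo-t : loₜ s ℚ.≤ loₜ t
    lo-t = subst (λ t → loₜ s ℚ.≤ loₜ t) (ℕ.m∸n+n≡m s≤t) (lo-mono s (t ∸ s))
    hi-t : hiₜ t ℚ.≤ hiₜ s
    hi-t = subst (λ t → hiₜ t ℚ.≤ hiₜ s) (ℕ.m∸n+n≡m s≤t) (hi-mono s (t ∸ s))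
    by-cases : ∀ e → let P = if e then lo (brackets t) else hi (brackets t) in loₜ s ℚ.≤ ν P × ν P ℚ.≤ hiₜ s
    by-cases true  = lo-t , ℚ.≤-trans (lo≤hi (brackets t)) hi-t
    by-cases false = ℚ.≤-trans lo-t (lo≤hi (brackets t)) , hi-t

  ν-cauchy : IsCauchy (λ t → ν (points t))
  ν-cauchy ε 0<ε = s , λ i j s≤i s≤j → abs-≤ (close i j s≤i s≤j) (close j i s≤j s≤i)
    where
    s = proj₁ (narrow ε 0<ε)
    close : ∀ i j → s ℕ.≤ i → s ℕ.≤ j → ν (points i) ℚ.≤ ν (points j) + ε
    close i j s≤i s≤j = ≤-by (hiₜ s - ν (points i) + (ν (points j) - loₜ s) + (ε - (hiₜ s - loₜ s))) (eq (ν (points i)) (ν (points j)) (hiₜ s) (loₜ s) ε)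
      (≤⇒0≤- (proj₂ (ν-bounds s i s≤i)) ⟨+⟩ ≤⇒0≤- (proj₁ (ν-bounds s j s≤j)) ⟨+⟩ ≤⇒0≤- (proj₂ (narrow ε 0<ε)))
      where
      eq : ∀ a b h l e → b + e ≡ a + (h - a + (b - l) + (e - (h - l)))
      eq = solve-∀ ℚring

  -- If a and c have opposite signs, |a| ≤ |a - c|. Hence a Cauchy sequence whose consecutive terms
  -- have opposite signs is null.
  defect→0 : IsCauchy (λ t → defect (points t)) → Null (λ t → defect (points t))
  defect→0 cauchy ε 0<ε = proj₁ (cauchy ε 0<ε) , λ t N≤t → small t (defect (points t)) (defect (points (suc t))) (alternates t)
      (proj₂ (cauchy ε 0<ε) t (suc t) N≤t (ℕ.m≤n⇒m≤1+n N≤t))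
    where
    Opposite : ℚ → ℚ → Set
    Opposite a c = (a ℚ.≤ 0ℚ × 0ℚ ℚ.≤ c) ⊎ (0ℚ ℚ.≤ a × c ℚ.≤ 0ℚ)
    sign : ∀ t e → let d = defect (if e then lo (brackets t) else hi (brackets t)) in if e then d ℚ.≤ 0ℚ else 0ℚ ℚ.≤ d
    sign t true  = ℚ.<⇒≤ (lo<0 (brackets t))
    sign t false = 0≤hi (brackets t)
    parity : ∀ t → (even? t ≡ true × even? (suc t) ≡ false) ⊎ (even? t ≡ false × even? (suc t) ≡ true)
    parity zero          = inj₁ (refl , refl)
    parity (suc zero)    = inj₂ (refl , refl)
    parity (suc (suc t)) = parity t
    at : ∀ t {e} → even? t ≡ e → if e then defect (points t) ℚ.≤ 0ℚ else 0ℚ ℚ.≤ defect (points t)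
    at t refl = sign t (even? t)
    alternates : ∀ t → Opposite (defect (points t)) (defect (points (suc t)))
    alternates t = [ (λ (p , q) → inj₁ (at t p , at (suc t) q)) , (λ (p , q) → inj₂ (at t p , at (suc t) q)) ]′ (parity t)
    small : ∀ (t : ℕ) a c → Opposite a c → ℚ.∣ a - c ∣ ℚ.≤ ε → ℚ.∣ a ∣ ℚ.≤ ε
    small _ a c opp near = subst (ℚ._≤ ε) (cong ℚ.∣_∣ (eq₀ a)) (abs-≤ {a} {0ℚ} (proj₁ (two opp)) (proj₂ (two opp)))
      where
      eq₀ : ∀ a → a - 0ℚ ≡ a
      eq₀ = solve-∀ ℚring
      eq₁ : ∀ a c e → 0ℚ + e ≡ a + (e - (a - c) + (0ℚ - c))
      eq₁ = solve-∀ ℚring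
      eq₂ : ∀ a e → 0ℚ + e ≡ a + (e + (0ℚ - a))
      eq₂ = solve-∀ ℚring
      eq₃ : ∀ a c e → a + e ≡ 0ℚ + (e - - (a - c) + c)
      eq₃ = solve-∀ ℚring
      two : Opposite a c → a ℚ.≤ 0ℚ + ε × 0ℚ ℚ.≤ a + ε
      two (inj₁ (a≤0 , 0≤c)) = ≤-by (ε + (0ℚ - a)) (eq₂ a ε) (ℚ.<⇒≤ 0<ε ⟨+⟩ ≤⇒0≤- a≤0)
        , ≤-by (ε - - (a - c) + c) (eq₃ a c ε) (≤⇒0≤- (ℚ.≤-trans (-p≤∣p∣ (a - c)) near) ⟨+⟩ 0≤c)
      two (inj₂ (0≤a , c≤0)) = ≤-by (ε - (a - c) + (0ℚ - c)) (eq₁ a c ε) (≤⇒0≤- (ℚ.≤-trans (p≤∣p∣ (a - c)) near) ⟨+⟩ ≤⇒0≤- c≤0)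
        , 0≤a ⟨+⟩ ℚ.<⇒≤ 0<ε

-- Convergence of the profile along the bisection, and its vertex equations

IsCauchy-inv : ∀ (x : ℕ → ℚ) (1≤x : ∀ i → 1ℚ ℚ.≤ x i) (0<x : ∀ i → 0ℚ ℚ.< x i) → IsCauchy x → IsCauchy (λ i → inv (x i) (0<x i))
IsCauchy-inv x 1≤x 0<x X ε 0<ε = proj₁ (X ε 0<ε) , λ i j p q → abs-≤
    (close i j (∣-∣≤⁻ (x j) (x i) (proj₂ (X ε 0<ε) j i q p))) (close j i (∣-∣≤⁻ (x i) (x j) (proj₂ (X ε 0<ε) i j p q)))
  where
  y : ℕ → ℚ
  y i = inv (x i) (0<x i)
  0≤y : ∀ i → 0ℚ ℚ.≤ y i
  0≤y i = ℚ.<⇒≤ (0<inv (x i) (0<x i))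
  y≤1 : ∀ i → y i ℚ.≤ 1ℚ
  y≤1 i = subst₂ ℚ._≤_ (ℚ.*-identityʳ (y i)) (inv-* (x i) (0<x i)) (*-monoˡ (0≤y i) (1≤x i))
  close : ∀ i j → x j ℚ.≤ x i + ε → y i ℚ.≤ y j + ε
  close i j h = ≤-by (y i * y j * (x i + ε - x j) + ε * (y i * (1ℚ - y j) + (1ℚ - y i)))
    (trans (trans (eq₀ (y j) ε) (cong (λ a → a * y j + ε) (sym (inv-* (x i) (0<x i)))))
      (trans (eq (y i) (y j) (x i) (x j) ε) (trans (cong (λ a → y i * a + (y i * y j * (x i + ε - x j) + ε * (1ℚ - y i * y j))) (inv-* (x j) (0<x j)))
        (eq′ (y i) (y j) ε (y i * y j * (x i + ε - x j))))))
    (0≤y i ⟨*⟩ 0≤y j ⟨*⟩ ≤⇒0≤- h ⟨+⟩ ℚ.<⇒≤ 0<ε ⟨*⟩ (0≤y i ⟨*⟩ ≤⇒0≤- (y≤1 j) ⟨+⟩ ≤⇒0≤- (y≤1 i)))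
    where
    eq₀ : ∀ b e → b + e ≡ 1ℚ * b + e
    eq₀ = solve-∀ ℚring
    eq : ∀ a b c d e → a * c * b + e ≡ a * (b * d) + (a * b * (c + e - d) + e * (1ℚ - a * b))
    eq = solve-∀ ℚring
    eq′ : ∀ a b e z → a * 1ℚ + (z + e * (1ℚ - a * b)) ≡ a + (z + e * (a * (1ℚ - b) + (1ℚ - a)))
    eq′ = solve-∀ ℚring

module ProfileLimit (r b l′ : ℕ) (P : ℕ → Point) (ν-cauchy : IsCauchy (λ t → Point.ν (P t))) where

  private
    module P t = Profile r b l′ (P t)
    5≤⇒1≤ : ∀ {x} → 5ℚ ℚ.≤ x → 1ℚ ℚ.≤ x
    5≤⇒1≤ = ℚ.≤-trans (≤-by 4ℚ refl (ℚ.nonNegative⁻¹ 4ℚ))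

  p-cauchy : IsCauchy (λ t → P.p t)
  p-cauchy = IsCauchy-inv (λ t → P.ν t) (λ t → 5≤⇒1≤ (P.5≤ν t)) (λ t → P.0<ν t) ν-cauchy

  private
    ν′ p′ : ℝ
    ν′ = mkℝ (λ t → P.ν t) ν-cauchy
    p′ = mkℝ (λ t → P.p t) p-cauchy

  κ-cauchy : IsCauchy (λ t → P.κ t)
  κ-cauchy = cauchy (fromℚ (fromℕ′ r) Defs.* mkℝ _ (IsCauchy-inv (λ t → P.ν t + (1ℚ + fromℕ′ r))
    (λ t → ℚ.≤-trans (5≤⇒1≤ (P.5≤ν t)) (≤-by (1ℚ + fromℕ′ r) refl (0≤1 ⟨+⟩ fromℕ′-0≤ r))) (λ t → Coefficient.0<D r (P t))
    (cauchy (ν′ Defs.+ fromℚ (1ℚ + fromℕ′ r)))))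

  private
    κ′ : ℝ
    κ′ = mkℝ (λ t → P.κ t) κ-cauchy

  recurrence-cauchy : ∀ (T x₀ x₁ : ℝ) j → IsCauchy (λ t → recurrence (seq T t) (seq x₀ t) (seq x₁ t) j)
  recurrence-cauchy T x₀ x₁ zero          = cauchy x₀
  recurrence-cauchy T x₀ x₁ (suc zero)    = cauchy x₁
  recurrence-cauchy T x₀ x₁ (suc (suc j)) = cauchy (T Defs.* mkℝ _ (recurrence-cauchy T x₀ x₁ (suc j)) Defs.- mkℝ _ (recurrence-cauchy T x₀ x₁ j))

  S-cauchy : ∀ j → IsCauchy (λ t → P.S t j)
  S-cauchy = recurrence-cauchy (ν′ Defs.- κ′) (fromℚ 0ℚ) (fromℚ 1ℚ)

  R-cauchy : ∀ j → IsCauchy (λ t → P.R t j)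
  R-cauchy = recurrence-cauchy (ν′ Defs.- κ′) (fromℚ 1ℚ) (ν′ Defs.- fromℚ 2ℚ Defs.* κ′ Defs.- p′)

  Y-cauchy : ∀ i → IsCauchy (λ t → P.Y t i)
  Y-cauchy zero    = R-cauchy (2 ℕ.+ l′)
  Y-cauchy (suc i) = cauchy (mkℝ (λ t → P.R t i) (R-cauchy i) Defs.+ mkℝ (λ t → P.S t (2 ℕ.+ l′ ∸ i)) (S-cauchy (2 ℕ.+ l′ ∸ i)))

  defect-cauchy : IsCauchy (λ t → P.defect t)
  defect-cauchy = cauchy ((ν′ Defs.- κ′ Defs.- fromℚ (fromℕ′ b) Defs.* (κ′ Defs.+ p′)) Defs.* mkℝ (λ t → P.Y t 0) (Y-cauchy 0) Defs.- (mkℝ (λ t → P.Y t 1) (Y-cauchy 1) Defs.+ mkℝ (λ t → P.Y t (2 ℕ.+ l′)) (Y-cauchy (2 ℕ.+ l′))))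

Along : ∀ {V : Set} → (V → ℚ) → (ℕ → ℚ) → ℕ → List V → Set
Along Y y i []       = ⊤
Along Y y i (c ∷ cs) = Y c ≡ y i × Along Y y (suc i) cs

module Eigenvector (r b l′ : ℕ) (P : Point) {V : Set} (_≟_ : DecidableEquality V) (Y : V → ℚ) (ψ : V → ℚ) where
  open Profile r b l′ P using (κ; ν; p; νp≡1; defect; Y-head; Y-cycle; Y-interior; T₁; T₂) renaming (Y to y)

  private
    N = ν + κ

  -- The polarised form with a test function ψ. For ψ the indicator of v it is the row of v, so a
  -- single computation along the edge list yields the equations at all vertices.
  bil : V → V → ℚ
  bil a b = ψ a * (κ * Y a + Y b) + ψ b * (κ * Y b + Y a)

  path-bil : ∀ i a cs b → (∀ j → i ℕ.≤ j → j ℕ.< i ℕ.+ length cs → y j + y (2 ℕ.+ j) ≡ (ν - κ) * y (suc j)) →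
    Y a ≡ y i → Along Y y (suc i) cs → Y b ≡ y (suc i ℕ.+ length cs) →
    val bil (pathE a cs b) ≡ ψ a * (κ * y i + y (suc i)) + N * (∑[ c ∈ cs ] ψ c * Y c) + ψ b * (κ * Y b + y (i ℕ.+ length cs))
  path-bil i a [] b _ Ya _ Yb = trans (cong₂ (λ s t → ψ a * (κ * s + t) + ψ b * (κ * Y b + s) + 0ℚ) Ya (trans Yb (cong (y ∘ suc) (ℕ.+-identityʳ i))))
    (trans (eq (ψ a * (κ * y i + y (suc i))) (ψ b * (κ * Y b + y i)) N)
      (cong (λ k → ψ a * (κ * y i + y (suc i)) + N * 0ℚ + ψ b * (κ * Y b + y k)) (sym (ℕ.+-identityʳ i))))
    where
    eq : ∀ a b n → a + b + 0ℚ ≡ a + n * 0ℚ + b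
    eq = solve-∀ ℚring
  path-bil i a (c ∷ cs) b rec Ya (Yc , Ycs) Yb = trans
    (cong₂ _+_ (cong₂ (λ s t → ψ a * (κ * s + t) + ψ c * (κ * t + s)) Ya Yc)
      (path-bil (suc i) c cs b (λ j i<j j< → rec j (ℕ.≤-trans (ℕ.n≤1+n i) i<j) (subst (j ℕ.<_) (sym (ℕ.+-suc i (length cs))) j<)) Yc Ycs
        (trans Yb (cong (y ∘ suc) (ℕ.+-suc i (length cs))))))
    (trans (eq κ ν (ψ a) (ψ c) (y i) (y (suc i)) (y (suc (suc i))) s e)
      (trans (cong (λ x → ψ a * (κ * y i + y (suc i)) + (ψ c * (2ℚ * κ * y (suc i) + x) + N * s) + e)
          (rec i ℕ.≤-refl (subst (i ℕ.<_) (sym (ℕ.+-suc i (length cs))) (s≤s (ℕ.m≤m+n i (length cs))))))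
        (trans (eq′ κ ν (ψ c) (y (suc i)) (ψ a * (κ * y i + y (suc i))) s e)
          (cong₂ (λ x k → ψ a * (κ * y i + y (suc i)) + N * (ψ c * x + s) + ψ b * (κ * Y b + y k)) (sym Yc) (sym (ℕ.+-suc i (length cs)))))))
    where
    s = ∑[ c ∈ cs ] ψ c * Y c
    e = ψ b * (κ * Y b + y (suc (i ℕ.+ length cs)))
    eq : ∀ k n a c y₀ y₁ y₂ s e → a * (k * y₀ + y₁) + c * (k * y₁ + y₀) + (c * (k * y₁ + y₂) + (n + k) * s + e)
      ≡ a * (k * y₀ + y₁) + (c * (2ℚ * k * y₁ + (y₀ + y₂)) + (n + k) * s) + e
    eq = solve-∀ ℚring
    eq′ : ∀ k n c y x s e → x + (c * (2ℚ * k * y + (n - k) * y) + (n + k) * s) + e ≡ x + (n + k) * (c * y + s) + e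
    eq′ = solve-∀ ℚring

  U-bil : ∀ (U : Labelled V) → let open Labelled U in length rim ≡ suc l′ → length leaves ≡ b →
    Y centre ≡ y 0 → Y head ≡ y 1 → Along Y y 2 rim → All (λ o → Y o ≡ p * y 0) leaves → Y foot ≡ p * y 1 →
    val bil (edgesU U) ≡ N * (∑[ v ∈ vertsU U ] ψ v * Y v) - ψ centre * defect
  U-bil (labelled M c cs os t) cs≡ os≡ YM Yc Ycs Yos Yt = trans (val-X bil M (c ∷ cs) os t c) (trans
      (cong₂ _+_ (cong₂ _+_ (cong₂ (λ s t → ψ M * (κ * s + t) + ψ c * (κ * t + s)) YM Yc) round) (cong₂ _+_ (at-leaves os Yos)
        (cong₂ (λ s u → ψ t * (κ * s + u) + ψ c * (κ * u + s)) Yt Yc)))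
      (trans (cong (λ k → ψ M * (κ * y 0 + y 1) + ψ c * (κ * y 1 + y 0) + (ψ c * (κ * y 1 + y 2) + N * C + ψ M * (κ * y 0 + y (2 ℕ.+ l′)))
                + (N * O + fromℕ′ k * (ψ M * ((κ + p) * y 0)) + (ψ t * (κ * (p * y 1) + y 1) + ψ c * (κ * y 1 + p * y 1)))) os≡)
        (trans (eq ν κ p (fromℕ′ b) (ψ M) (ψ c) (ψ t) (y 0) (y 1) (y 2) (y (2 ℕ.+ l′)) C O)
          (trans (cong₂ (λ s u → (ν + κ) * (ψ M * y 0 + (C + (O + 0ℚ))) + ψ c * (3ℚ * κ * y 1 + s + p * y 1) + ψ t * (κ * p * y 1 + u * y 1) - ψ M * defect) Y-head (sym νp≡1))
            (trans (eq′ ν κ p (ψ M * y 0) (ψ c) (ψ t) (y 1) C O (ψ M * defect))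
              (cong (λ s → N * s - ψ M * defect) (sym total)))))))
    where
    C = ∑[ v ∈ cs ] ψ v * Y v
    O = ∑[ v ∈ os ] ψ v * Y v
    Yl : Y M ≡ y (2 ℕ.+ length cs)
    Yl = trans YM (trans (sym Y-cycle) (cong (λ n → y (2 ℕ.+ n)) (sym cs≡)))
    round : val bil (pathE c cs M) ≡ ψ c * (κ * y 1 + y 2) + N * C + ψ M * (κ * y 0 + y (2 ℕ.+ l′))
    round = trans (path-bil 1 c cs M interior Yc Ycs Yl) (cong₂ (λ s n → ψ c * (κ * y 1 + y 2) + N * C + ψ M * (κ * s + y (suc n))) YM cs≡)
      where
      interior : ∀ j → 1 ℕ.≤ j → j ℕ.< 1 ℕ.+ length cs → y j + y (2 ℕ.+ j) ≡ (ν - κ) * y (suc j)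
      interior (suc i) _ (s≤s i<) = Y-interior i (ℕ.≤-pred (subst (suc i ℕ.≤_) cs≡ i<))
    at-leaves : ∀ os → All (λ o → Y o ≡ p * y 0) os → (∑[ o ∈ os ] bil o M) ≡ N * (∑[ o ∈ os ] ψ o * Y o) + fromℕ′ (length os) * (ψ M * ((κ + p) * y 0))
    at-leaves [] [] = trans (eq₀ N (ψ M * ((κ + p) * y 0))) (cong (λ k → N * 0ℚ + k * (ψ M * ((κ + p) * y 0))) (sym fromℕ′-0))
      where
      eq₀ : ∀ n x → 0ℚ ≡ n * 0ℚ + 0ℚ * x
      eq₀ = solve-∀ ℚring
    at-leaves (o ∷ os) (Yo ∷ Yos) = trans (cong₂ _+_ (cong₂ (λ s u → ψ o * (κ * s + u) + ψ M * (κ * u + s)) Yo YM) (at-leaves os Yos))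
      (trans (eq₁ κ p (ψ o) (ψ M) (y 0) (N * (∑[ o ∈ os ] ψ o * Y o)) (fromℕ′ (length os)))
        (trans (cong (λ u → ψ o * (κ * (p * y 0) + u * y 0) + N * (∑[ o ∈ os ] ψ o * Y o) + (1ℚ + fromℕ′ (length os)) * (ψ M * ((κ + p) * y 0))) (sym νp≡1))
          (trans (eq₂ κ ν p (ψ o) (y 0) (∑[ o ∈ os ] ψ o * Y o) ((1ℚ + fromℕ′ (length os)) * (ψ M * ((κ + p) * y 0))))
            (cong₂ (λ s k → N * (ψ o * s + (∑[ o ∈ os ] ψ o * Y o)) + k * (ψ M * ((κ + p) * y 0))) (sym Yo) (sym (fromℕ′-suc (length os)))))))
      where
      eq₁ : ∀ k p o m y s n → o * (k * (p * y) + y) + m * (k * y + p * y) + (s + n * (m * ((k + p) * y)))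
        ≡ o * (k * (p * y) + 1ℚ * y) + s + (1ℚ + n) * (m * ((k + p) * y))
      eq₁ = solve-∀ ℚring
      eq₂ : ∀ k n p o y s x → o * (k * (p * y) + n * p * y) + (n + k) * s + x ≡ (n + k) * (o * (p * y) + s) + x
      eq₂ = solve-∀ ℚring
    total : (∑[ v ∈ vertsU (labelled M c cs os t) ] ψ v * Y v) ≡ ψ M * y 0 + (ψ c * y 1 + (C + (O + (ψ t * (p * y 1) + 0ℚ))))
    total = cong₂ _+_ (cong (_*_ (ψ M)) YM) (cong₂ _+_ (cong (_*_ (ψ c)) Yc) (trans (∑-++ cs (os ++ [ t ]) (λ v → ψ v * Y v))
      (cong (_+_ C) (trans (∑-++ os [ t ] (λ v → ψ v * Y v)) (cong (λ s → O + (ψ t * s + 0ℚ)) Yt)))))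
    eq : ∀ ν κ p b m c t y₀ y₁ y₂ yₗ C O →
      m * (κ * y₀ + y₁) + c * (κ * y₁ + y₀) + (c * (κ * y₁ + y₂) + (ν + κ) * C + m * (κ * y₀ + yₗ))
        + ((ν + κ) * O + b * (m * ((κ + p) * y₀)) + (t * (κ * (p * y₁) + y₁) + c * (κ * y₁ + p * y₁)))
      ≡ (ν + κ) * (m * y₀ + (C + (O + 0ℚ))) + c * (3ℚ * κ * y₁ + (y₀ + y₂) + p * y₁) + t * (κ * p * y₁ + 1ℚ * y₁)
        - m * ((ν - κ - b * (κ + p)) * y₀ - (y₁ + yₗ))
    eq = solve-∀ ℚring
    eq′ : ∀ ν κ p m c t y₁ C O d →
      (ν + κ) * (m + (C + (O + 0ℚ))) + c * (3ℚ * κ * y₁ + (ν - 2ℚ * κ - p) * y₁ + p * y₁) + t * (κ * p * y₁ + ν * p * y₁) - d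
      ≡ (ν + κ) * (m + (c * y₁ + (C + (O + (t * (p * y₁) + 0ℚ))))) - d
    eq′ = solve-∀ ℚring

-- Graphs of the hypergraphs UC

↔-injective : (b : A ↔ B) → ∀ {x y} → Inverse.to b x ≡ Inverse.to b y → x ≡ y
↔-injective b eq = trans (sym (Inverse.strictlyInverseʳ b _)) (trans (cong (Inverse.from b) eq) (Inverse.strictlyInverseʳ b _))

≅-sym : ∀ {G H} → G ≅ H → H ≅ G
≅-sym {G} {H} iso = record
  { onV = ↔-sym onV ; onE = ↔-sym onE
  ; incident = λ v e → mk⇔
      (λ v∈e → Equivalence.from (incident _ _) (subst₂ (Hypergraph._∈_ H) (sym (Inverse.strictlyInverseˡ onV v)) (sym (Inverse.strictlyInverseˡ onE e)) v∈e))
      (λ v∈e → subst₂ (Hypergraph._∈_ H) (Inverse.strictlyInverseˡ onV v) (Inverse.strictlyInverseˡ onE e) (Equivalence.to (incident _ _) v∈e)) }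
  where open _≅_ iso

≅-trans : ∀ {G H K} → G ≅ H → H ≅ K → G ≅ K
≅-trans i j = record
  { onV = ↔-trans (onV i) (onV j) ; onE = ↔-trans (onE i) (onE j)
  ; incident = λ v e → mk⇔
      (λ p → Equivalence.to (incident j _ _) (Equivalence.to (incident i v e) p))
      (λ p → Equivalence.from (incident i v e) (Equivalence.from (incident j _ _) p)) }
  where open _≅_

power-cong : ∀ m {G H} → G ≅ H → power m G ≅ power m H
power-cong m {G} {H} iso = record
  { onV = mk↔ₛ′ (λ { (inj₁ v) → inj₁ (to onV v) ; (inj₂ (e , j)) → inj₂ (to onE e , j) })
                (λ { (inj₁ v) → inj₁ (from onV v) ; (inj₂ (e , j)) → inj₂ (from onE e , j) })
                (λ { (inj₁ v) → cong inj₁ (strictlyInverseˡ onV v) ; (inj₂ (e , j)) → cong (λ e → inj₂ (e , j)) (strictlyInverseˡ onE e) })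
                (λ { (inj₁ v) → cong inj₁ (strictlyInverseʳ onV v) ; (inj₂ (e , j)) → cong (λ e → inj₂ (e , j)) (strictlyInverseʳ onE e) })
  ; onE = onE
  ; incident = λ { (inj₁ v) e → incident v e ; (inj₂ (f , j)) e → mk⇔ (cong (to onE)) (↔-injective onE) } }
  where
  open _≅_ iso
  open Inverse

module Model (l′ a b : ℕ) where

  l : ℕ
  l = 3 ℕ.+ l′

  3≤3+l′ : 3 ℕ.≤ l
  3≤3+l′ = s≤s (s≤s (s≤s z≤n))

  I : Set
  I = Fin l ⊎ (Fin a ⊎ Fin b)

  -- A unicyclic graph has as many edges as vertices. The edge named x joins x to f x: one index
  -- type serves vertices and edges, and the map f is the whole graph.
  f : I → I
  f (inj₁ i)        = inj₁ (next i)
  f (inj₂ (inj₁ _)) = inj₁ zero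
  f (inj₂ (inj₂ _)) = inj₁ (suc zero)

  f²≢ : ∀ x → f (f x) ≢ x
  f²≢ (inj₁ i) eq = next²≢ 3≤3+l′ i (inj₁-injective eq)
  f²≢ (inj₂ (inj₁ _)) ()
  f²≢ (inj₂ (inj₂ _)) ()

  f≢ : ∀ x → f x ≢ x
  f≢ x eq = f²≢ x (trans (cong f eq) eq)

  I-finite : Finite I
  I-finite = ⊎-finite (Fin-finite l) (⊎-finite (Fin-finite a) (Fin-finite b))

  graph : Hypergraph
  graph = record
    { V = I ; E = I ; V-finite = I-finite ; E-finite = I-finite
    ; _∈_ = λ v e → v ≡ e ⊎ v ≡ f e
    ; _∈?_ = λ v e → decEq I-finite v e ⊎-dec decEq I-finite v (f e)
    ; nonempty = λ e → e , inj₁ refl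
    ; extensional = λ {e} {g} h → ext (Equivalence.to (h e) (inj₁ refl)) (Equivalence.from (h g) (inj₁ refl)) }
    where
    ext : ∀ {e g} → e ≡ g ⊎ e ≡ f g → g ≡ e ⊎ g ≡ f e → e ≡ g
    ext (inj₁ p) _ = p
    ext (inj₂ _) (inj₁ q) = sym q
    ext {e} (inj₂ p) (inj₂ q) = contradiction (trans (cong f (sym q)) (sym p)) (f²≢ e)

  graph-ends : Ends graph
  graph-ends = record { src = id ; tgt = f ; src≢tgt = λ e → f≢ e ∘ sym ; ends = λ e v → mk⇔ id id }

  module FromIndexing (G : Hypergraph) (G-ends : Ends G) (vb : I ↔ Hypergraph.V G)
    (adjacent : ∀ x → ∃ λ e → Hypergraph._∈_ G (Inverse.to vb x) e × Hypergraph._∈_ G (Inverse.to vb (f x)) e)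
    (complete : ∀ e → ∃ λ x → Hypergraph._∈_ G (Inverse.to vb x) e × Hypergraph._∈_ G (Inverse.to vb (f x)) e) where

    open Hypergraph G
    open Ends G-ends

    private
      v : I → V
      v = Inverse.to vb

    v≢ : ∀ x → v x ≢ v (f x)
    v≢ x eq = f≢ x (sym (↔-injective vb eq))

    eb : I → E
    eb x = proj₁ (adjacent x)

    eb-unique : ∀ x {e} → v x ∈ e → v (f x) ∈ e → eb x ≡ e
    eb-unique x p q = edge-unique (v≢ x) (proj₁ (proj₂ (adjacent x))) (proj₂ (proj₂ (adjacent x))) p q

    ∈eb : ∀ x {u} → u ∈ eb x → u ≡ v x ⊎ u ≡ v (f x)
    ∈eb x = two (v≢ x) (proj₁ (proj₂ (adjacent x))) (proj₂ (proj₂ (adjacent x)))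

    eb-injective : ∀ {x y} → eb x ≡ eb y → x ≡ y
    eb-injective {x} {y} eq with ∈eb y (subst (v x ∈_) eq (proj₁ (proj₂ (adjacent x)))) | ∈eb x (subst (v y ∈_) (sym eq) (proj₁ (proj₂ (adjacent y))))
    ... | inj₁ p | _      = ↔-injective vb p
    ... | inj₂ _ | inj₁ q = sym (↔-injective vb q)
    ... | inj₂ p | inj₂ q = contradiction (trans (cong f (sym (↔-injective vb q))) (sym (↔-injective vb p))) (f²≢ x)

    edges : I ↔ E
    edges = mk↔ₛ′ eb (proj₁ ∘ complete) right (λ x → eb-injective (right (eb x)))
      where
      right : ∀ e → eb (proj₁ (complete e)) ≡ e
      right e = eb-unique _ (proj₁ (proj₂ (complete e))) (proj₂ (proj₂ (complete e)))

    model≅ : graph ≅ G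
    model≅ = record { onV = vb ; onE = edges ; incident = λ u x → mk⇔
      [ (λ { refl → proj₁ (proj₂ (adjacent x)) }) , (λ { refl → proj₂ (proj₂ (adjacent x)) }) ]′
      (λ u∈ → [ (λ p → inj₁ (↔-injective vb p)) , (λ p → inj₂ (↔-injective vb p)) ]′ (∈eb x u∈)) }

  module _ (r : ℕ) (2≤m : 2 ℕ.≤ suc (suc r)) (3≤l : 3 ℕ.≤ 3 ℕ.+ l′) where

    private
      U = UC (suc (suc r)) (3 ℕ.+ l′) 2≤m 3≤l (c₁₂ a b)
      P = Σ (Fin l ⊎ Fin l × Fin r) (Fin ∘ [ c₁₂ a b , const 0 ]′)
      module U = Hypergraph U
      module G = Hypergraph (power (suc (suc r)) graph)

    pend : Fin a ⊎ Fin b → P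
    pend (inj₁ j) = inj₁ zero , j
    pend (inj₂ j) = inj₁ (suc zero) , j

    pend⁻¹ : P → Fin a ⊎ Fin b
    pend⁻¹ (inj₁ zero , j)       = inj₁ j
    pend⁻¹ (inj₁ (suc zero) , j) = inj₂ j

    pend-pend⁻¹ : ∀ x → pend (pend⁻¹ x) ≡ x
    pend-pend⁻¹ (inj₁ zero , j)       = refl
    pend-pend⁻¹ (inj₁ (suc zero) , j) = refl

    pend⁻¹-pend : ∀ x → pend⁻¹ (pend x) ≡ x
    pend⁻¹-pend (inj₁ j) = refl
    pend⁻¹-pend (inj₂ j) = refl

    -- Of the m - 1 new vertices of a pendant edge, number `zero` plays the pendant vertex of the
    -- graph, and the other m - 2 are the vertices that `power` adds.
    onV : G.V ↔ U.V
    onV = mk↔ₛ′ to from to-from from-to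
      where
      to : G.V → U.V
      to (inj₁ (inj₁ i))     = inj₁ (inj₁ i)
      to (inj₁ (inj₂ x))     = inj₂ (pend x , zero)
      to (inj₂ (inj₁ i , j)) = inj₁ (inj₂ (i , j))
      to (inj₂ (inj₂ x , j)) = inj₂ (pend x , suc j)
      from : U.V → G.V
      from (inj₁ (inj₁ i))       = inj₁ (inj₁ i)
      from (inj₁ (inj₂ (i , j))) = inj₂ (inj₁ i , j)
      from (inj₂ (x , zero))     = inj₁ (inj₂ (pend⁻¹ x))
      from (inj₂ (x , suc j))    = inj₂ (inj₂ (pend⁻¹ x) , j)
      to-from : ∀ v → to (from v) ≡ v
      to-from (inj₁ (inj₁ i))       = refl
      to-from (inj₁ (inj₂ (i , j))) = refl
      to-from (inj₂ (x , zero))     = cong (λ y → inj₂ (y , zero)) (pend-pend⁻¹ x)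
      to-from (inj₂ (x , suc j))    = cong (λ y → inj₂ (y , suc j)) (pend-pend⁻¹ x)
      from-to : ∀ v → from (to v) ≡ v
      from-to (inj₁ (inj₁ i))     = refl
      from-to (inj₁ (inj₂ x))     = cong (inj₁ ∘ inj₂) (pend⁻¹-pend x)
      from-to (inj₂ (inj₁ i , j)) = refl
      from-to (inj₂ (inj₂ x , j)) = cong (λ y → inj₂ (inj₂ y , j)) (pend⁻¹-pend x)

    onE : G.E ↔ U.E
    onE = mk↔ₛ′ (λ { (inj₁ i) → inj₁ i ; (inj₂ x) → inj₂ (pend x) }) (λ { (inj₁ i) → inj₁ i ; (inj₂ x) → inj₂ (pend⁻¹ x) })
      (λ { (inj₁ i) → refl ; (inj₂ x) → cong inj₂ (pend-pend⁻¹ x) }) (λ { (inj₁ i) → refl ; (inj₂ x) → cong inj₂ (pend⁻¹-pend x) })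

    pend-injective : ∀ {x y} → pend x ≡ pend y → x ≡ y
    pend-injective {x} {y} eq = trans (sym (pend⁻¹-pend x)) (trans (cong pend⁻¹ eq) (pend⁻¹-pend y))

    power-model≅ : power (suc (suc r)) graph ≅ UC (suc (suc r)) (3 ℕ.+ l′) 2≤m 3≤l (c₁₂ a b)
    power-model≅ = record { onV = onV ; onE = onE ; incident = inc }
      where
      inc : ∀ v e → v G.∈ e ⇔ Inverse.to onV v U.∈ Inverse.to onE e
      inc (inj₁ (inj₁ i)) (inj₁ j) = mk⇔ (λ { (inj₁ refl) → inj₁ refl ; (inj₂ refl) → inj₂ refl }) (λ { (inj₁ refl) → inj₁ refl ; (inj₂ refl) → inj₂ refl })
      inc (inj₁ (inj₁ i)) (inj₂ (inj₁ j)) = mk⇔ (λ { (inj₁ ()) ; (inj₂ refl) → refl }) (λ { refl → inj₂ refl })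
      inc (inj₁ (inj₁ i)) (inj₂ (inj₂ j)) = mk⇔ (λ { (inj₁ ()) ; (inj₂ refl) → refl }) (λ { refl → inj₂ refl })
      inc (inj₁ (inj₂ x)) (inj₁ j) = mk⇔ (λ { (inj₁ ()) ; (inj₂ ()) }) (λ ())
      inc (inj₁ (inj₂ x)) (inj₂ y) = mk⇔ (λ { (inj₁ refl) → refl ; (inj₂ p) → ⊥-elim (not-rim y p) }) (λ p → inj₁ (cong inj₂ (pend-injective p)))
        where
        not-rim : ∀ y → inj₂ x ≡ f (inj₂ y) → ⊥
        not-rim (inj₁ _) ()
        not-rim (inj₂ _) ()
      inc (inj₂ (inj₁ i , j)) (inj₁ e) = mk⇔ (λ { refl → refl }) (λ { refl → refl })
      inc (inj₂ (inj₁ i , j)) (inj₂ (inj₁ _)) = mk⇔ (λ ()) (λ ())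
      inc (inj₂ (inj₁ i , j)) (inj₂ (inj₂ _)) = mk⇔ (λ ()) (λ ())
      inc (inj₂ (inj₂ x , j)) (inj₁ e) = mk⇔ (λ ()) (λ ())
      inc (inj₂ (inj₂ x , j)) (inj₂ y) = mk⇔ (λ { refl → refl }) (λ p → cong inj₂ (pend-injective p))

next-inject₁ : ∀ {n} (j : Fin n) → next (Fin.inject₁ j) ≡ suc j
next-inject₁ {n} j with next-cases (Fin.inject₁ j)
... | inj₁ p       = Fin.toℕ-injective (trans p (cong suc (Fin.toℕ-inject₁ j)))
... | inj₂ (p , _) = contradiction (trans (sym (Fin.toℕ-inject₁ j)) p) (ℕ.<⇒≢ (Fin.toℕ<n j))

next-last : ∀ n → next (Fin.fromℕ n) ≡ zero
next-last n with next-cases (Fin.fromℕ n)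
... | inj₁ p       = contradiction (subst (ℕ._< suc n) (trans p (cong suc (Fin.toℕ-fromℕ n))) (Fin.toℕ<n (next (Fin.fromℕ n)))) (ℕ.<-irrefl refl)
... | inj₂ (_ , q) = Fin.toℕ-injective q

tabulate-pathE : ∀ {n} (c nx : Fin (suc n) → A) {z} → (∀ j → nx (Fin.inject₁ j) ≡ c (suc j)) → nx (Fin.fromℕ n) ≡ z →
  List.tabulate (λ i → c i , nx i) ≡ pathE (c zero) (List.tabulate (c ∘ suc)) z
tabulate-pathE {n = zero}  c nx _  eq = cong (λ z → [ (c zero , z) ]) eq
tabulate-pathE {n = suc n} c nx eqs eq = cong₂ (λ x L → (c zero , x) ∷ L) (eqs zero) (tabulate-pathE (c ∘ suc) (nx ∘ suc) (eqs ∘ suc) eq)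

tabulate-cycle : ∀ {n} (c : Fin (suc n) → A) → List.tabulate (λ i → c i , c (next i)) ≡ pathE (c zero) (List.tabulate (c ∘ suc)) (c zero)
tabulate-cycle {n = n} c = tabulate-pathE c (c ∘ next) (λ j → cong c (next-inject₁ j)) (cong c (next-last n))

map-injective-∈ : ∀ {f : A → B} {xs x y} → Unique (map f xs) → x ∈ˡ xs → y ∈ˡ xs → f x ≡ f y → x ≡ y
map-injective-∈ _ (here refl) (here refl) _ = refl
map-injective-∈ (f≢ ∷ _) (here refl) (there y∈) eq = contradiction eq (All.lookup f≢ (∈ˡ.∈-map⁺ _ y∈))
map-injective-∈ (f≢ ∷ _) (there x∈) (here refl) eq = contradiction (sym eq) (All.lookup f≢ (∈ˡ.∈-map⁺ _ x∈))
map-injective-∈ (_ ∷ u) (there x∈) (there y∈) eq = map-injective-∈ u x∈ y∈ eq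

-- The graph of UC 2 l (a , b), with the pendant vertices os at the centre M and fs at its neighbour c.
vertsUC : A → A → List A → List A → List A → List A
vertsUC M c cs os fs = (M ∷ c ∷ cs) ++ (os ++ fs)

edgesUC : A → A → List A → List A → List A → List (A × A)
edgesUC M c cs os fs = pathE M (c ∷ cs) M ++ (map (_, M) os ++ map (_, c) fs)

module ModelLists (l′ a b : ℕ) where
  open Model l′ a b

  rim : ∀ {V : Set} → (I → V) → Fin (suc l′) → V
  rim g i = g (inj₁ (suc (suc i)))

  indices : List I
  indices = map inj₁ (List.allFin l) ++ map inj₂ (map inj₁ (List.allFin a) ++ map inj₂ (List.allFin b))

  indices-enumerates : Enumerates indices
  indices-enumerates = ⊎-enumerates (allFin-enumerates l) (⊎-enumerates (allFin-enumerates a) (allFin-enumerates b))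

  map-indices : ∀ {V : Set} (g : I → V) → map g indices
    ≡ List.tabulate (g ∘ inj₁) ++ (List.tabulate (g ∘ inj₂ ∘ inj₁) ++ List.tabulate (g ∘ inj₂ ∘ inj₂))
  map-indices g = trans (List.map-++ g (map inj₁ (List.allFin l)) _) (cong₂ _++_ (part g inj₁)
    (trans (cong (map g) (List.map-++ inj₂ (map inj₁ (List.allFin a)) _)) (trans (List.map-++ g (map inj₂ (map inj₁ (List.allFin a))) _)
      (cong₂ _++_ (part₂ g inj₁) (part₂ g inj₂)))))
    where
    part : ∀ {n} {X V : Set} (g : X → V) (h : Fin n → X) → map g (map h (List.allFin n)) ≡ List.tabulate (g ∘ h)
    part g h = trans (sym (List.map-∘ (List.allFin _))) (List.map-tabulate id (g ∘ h))
    part₂ : ∀ {n} {V : Set} (g : I → V) (h : Fin n → Fin a ⊎ Fin b) → map g (map inj₂ (map h (List.allFin n))) ≡ List.tabulate (g ∘ inj₂ ∘ h)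
    part₂ g h = trans (sym (List.map-∘ (map h (List.allFin _)))) (part (g ∘ inj₂) h)

  vertices-list : ∀ {V : Set} (g : I → V) → map g indices
    ≡ vertsUC (g (inj₁ zero)) (g (inj₁ (suc zero))) (List.tabulate (rim g)) (List.tabulate (g ∘ inj₂ ∘ inj₁)) (List.tabulate (g ∘ inj₂ ∘ inj₂))
  vertices-list = map-indices

  edges-list : ∀ {V : Set} (g : I → V) → map (λ x → g x , g (f x)) indices
    ≡ edgesUC (g (inj₁ zero)) (g (inj₁ (suc zero))) (List.tabulate (rim g)) (List.tabulate (g ∘ inj₂ ∘ inj₁)) (List.tabulate (g ∘ inj₂ ∘ inj₂))
  edges-list g = trans (map-indices (λ x → g x , g (f x))) (cong₂ _++_ (tabulate-cycle (g ∘ inj₁))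
    (cong₂ _++_ (sym (List.map-tabulate (g ∘ inj₂ ∘ inj₁) (_, g (inj₁ zero)))) (sym (List.map-tabulate (g ∘ inj₂ ∘ inj₂) (_, g (inj₁ (suc zero)))))))

module Listed (G : Hypergraph) (G-ends : Ends G) where
  open Hypergraph G
  open Ends G-ends

  Joined : V × V → Set
  Joined (u , v) = ∃ λ e → u ∈ e × v ∈ e

  Covers : List (V × V) → E → Set
  Covers L e = (src e , tgt e) ∈ˡ L ⊎ (tgt e , src e) ∈ˡ L

  -- Turns the list description used by the moves back into an isomorphism. The list fs is kept
  -- general: fs = [] yields U₁ and a single foot yields U₂.
  listed≅ : ∀ M c z rim os fs → Enumerates (vertsUC M c (z ∷ rim) os fs) → All Joined (edgesUC M c (z ∷ rim) os fs) →
    (∀ e → Covers (edgesUC M c (z ∷ rim) os fs) e) → Model.graph (length rim) (length os) (length fs) ≅ G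
  listed≅ M c z rim os fs vs joined covers = FromIndexing.model≅ G G-ends vb adjacent complete′
    where
    open Model (length rim) (length os) (length fs)
    open ModelLists (length rim) (length os) (length fs) using (indices; indices-enumerates; vertices-list; edges-list)
    g : I → V
    g = [ List.lookup (M ∷ c ∷ z ∷ rim) , [ List.lookup os , List.lookup fs ]′ ]′
    vertices≡ : map g indices ≡ vertsUC M c (z ∷ rim) os fs
    vertices≡ = trans (vertices-list g) (cong₂ _++_ (cong (λ xs → M ∷ c ∷ z ∷ xs) (List.tabulate-lookup rim)) (cong₂ _++_ (List.tabulate-lookup os) (List.tabulate-lookup fs)))
    edges≡ : map (λ x → g x , g (f x)) indices ≡ edgesUC M c (z ∷ rim) os fs
    edges≡ = trans (edges-list g) (cong₂ _++_ (cong (λ xs → pathE M (c ∷ z ∷ xs) M) (List.tabulate-lookup rim))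
      (cong₂ (λ os fs → map (_, M) os ++ map (_, c) fs) (List.tabulate-lookup os) (List.tabulate-lookup fs)))
    preimage : ∀ v → ∃ λ x → v ≡ g x
    preimage v with ∈ˡ.∈-map⁻ g {xs = indices} (subst (v ∈ˡ_) (sym vertices≡) (complete vs v))
    ... | x , _ , eq = x , eq
    g-injective : ∀ {x y} → g x ≡ g y → x ≡ y
    g-injective = map-injective-∈ (subst Unique (sym vertices≡) (unique vs)) (complete indices-enumerates _) (complete indices-enumerates _)
    vb : I ↔ V
    vb = mk↔ₛ′ g (proj₁ ∘ preimage) (λ v → sym (proj₂ (preimage v))) (λ x → g-injective (sym (proj₂ (preimage (g x)))))
    pair∈ : ∀ x → (g x , g (f x)) ∈ˡ edgesUC M c (z ∷ rim) os fs
    pair∈ x = subst ((g x , g (f x)) ∈ˡ_) edges≡ (∈ˡ.∈-map⁺ (λ x → g x , g (f x)) (complete indices-enumerates x))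
    adjacent : ∀ x → ∃ λ e → g x ∈ e × g (f x) ∈ e
    adjacent x = All.lookup joined (pair∈ x)
    index-of : ∀ {u v} → (u , v) ∈ˡ edgesUC M c (z ∷ rim) os fs → ∃ λ x → (u , v) ≡ (g x , g (f x))
    index-of {u} {v} p with ∈ˡ.∈-map⁻ (λ x → g x , g (f x)) {xs = indices} (subst ((u , v) ∈ˡ_) (sym edges≡) p)
    ... | x , _ , eq = x , eq
    complete′ : ∀ e → ∃ λ x → g x ∈ e × g (f x) ∈ e
    complete′ e = [ (λ p → proj₁ (index-of p) , subst (λ (u , v) → u ∈ e × v ∈ e) (proj₂ (index-of p)) (src∈ e , tgt∈ e))
                  , (λ p → proj₁ (index-of p) , subst (λ (u , v) → u ∈ e × v ∈ e) (proj₂ (index-of p)) (tgt∈ e , src∈ e)) ]′ (covers e)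

-- Normal form of unicyclic graphs

next-prev : ∀ {n} (i : Fin (suc n)) → ∃ λ j → next j ≡ i
next-prev {n} zero    = Fin.fromℕ n , next-last n
next-prev     (suc j) = Fin.inject₁ j , next-inject₁ j

next-injective : ∀ {n} {i j : Fin (suc n)} → next i ≡ next j → i ≡ j
next-injective {n} {i} {j} eq with next-cases i | next-cases j
... | inj₁ p       | inj₁ q       = Fin.toℕ-injective (ℕ.suc-injective (trans (sym p) (trans (cong toℕ eq) q)))
... | inj₂ (p , _) | inj₂ (q , _) = Fin.toℕ-injective (trans p (sym q))
... | inj₁ p       | inj₂ (_ , q) = contradiction (trans (sym p) (trans (cong toℕ eq) q)) λ ()
... | inj₂ (_ , p) | inj₁ q       = contradiction (trans (sym q) (trans (cong toℕ (sym eq)) p)) λ ()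

next≢ : ∀ {n} → 3 ℕ.≤ n → (i : Fin n) → next i ≢ i
next≢ 3≤n i eq = next²≢ 3≤n i (trans (cong next eq) eq)

module _ where
  open import Data.Fin.Subset using (∣_∣)
  open import Data.Vec.Base using (tabulate)

  ∣∣≡0 : ∀ {n} (f : Fin n → Bool) → ∣ tabulate f ∣ ≡ 0 → ∀ i → f i ≢ true
  ∣∣≡0 {suc n} f eq i fi with f zero in f0
  ∣∣≡0 {suc n} f eq zero    fi | false = contradiction (trans (sym f0) fi) λ ()
  ∣∣≡0 {suc n} f eq (suc i) fi | false = ∣∣≡0 (f ∘ suc) eq i fi

  ∣∣≡1 : ∀ {n} (f : Fin n → Bool) → ∣ tabulate f ∣ ≡ 1 → ∃ λ i → f i ≡ true × (∀ j → f j ≡ true → j ≡ i)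
  ∣∣≡1 {suc n} f eq with f zero in f0
  ... | true  = zero , f0 , λ { zero _ → refl ; (suc j) fj → contradiction fj (∣∣≡0 (f ∘ suc) (ℕ.suc-injective eq) j) }
  ... | false with ∣∣≡1 (f ∘ suc) eq
  ...   | i , fi , only = suc i , fi , λ { zero fj → contradiction (trans (sym f0) fj) λ () ; (suc j) fj → cong suc (only j fj) }

  ∣∣≡2 : ∀ {n} (f : Fin n → Bool) → ∣ tabulate f ∣ ≡ 2 →
    ∃₂ λ i j → i ≢ j × f i ≡ true × f j ≡ true × (∀ k → f k ≡ true → k ≡ i ⊎ k ≡ j)
  ∣∣≡2 {suc n} f eq with f zero in f0
  ... | true with ∣∣≡1 (f ∘ suc) (ℕ.suc-injective eq)
  ...   | j , fj , only = zero , suc j , (λ ()) , f0 , fj , λ { zero _ → inj₁ refl ; (suc k) fk → inj₂ (cong suc (only k fk)) }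
  ∣∣≡2 {suc n} f eq | false with ∣∣≡2 (f ∘ suc) eq
  ...   | i , j , i≢j , fi , fj , only = suc i , suc j , i≢j ∘ Fin.suc-injective , fi , fj ,
    λ { zero fk → contradiction (trans (sym f0) fk) λ () ; (suc k) fk → [ inj₁ ∘ cong suc , inj₂ ∘ cong suc ]′ (only k fk) }

does⇒ : ∀ {P : Set} (d : Dec P) → does d ≡ true → P
does⇒ (yes p) _ = p

uniform-ends : ∀ G → Hypergraph.Uniform G 2 → Ends G
uniform-ends G uniform = record
  { src = λ e → vertex (proj₁ (pair e)) ; tgt = λ e → vertex (proj₁ (proj₂ (pair e)))
  ; src≢tgt = λ e eq → proj₁ (proj₂ (proj₂ (pair e))) (↔-injective (Finite.enum V-finite) eq)
  ; ends = λ e v → mk⇔ (to e v)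
      [ (λ { refl → does⇒ (vertex (proj₁ (pair e)) ∈? e) (proj₁ (proj₂ (proj₂ (proj₂ (pair e))))) }) , (λ { refl → does⇒ (vertex (proj₁ (proj₂ (pair e))) ∈? e) (proj₁ (proj₂ (proj₂ (proj₂ (proj₂ (pair e)))))) }) ]′ }
  where
  open Hypergraph G
  pair : ∀ e → ∃₂ λ i j → i ≢ j × does (vertex i ∈? e) ≡ true × does (vertex j ∈? e) ≡ true × (∀ k → does (vertex k ∈? e) ≡ true → k ≡ i ⊎ k ≡ j)
  pair e = ∣∣≡2 (λ i → does (vertex i ∈? e)) (uniform e)
  vertex-index : ∀ v → vertex (Finite.index V-finite v) ≡ v
  vertex-index v = Inverse.strictlyInverseˡ (Finite.enum V-finite) v
  to : ∀ e v → v ∈ e → v ≡ vertex (proj₁ (pair e)) ⊎ v ≡ vertex (proj₁ (proj₂ (pair e)))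
  to e v v∈e = [ (λ eq → inj₁ (trans (sym (vertex-index v)) (cong vertex eq))) , (λ eq → inj₂ (trans (sym (vertex-index v)) (cong vertex eq))) ]′
    (proj₂ (proj₂ (proj₂ (proj₂ (proj₂ (pair e))))) (Finite.index V-finite v)
      (dec-true (vertex (Finite.index V-finite v) ∈? e) (subst (_∈ e) (sym (vertex-index v)) v∈e)))

cycle-transport : ∀ {H K l} → (iso : H ≅ K) → (C : LooseCycleIn H l) →
  Σ (LooseCycleIn K l) λ D → ∀ i → LooseCycleIn.edge D i ≡ Inverse.to (_≅_.onE iso) (LooseCycleIn.edge C i)
cycle-transport {H} {K} iso C = record
  { 3≤l = 3≤l ; core = to onV ∘ core ; edge = to onE ∘ edge
  ; core-injective = core-injective ∘ ↔-injective onV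
  ; consecutive = λ i v → mk⇔
      (λ (p , q) → trans (sym (strictlyInverseˡ onV v)) (cong (to onV) (Equivalence.to (consecutive i (from onV v)) (back v _ p , back v _ q))))
      (λ { refl → Equivalence.to (incident _ _) (proj₁ (Equivalence.from (consecutive i _) refl)) , Equivalence.to (incident _ _) (proj₂ (Equivalence.from (consecutive i _) refl)) })
  ; disjoint = λ i≢j ni≢j nj≢i v (p , q) → disjoint i≢j ni≢j nj≢i (from onV v) (back v _ p , back v _ q)
  } , λ _ → refl
  where
  open _≅_ iso
  open Inverse
  open LooseCycleIn C
  back : ∀ v e → Hypergraph._∈_ K v (to onE e) → Hypergraph._∈_ H (from onV v) e
  back v e p = Equivalence.from (incident _ e) (subst (λ v → Hypergraph._∈_ K v (to onE e)) (sym (strictlyInverseˡ onV v)) p)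

unicyclic-transport : ∀ {H K l} → H ≅ K → UnicyclicOfLength H l → UnicyclicOfLength K l
unicyclic-transport {H} {K} iso (C , only) = proj₁ (cycle-transport iso C) , same
  where
  same : ∀ {l′} (D : LooseCycleIn K l′) → SameCycle (proj₁ (cycle-transport iso C)) D
  same D e = mk⇔
    (λ (i , eq) → let (j , q) = Equivalence.to (only D′ (from onE e)) (i , ↔-injective onE (trans eq (sym (strictlyInverseˡ onE e)))) in j , ↔-injective (↔-sym onE) q)
    (λ (j , eq) → let (i , q) = Equivalence.from (only D′ (from onE e)) (j , cong (from onE) eq) in i , trans (cong (to onE) q) (strictlyInverseˡ onE e))
    where
    open _≅_ iso
    open Inverse
    D′ = proj₁ (cycle-transport (≅-sym iso) D)

module _ (G : Hypergraph) (G-ends : Ends G) (m : ℕ) where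
  open Hypergraph G
  open Ends G-ends

  -- New vertices lie in a single edge each, so they add nothing to the intersections of distinct
  -- edges, and a cycle of the graph becomes a loose cycle of its power.
  power-cycle : ∀ {l} → 3 ℕ.≤ l → (c : Fin l → V) → (∀ {i j} → c i ≡ c j → i ≡ j) →
    (ce : Fin l → E) → (∀ i → c i ∈ ce i × c (next i) ∈ ce i) → LooseCycleIn (power m G) l
  power-cycle {suc l} 3≤l c c-injective ce joins = record
    { 3≤l = 3≤l ; core = inj₁ ∘ c ; edge = ce
    ; core-injective = λ { {i} {j} eq → c-injective (inj₁-injective eq) }
    ; consecutive = consecutive ; disjoint = disjoint }
    where
    on : ∀ {i u} → u ∈ ce i → u ≡ c i ⊎ u ≡ c (next i)
    on {i} = two (λ eq → next≢ 3≤l i (sym (c-injective eq))) (proj₁ (joins i)) (proj₂ (joins i))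
    corner : ∀ {i j} → c i ∈ ce j → i ≡ j ⊎ i ≡ next j
    corner c∈ = [ inj₁ ∘ c-injective , inj₂ ∘ c-injective ]′ (on c∈)
    consecutive : ∀ i v → (Hypergraph._∈_ (power m G) v (ce i) × Hypergraph._∈_ (power m G) v (ce (next i))) ⇔ v ≡ inj₁ (c (next i))
    consecutive i (inj₂ (f , _)) = mk⇔ (λ (p , q) → contradiction (subst (c i ∈_) (trans (sym p) q) (proj₁ (joins i))) not-next) λ ()
      where
      not-next : ¬ c i ∈ ce (next i)
      not-next p = [ next≢ 3≤l i ∘ sym , next²≢ 3≤l i ∘ sym ]′ (corner p)
    consecutive i (inj₁ u) = mk⇔ (λ (p , q) → cong inj₁ (meet (on p) (on q))) (λ { refl → proj₂ (joins i) , proj₁ (joins (next i)) })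
      where
      meet : u ≡ c i ⊎ u ≡ c (next i) → u ≡ c (next i) ⊎ u ≡ c (next (next i)) → u ≡ c (next i)
      meet (inj₂ p) _        = p
      meet (inj₁ _) (inj₁ q) = q
      meet (inj₁ p) (inj₂ q) = contradiction (c-injective (trans (sym q) p)) (next²≢ 3≤l i)
    disjoint : ∀ {i j} → i ≢ j → next i ≢ j → next j ≢ i → ∀ v → ¬ (Hypergraph._∈_ (power m G) v (ce i) × Hypergraph._∈_ (power m G) v (ce j))
    disjoint {i} {j} i≢j ni≢j nj≢i (inj₂ _) (p , q) = [ i≢j , nj≢i ∘ sym ]′ (corner (subst (c i ∈_) (trans (sym p) q) (proj₁ (joins i))))
    disjoint {i} {j} i≢j ni≢j nj≢i (inj₁ u) (p , q) with on p | on q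
    ... | inj₁ x | inj₁ y = i≢j (c-injective (trans (sym x) y))
    ... | inj₁ x | inj₂ y = nj≢i (c-injective (trans (sym y) x))
    ... | inj₂ x | inj₁ y = ni≢j (c-injective (trans (sym x) y))
    ... | inj₂ x | inj₂ y = i≢j (next-injective (c-injective (trans (sym x) y)))

  -- Shifted by one step, so that both c i and c (next i) are given by the intersection condition.
  cycle-in-graph : ∀ {l} (C : LooseCycleIn (power m G) (suc l)) → let open LooseCycleIn C in
    Σ (Fin (suc l) → V) λ c → (∀ {i j} → c i ≡ c j → i ≡ j) × (∀ i → c i ∈ edge (next i) × c (next i) ∈ edge (next i))
  cycle-in-graph {l} C = c , c-inj , λ i → on-edge i (proj₂ (Equivalence.from (consecutive i _) refl)) ,
      on-edge (next i) (proj₁ (Equivalence.from (consecutive (next i) _) refl))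
    where
    open LooseCycleIn C
    -- If consecutive edges were equal, both ends of the edge would lie in an intersection that has
    -- only one vertex.
    not-loop : ∀ i → edge i ≢ edge (next i)
    not-loop i eq = contradiction (trans (at src src∈) (sym (at tgt tgt∈))) (λ p → src≢tgt (edge i) (inj₁-injective p))
      where
      at : ∀ (s : E → V) → (∀ e → s e ∈ e) → inj₁ (s (edge i)) ≡ core (next i)
      at s s∈ = Equivalence.to (consecutive i (inj₁ (s (edge i)))) (s∈ (edge i) , subst (s (edge i) ∈_) eq (s∈ (edge i)))
    -- A core vertex lies in two distinct edges, whereas a new vertex lies in one.
    is-old : ∀ i → ∃ λ v → core (next i) ≡ inj₁ v
    is-old i with core (next i) in eq
    ... | inj₁ v = v , refl
    ... | inj₂ (f , j) = contradiction (trans (sym (proj₁ both)) (proj₂ both)) (not-loop i)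
      where
      both : f ≡ edge i × f ≡ edge (next i)
      both = Equivalence.from (consecutive i (inj₂ (f , j))) (sym eq)
    c : Fin (suc l) → V
    c i = proj₁ (is-old i)
    c-inj : ∀ {i j} → c i ≡ c j → i ≡ j
    c-inj {i} {j} eq = next-injective (core-injective (trans (proj₂ (is-old i)) (trans (cong inj₁ eq) (sym (proj₂ (is-old j))))))
    on-edge : ∀ i {e} → Hypergraph._∈_ (power m G) (core (next i)) e → c i ∈ e
    on-edge i {e} p = subst (λ v → Hypergraph._∈_ (power m G) v e) (proj₂ (is-old i)) p

-- Growing a forest out of the cycle

data SimplePath {A : Set} (R : A → A → Set) : A → List A → A → Set where
  []  : ∀ {x} → SimplePath R x [] x
  _∷_ : ∀ {x y z ys} → R x y → SimplePath R y ys z → SimplePath R x (y ∷ ys) z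

module _ {A : Set} (_≟_ : DecidableEquality A) {R : A → A → Set} where

  _∈?ˡ_ : ∀ x xs → Dec (x ∈ˡ xs)
  x ∈?ˡ xs = Any.any? (x ≟_) xs

  suffix : ∀ {x ys z a} → SimplePath R x ys z → Unique (x ∷ ys) → a ∈ˡ x ∷ ys → ∃ λ ws → SimplePath R a ws z × Unique (a ∷ ws)
  suffix p       u       (here refl) = _ , p , u
  suffix (_ ∷ p) (_ ∷ u) (there a∈)  = suffix p u a∈

  loop-erase : ∀ {a b} → Star R a b → ∃ λ ws → SimplePath R a ws b × Unique (a ∷ ws)
  loop-erase stop = [] , [] , [] ∷ []
  loop-erase (_◅_ {a} {c} r rs) with loop-erase rs
  ... | ws , p , u with a ∈?ˡ (c ∷ ws)
  ...   | yes a∈ = suffix p u a∈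
  ...   | no  a∉ = c ∷ ws , r ∷ p , All.tabulate (λ x∈ eq → a∉ (subst (_∈ˡ c ∷ ws) (sym eq) x∈)) ∷ u

lookup-injective : ∀ {xs : List A} → Unique xs → ∀ {i j} → List.lookup xs i ≡ List.lookup xs j → i ≡ j
lookup-injective (_ ∷ _)  {zero}  {zero}  _  = refl
lookup-injective (x≢ ∷ _) {zero}  {suc j} eq = contradiction eq (All.lookup x≢ (∈ˡ.∈-lookup j))
lookup-injective (x≢ ∷ _) {suc i} {zero}  eq = contradiction (sym eq) (All.lookup x≢ (∈ˡ.∈-lookup i))
lookup-injective (_ ∷ u)  {suc i} {suc j} eq = cong suc (lookup-injective u eq)

path-lookup : ∀ {R : A → A → Set} {x ys z} → SimplePath R x ys z →
  (∀ j → R (List.lookup (x ∷ ys) (Fin.inject₁ j)) (List.lookup (x ∷ ys) (suc j))) × List.lookup (x ∷ ys) (Fin.fromℕ (length ys)) ≡ z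
path-lookup []      = (λ ()) , refl
path-lookup (r ∷ p) = (λ { zero → r ; (suc j) → proj₁ (path-lookup p) j }) , proj₂ (path-lookup p)

last-or-inject : ∀ {n} (i : Fin (suc n)) → i ≡ Fin.fromℕ n ⊎ ∃ λ j → i ≡ Fin.inject₁ j
last-or-inject {zero}  zero    = inj₁ refl
last-or-inject {suc n} zero    = inj₂ (zero , refl)
last-or-inject {suc n} (suc i) with last-or-inject i
... | inj₁ eq       = inj₁ (cong suc eq)
... | inj₂ (j , eq) = inj₂ (suc j , cong suc eq)

unique-length : ∀ {xs ys : List A} → Unique xs → Enumerates ys → length xs ℕ.≤ length ys
unique-length {xs = xs} {ys} u Y = Fin.injective⇒≤ {f = λ i → Any.index (complete Y (List.lookup xs i))}
  (λ {i} {j} eq → lookup-injective u (trans (Any.lookup-index (complete Y (List.lookup xs i)))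
    (trans (cong (List.lookup ys) eq) (sym (Any.lookup-index (complete Y (List.lookup xs j)))))))

module Spanning (G : Hypergraph) (G-ends : Ends G) (connected : ∀ u v → Star (λ u v → ∃ λ e → Hypergraph._∈_ G u e × Hypergraph._∈_ G v e) u v)
  (l₁ : ℕ) (3≤l : 3 ℕ.≤ suc l₁) (c : Fin (suc l₁) → Hypergraph.V G) (c-injective : ∀ {i j} → c i ≡ c j → i ≡ j)
  (ce : Fin (suc l₁) → Hypergraph.E G) (joins : ∀ i → Hypergraph._∈_ G (c i) (ce i) × Hypergraph._∈_ G (c (next i)) (ce i)) where

  open Hypergraph G
  open Ends G-ends
  open Listed G G-ends

  _≟ⱽ_ : DecidableEquality V
  _≟ⱽ_ = decEq V-finite

  cs₀ cycle : List V
  cs₀   = List.tabulate (c ∘ suc)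
  cycle = c zero ∷ cs₀

  data TreeEdges : List (V × V) → List E → Set where
    []  : TreeEdges [] []
    _∷_ : ∀ {v p e ts es} → v ∈ e × p ∈ e × v ≢ p → TreeEdges ts es → TreeEdges ((v , p) ∷ ts) (e ∷ es)

  InTree : List E → V → V → Set
  InTree es u v = ∃ λ e → e ∈ˡ es × u ∈ e × v ∈ e

  -- The invariant of adding leaving edges one at a time. The walks of `reach` use only edges
  -- already taken; they later close any remaining edge to a second cycle.
  record State (ts : List (V × V)) : Set where
    field
      {tree-es}  : List E
      forest     : Forest cycle ts
      tree       : TreeEdges ts tree-es

    verts : List V
    verts = children ts ++ cycle

    es : List E
    es = tree-es ++ List.tabulate ce

    field
      verts-unique : Unique verts
      es-unique    : Unique es
      within       : ∀ {e v} → e ∈ˡ es → v ∈ e → v ∈ˡ verts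
      reach        : ∀ {v} → v ∈ˡ verts → Star (InTree es) v (c zero)

  ce-injective : ∀ {i j} → ce i ≡ ce j → i ≡ j
  ce-injective {i} {j} eq with at i (subst (c j ∈_) (sym eq) (proj₁ (joins j))) | at j (subst (c i ∈_) eq (proj₁ (joins i)))
    where
    at : ∀ i {u} → u ∈ ce i → u ≡ c i ⊎ u ≡ c (next i)
    at i = two (λ q → next≢ 3≤l i (sym (c-injective q))) (proj₁ (joins i)) (proj₂ (joins i))
  ... | inj₁ p | _      = sym (c-injective p)
  ... | inj₂ _ | inj₁ q = c-injective q
  ... | inj₂ p | inj₂ q = contradiction (trans (cong next (sym (c-injective p))) (sym (c-injective q))) (next²≢ 3≤l i)

  c∈cycle : ∀ i → c i ∈ˡ cycle
  c∈cycle i = ∈ˡ.∈-tabulate⁺ {f = c} i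

  InTree-mono : ∀ {es e u v} → Star (InTree es) u v → Star (InTree (e ∷ es)) u v
  InTree-mono stop = stop
  InTree-mono ((e , e∈ , p) ◅ rs) = (e , there e∈ , p) ◅ InTree-mono rs

  initial : State []
  initial = record
    { forest = [] ; tree = []
    ; verts-unique = Unique.tabulate⁺ {f = c} c-injective
    ; es-unique = Unique.tabulate⁺ {f = ce} ce-injective
    ; within = within ; reach = reach }
    where
    within : ∀ {e v} → e ∈ˡ List.tabulate ce → v ∈ e → v ∈ˡ cycle
    within e∈ v∈e with ∈ˡ.∈-tabulate⁻ {f = ce} e∈
    ... | i , refl with two (λ q → next≢ 3≤l i (sym (c-injective q))) (proj₁ (joins i)) (proj₂ (joins i)) v∈e
    ...   | inj₁ refl = c∈cycle i
    ...   | inj₂ refl = c∈cycle (next i)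
    back : ∀ n (i : Fin (suc l₁)) → toℕ i ≡ n → Star (InTree (List.tabulate ce)) (c i) (c zero)
    back n zero _ = stop
    back (suc n) (suc j) eq = (ce (Fin.inject₁ j) , ∈ˡ.∈-tabulate⁺ {f = ce} (Fin.inject₁ j) ,
        subst (λ i → c i ∈ ce (Fin.inject₁ j)) (next-inject₁ j) (proj₂ (joins (Fin.inject₁ j))) , proj₁ (joins (Fin.inject₁ j)))
      ◅ back n (Fin.inject₁ j) (trans (Fin.toℕ-inject₁ j) (ℕ.suc-injective eq))
    reach : ∀ {v} → v ∈ˡ cycle → Star (InTree (List.tabulate ce)) v (c zero)
    reach v∈ with ∈ˡ.∈-tabulate⁻ {f = c} v∈
    ... | i , refl = back (toℕ i) i refl

  extend : ∀ {ts} (S : State ts) {v p e} → v ∈ e → p ∈ e → v ∉ˡ State.verts S → p ∈ˡ State.verts S → State ((v , p) ∷ ts)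
  extend {ts} S {v} {p} {e} v∈e p∈e v∉ p∈ = record
    { forest = grow v≢p (parent (∈ˡ.∈-++⁻ (children ts) p∈)) forest
    ; tree = (v∈e , p∈e , v≢p) ∷ tree
    ; verts-unique = All.tabulate (λ x∈ eq → v∉ (subst (_∈ˡ verts) (sym eq) x∈)) ∷ verts-unique
    ; es-unique = All.tabulate (λ x∈ eq → v∉ (within (subst (_∈ˡ es) (sym eq) x∈) v∈e)) ∷ es-unique
    ; within = λ { (here refl) x∈e → [ here , (λ { refl → there p∈ }) ]′ (two v≢p v∈e p∈e x∈e) ; (there f∈) x∈f → there (within f∈ x∈f) }
    ; reach = λ { (here refl) → (e , here refl , v∈e , p∈e) ◅ InTree-mono (reach p∈) ; (there x∈) → InTree-mono (reach x∈) } }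
    where
    open State S
    v≢p : v ≢ p
    v≢p refl = v∉ p∈
    parent : p ∈ˡ children ts ⊎ p ∈ˡ cycle → p ∈ˡ cycle ⊎ p ∈ˡ children ts
    parent (inj₁ x) = inj₂ x
    parent (inj₂ x) = inj₁ x

  Full : Set
  Full = ∃ λ ts → Σ (State ts) λ S → ∀ v → v ∈ˡ State.verts S

  -- The fuel bounds the number of vertices still missing. A leaving edge after it has run out would
  -- give a duplicate-free list longer than the list of all vertices.
  spanning : ∀ fuel {ts} (S : State ts) → length (elements V-finite) ℕ.≤ fuel ℕ.+ length (State.verts S) → Full
  spanning fuel {ts} S bound = go (search E-finite leaving?)
    where
    open State S
    _∈?ⱽ_ : ∀ v xs → Dec (v ∈ˡ xs)
    _∈?ⱽ_ = _∈?ˡ_ _≟ⱽ_ {R = λ _ _ → ⊤}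
    Leaving : E → Set
    Leaving e = (src e ∈ˡ verts × ¬ tgt e ∈ˡ verts) ⊎ (tgt e ∈ˡ verts × ¬ src e ∈ˡ verts)
    leaving? : ∀ e → Dec (Leaving e)
    leaving? e = ((src e ∈?ⱽ verts) ×-dec ¬? (tgt e ∈?ⱽ verts)) ⊎-dec ((tgt e ∈?ⱽ verts) ×-dec ¬? (src e ∈?ⱽ verts))
    next-state : ∀ fuel {v p e} → length (elements V-finite) ℕ.≤ fuel ℕ.+ length verts → v ∈ e → p ∈ e → v ∉ˡ verts → p ∈ˡ verts → Full
    next-state (suc fuel) bound v∈ p∈ v∉ p∈V = spanning fuel (extend S v∈ p∈ v∉ p∈V) (subst (length (elements V-finite) ℕ.≤_) (sym (ℕ.+-suc fuel (length verts))) bound)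
    next-state zero bound v∈ p∈ v∉ p∈V = contradiction
      (ℕ.≤-trans (unique-length (State.verts-unique (extend S v∈ p∈ v∉ p∈V)) (elements-enumerates V-finite)) bound) ℕ.1+n≰n
    go : Dec (∃ Leaving) → Full
    go (yes (e , inj₁ (s∈ , t∉))) = next-state fuel bound (tgt∈ e) (src∈ e) t∉ s∈
    go (yes (e , inj₂ (t∈ , s∉))) = next-state fuel bound (src∈ e) (tgt∈ e) s∉ t∈
    go (no closed) = ts , S , λ v → walk (connected (c zero) v) (∈ˡ.∈-++⁺ʳ (children ts) (here refl))
      where
      inside : ∀ {e u v} → u ∈ e → v ∈ e → u ∈ˡ verts → v ∈ˡ verts
      inside {e} {u} {v} u∈e v∈e u∈ with Equivalence.to (ends e u) u∈e | Equivalence.to (ends e v) v∈e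
      ... | inj₁ refl | inj₁ refl = u∈
      ... | inj₂ refl | inj₂ refl = u∈
      ... | inj₁ refl | inj₂ refl with tgt e ∈?ⱽ verts
      ...   | yes t∈ = t∈
      ...   | no  t∉ = contradiction (e , inj₁ (u∈ , t∉)) closed
      inside {e} {u} {v} u∈e v∈e u∈ | inj₂ refl | inj₁ refl with src e ∈?ⱽ verts
      ...   | yes s∈ = s∈
      ...   | no  s∉ = contradiction (e , inj₂ (u∈ , s∉)) closed
      walk : ∀ {u v} → Star (λ u v → ∃ λ e → u ∈ e × v ∈ e) u v → u ∈ˡ verts → v ∈ˡ verts
      walk stop u∈ = u∈
      walk ((e , p , q) ◅ rs) u∈ = walk rs (inside p q u∈)

-- What the extremal argument has to know of the graph. The field `sum` is restricted to symmetric φ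
-- because the order of `src` and `tgt` need not be that of the listed pair.
record Normal (G : Hypergraph) (G-ends : Ends G) (l : ℕ) : Set where
  open Hypergraph G
  open Ends G-ends
  open Listed G G-ends
  field
    c₀       : V
    cs₀      : List V
    ts       : List (V × V)
    es       : List E
    cycle-l  : suc (length cs₀) ≡ l
    forest   : Forest (c₀ ∷ cs₀) ts
    uniq     : Unique (c₀ ∷ cs₀ ++ children ts)
    full     : ∀ v → v ∈ˡ c₀ ∷ cs₀ ++ children ts
    ES       : Enumerates es
    es-l     : length es ≡ length ts ℕ.+ l
    sum      : ∀ φ → Symmetric φ → (∑[ e ∈ es ] φ (src e) (tgt e)) ≡ val φ (pathE c₀ cs₀ c₀ ++ ts)
    joined   : All Joined (pathE c₀ cs₀ c₀ ++ ts)
    covers   : ∀ e → Covers (pathE c₀ cs₀ c₀ ++ ts) e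

module _ (G : Hypergraph) (G-ends : Ends G) (connected : ∀ u v → Star (λ u v → ∃ λ e → Hypergraph._∈_ G u e × Hypergraph._∈_ G v e) u v)
  (l₁ : ℕ) (3≤l : 3 ℕ.≤ suc l₁) (c : Fin (suc l₁) → Hypergraph.V G) (c-injective : ∀ {i j} → c i ≡ c j → i ≡ j)
  (ce : Fin (suc l₁) → Hypergraph.E G) (joins : ∀ i → Hypergraph._∈_ G (c i) (ce i) × Hypergraph._∈_ G (c (next i)) (ce i))
  (m : ℕ) (only : ∀ {l′} (D : LooseCycleIn (power m G) l′) i → LooseCycleIn.edge D i ∈ˡ List.tabulate ce) where

  open Hypergraph G
  open Ends G-ends
  open Listed G G-ends
  open Spanning G G-ends connected l₁ 3≤l c c-injective ce joins

  private
    InTree-sym : ∀ {es u v} → InTree es u v → InTree es v u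
    InTree-sym (e , e∈ , p , q) = e , e∈ , q , p

    Star-sym : ∀ {es u v} → Star (InTree es) u v → Star (InTree es) v u
    Star-sym stop     = stop
    Star-sym (r ◅ rs) = Star-sym rs ◅◅ (InTree-sym r ◅ stop)

  -- An edge outside the spanning structure would close a path into a second cycle.
  module _ {ts} (S : State ts) (full : ∀ v → v ∈ˡ State.verts S) where
    open State S

    all-edges : ∀ e → e ∈ˡ es
    all-edges e with _∈?ˡ_ (decEq E-finite) {R = λ _ _ → ⊤} e es
    ... | yes e∈ = e∈
    ... | no  e∉ = from-path (loop-erase _≟ⱽ_ (reach (full (src e)) ◅◅ Star-sym (reach (full (tgt e)))))
      where
      from-path : (∃ λ ws → SimplePath (InTree es) (src e) ws (tgt e) × Unique (src e ∷ ws)) → e ∈ˡ es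
      from-path ([] , path , _) = contradiction (proj₂ (path-lookup path)) (src≢tgt e)
      from-path (y ∷ [] , (f , f∈ , p , q) ∷ [] , _) = subst (_∈ˡ es) (edge-unique (src≢tgt e) p q (src∈ e) (tgt∈ e)) f∈
      -- With at least two path edges, the path and e form a loose cycle of the power hypergraph
      -- whose closing edge is e. Uniqueness makes e an edge of the given cycle.
      from-path (ws@(_ ∷ _ ∷ ws′) , path , u) = ∈ˡ.∈-++⁺ʳ tree-es (subst (_∈ˡ List.tabulate ce) last-edge (only D (Fin.fromℕ (length ws))))
        where
        v : Fin (suc (length ws)) → V
        v = List.lookup (src e ∷ ws)
        Edge : Fin (suc (length ws)) → Set
        Edge i = ∃ λ f → v i ∈ f × v (next i) ∈ f
        closing : Edge (Fin.fromℕ (length ws))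
        closing = e , subst (_∈ e) (sym (proj₂ (path-lookup path))) (tgt∈ e) , subst (λ i → v i ∈ e) (sym (next-last (length ws))) (src∈ e)
        edge-at : ∀ i → i ≡ Fin.fromℕ (length ws) ⊎ (∃ λ j → i ≡ Fin.inject₁ j) → Edge i
        edge-at i (inj₁ refl) = closing
        edge-at i (inj₂ (j , refl)) with proj₁ (path-lookup path) j
        ... | f , _ , p , q = f , p , subst (λ i → v i ∈ f) (sym (next-inject₁ j)) q
        D : LooseCycleIn (power m G) (suc (length ws))
        D = power-cycle G G-ends m (s≤s (s≤s (s≤s z≤n))) v (lookup-injective u) (λ i → proj₁ (edge-at i (last-or-inject i))) (λ i → proj₂ (edge-at i (last-or-inject i)))
        last-edge : proj₁ (edge-at (Fin.fromℕ (length ws)) (last-or-inject (Fin.fromℕ (length ws)))) ≡ e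
        last-edge = at (last-or-inject (Fin.fromℕ (length ws)))
          where
          at : ∀ d → proj₁ (edge-at (Fin.fromℕ (length ws)) d) ≡ e
          at (inj₁ refl)     = refl
          at (inj₂ (j , eq)) = contradiction eq Fin.fromℕ≢inject₁

  module _ {φ : V → V → ℚ} (φ-sym : Symmetric φ) where

    joined-val : ∀ {e u v} → u ≢ v → u ∈ e → v ∈ e → φ (src e) (tgt e) ≡ φ u v
    joined-val {e} {u} {v} u≢v u∈ v∈ with Equivalence.to (ends e u) u∈ | Equivalence.to (ends e v) v∈
    ... | inj₁ refl | inj₂ refl = refl
    ... | inj₂ refl | inj₁ refl = φ-sym (src e) (tgt e)
    ... | inj₁ refl | inj₁ refl = contradiction refl u≢v
    ... | inj₂ refl | inj₂ refl = contradiction refl u≢v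

    tree-val : ∀ {ts es} → TreeEdges ts es → (∑[ e ∈ es ] φ (src e) (tgt e)) ≡ val φ ts
    tree-val []                     = refl
    tree-val ((v∈ , p∈ , v≢p) ∷ T) = cong₂ _+_ (joined-val v≢p v∈ p∈) (tree-val T)

    tabulate-val : ∀ {n} (ce : Fin n → E) (u v : Fin n → V) → (∀ i → u i ≢ v i × u i ∈ ce i × v i ∈ ce i) →
      (∑[ e ∈ List.tabulate ce ] φ (src e) (tgt e)) ≡ val φ (List.tabulate (λ i → u i , v i))
    tabulate-val {zero}  ce u v h = refl
    tabulate-val {suc n} ce u v h = cong₂ _+_ (joined-val (proj₁ (h zero)) (proj₁ (proj₂ (h zero))) (proj₂ (proj₂ (h zero)))) (tabulate-val (ce ∘ suc) (u ∘ suc) (v ∘ suc) (h ∘ suc))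

  tree-joined : ∀ {ts es} → TreeEdges ts es → All Joined ts
  tree-joined []                       = []
  tree-joined (_∷_ {e = e} (p , q , _) T) = (e , p , q) ∷ tree-joined T

  pair-covers : ∀ {L e u v} → u ≢ v → u ∈ e → v ∈ e → (u , v) ∈ˡ L → Covers L e
  pair-covers {e = e} {u} {v} u≢v u∈ v∈ p with Equivalence.to (ends e u) u∈ | Equivalence.to (ends e v) v∈
  ... | inj₁ refl | inj₂ refl = inj₁ p
  ... | inj₂ refl | inj₁ refl = inj₂ p
  ... | inj₁ refl | inj₁ refl = contradiction refl u≢v
  ... | inj₂ refl | inj₂ refl = contradiction refl u≢v

  tree-covers : ∀ {ts es e} → TreeEdges ts es → e ∈ˡ es → ∃₂ λ u v → u ≢ v × u ∈ e × v ∈ e × (u , v) ∈ˡ ts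
  tree-covers ((v∈ , p∈ , v≢p) ∷ _) (here refl) = _ , _ , v≢p , v∈ , p∈ , here refl
  tree-covers (_ ∷ T) (there e∈) with tree-covers T e∈
  ... | u , v , u≢v , p , q , r = u , v , u≢v , p , q , there r

  tree-length : ∀ {ts es} → TreeEdges ts es → length es ≡ length ts
  tree-length []      = refl
  tree-length (_ ∷ T) = cong suc (tree-length T)

  normal : Normal G G-ends (suc l₁)
  normal with spanning (length (elements V-finite)) initial (ℕ.m≤m+n (length (elements V-finite)) _)
  ... | ts , S , full = record
    { c₀ = c zero ; cs₀ = cs₀ ; ts = ts ; es = es
    ; cycle-l = cong suc (List.length-tabulate (c ∘ suc))
    ; forest = forest
    ; uniq = Unique-↭ (↭.++-comm (children ts) cycle) verts-unique
    ; full = λ v → ↭.∈-resp-↭ (↭.++-comm (children ts) cycle) (full v)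
    ; ES = enumerates es-unique (all-edges S full)
    ; es-l = trans (List.length-++ tree-es) (cong₂ ℕ._+_ (tree-length tree) (List.length-tabulate ce))
    ; sum = λ φ φ-sym → trans (∑-++ tree-es (List.tabulate ce) (λ e → φ (src e) (tgt e)))
        (trans (cong₂ _+_ (tree-val φ-sym tree) (trans (tabulate-val φ-sym ce c (c ∘ next) cycle-edge) (cong (val φ) (tabulate-cycle c))))
          (trans (ℚ.+-comm (val φ ts) (val φ (pathE (c zero) cs₀ (c zero)))) (sym (val-++ φ (pathE (c zero) cs₀ (c zero)) ts))))
    ; joined = All.++⁺ (subst (All Joined) (tabulate-cycle c) (All.tabulate⁺ (λ i → ce i , joins i))) (tree-joined tree)
    ; covers = λ e → cover e (∈ˡ.∈-++⁻ tree-es (all-edges S full e)) }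
    where
    open State S
    cycle-edge : ∀ i → c i ≢ c (next i) × c i ∈ ce i × c (next i) ∈ ce i
    cycle-edge i = (λ eq → next≢ 3≤l i (sym (c-injective eq))) , joins i
    cover : ∀ e → e ∈ˡ tree-es ⊎ e ∈ˡ List.tabulate ce → Covers (pathE (c zero) cs₀ (c zero) ++ ts) e
    cover e (inj₁ e∈) with tree-covers tree e∈
    ... | u , v , u≢v , p , q , uv∈ = pair-covers u≢v p q (∈ˡ.∈-++⁺ʳ (pathE (c zero) cs₀ (c zero)) uv∈)
    cover e (inj₂ e∈) with ∈ˡ.∈-tabulate⁻ {f = ce} e∈
    ... | i , refl = pair-covers (proj₁ (cycle-edge i)) (proj₁ (joins i)) (proj₂ (joins i))
      (∈ˡ.∈-++⁺ˡ (subst ((c i , c (next i)) ∈ˡ_) (tabulate-cycle c) (∈ˡ.∈-tabulate⁺ {f = λ i → c i , c (next i)} i)))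

-- The extremal form

maximum : ∀ {xs : List A} (f : A → ℚ) x → (∀ y → y ∈ˡ x ∷ xs) → ∃ λ M → ∀ y → f y ℚ.≤ f M
maximum {xs = xs} f x full with go x xs
  where
  go : ∀ x xs → ∃ λ M → ∀ {y} → y ∈ˡ x ∷ xs → f y ℚ.≤ f M
  go x [] = x , λ { (here refl) → ℚ.≤-refl }
  go x (y ∷ ys) with go y ys
  ... | M , M≥ with ℚ.≤-total (f x) (f M)
  ...   | inj₁ x≤M = M , λ { (here refl) → x≤M ; (there p) → M≥ p }
  ...   | inj₂ M≤x = x , λ { (here refl) → ℚ.≤-refl ; (there p) → ℚ.≤-trans (M≥ p) M≤x }
... | M , M≥ = M , λ y → M≥ (full y)

module GraphForm (V : Set) (_≟_ : DecidableEquality V) (c₀ : V) (vs′ : List V) (uniq : Unique (c₀ ∷ vs′)) (full : ∀ v → v ∈ˡ c₀ ∷ vs′) (L : List (V × V)) where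

  vs : List V
  vs = c₀ ∷ vs′

  qAt : ℚ → (V → ℚ) → V → V → ℚ
  qAt κ w a b = qForm κ (w a) (w b)

  norm² : (V → ℚ) → ℚ
  norm² w = ∑[ v ∈ vs ] w v * w v

  NonNeg : (V → ℚ) → Set
  NonNeg w = ∀ v → 0ℚ ℚ.≤ w v

  Bound : ℚ → ℚ → List (V × V) → (V → ℚ) → Set
  Bound κ N L w = val (qAt κ w) L ℚ.≤ N * norm² w

  record Normalised (w : V → ℚ) : Set where
    constructor normalised
    field
      M   : V
      0≤w : NonNeg w
      M≡1 : w M ≡ 1ℚ
      w≤1 : ∀ v → w v ℚ.≤ 1ℚ

  -- The form is homogeneous, so it suffices to bound it on weights of maximum 1.
  normalise : ∀ {κ N} → (∀ w → Normalised w → Bound κ N L w) → ∀ w → NonNeg w → Bound κ N L w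
  normalise {κ} {N} bound w 0≤w = by-cases (maximum w c₀ full)
    where
    by-cases : (∃ λ M → ∀ v → w v ℚ.≤ w M) → Bound κ N L w
    by-cases (M , w≤M) = go (0ℚ ℚ.<? w M)
      where
      go : Dec (0ℚ ℚ.< w M) → Bound κ N L w
      go (yes 0<M) = subst₂ ℚ._≤_ form norm (*-monoˡ (0≤p² (w M)) (bound w′ (normalised M (λ v → 0≤w v ⟨*⟩ ℚ.<⇒≤ (0<inv (w M) 0<M)) (trans (ℚ.*-comm (w M) i) (inv-* (w M) 0<M))
          (λ v → subst (w v * i ℚ.≤_) (trans (ℚ.*-comm (w M) i) (inv-* (w M) 0<M)) (*-monoʳ (ℚ.<⇒≤ (0<inv (w M) 0<M)) (w≤M v))))))
        where
        i = inv (w M) 0<M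
        w′ : V → ℚ
        w′ v = w v * i
        back : ∀ v → w M * w′ v ≡ w v
        back v = trans (eq (w M) (w v) i) (trans (cong (_*_ (w v)) (inv-* (w M) 0<M)) (ℚ.*-identityʳ (w v)))
          where
          eq : ∀ m v i → m * (v * i) ≡ v * (i * m)
          eq = solve-∀ ℚring
        form : w M * w M * val (qAt κ w′) L ≡ val (qAt κ w) L
        form = trans (*-distribˡ-∑ (w M * w M) L (λ (a , b) → qAt κ w′ a b)) (∑-cong L (λ (a , b) → trans (eq (w M) κ (w′ a) (w′ b)) (cong₂ (qForm κ) (back a) (back b))))
          where
          eq : ∀ m k a b → m * m * (k * (a * a + b * b) + 2ℚ * (a * b)) ≡ k * (m * a * (m * a) + m * b * (m * b)) + 2ℚ * (m * a * (m * b))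
          eq = solve-∀ ℚring
        norm : w M * w M * (N * norm² w′) ≡ N * norm² w
        norm = trans (eq (w M * w M) N (norm² w′)) (cong (_*_ N) (trans (*-distribˡ-∑ (w M * w M) vs (λ v → w′ v * w′ v)) (∑-cong vs (λ v → trans (eq′ (w M) (w′ v)) (cong₂ _*_ (back v) (back v))))))
          where
          eq : ∀ m n x → m * (n * x) ≡ n * (m * x)
          eq = solve-∀ ℚring
          eq′ : ∀ m a → m * m * (a * a) ≡ m * a * (m * a)
          eq′ = solve-∀ ℚring
      go (no ¬0<M) = ℚ.≤-reflexive (trans (trans (∑-cong L (λ (a , b) → trans (cong₂ (qForm κ) (zero′ a) (zero′ b)) (eq κ))) (∑-zero L))
          (sym (trans (cong (_*_ N) (trans (∑-cong vs (λ v → trans (cong₂ _*_ (zero′ v) (zero′ v)) (ℚ.*-zeroˡ 0ℚ))) (∑-zero vs))) (ℚ.*-zeroʳ N))))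
        where
        zero′ : ∀ v → w v ≡ 0ℚ
        zero′ v = ℚ.≤-antisym (ℚ.≤-trans (w≤M v) (ℚ.≮⇒≥ ¬0<M)) (0≤w v)
        eq : ∀ k → k * (0ℚ * 0ℚ + 0ℚ * 0ℚ) + 2ℚ * (0ℚ * 0ℚ) ≡ 0ℚ
        eq = solve-∀ ℚring

  bump : (V → ℚ) → ℚ → V → V → ℚ
  bump w s v u = w u + s * 𝟙 (u ≟ v)

  norm²-bump : ∀ w s v → norm² (bump w s v) ≡ norm² w + (2ℚ * s * w v + s * s)
  norm²-bump w s v = trans (∑-cong vs (λ u → trans (eq (w u) s (𝟙 (u ≟ v))) (cong (λ i → w u * w u + (2ℚ * s * (𝟙 (u ≟ v) * w u) + s * s * i)) (idem (u ≟ v)))))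
    (trans (∑-distrib-+ vs (λ u → w u * w u) (λ u → 2ℚ * s * (𝟙 (u ≟ v) * w u) + s * s * (𝟙 (u ≟ v) * 1ℚ)))
      (cong (_+_ (norm² w)) (trans (∑-distrib-+ vs (λ u → 2ℚ * s * (𝟙 (u ≟ v) * w u)) (λ u → s * s * (𝟙 (u ≟ v) * 1ℚ)))
        (cong₂ _+_ (trans (sym (*-distribˡ-∑ (2ℚ * s) vs (λ u → 𝟙 (u ≟ v) * w u))) (cong (_*_ (2ℚ * s)) (∑-point (_≟ v) w uniq (full v) refl sym)))
          (trans (sym (*-distribˡ-∑ (s * s) vs (λ u → 𝟙 (u ≟ v) * 1ℚ))) (trans (cong (_*_ (s * s)) (∑-point (_≟ v) (const 1ℚ) uniq (full v) refl sym)) (ℚ.*-identityʳ (s * s))))))))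
    where
    idem : ∀ {P : Set} (d : Dec P) → 𝟙 d * 𝟙 d ≡ 𝟙 d * 1ℚ
    idem (yes _) = refl
    idem (no _)  = refl
    eq : ∀ w s i → (w + s * i) * (w + s * i) ≡ w * w + (2ℚ * s * (i * w) + s * s * (i * i))
    eq = solve-∀ ℚring

  val-bump : ∀ {κ} → 0ℚ ℚ.≤ κ → ∀ w s v L → val (qAt κ w) L + 2ℚ * s * val (qRow _≟_ κ w v) L ℚ.≤ val (qAt κ (bump w s v)) L
  val-bump {κ} 0≤κ w s v L = ℚ.≤-trans (ℚ.≤-reflexive (trans (cong (_+_ (val (qAt κ w) L)) (*-distribˡ-∑ (2ℚ * s) L (λ (a , b) → qRow _≟_ κ w v a b)))
      (sym (∑-distrib-+ L (λ (a , b) → qAt κ w a b) (λ (a , b) → 2ℚ * s * qRow _≟_ κ w v a b)))))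
    (∑-mono L (λ (a , b) → ≤-by (s * s * (κ * (𝟙 (a ≟ v) * 𝟙 (a ≟ v) + 𝟙 (b ≟ v) * 𝟙 (b ≟ v)) + 2ℚ * (𝟙 (a ≟ v) * 𝟙 (b ≟ v))))
      (eq κ s (w a) (w b) (𝟙 (a ≟ v)) (𝟙 (b ≟ v)))
      (0≤p² s ⟨*⟩ (0≤κ ⟨*⟩ (0≤p² (𝟙 (a ≟ v)) ⟨+⟩ 0≤p² (𝟙 (b ≟ v))) ⟨+⟩ 0≤2 ⟨*⟩ (0≤𝟙 (a ≟ v) ⟨*⟩ 0≤𝟙 (b ≟ v))))))
    where
    eq : ∀ k s a b i j → k * ((a + s * i) * (a + s * i) + (b + s * j) * (b + s * j)) + 2ℚ * ((a + s * i) * (b + s * j))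
      ≡ k * (a * a + b * b) + 2ℚ * (a * b) + 2ℚ * s * (i * (k * a + b) + j * (k * b + a)) + s * s * (k * (i * i + j * j) + 2ℚ * (i * j))
    eq = solve-∀ ℚring

  slack : ℚ → ℚ → List (V × V) → (V → ℚ) → ℚ
  slack κ N L w = N * norm² w - val (qAt κ w) L

  -- The first-order condition at a near maximiser. If the bound also holds after adding s at v, the
  -- slack and s² limit how far w is from the eigenvalue equation at v; s may have either sign.
  slack-bump : ∀ {κ N} → 0ℚ ℚ.≤ κ → ∀ w s v L → Bound κ N L (bump w s v) →
    2ℚ * s * (val (qRow _≟_ κ w v) L - N * w v) ℚ.≤ slack κ N L w + N * (s * s)
  slack-bump {κ} {N} 0≤κ w s v L bound = ≤-by (N * norm² (bump w s v) - val (qAt κ (bump w s v)) L + (val (qAt κ (bump w s v)) L - (val (qAt κ w) L + 2ℚ * s * val (qRow _≟_ κ w v) L)))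
    (trans (eq N (norm² w) s (w v) (val (qAt κ w) L) (val (qRow _≟_ κ w v) L) (val (qAt κ (bump w s v)) L))
      (cong (λ x → 2ℚ * s * (val (qRow _≟_ κ w v) L - N * w v) + (N * x - val (qAt κ (bump w s v)) L + (val (qAt κ (bump w s v)) L - (val (qAt κ w) L + 2ℚ * s * val (qRow _≟_ κ w v) L)))) (sym (norm²-bump w s v))))
    (≤⇒0≤- bound ⟨+⟩ ≤⇒0≤- (val-bump 0≤κ w s v L))
    where
    eq : ∀ n x s w f r g → n * x - f + n * (s * s) ≡ 2ℚ * s * (r - n * w) + (n * (x + (2ℚ * s * w + s * s)) - g + (g - (f + 2ℚ * s * r)))
    eq = solve-∀ ℚring

module Extremal (V : Set) (_≟_ : DecidableEquality V) (c₀ : V) (cs₀ : List V) (ts₀ : List (V × V))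
  (forest : Forest (c₀ ∷ cs₀) ts₀) (2≤ : 2 ℕ.≤ length cs₀) (uniq : Unique (c₀ ∷ cs₀ ++ children ts₀)) (full : ∀ v → v ∈ˡ c₀ ∷ cs₀ ++ children ts₀)
  (r b l′ : ℕ) (cs≡ : length cs₀ ≡ 2 ℕ.+ l′) (ts≡ : length ts₀ ≡ suc b) where

  open Classify V _≟_ c₀ cs₀ ts₀ forest 2≤ uniq full public
  open GraphForm V _≟_ c₀ (cs₀ ++ children ts₀) uniq full L₀ public

  near : ∀ {M} → Class M → Bool
  near (isX _ _ _ _ _ _ _ _ pos) = near? pos
  near _ = false

  record CentreOff (M : V) : Set where
    constructor centre-off
    field
      {u c d} : V
      {cs os} : List V
      val≡    : ∀ φ → Symmetric φ → val φ L₀ ≡ val φ (pathE u (c ∷ d ∷ cs) u) + (φ u M + (∑[ o ∈ os ] φ o M))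
      verts↭  : M ∷ u ∷ (c ∷ d ∷ cs) ++ os ↭ vs₀
      leaves≡ : length os ≡ b

  UnicyclicStar : Set
  UnicyclicStar = ∃ λ M → ∃₂ λ cs os → L₀ ↭ pathE M cs M ++ map (_, M) os × M ∷ cs ++ os ↭ vs₀ × length cs ≡ length cs₀

  length-vs₀ : length vs₀ ≡ 3 ℕ.+ l′ ℕ.+ suc b
  length-vs₀ = cong suc (trans (List.length-++ cs₀) (cong₂ ℕ._+_ cs≡ (trans (List.length-map proj₁ ts₀) ts≡)))

  module Progressing (κ : ℚ) (0≤κ : 0ℚ ℚ.≤ κ) (κ≤1 : κ ℚ.≤ 1ℚ) (w : V → ℚ) (W : Normalised w)
    (δ δ₁ : ℚ) (0≤δ : 0ℚ ℚ.≤ δ) (δ≤δ₁ : δ ℚ.≤ δ₁) (δ₁≤w : ∀ v → δ₁ ℚ.≤ w v) where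
    open Normalised W
    open Moves V _≟_ κ 0≤κ κ≤1 w 0≤w w≤1 M (λ v → subst (w v ℚ.≤_) (sym M≡1) (w≤1 v)) δ δ₁ 0≤δ δ≤δ₁ δ₁≤w public

    Goal : Bool → Set
    Goal true  = Towards L₀ (suc l′) vs₀ 0ℚ
    Goal false = Improved L₀ (suc l′) vs₀

    pred-length : ∀ (cs : List V) → length cs ≡ length cs₀ → ℕ.pred (length cs) ≡ suc l′
    pred-length cs eq = cong ℕ.pred (trans eq cs≡)

    unique-X : ∀ cs os t → vertsX cs os t ↭ vs₀ → Unique (vertsX cs os t)
    unique-X cs os t p = Unique-↭ (↭-sym p) uniq

    progress : (C : Class M) → UnicyclicStar ⊎ CentreOff M ⊎ Goal (near C)
    progress (isU₁ cs os L↭ vs↭ len) = inj₁ (M , cs , os , L↭ , vs↭ , len)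
    progress (isO u cs os val≡ vs↭ len) = inj₂ (inj₁ (on cs val≡ vs↭ (trans len cs≡)))
      where
      on : ∀ cs → (∀ φ → Symmetric φ → val φ L₀ ≡ val φ (pathE u cs u) + (φ u M + (∑[ o ∈ os ] φ o M))) → M ∷ u ∷ cs ++ os ↭ vs₀ → length cs ≡ 2 ℕ.+ l′ → CentreOff M
      on (c ∷ d ∷ cs) val≡ vs↭ len = centre-off {u = u} {c} {d} {cs} {os} val≡ vs↭ (ℕ.+-cancelˡ-≡ (length cs) (length os) b (ℕ.suc-injective (ℕ.suc-injective (ℕ.suc-injective (ℕ.suc-injective
        (trans (cong (4 ℕ.+_) (sym (List.length-++ cs))) (trans (↭.↭-length vs↭) (trans length-vs₀ (trans (cong (3 ℕ.+_) (ℕ.+-suc l′ b)) (cong (λ n → 4 ℕ.+ (n ℕ.+ b)) (sym (ℕ.suc-injective (ℕ.suc-injective len)))))))))))))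
    progress (isX cs os t s L↭ vs↭ len s≢t pos) = inj₂ (inj₂ (go (near? pos) refl))
      where
      same : ∀ φ → Symmetric φ → val φ (edgesX M cs os t s) ≡ val φ L₀
      same φ _ = sym (val-↭ φ L↭)
      go : ∀ n → near? pos ≡ n → Goal (near? pos)
      go n eq = subst Goal (sym eq) (at n eq)
        where
        at : ∀ n → near? pos ≡ n → Goal n
        at false far = subst (λ n → Improved L₀ n vs₀) (pred-length cs len) (transport-Improved {edgesX M cs os t s} {L₀} same vs↭ (step₂-far {cs} {os} t s≢t (unique-X cs os t vs↭) pos far))
        at true close = subst (λ n → Towards L₀ n vs₀ 0ℚ) (pred-length cs len) (transport {edgesX M cs os t s} {L₀} same vs↭ (step₂-near {cs} {os} t pos close))
    progress (moreOn cs ts t s L≡ vs↭ len s≢t pos more) = inj₂ (inj₂ (subst (λ n → Improved L₀ n vs₀) (pred-length cs len)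
      (transport-Improved {L₀} {L₀} (λ _ _ → refl) vs↭ (extend-Progress {L₀} {edgesX M cs (children ts) t s} (proj₁ gain) (proj₂ gain) (step₂ {cs} {children ts} t s≢t (unique-X cs (children ts) t vs↭) pos)))))
      where
      children≢M : All (λ (v , _) → v ≢ M) ts
      children≢M with unique-X cs (children ts) t vs↭
      ... | M≢ ∷ _ = All.tabulate (λ {e} e∈ → ∈≢ M≢ (∈ˡ.∈-++⁺ʳ cs (∈ˡ.∈-++⁺ˡ (∈ˡ.∈-map⁺ proj₁ e∈))))
      gain = gain-on-cycle {L₀} {cs} {ts} {t} {s} L≡ children≢M more
    progress (moreOff u c cs ts t s L≡ u≢M vs↭ len s≢t pos) = inj₂ (inj₂ (subst (λ n → Improved L₀ n vs₀) (pred-length (c ∷ cs) len)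
      (transport-Improved {L₀} {L₀} (λ _ _ → refl) vs↭ (extend-Progress {L₀} {edgesX M (c ∷ cs) (children ts) t s} (proj₁ gain) (proj₂ gain) (step₂ {c ∷ cs} {children ts} t s≢t (unique-X (c ∷ cs) (children ts) t vs↭) pos)))))
      where
      rim≢M : All (_≢ M) (c ∷ cs)
      rim≢M with unique-X (c ∷ cs) (children ts) t vs↭
      ... | M≢ ∷ _ = All.tabulate (λ x∈ → ∈≢ M≢ (∈ˡ.∈-++⁺ˡ x∈))
      gain = gain-off-cycle {L₀} {u} {c} {cs} {ts} {t} {s} L≡ u≢M rim≢M

  norm²-↭ : ∀ {xs} w → xs ↭ vs₀ → (∑[ v ∈ xs ] w v * w v) ≡ norm² w
  norm²-↭ w p = ∑-↭ (λ v → w v * w v) p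

  leaves-length : ∀ (U : Labelled V) → vertsU U ↭ vs₀ → length (Labelled.rim U) ≡ suc l′ → length (Labelled.leaves U) ≡ b
  leaves-length (labelled M c cs os t) vs↭ rim≡ = ℕ.+-cancelˡ-≡ (suc l′) (length os) b (ℕ.suc-injective (ℕ.suc-injective (ℕ.suc-injective
    (trans (sym (trans (cong (λ n → 2 ℕ.+ n) (trans (List.length-++ cs) (cong₂ ℕ._+_ rim≡ (trans (List.length-++ os) (ℕ.+-comm (length os) 1)))))
        (cong (λ n → 3 ℕ.+ n) (ℕ.+-suc l′ (length os)))))
      (trans (↭.↭-length vs↭) (trans length-vs₀ (cong (λ n → 3 ℕ.+ n) (ℕ.+-suc l′ b))))))))

  centre-off-bound : ∀ {M} → CentreOff M → ∀ κ ν p → 0ℚ ℚ.≤ κ → κ ℚ.≤ 1ℚ → (0<p : 0ℚ ℚ.< p) → ν * p ≡ 1ℚ → 9ℚ/2 ℚ.≤ ν →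
    (fromℕ′ b + 3ℚ * ℚ.½) * (κ + p) ℚ.≤ ν + κ → ∀ w → NonNeg w → Bound κ (ν + κ) L₀ w
  centre-off-bound {M} (centre-off {u} {c} {d} {cs} {os} val≡ vs↭ leaves≡) κ ν p 0≤κ κ≤1 0<p νp≡1 9/2≤ν h w 0≤w =
    subst₂ ℚ._≤_ (sym (val≡ (qAt κ w) (Weights.q-sym V _≟_ κ 0≤κ w 0≤w))) (cong (_*_ (ν + κ)) norm)
      (Supersolution.O-≤ V _≟_ κ 0≤κ w 0≤w ν p 0<p νp≡1 9/2≤ν κ≤1 u c d cs M os (subst (λ n → (fromℕ′ n + 3ℚ * ℚ.½) * (κ + p) ℚ.≤ ν + κ) (sym leaves≡) h))
    where
    w² : V → ℚ
    w² v = w v * w v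
    norm : w² M + (w² u + (∑ (c ∷ d ∷ cs) w² + ∑ os w²)) ≡ norm² w
    norm = trans (cong (λ s → w² M + (w² u + s)) (sym (∑-++ (c ∷ d ∷ cs) os w²))) (norm²-↭ w vs↭)

  module AtPoint (P : Point) where
    open Profile r b l′ P using (ν; κ; p; 0<p; νp≡1; 0≤κ; κ≤1; defect; 5≤ν) public

    N : ℚ
    N = ν + κ

    U-bound : 0ℚ ℚ.≤ defect → ∀ (U : Labelled V) → vertsU U ↭ vs₀ → length (Labelled.rim U) ≡ suc l′ → ∀ w → NonNeg w → Bound κ N (edgesU U) w
    U-bound 0≤defect U vs↭ rim≡ w 0≤w = subst (λ s → val (qAt κ w) (edgesU U) ℚ.≤ N * s) (norm²-↭ w vs↭)
      (Profile.U-form r b l′ P V _≟_ w 0≤w 0≤defect U rim≡ (leaves-length U vs↭ rim≡))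

    -- Contrapositive of `defect-<0`: a non-negative defect forces ν + κ above (b + 2)(κ + p), half
    -- a leaf more than `O-≤` asks for.
    O-condition : 0ℚ ℚ.≤ defect → (fromℕ′ b + 3ℚ * ℚ.½) * (κ + p) ℚ.≤ ν + κ
    O-condition 0≤defect = by-cases (ν + κ ℚ.≤? (fromℕ′ b + 2ℚ) * (κ + p))
      where
      by-cases : Dec (ν + κ ℚ.≤ (fromℕ′ b + 2ℚ) * (κ + p)) → (fromℕ′ b + 3ℚ * ℚ.½) * (κ + p) ℚ.≤ ν + κ
      by-cases (yes h) = contradiction (ℚ.<-≤-trans (Profile.defect-<0 r b l′ P h) 0≤defect) (ℚ.<-irrefl refl)
      by-cases (no ¬h) = ℚ.≤-trans (≤-by (ℚ.½ * (κ + p)) (eq (fromℕ′ b) (κ + p)) (ℚ.<⇒≤ 0<½ ⟨*⟩ (0≤κ ⟨+⟩ ℚ.<⇒≤ 0<p))) (ℚ.<⇒≤ (ℚ.≰⇒> ¬h))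
        where
        eq : ∀ b x → (b + 2ℚ) * x ≡ (b + 3ℚ * ℚ.½) * x + ℚ.½ * x
        eq = solve-∀ ℚring

    module _ (no-star : ¬ UnicyclicStar) (0≤defect : 0ℚ ℚ.≤ defect) where

      -- With zero tolerances the moves already show that the form of the graph is dominated.
      form-bound : ∀ w → NonNeg w → Bound κ N L₀ w
      form-bound = normalise {κ} {N} by-class
        where
        by-class : ∀ w → Normalised w → Bound κ N L₀ w
        by-class w W = conclude (near (classify M)) (progress (classify M))
          where
          open Normalised W
          open Progressing κ 0≤κ κ≤1 w W 0ℚ 0ℚ ℚ.≤-refl ℚ.≤-refl 0≤w
          towards-bound : ∀ {tol} → tol ≡ 0ℚ → Towards L₀ (suc l′) vs₀ tol → Bound κ N L₀ w
          towards-bound {tol} tol≡0 T = ℚ.≤-trans (subst (λ t → val (qAt κ w) L₀ ℚ.≤ val (qAt κ w) (edgesU target) + t) tol≡0 q-≤)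
            (ℚ.≤-trans (ℚ.≤-reflexive (ℚ.+-identityʳ (val (qAt κ w) (edgesU target)))) (U-bound 0≤defect target vertices rim-length w 0≤w))
            where open Towards T
          goal-bound : ∀ n → Goal n → Bound κ N L₀ w
          goal-bound true  T = towards-bound refl T
          goal-bound false (inj₁ (T , _)) = towards-bound refl T
          goal-bound false (inj₂ (T , _)) = towards-bound (ℚ.*-zeroʳ 4ℚ) T
          conclude : ∀ n → UnicyclicStar ⊎ CentreOff M ⊎ Goal n → Bound κ N L₀ w
          conclude n (inj₁ star)       = contradiction star no-star
          conclude n (inj₂ (inj₁ O))   = centre-off-bound O κ ν p 0≤κ κ≤1 0<p νp≡1 (ℚ.≤-trans (≤-by ℚ.½ refl (ℚ.<⇒≤ 0<½)) 5≤ν) (O-condition 0≤defect) w 0≤w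
          conclude n (inj₂ (inj₂ g))   = goal-bound n g

  Linked : V → V → Set
  Linked u v = (u , v) ∈ˡ L₀ ⊎ (v , u) ∈ˡ L₀

  -- Strict inequality through a gap that is independent of ν

  module Strict (no-star : ¬ UnicyclicStar) (linked : ∀ u v → Star Linked u v) where

    -- N̄ = b + 6 dominates N + 1 for every ν ≤ b + 4, as κ ≤ 1. All constants below are built from
    -- θ = 1/N̄ and therefore serve every point of the bisection.
    N̄ θ : ℚ
    N̄ = fromℕ′ b + 2ℚ * 3ℚ

    0<N̄ : 0ℚ ℚ.< N̄
    0<N̄ = ℚ.+-mono-≤-< (fromℕ′-0≤ b) (ℚ.positive⁻¹ (2ℚ * 3ℚ))

    θ = inv N̄ 0<N̄

    0<θ : 0ℚ ℚ.< θ
    0<θ = 0<inv N̄ 0<N̄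

    θ≤1 : θ ℚ.≤ 1ℚ
    θ≤1 = subst₂ ℚ._≤_ (ℚ.*-identityʳ θ) (inv-* N̄ 0<N̄) (*-monoˡ (ℚ.<⇒≤ 0<θ) (≤-by (fromℕ′ b + 5ℚ) (eq (fromℕ′ b)) (fromℕ′-0≤ b ⟨+⟩ ℚ.nonNegative⁻¹ 5ℚ)))
      where
      eq : ∀ b → b + 2ℚ * 3ℚ ≡ 1ℚ + (b + 5ℚ)
      eq = solve-∀ ℚring

    record Admissible (P : Point) : Set where
      field
        0≤defect : 0ℚ ℚ.≤ AtPoint.defect P
        ν≤       : Point.ν P ℚ.≤ fromℕ′ b + 4ℚ

      open AtPoint P public

      N+1≤N̄ : N + 1ℚ ℚ.≤ N̄
      N+1≤N̄ = ≤-by (fromℕ′ b + 4ℚ - ν + (1ℚ - κ)) (eq (fromℕ′ b) ν κ) (≤⇒0≤- ν≤ ⟨+⟩ ≤⇒0≤- κ≤1)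
        where
        eq : ∀ b n k → b + 2ℚ * 3ℚ ≡ n + k + 1ℚ + (b + 4ℚ - n + (1ℚ - k))
        eq = solve-∀ ℚring

      N≤N̄ : N ℚ.≤ N̄
      N≤N̄ = ℚ.≤-trans (≤-by 1ℚ refl 0≤1) N+1≤N̄

    row-linked : ∀ κ → 0ℚ ℚ.≤ κ → ∀ w → NonNeg w → ∀ {u v} → Linked u v → w u ℚ.≤ val (qRow _≟_ κ w v) L₀
    row-linked κ 0≤κ w 0≤w {u} {v} link = [ (λ uv∈ → ℚ.≤-trans end (∑-∈ {f = λ (a , b) → row v a b} (λ (a , b) → 0≤row v a b) uv∈))
      , (λ vu∈ → ℚ.≤-trans end (ℚ.≤-trans (ℚ.≤-reflexive (row-sym v u v)) (∑-∈ {f = λ (a , b) → row v a b} (λ (a , b) → 0≤row v a b) vu∈))) ]′ link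
      where
      open Weights V _≟_ κ 0≤κ w 0≤w
      end : w u ℚ.≤ row v u v
      end = ≤-by (𝟙 (u ≟ v) * (κ * w u + w v) + κ * w v) (trans (cong (λ i → 𝟙 (u ≟ v) * (κ * w u + w v) + i * (κ * w v + w u)) (𝟙-yes (v ≟ v) refl))
          (eq (𝟙 (u ≟ v) * (κ * w u + w v)) (κ * w v) (w u)))
        (0≤𝟙 (u ≟ v) ⟨*⟩ 0≤half-row u v ⟨+⟩ 0≤κ ⟨*⟩ 0≤w v)
        where
        eq : ∀ a b c → a + 1ℚ * (b + c) ≡ c + (a + b)
        eq = solve-∀ ℚring

    bump-NonNeg : ∀ {w s} → NonNeg w → 0ℚ ℚ.≤ s → ∀ v → NonNeg (bump w s v)
    bump-NonNeg 0≤w 0≤s v u = 0≤w u ⟨+⟩ 0≤s ⟨*⟩ 0≤𝟙 (u ≟ v)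

    unbump-NonNeg : ∀ {w s} → NonNeg w → ∀ v → s ℚ.≤ w v → NonNeg (bump w (- s) v)
    unbump-NonNeg {w} {s} 0≤w v s≤wv u = by-cases (u ≟ v)
      where
      by-cases : (d : Dec (u ≡ v)) → 0ℚ ℚ.≤ w u + - s * 𝟙 d
      by-cases (yes refl) = subst (0ℚ ℚ.≤_) (eq (w u) s) (≤⇒0≤- s≤wv)
        where
        eq : ∀ w s → w - s ≡ w + - s * 1ℚ
        eq = solve-∀ ℚring
      by-cases (no _) = subst (0ℚ ℚ.≤_) (eq (w u) s) (0≤w u)
        where
        eq : ∀ w s → w ≡ w + - s * 0ℚ
        eq = solve-∀ ℚring

    -- A quantitative form of the positivity of Perron vectors: η is fixed before the point P and
    -- the weights w, and may depend on the maximal vertex M and on v only.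
    Positivity : V → V → ℚ → Set
    Positivity M v η = ∀ {P} (A : Admissible P) w (W : Normalised w) → Normalised.M W ≡ M → ∀ ε → 0ℚ ℚ.< ε → ε ℚ.≤ η →
      let open Admissible A in slack κ N L₀ w ℚ.≤ ε * ε → η ℚ.≤ w v

    Positive : V → V → Set
    Positive M v = ∃ λ η → 0ℚ ℚ.< η × η ℚ.≤ 1ℚ × Positivity M v η

    -- The first-order condition gives N w v + ε N̄ ≥ row of v, and the row is at least w u ≥ η.
    -- With η′ = η/(2 N̄) the error ε N̄ consumes at most half of η, so w v ≥ η′ remains.
    positive-step : ∀ {M u v} → Linked u v → Positive M u → Positive M v
    positive-step {M} {u} {v} link (η , 0<η , η≤1 , pos) = η′ , 0<η′ , ℚ.≤-trans η′≤η η≤1 , λ A w W M≡ ε 0<ε ε≤η′ slack≤ → bound′ A w W M≡ ε 0<ε ε≤η′ slack≤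
      where
      η′ = η * θ * ℚ.½
      0<η′ : 0ℚ ℚ.< η′
      0<η′ = ½ε>0 (0<η ⟨*⟩⁺ 0<θ)
      η′≤η : η′ ℚ.≤ η
      η′≤η = ≤-by (η * (1ℚ - θ) * ℚ.½ + η * ℚ.½) (eq η θ) (ℚ.<⇒≤ 0<η ⟨*⟩ ≤⇒0≤- θ≤1 ⟨*⟩ ℚ.<⇒≤ 0<½ ⟨+⟩ ℚ.<⇒≤ (½ε>0 0<η))
        where
        eq : ∀ h t → h ≡ h * t * ℚ.½ + (h * (1ℚ - t) * ℚ.½ + h * ℚ.½)
        eq = solve-∀ ℚring
      bound′ : Positivity M v η′
      bound′ {P} A w W M≡ ε 0<ε ε≤η′ slack≤ = *-cancelˡ 0<N̄ (≤-by ((w u - η) + (ρ - w u) + (N * w v + ε * N̄ - ρ) + ((N̄ - N) * w v) + N̄ * (η′ - ε))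
          (trans (eq (w v) η ε N N̄ (w u) ρ η′) (trans (cong (λ x → N̄ * η′ + (w u - η) + (ρ - w u) + (N * w v + ε * N̄ - ρ) + ((N̄ - N) * w v) + N̄ * (η′ - ε) + (η - 2ℚ * x)) N̄η′)
            (eq′ η (N̄ * η′) (w u - η) (ρ - w u) (N * w v + ε * N̄ - ρ) ((N̄ - N) * w v) (N̄ * (η′ - ε)))))
          (≤⇒0≤- (pos A w W M≡ ε 0<ε (ℚ.≤-trans ε≤η′ η′≤η) slack≤) ⟨+⟩ ≤⇒0≤- (row-linked κ 0≤κ w 0≤w link) ⟨+⟩ ≤⇒0≤- row≤ ⟨+⟩ ≤⇒0≤- N≤N̄ ⟨*⟩ 0≤w v ⟨+⟩ ℚ.<⇒≤ 0<N̄ ⟨*⟩ ≤⇒0≤- ε≤η′))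
        where
        open Admissible A
        open Normalised W
        ρ = val (qRow _≟_ κ w v) L₀
        row≤ : ρ ℚ.≤ N * w v + ε * N̄
        row≤ = *-cancelˡ (0<2 ⟨*⟩⁺ 0<ε) (≤-by ((slack κ N L₀ w + N * (ε * ε) - 2ℚ * ε * (ρ - N * w v)) + (ε * ε - slack κ N L₀ w) + ε * ε * (N̄ - (N + 1ℚ)) + ε * ε * N̄)
          (eq₁ ε ρ N N̄ (w v) (slack κ N L₀ w))
          (≤⇒0≤- (slack-bump {κ} {N} 0≤κ w ε v L₀ (form-bound no-star 0≤defect (bump w ε v) (bump-NonNeg 0≤w (ℚ.<⇒≤ 0<ε) v)))
            ⟨+⟩ ≤⇒0≤- slack≤ ⟨+⟩ 0≤p² ε ⟨*⟩ ≤⇒0≤- N+1≤N̄ ⟨+⟩ 0≤p² ε ⟨*⟩ ℚ.<⇒≤ 0<N̄))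
          where
          eq₁ : ∀ e r n m w s → 2ℚ * e * (n * w + e * m) ≡ 2ℚ * e * r + ((s + n * (e * e) - 2ℚ * e * (r - n * w)) + (e * e - s) + e * e * (m - (n + 1ℚ)) + e * e * m)
          eq₁ = solve-∀ ℚring
        N̄η′ : N̄ * η′ ≡ η * ℚ.½
        N̄η′ = trans (eq₂ N̄ η θ) (trans (cong (λ x → η * x * ℚ.½) (inv-* N̄ 0<N̄)) (cong (_* ℚ.½) (ℚ.*-identityʳ η)))
          where
          eq₂ : ∀ n h t → n * (h * t * ℚ.½) ≡ h * (t * n) * ℚ.½
          eq₂ = solve-∀ ℚring
        eq : ∀ w η ε n m u r h → m * w ≡ m * h + (u - η) + (r - u) + (n * w + ε * m - r) + ((m - n) * w) + m * (h - ε) + (η - 2ℚ * (m * h))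
        eq = solve-∀ ℚring
        eq′ : ∀ η x a b c d e → x + a + b + c + d + e + (η - 2ℚ * (η * ℚ.½)) ≡ x + (a + b + c + d + e)
        eq′ = solve-∀ ℚring

    positive : ∀ M v → Positive M v
    positive M v = walk (linked M v) (1ℚ , 0<1 , ℚ.≤-refl , λ A w W M≡ ε 0<ε ε≤ _ → ℚ.≤-reflexive (sym (trans (cong w (sym M≡)) (Normalised.M≡1 W))))
      where
      walk : ∀ {u v} → Star Linked u v → Positive M u → Positive M v
      walk stop pos = pos
      walk (r ◅ rs) pos = walk rs (positive-step r pos)

    -- For numbers in (0, 1] the product serves as a common positive lower bound.
    uniformly : ∀ (Q : V → ℚ → Set) → (∀ {v η η′} → η′ ℚ.≤ η → Q v η → Q v η′) → (∀ v → ∃ λ η → 0ℚ ℚ.< η × η ℚ.≤ 1ℚ × Q v η) →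
      ∃ λ η → 0ℚ ℚ.< η × η ℚ.≤ 1ℚ × (∀ v → Q v η)
    uniformly Q down each = collect vs₀ ⟨$⟩ full
      where
      All-Q : List V → Set
      All-Q xs = ∃ λ η → 0ℚ ℚ.< η × η ℚ.≤ 1ℚ × (∀ {v} → v ∈ˡ xs → Q v η)
      collect : ∀ xs → All-Q xs
      collect [] = 1ℚ , 0<1 , ℚ.≤-refl , λ ()
      collect (x ∷ xs) with each x | collect xs
      ... | η , 0<η , η≤1 , qx | ζ , 0<ζ , ζ≤1 , qxs = η * ζ , 0<η ⟨*⟩⁺ 0<ζ , ℚ.≤-trans ηζ≤ζ ζ≤1 , λ
          { (here refl) → down (subst (η * ζ ℚ.≤_) (ℚ.*-identityʳ η) (*-monoˡ (ℚ.<⇒≤ 0<η) ζ≤1)) qx ; (there v∈) → down ηζ≤ζ (qxs v∈) }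
        where
        ηζ≤ζ : η * ζ ℚ.≤ ζ
        ηζ≤ζ = subst (η * ζ ℚ.≤_) (ℚ.*-identityˡ ζ) (*-monoʳ (ℚ.<⇒≤ 0<ζ) η≤1)
      _⟨$⟩_ : All-Q vs₀ → (∀ v → v ∈ˡ vs₀) → ∃ λ η → 0ℚ ℚ.< η × η ℚ.≤ 1ℚ × (∀ v → Q v η)
      (η , 0<η , η≤1 , all) ⟨$⟩ full = η , 0<η , η≤1 , λ v → all (full v)

    Positivity-down : ∀ {M v η η′} → η′ ℚ.≤ η → Positivity M v η → Positivity M v η′
    Positivity-down η′≤η pos A w W M≡ ε 0<ε ε≤η′ slack≤ = ℚ.≤-trans η′≤η (pos A w W M≡ ε 0<ε (ℚ.≤-trans ε≤η′ η′≤η) slack≤)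

    uniform-positivity : ∃ λ η → 0ℚ ℚ.< η × η ℚ.≤ 1ℚ × (∀ M v → Positivity M v η)
    uniform-positivity = uniformly (λ M η → ∀ v → Positivity M v η) (λ η′≤η pos v → Positivity-down η′≤η (pos v))
      (λ M → uniformly (Positivity M) Positivity-down (positive M))

    private
      η = proj₁ uniform-positivity
      0<η = proj₁ (proj₂ uniform-positivity)
      η≤1 = proj₁ (proj₂ (proj₂ uniform-positivity))
      everywhere = proj₂ (proj₂ (proj₂ uniform-positivity))

      16ℚ⁻¹ : ℚ
      16ℚ⁻¹ = + 1 ℚ./ 16

      -- An inexact move yields η² θ/2 = 8 δ and may lose 4 δ. The factor 1/16 thus leaves 4 δ for
      -- twice the slack.
      δ : ℚ
      δ = η * η * θ * 16ℚ⁻¹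

      0<δ : 0ℚ ℚ.< δ
      0<δ = 0<η ⟨*⟩⁺ 0<η ⟨*⟩⁺ 0<θ ⟨*⟩⁺ ℚ.positive⁻¹ 16ℚ⁻¹

      ≤1* : ∀ {x y} → 0ℚ ℚ.≤ x → y ℚ.≤ 1ℚ → x * y ℚ.≤ x
      ≤1* {x} {y} 0≤x y≤1 = subst (x * y ℚ.≤_) (ℚ.*-identityʳ x) (*-monoˡ 0≤x y≤1)

      δ≤η : δ ℚ.≤ η
      δ≤η = ℚ.≤-trans (≤1* (ℚ.<⇒≤ (0<η ⟨*⟩⁺ 0<η ⟨*⟩⁺ 0<θ)) (≤-by (+ 15 ℚ./ 16) refl (ℚ.nonNegative⁻¹ (+ 15 ℚ./ 16))))
        (ℚ.≤-trans (≤1* (ℚ.<⇒≤ (0<η ⟨*⟩⁺ 0<η)) θ≤1) (≤1* (ℚ.<⇒≤ 0<η) η≤1))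

    -- The slack δ² θ/4 secured by an exact move with row gain δ. It lies below the 2 δ of an
    -- inexact move and below η².
    gap : ℚ
    gap = δ * δ * θ * (ℚ.½ * ℚ.½)

    0<gap : 0ℚ ℚ.< gap
    0<gap = 0<δ ⟨*⟩⁺ 0<δ ⟨*⟩⁺ 0<θ ⟨*⟩⁺ (0<½ ⟨*⟩⁺ 0<½)

    module _ {P : Point} (A : Admissible P) (w : V → ℚ) (W : Normalised w) where
      open Admissible A
      open Normalised W

      -- Compare the bound for the graph at w - s v with the bound for the target at w + s v.
      gain-slack : ∀ (U : Labelled V) → vertsU U ↭ vs₀ → length (Labelled.rim U) ≡ suc l′ → ∀ {tol g v} →
        val (qAt κ w) L₀ ℚ.≤ val (qAt κ w) (edgesU U) + tol → val (qRow _≟_ κ w v) L₀ + g ℚ.≤ val (qRow _≟_ κ w v) (edgesU U) →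
        0ℚ ℚ.< g → g ℚ.≤ w v → g * g * θ * ℚ.½ ℚ.≤ 2ℚ * slack κ N L₀ w + tol
      gain-slack U vs↭ rim≡ {tol} {g} {v} form≤ row+g≤ 0<g g≤wv = ≤-by
          ((Σ₀ + N * (- s * - s) - 2ℚ * - s * (ρ - N * w v)) + (slack κ N (edgesU U) w + N * (s * s) - 2ℚ * s * (ρ′ - N * w v))
            + 2ℚ * s * (ρ′ - (ρ + g)) + (val (qAt κ w) (edgesU U) + tol - val (qAt κ w) L₀) + 2ℚ * (N̄ - N) * (s * s))
          (trans (eq₁ (norm² w) N N̄ s ρ ρ′ (w v) g tol (val (qAt κ w) L₀) (val (qAt κ w) (edgesU U)))
            (cong (_+ ((Σ₀ + N * (- s * - s) - 2ℚ * - s * (ρ - N * w v)) + (slack κ N (edgesU U) w + N * (s * s) - 2ℚ * s * (ρ′ - N * w v))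
              + 2ℚ * s * (ρ′ - (ρ + g)) + (val (qAt κ w) (edgesU U) + tol - val (qAt κ w) L₀) + 2ℚ * (N̄ - N) * (s * s))) balance))
          (≤⇒0≤- (slack-bump {κ} {N} 0≤κ w (- s) v L₀ (form-bound no-star 0≤defect (bump w (- s) v) (unbump-NonNeg 0≤w v s≤wv)))
            ⟨+⟩ ≤⇒0≤- (slack-bump {κ} {N} 0≤κ w s v (edgesU U) (U-bound 0≤defect U vs↭ rim≡ (bump w s v) (bump-NonNeg 0≤w (ℚ.<⇒≤ 0<s) v)))
            ⟨+⟩ 0≤2 ⟨*⟩ ℚ.<⇒≤ 0<s ⟨*⟩ ≤⇒0≤- row+g≤ ⟨+⟩ ≤⇒0≤- form≤ ⟨+⟩ 0≤2 ⟨*⟩ ≤⇒0≤- N≤N̄ ⟨*⟩ 0≤p² s)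
        where
        -- The maximiser of 2 s g - 2 N̄ s²; the maximum is g² θ/2.
        s = g * θ * ℚ.½
        0<s : 0ℚ ℚ.< s
        0<s = ½ε>0 (0<g ⟨*⟩⁺ 0<θ)
        s≤wv : s ℚ.≤ w v
        s≤wv = ℚ.≤-trans (ℚ.≤-trans (ℚ.<⇒≤ (½<1 (0<g ⟨*⟩⁺ 0<θ))) (≤1* (ℚ.<⇒≤ 0<g) θ≤1)) g≤wv
        ρ = val (qRow _≟_ κ w v) L₀
        ρ′ = val (qRow _≟_ κ w v) (edgesU U)
        Σ₀ = slack κ N L₀ w
        balance : 2ℚ * s * g - 2ℚ * N̄ * (s * s) ≡ g * g * θ * ℚ.½
        balance = trans (eq₂ g θ N̄) (trans (cong (λ x → g * g * θ * (1ℚ - x * ℚ.½)) (inv-* N̄ 0<N̄)) (eq₃ (g * g * θ)))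
          where
          eq₂ : ∀ g t n → 2ℚ * (g * t * ℚ.½) * g - 2ℚ * n * ((g * t * ℚ.½) * (g * t * ℚ.½)) ≡ g * g * t * (1ℚ - t * n * ℚ.½)
          eq₂ = solve-∀ ℚring
          eq₃ : ∀ x → x * (1ℚ - 1ℚ * ℚ.½) ≡ x * ℚ.½
          eq₃ = solve-∀ ℚring
        eq₁ : ∀ X n m s r r′ w g t f f′ → 2ℚ * (n * X - f) + t ≡ (2ℚ * s * g - 2ℚ * m * (s * s))
          + ((n * X - f + n * (- s * - s) - 2ℚ * - s * (r - n * w)) + (n * X - f′ + n * (s * s) - 2ℚ * s * (r′ - n * w))
            + 2ℚ * s * (r′ - (r + g)) + (f′ + t - f) + 2ℚ * (m - n) * (s * s))
        eq₁ = solve-∀ ℚring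

      -- A slack above η² is already above the gap. Otherwise positivity applies with ε = η, so all
      -- weights are at least η and the moves gain. If M is off the cycle and all tree edges end at
      -- M there is no move, and the case is handed on.
      strict : near (classify M) ≡ false → CentreOff M ⊎ gap ℚ.≤ slack κ N L₀ w
      strict far = by-cases (slack κ N L₀ w ℚ.≤? η * η)
        where
        gap≤η² : gap ℚ.≤ η * η
        gap≤η² = ℚ.≤-trans (≤1* (ℚ.<⇒≤ (0<δ ⟨*⟩⁺ 0<δ ⟨*⟩⁺ 0<θ)) (≤-by (+ 3 ℚ./ 4) refl (ℚ.nonNegative⁻¹ (+ 3 ℚ./ 4)))) (ℚ.≤-trans (≤1* (ℚ.<⇒≤ (0<δ ⟨*⟩⁺ 0<δ)) θ≤1) (*-mono (ℚ.<⇒≤ 0<δ) (ℚ.<⇒≤ 0<η) δ≤η δ≤η))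
        by-cases : Dec (slack κ N L₀ w ℚ.≤ η * η) → CentreOff M ⊎ gap ℚ.≤ slack κ N L₀ w
        by-cases (no big) = inj₂ (ℚ.≤-trans gap≤η² (ℚ.<⇒≤ (ℚ.≰⇒> big)))
        by-cases (yes small) = conclude (subst (λ n → UnicyclicStar ⊎ CentreOff M ⊎ Goal n) far (progress (classify M)))
          where
          η≤w : ∀ v → η ℚ.≤ w v
          η≤w v = everywhere M v A w W refl η 0<η ℚ.≤-refl small
          open Progressing κ 0≤κ κ≤1 w W δ η (ℚ.<⇒≤ 0<δ) δ≤η η≤w using (Goal; progress; module Towards)
          conclude : UnicyclicStar ⊎ CentreOff M ⊎ Goal false → CentreOff M ⊎ gap ℚ.≤ slack κ N L₀ w
          conclude (inj₁ star) = contradiction star no-star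
          conclude (inj₂ (inj₁ O)) = inj₁ O
          conclude (inj₂ (inj₂ (inj₁ (T , v , g)))) = inj₂ (*-cancelˡ 0<2 (ℚ.≤-trans (ℚ.≤-reflexive (eq (δ * δ * θ)))
              (ℚ.≤-trans (gain-slack target vertices rim-length q-≤ g 0<δ (ℚ.≤-trans δ≤η (η≤w v))) (ℚ.≤-reflexive (ℚ.+-identityʳ (2ℚ * slack κ N L₀ w))))))
            where
            open Towards T
            eq : ∀ x → 2ℚ * (x * (ℚ.½ * ℚ.½)) ≡ x * ℚ.½
            eq = solve-∀ ℚring
          conclude (inj₂ (inj₂ (inj₂ (T , v , g)))) = inj₂ (ℚ.≤-trans gap≤2δ (*-cancelˡ 0<2 (≤-by (2ℚ * slack κ N L₀ w + 4ℚ * δ - η * η * θ * ℚ.½) (eq (η * η * θ) (slack κ N L₀ w))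
              (≤⇒0≤- (gain-slack target vertices rim-length q-≤ g 0<η (η≤w v))))))
            where
            open Towards T
            eq : ∀ x s → 2ℚ * s ≡ 2ℚ * (2ℚ * (x * 16ℚ⁻¹)) + (2ℚ * s + 4ℚ * (x * 16ℚ⁻¹) - x * ℚ.½)
            eq = solve-∀ ℚring
            gap≤2δ : gap ℚ.≤ 2ℚ * δ
            gap≤2δ = ℚ.≤-trans (≤1* (ℚ.<⇒≤ (0<δ ⟨*⟩⁺ 0<δ ⟨*⟩⁺ 0<θ)) (≤-by (+ 3 ℚ./ 4) refl (ℚ.nonNegative⁻¹ (+ 3 ℚ./ 4)))) (ℚ.≤-trans (≤1* (ℚ.<⇒≤ (0<δ ⟨*⟩⁺ 0<δ)) θ≤1)
              (ℚ.≤-trans (≤1* (ℚ.<⇒≤ 0<δ) (ℚ.≤-trans δ≤η η≤1)) (≤-by δ (eq′ δ) (ℚ.<⇒≤ 0<δ))))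
              where
              eq′ : ∀ d → 2ℚ * d ≡ d + d
              eq′ = solve-∀ ℚring

    private
      K : ℚ
      K = fromℕ′ (length vs₀) + 2ℚ * fromℕ′ (length L₀)

      0≤K : 0ℚ ℚ.≤ K
      0≤K = fromℕ′-0≤ (length vs₀) ⟨+⟩ 0≤2 ⟨*⟩ fromℕ′-0≤ (length L₀)

    -- Lowering ν by ζ raises κ by some Δ ≤ ζ. For weights up to 1 the right side drops by at most ζ
    -- times the number of vertices, and the form grows by at most 2 ζ times the number of edges.
    -- Together this is ζ K, which the gap absorbs.
    shifted-bound : (∀ M → near (classify M) ≡ false) → ∀ {P} → Admissible P → ∀ P′ ζ → 0ℚ ℚ.≤ ζ → Point.ν P ≡ Point.ν P′ + ζ → ζ * K ℚ.≤ gap →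
      let open AtPoint P′ in (fromℕ′ b + 3ℚ * ℚ.½) * (κ + p) ℚ.≤ ν + κ → ∀ w → NonNeg w → Bound κ N L₀ w
    shifted-bound far {P} A P′ ζ 0≤ζ ν≡ ζK≤gap O-cond = normalise {κ′} {N′} by-class
      where
      open Admissible A
      open AtPoint P′ using () renaming (κ to κ′; N to N′; ν to ν′; p to p′; 0≤κ to 0≤κ′; κ≤1 to κ′≤1; 0<p to 0<p′; νp≡1 to νp′≡1; 5≤ν to 5≤ν′)
      D : ℚ
      D = ν + (1ℚ + fromℕ′ r)
      0<D′ : 0ℚ ℚ.< D
      0<D′ = Coefficient.0<D r P
      Δ : ℚ
      Δ = κ′ - κ
      DΔ : D * Δ ≡ κ′ * ζ
      DΔ = trans (eq₁ κ′ κ D) (trans (cong₂ _-_ (trans (cong (λ x → κ′ * (x + (1ℚ + fromℕ′ r))) ν≡) (trans (eq₂ κ′ ν′ ζ (1ℚ + fromℕ′ r)) (cong (_+ κ′ * ζ) (Coefficient.κ-eq r P′)))) (Coefficient.κ-eq r P)) (eq₃ (fromℕ′ r) (κ′ * ζ)))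
        where
        eq₁ : ∀ a b d → d * (a - b) ≡ a * d - b * d
        eq₁ = solve-∀ ℚring
        eq₂ : ∀ k n z d → k * (n + z + d) ≡ k * (n + d) + k * z
        eq₂ = solve-∀ ℚring
        eq₃ : ∀ r x → r + x - r ≡ x
        eq₃ = solve-∀ ℚring
      0≤Δ : 0ℚ ℚ.≤ Δ
      0≤Δ = 0≤-cancel 0<D′ (subst (0ℚ ℚ.≤_) (sym DΔ) (0≤κ′ ⟨*⟩ 0≤ζ))
      Δ≤ζ : Δ ℚ.≤ ζ
      Δ≤ζ = *-cancelˡ 0<D′ (≤-by ((1ℚ - κ′) * ζ + (ν + fromℕ′ r) * ζ) (trans (eq₁ ν (fromℕ′ r) ζ κ′) (cong (_+ ((1ℚ - κ′) * ζ + (ν + fromℕ′ r) * ζ)) (sym DΔ)))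
          (≤⇒0≤- κ′≤1 ⟨*⟩ 0≤ζ ⟨+⟩ (ℚ.≤-trans (ℚ.nonNegative⁻¹ 5ℚ) 5≤ν ⟨+⟩ fromℕ′-0≤ r) ⟨*⟩ 0≤ζ))
        where
        eq₁ : ∀ n r z k → (n + (1ℚ + r)) * z ≡ k * z + ((1ℚ - k) * z + (n + r) * z)
        eq₁ = solve-∀ ℚring
      by-class : ∀ w → Normalised w → Bound κ′ N′ L₀ w
      by-class w W = [ (λ O → centre-off-bound O κ′ ν′ p′ 0≤κ′ κ′≤1 0<p′ νp′≡1 (ℚ.≤-trans (≤-by ℚ.½ refl (ℚ.<⇒≤ 0<½)) 5≤ν′) O-cond w 0≤w) , from-gap ]′ (strict A w W (far M))
        where
        open Normalised W
        squares : ℚ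
        squares = val (λ a b → w a * w a + w b * w b) L₀
        sq≤1 : ∀ v → w v * w v ℚ.≤ 1ℚ
        sq≤1 v = *-mono (0≤w v) 0≤1 (w≤1 v) (w≤1 v)
        norm²≤ : norm² w ℚ.≤ fromℕ′ (length vs₀)
        norm²≤ = ℚ.≤-trans (∑-mono vs₀ sq≤1) (ℚ.≤-reflexive (trans (∑-const vs₀ 1ℚ) (ℚ.*-identityʳ (fromℕ′ (length vs₀)))))
        squares≤ : squares ℚ.≤ 2ℚ * fromℕ′ (length L₀)
        squares≤ = ℚ.≤-trans (∑-mono L₀ (λ (a , b) → ℚ.+-mono-≤ (sq≤1 a) (sq≤1 b))) (ℚ.≤-reflexive (trans (∑-const L₀ 2ℚ) (ℚ.*-comm (fromℕ′ (length L₀)) 2ℚ)))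
        0≤squares : 0ℚ ℚ.≤ squares
        0≤squares = ∑-0≤ L₀ (λ (a , b) → 0≤p² (w a) ⟨+⟩ 0≤p² (w b))
        form′ : val (qAt κ′ w) L₀ ≡ val (qAt κ w) L₀ + Δ * squares
        form′ = trans (∑-cong L₀ (λ (a , b) → eq₁ κ′ κ (w a) (w b))) (trans (∑-distrib-+ L₀ (λ (a , b) → qAt κ w a b) (λ (a , b) → Δ * (w a * w a + w b * w b)))
          (cong (_+_ (val (qAt κ w) L₀)) (sym (*-distribˡ-∑ Δ L₀ (λ (a , b) → w a * w a + w b * w b)))))
          where
          eq₁ : ∀ k′ k a b → k′ * (a * a + b * b) + 2ℚ * (a * b) ≡ k * (a * a + b * b) + 2ℚ * (a * b) + (k′ - k) * (a * a + b * b)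
          eq₁ = solve-∀ ℚring
        from-gap : gap ℚ.≤ slack κ N L₀ w → Bound κ′ N′ L₀ w
        from-gap gap≤ = ≤-by ((slack κ N L₀ w - gap) + (gap - ζ * K) + ζ * (fromℕ′ (length vs₀) - norm² w) + ζ * (2ℚ * fromℕ′ (length L₀) - squares) + (ζ - Δ) * squares + Δ * norm² w)
          (trans (eq₁ ν′ ζ κ′ κ (norm² w) (val (qAt κ w) L₀) squares (fromℕ′ (length vs₀)) (fromℕ′ (length L₀)) gap)
            (cong₂ (λ n f → f + ((((n + κ) * norm² w - val (qAt κ w) L₀) - gap) + (gap - ζ * K) + ζ * (fromℕ′ (length vs₀) - norm² w) + ζ * (2ℚ * fromℕ′ (length L₀) - squares) + (ζ - Δ) * squares + Δ * norm² w)) (sym ν≡) (sym form′)))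
          (≤⇒0≤- gap≤ ⟨+⟩ ≤⇒0≤- ζK≤gap ⟨+⟩ 0≤ζ ⟨*⟩ ≤⇒0≤- norm²≤ ⟨+⟩ 0≤ζ ⟨*⟩ ≤⇒0≤- squares≤ ⟨+⟩ ≤⇒0≤- Δ≤ζ ⟨*⟩ 0≤squares ⟨+⟩ 0≤Δ ⟨*⟩ ∑-0≤ vs₀ (λ v → 0≤p² (w v)))
          where
          eq₁ : ∀ ν′ ζ κ′ κ X F S A B g → (ν′ + κ′) * X ≡ (F + (κ′ - κ) * S)
            + ((((ν′ + ζ + κ) * X - F) - g) + (g - ζ * (A + 2ℚ * B)) + ζ * (A - X) + ζ * (2ℚ * B - S) + (ζ - (κ′ - κ)) * S + (κ′ - κ) * X)
          eq₁ = solve-∀ ℚring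

    module _ (20≤ : 5ℚ * 4ℚ ℚ.≤ (fromℕ′ b - 5ℚ) * (1ℚ + fromℕ′ r)) where

      private
        n = fromℕ′ r
        b′ = fromℕ′ b
        -- A shift of at most y = 1/(4 b + 18) lowers ν (ν + n) by at most (1 + n)/2 when ν ≤ b + 4.
        -- That is the half leaf between the b + 2 which holds and the b + 3/2 which the
        -- supersolution requires.
        y⁻¹ : ℚ
        y⁻¹ = 2ℚ * (2ℚ * b′ + 5ℚ + 4ℚ)
        0<y⁻¹ : 0ℚ ℚ.< y⁻¹
        0<y⁻¹ = 0<2 ⟨*⟩⁺ ℚ.+-mono-≤-< (0≤2 ⟨*⟩ fromℕ′-0≤ b ⟨+⟩ ℚ.nonNegative⁻¹ 5ℚ) (ℚ.positive⁻¹ 4ℚ)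
        y = inv y⁻¹ 0<y⁻¹
        0<y : 0ℚ ℚ.< y
        0<y = 0<inv y⁻¹ 0<y⁻¹
        0<K+1 : 0ℚ ℚ.< K + 1ℚ
        0<K+1 = ℚ.+-mono-≤-< 0≤K 0<1
        x = gap * inv (K + 1ℚ) 0<K+1
        0<x : 0ℚ ℚ.< x
        0<x = 0<gap ⟨*⟩⁺ 0<inv (K + 1ℚ) 0<K+1
        inv≤1 : inv (K + 1ℚ) 0<K+1 ℚ.≤ 1ℚ
        inv≤1 = subst₂ ℚ._≤_ (ℚ.*-identityʳ (inv (K + 1ℚ) 0<K+1)) (inv-* (K + 1ℚ) 0<K+1) (*-monoˡ (ℚ.<⇒≤ (0<inv (K + 1ℚ) 0<K+1)) (≤-by K (ℚ.+-comm K 1ℚ) 0≤K))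
        δ≤1 : δ ℚ.≤ 1ℚ
        δ≤1 = ℚ.≤-trans δ≤η η≤1
        gap≤1 : gap ℚ.≤ 1ℚ
        gap≤1 = ℚ.≤-trans (≤1* (ℚ.<⇒≤ (0<δ ⟨*⟩⁺ 0<δ ⟨*⟩⁺ 0<θ)) (≤-by (+ 3 ℚ./ 4) refl (ℚ.nonNegative⁻¹ (+ 3 ℚ./ 4)))) (ℚ.≤-trans (≤1* (ℚ.<⇒≤ (0<δ ⟨*⟩⁺ 0<δ)) θ≤1) (ℚ.≤-trans (≤1* (ℚ.<⇒≤ 0<δ) δ≤1) δ≤1))

      -- The factor y protects the supersolution and the condition ν ≥ 5, the factor x makes ζ K ≤
      -- `gap`; neither exceeds 1.
      ζ : ℚ
      ζ = y * x

      0<ζ : 0ℚ ℚ.< ζ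
      0<ζ = 0<y ⟨*⟩⁺ 0<x

      private
        0≤ζ = ℚ.<⇒≤ 0<ζ
        ζ≤y : ζ ℚ.≤ y
        ζ≤y = ≤1* (ℚ.<⇒≤ 0<y) (ℚ.≤-trans (≤1* (ℚ.<⇒≤ 0<gap) inv≤1) gap≤1)
        y≤1/6 : y ℚ.≤ + 1 ℚ./ 6
        y≤1/6 = *-cancelˡ 0<y⁻¹ (subst (ℚ._≤ y⁻¹ * (+ 1 ℚ./ 6)) (sym (trans (ℚ.*-comm y⁻¹ y) (inv-* y⁻¹ 0<y⁻¹))) (≤-by ((+ 2 ℚ./ 3) * b′ + 2ℚ) (eq b′) (ℚ.nonNegative⁻¹ (+ 2 ℚ./ 3) ⟨*⟩ fromℕ′-0≤ b ⟨+⟩ 0≤2)))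
          where
          eq : ∀ b → 2ℚ * (2ℚ * b + 5ℚ + 4ℚ) * (+ 1 ℚ./ 6) ≡ 1ℚ + ((+ 2 ℚ./ 3) * b + 2ℚ)
          eq = solve-∀ ℚring
        ζK≤gap : ζ * K ℚ.≤ gap
        ζK≤gap = ≤-by (gap * (1ℚ - y) + y * gap * inv (K + 1ℚ) 0<K+1) (trans (eq₁ gap y) (trans (cong (λ i → y * (gap * i) + gap * (1ℚ - y)) (sym (inv-* (K + 1ℚ) 0<K+1))) (eq₂ y gap (inv (K + 1ℚ) 0<K+1) K)))
            (ℚ.<⇒≤ 0<gap ⟨*⟩ ≤⇒0≤- (ℚ.≤-trans y≤1/6 (≤-by (+ 5 ℚ./ 6) refl (ℚ.nonNegative⁻¹ (+ 5 ℚ./ 6)))) ⟨+⟩ ℚ.<⇒≤ (0<y ⟨*⟩⁺ 0<gap ⟨*⟩⁺ 0<inv (K + 1ℚ) 0<K+1))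
          where
          eq₁ : ∀ g y → g ≡ y * (g * 1ℚ) + g * (1ℚ - y)
          eq₁ = solve-∀ ℚring
          eq₂ : ∀ y g i k → y * (g * (i * (k + 1ℚ))) + g * (1ℚ - y) ≡ y * (g * i) * k + (g * (1ℚ - y) + y * g * i)
          eq₂ = solve-∀ ℚring

      module _ {P : Point} (A : Admissible P) where
        open Admissible A

        private
          beyond : (b′ + 2ℚ) * (1ℚ + n) ℚ.< ν * (ν + n)
          beyond = ℚ.≰⇒> (λ h → ℚ.<-irrefl refl (ℚ.<-≤-trans (Sign.negative-defect r b l′ P h) 0≤defect))

          -- Room to lower ν by 1/6 without falling below 5. It exists because (b + 2)(1 + n) ≥ 27 +
          -- 7 n, while (31/6)(31/6 + n) = 26 + 25/36 + (31/6) n.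
          31/6≤ν : + 31 ℚ./ 6 ℚ.≤ ν
          31/6≤ν = by-cases (+ 31 ℚ./ 6 ℚ.≤? ν)
            where
            c = + 31 ℚ./ 6
            eq : ∀ b n → (b + 2ℚ) * (1ℚ + n) ≡ (+ 31 ℚ./ 6) * (+ 31 ℚ./ 6 + n) + ((b - 5ℚ) * (1ℚ + n) - 5ℚ * 4ℚ + (+ 11 ℚ./ 36) + (+ 11 ℚ./ 6) * n)
            eq = solve-∀ ℚring
            by-cases : Dec (c ℚ.≤ ν) → c ℚ.≤ ν
            by-cases (yes h) = h
            by-cases (no ¬h) = contradiction (ℚ.<-≤-trans beyond (ℚ.≤-trans (*-mono (ℚ.≤-trans (ℚ.nonNegative⁻¹ 5ℚ) 5≤ν) (ℚ.nonNegative⁻¹ c ⟨+⟩ fromℕ′-0≤ r) ν≤c (ℚ.+-monoˡ-≤ n ν≤c))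
                (≤-by ((b′ - 5ℚ) * (1ℚ + n) - 5ℚ * 4ℚ + (+ 11 ℚ./ 36) + (+ 11 ℚ./ 6) * n) (eq b′ n)
                  (≤⇒0≤- 20≤ ⟨+⟩ ℚ.nonNegative⁻¹ (+ 11 ℚ./ 36) ⟨+⟩ ℚ.nonNegative⁻¹ (+ 11 ℚ./ 6) ⟨*⟩ fromℕ′-0≤ r)))) (ℚ.<-irrefl refl)
              where
              ν≤c = ℚ.<⇒≤ (ℚ.≰⇒> ¬h)

        shifted : Point
        shifted = point (ν - ζ) (≤-by ((ν - + 31 ℚ./ 6) + (+ 1 ℚ./ 6 - y) + (y - ζ)) (eq ν ζ y) (≤⇒0≤- 31/6≤ν ⟨+⟩ ≤⇒0≤- y≤1/6 ⟨+⟩ ≤⇒0≤- ζ≤y))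
          where
          eq : ∀ a z y → a - z ≡ 5ℚ + ((a - + 31 ℚ./ 6) + (+ 1 ℚ./ 6 - y) + (y - z))
          eq = solve-∀ ℚring

        shift-bound : (∀ M → near (classify M) ≡ false) → let open AtPoint shifted using () renaming (κ to κ′; N to N′) in ∀ w → NonNeg w → Bound κ′ N′ L₀ w
        shift-bound far = shifted-bound far A shifted ζ 0≤ζ (eq₀ ν ζ) ζK≤gap (Scale.≥-scale r shifted (b′ + 3ℚ * ℚ.½)
            (≤-by ((ν * (ν + n) - (b′ + 2ℚ) * (1ℚ + n)) + ζ * 2ℚ * (b′ + 4ℚ - ν) + ζ * ζ + (y - ζ) * (2ℚ * b′ + 2ℚ * 4ℚ + n) + y * (1ℚ + (2ℚ * b′ + 2ℚ * 4ℚ) * n))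
              (trans (eq₁ ν ζ n b′ y) (trans (cong (λ i → E + ((1ℚ - i) * ((1ℚ + n) * ℚ.½))) (inv-* y⁻¹ 0<y⁻¹)) (eq₂ E ((1ℚ + n) * ℚ.½))))
              (≤⇒0≤- (ℚ.<⇒≤ beyond) ⟨+⟩ 0≤ζ ⟨*⟩ 0≤2 ⟨*⟩ ≤⇒0≤- ν≤ ⟨+⟩ 0≤p² ζ ⟨+⟩ ≤⇒0≤- ζ≤y ⟨*⟩ (0≤2 ⟨*⟩ fromℕ′-0≤ b ⟨+⟩ 0≤2 ⟨*⟩ ℚ.nonNegative⁻¹ 4ℚ ⟨+⟩ fromℕ′-0≤ r)
                ⟨+⟩ ℚ.<⇒≤ 0<y ⟨*⟩ (0≤1 ⟨+⟩ (0≤2 ⟨*⟩ fromℕ′-0≤ b ⟨+⟩ 0≤2 ⟨*⟩ ℚ.nonNegative⁻¹ 4ℚ) ⟨*⟩ fromℕ′-0≤ r))))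
          where
          E = (b′ + 3ℚ * ℚ.½) * (1ℚ + n) + ((ν * (ν + n) - (b′ + 2ℚ) * (1ℚ + n)) + ζ * 2ℚ * (b′ + 4ℚ - ν) + ζ * ζ + (y - ζ) * (2ℚ * b′ + 2ℚ * 4ℚ + n) + y * (1ℚ + (2ℚ * b′ + 2ℚ * 4ℚ) * n))
          eq₀ : ∀ a z → a ≡ a - z + z
          eq₀ = solve-∀ ℚring
          eq₁ : ∀ ν ζ n b y → (ν - ζ) * (ν - ζ + n) ≡ (b + 3ℚ * ℚ.½) * (1ℚ + n)
            + ((ν * (ν + n) - (b + 2ℚ) * (1ℚ + n)) + ζ * 2ℚ * (b + 4ℚ - ν) + ζ * ζ + (y - ζ) * (2ℚ * b + 2ℚ * 4ℚ + n) + y * (1ℚ + (2ℚ * b + 2ℚ * 4ℚ) * n))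
            + (1ℚ - y * (2ℚ * (2ℚ * b + 5ℚ + 4ℚ))) * ((1ℚ + n) * ℚ.½)
          eq₁ = solve-∀ ℚring
          eq₂ : ∀ e x → e + (1ℚ - 1ℚ) * x ≡ e
          eq₂ = solve-∀ ℚring

-- The spectral radius of U₂

<⇒≤ : ∀ x y → x < y → x ≤ y
<⇒≤ x y (δ , 0<δ , x<y) (ε , 0<ε , y<x) = absurd (Eventually-map₂ _,_ x<y y<x)
  where
  eq : ∀ x y d e → 0ℚ ≡ e + (x - (y + e) + (y - (x + d)) + d)
  eq = solve-∀ ℚring
  absurd : Eventually (λ i → seq x i + δ ℚ.≤ seq y i × seq y i + ε ℚ.≤ seq x i) → ⊥
  absurd (N , h) = ℚ.<-irrefl refl (ℚ.<-≤-trans 0<ε (≤-by (seq x N - (seq y N + ε) + (seq y N - (seq x N + δ)) + δ) (eq (seq x N) (seq y N) δ ε)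
    (≤⇒0≤- (proj₂ (h N ℕ.≤-refl)) ⟨+⟩ ≤⇒0≤- (proj₁ (h N ℕ.≤-refl)) ⟨+⟩ ℚ.<⇒≤ 0<δ)))

<⇒≄ : ∀ x y → x < y → ¬ x ≃ y
<⇒≄ x y (δ , 0<δ , x<y) x≃y = absurd (Eventually-map₂ _,_ x<y (x≃y (δ * ℚ.½) (½ε>0 0<δ)))
  where
  eq : ∀ x y d h → h ≡ d + ((x + h - y) + (y - (x + d)))
  eq = solve-∀ ℚring
  absurd : Eventually (λ i → seq x i + δ ℚ.≤ seq y i × ℚ.∣ seq x i - seq y i ∣ ℚ.≤ δ * ℚ.½) → ⊥
  absurd (N , h) = ℚ.<-irrefl refl (ℚ.<-≤-trans (½<1 0<δ) (≤-by ((seq x N + δ * ℚ.½ - seq y N) + (seq y N - (seq x N + δ))) (eq (seq x N) (seq y N) δ (δ * ℚ.½))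
    (≤⇒0≤- (∣-∣≤⁻ (seq y N) (seq x N) (subst (ℚ._≤ δ * ℚ.½) (∣⇄∣ (seq x N) (seq y N)) (proj₂ (h N ℕ.≤-refl)))) ⟨+⟩ ≤⇒0≤- (proj₁ (h N ℕ.≤-refl)))))

separated : ∀ ρ σ a b ε → 0ℚ ℚ.< ε → a + ((ε + ε) + (ε + ε)) ℚ.≤ b → ρ ≤ fromℚ a → fromℚ b ≤ σ → ρ < σ
separated ρ σ a b ε 0<ε a<b ρ≤a b≤σ = ε + ε , ℚ.+-mono-< 0<ε 0<ε , Eventually-map₂
  (λ {i} p q → ≤-by (a + ε - seq ρ i + (seq σ i + ε - b) + (b - (a + ((ε + ε) + (ε + ε))))) (eq (seq ρ i) (seq σ i) a b ε) (≤⇒0≤- p ⟨+⟩ ≤⇒0≤- q ⟨+⟩ ≤⇒0≤- a<b))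
  (≤⇒eventually ρ (fromℚ a) ρ≤a ε 0<ε) (≤⇒eventually (fromℚ b) σ b≤σ ε 0<ε)
  where
  eq : ∀ x y a b e → y ≡ x + (e + e) + (a + e - x + (y + e - b) + (b - (a + ((e + e) + (e + e)))))
  eq = solve-∀ ℚring

squeezed : ∀ ρ σ → (∀ ε → 0ℚ ℚ.< ε → ∃₂ λ a b → a ℚ.≤ b + ε × ρ ≤ fromℚ a × fromℚ b ≤ σ) → ρ ≤ σ
squeezed ρ σ between (δ , 0<δ , σ<ρ) = at (between ε (½ε>0 (½ε>0 0<δ)))
  where
  ε = δ * ℚ.½ * ℚ.½
  0<ε = ½ε>0 (½ε>0 0<δ)
  δ≡ : δ ≡ (ε + ε) + (ε + ε)
  δ≡ = trans (sym (½+½ δ)) (sym (cong₂ _+_ (½+½ (δ * ℚ.½)) (½+½ (δ * ℚ.½))))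
  eq : ∀ x y a b e → 0ℚ ≡ e + ((x - (y + ((e + e) + (e + e)))) + (a + e - x + (y + e - b) + (b + e - a)))
  eq = solve-∀ ℚring
  absurd : ∀ {a b} → a ℚ.≤ b + ε → Eventually (λ i → seq σ i + δ ℚ.≤ seq ρ i × (seq ρ i ℚ.≤ a + ε × b ℚ.≤ seq σ i + ε)) → ⊥
  absurd {a} {b} a≤b+ε (N , h) = ℚ.<-irrefl refl (ℚ.<-≤-trans 0<ε (≤-by ((seq ρ N - (seq σ N + ((ε + ε) + (ε + ε)))) + (a + ε - seq ρ N + (seq σ N + ε - b) + (b + ε - a)))
    (eq (seq ρ N) (seq σ N) a b ε)
    (≤⇒0≤- (subst (λ d → seq σ N + d ℚ.≤ seq ρ N) δ≡ (proj₁ (h N ℕ.≤-refl)))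
      ⟨+⟩ (≤⇒0≤- (proj₁ (proj₂ (h N ℕ.≤-refl))) ⟨+⟩ ≤⇒0≤- (proj₂ (proj₂ (h N ℕ.≤-refl))) ⟨+⟩ ≤⇒0≤- a≤b+ε))))
  at : (∃₂ λ a b → a ℚ.≤ b + ε × ρ ≤ fromℚ a × fromℚ b ≤ σ) → ⊥
  at (a , b , a≤b+ε , ρ≤a , b≤σ) = absurd a≤b+ε (Eventually-map₂ _,_ σ<ρ (Eventually-map₂ _,_ (≤⇒eventually ρ (fromℚ a) ρ≤a ε 0<ε) (≤⇒eventually (fromℚ b) σ b≤σ ε 0<ε)))

-- `λ₁->` needs a positive margin and so reaches only the rationals below c. The margin is taken as
-- min(ε, c), which keeps the rational non-negative.
≤-from-below : ∀ σ c → 0ℚ ℚ.< c → (∀ c′ δ → 0ℚ ℚ.≤ c′ → 0ℚ ℚ.< δ → c′ + δ ≡ c → fromℚ c′ < σ) → fromℚ c ≤ σ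
≤-from-below σ c 0<c below (ε , 0<ε , σ<c) = by-min (ℚ.⊓-sel ε c)
  where
  at : ∀ δ → 0ℚ ℚ.< δ → δ ℚ.≤ ε → δ ℚ.≤ c → ⊥
  at δ 0<δ δ≤ε δ≤c = absurd (Eventually-map₂ _,_ σ<c (proj₂ (proj₂ c-δ<σ)))
    where
    eq₀ : ∀ c d → c - d + d ≡ c
    eq₀ = solve-∀ ℚring
    c-δ<σ : fromℚ (c - δ) < σ
    c-δ<σ = below (c - δ) δ (≤⇒0≤- δ≤c) 0<δ (eq₀ c δ)
    η = proj₁ c-δ<σ
    eq : ∀ s c d e h → 0ℚ ≡ h + ((c - (s + e)) + (s - (c - d + h)) + (e - d))
    eq = solve-∀ ℚring
    absurd : Eventually (λ i → seq σ i + ε ℚ.≤ c × c - δ + η ℚ.≤ seq σ i) → ⊥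
    absurd (N , h) = ℚ.<-irrefl refl (ℚ.<-≤-trans (proj₁ (proj₂ c-δ<σ)) (≤-by ((c - (seq σ N + ε)) + (seq σ N - (c - δ + η)) + (ε - δ))
      (eq (seq σ N) c δ ε η) (≤⇒0≤- (proj₁ (h N ℕ.≤-refl)) ⟨+⟩ ≤⇒0≤- (proj₂ (h N ℕ.≤-refl)) ⟨+⟩ ≤⇒0≤- δ≤ε)))
  by-min : ε ℚ.⊓ c ≡ ε ⊎ ε ℚ.⊓ c ≡ c → ⊥
  by-min (inj₁ eq) = at ε 0<ε ℚ.≤-refl (subst (ℚ._≤ c) eq (ℚ.p⊓q≤q ε c))
  by-min (inj₂ eq) = at c 0<c (subst (ℚ._≤ ε) eq (ℚ.p⊓q≤p ε c)) ℚ.≤-refl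

module _ (H G : Hypergraph) (G-ends : Ends G) (r : ℕ) (iso : H ≅ power (suc (suc r)) G)
  {vs : List (Hypergraph.V G)} {es : List (Hypergraph.E G)} (VS : Enumerates vs) (ES : Enumerates es) (P : Point) where
  open Ends G-ends
  open Point P
  open Coefficient r P

  λ₁-≤-form : (∀ w → (∀ v → 0ℚ ℚ.≤ w v) → (∑[ e ∈ es ] qForm κ (w (src e)) (w (tgt e))) ℚ.≤ (ν + κ) * (∑[ v ∈ vs ] w v * w v)) →
    ∀ ρ → Isλ₁ (suc (suc r)) H ρ → ρ ≤ fromℚ ((+ 1 ℚ./ suc r) * (ν + fromℕ′ r))
  λ₁-≤-form form ρ isλ₁ = PowerSpectrum.λ₁-≤ H G G-ends r iso vs es VS ES μ
      (norm-≤ μ 0<μ (PG.form-lift ν κ 0<ν κ-eq form)) ρ isλ₁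
      (ℚ.nonNegative⁻¹ (+ 1 ℚ./ suc r) {{ℚ.normalize-nonNeg 1 (suc r)}} ⟨*⟩ ℚ.<⇒≤ 0<μ)
    where
    module PG = PowerGraph G G-ends r vs es VS ES
    open PG using (norm-≤)
    μ : ℚ
    μ = ν + fromℕ′ r
    0<μ : 0ℚ ℚ.< μ
    0<μ = ℚ.+-mono-<-≤ 0<ν (fromℕ′-0≤ r)

Along-tabulate : ∀ {V : Set} (Y : V → ℚ) y k {n} (g : Fin n → V) → (∀ i → Y (g i) ≡ y (k ℕ.+ toℕ i)) → Along Y y k (List.tabulate g)
Along-tabulate Y y k {zero}  g eq = tt
Along-tabulate Y y k {suc n} g eq = trans (eq zero) (cong y (ℕ.+-identityʳ k)) ,
  Along-tabulate Y y (suc k) (g ∘ suc) (λ i → trans (eq (suc i)) (cong y (ℕ.+-suc k (toℕ i))))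

module ModelSpectrum (r b l′ : ℕ) (2≤m : 2 ℕ.≤ suc (suc r)) (3≤l : 3 ℕ.≤ 3 ℕ.+ l′)
  (20≤ : 5ℚ * 4ℚ ℚ.≤ (fromℕ′ b - 5ℚ) * (1ℚ + fromℕ′ r)) where
  open Model l′ b 1
  open ModelLists l′ b 1
  open Bisection r b l′ 20≤

  private
    iso : UC (suc (suc r)) (3 ℕ.+ l′) 2≤m 3≤l (c₁₂ b 1) ≅ power (suc (suc r)) graph
    iso = ≅-sym (power-model≅ r 2≤m 3≤l)

    s : ℚ
    s = + 1 ℚ./ suc r

    _≟ᴵ_ : DecidableEquality I
    _≟ᴵ_ = decEq I-finite

  layout : Labelled I
  layout = labelled (inj₁ zero) (inj₁ (suc zero)) (List.tabulate (rim id)) (List.tabulate (inj₂ ∘ inj₁)) (inj₂ (inj₂ zero))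

  indices≡ : indices ≡ vertsU layout
  indices≡ = trans (sym (List.map-id indices)) (vertices-list id)

  ∑-edges : ∀ φ → (∑[ x ∈ indices ] φ x (f x)) ≡ val φ (edgesU layout)
  ∑-edges φ = trans (sym (∑-map (λ x → x , f x) indices (λ (a , b) → φ a b))) (cong (val φ) (edges-list id))

  λ₁-≤-point : ∀ P → 0ℚ ℚ.≤ defect P → ∀ σ → Isλ₁ (suc (suc r)) (UC (suc (suc r)) (3 ℕ.+ l′) 2≤m 3≤l (c₁₂ b 1)) σ → σ ≤ fromℚ (s * (Point.ν P + fromℕ′ r))
  λ₁-≤-point P 0≤defect = λ₁-≤-form (UC (suc (suc r)) (3 ℕ.+ l′) 2≤m 3≤l (c₁₂ b 1)) graph graph-ends r iso indices-enumerates indices-enumerates P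
    (λ w 0≤w → subst₂ ℚ._≤_ (sym (∑-edges (λ a b → qForm κ (w a) (w b)))) (cong (λ vs → (ν + κ) * (∑[ v ∈ vs ] w v * w v)) (sym indices≡))
      (Profile.U-form r b l′ P I _≟ᴵ_ w 0≤w 0≤defect layout (List.length-tabulate (rim id)) (List.length-tabulate (inj₂ ∘ inj₁))))
    where
    open Point P using (ν)
    open Coefficient r P using (κ)

  module _ (P : Point) where
    open Profile r b l′ P using (ν; κ; p) renaming (Y to y)

    eigenvector : I → ℚ
    eigenvector (inj₁ i)        = y (toℕ i)
    eigenvector (inj₂ (inj₁ _)) = p * y 0
    eigenvector (inj₂ (inj₂ _)) = p * y 1

    residual≡ : ∀ v → (ν + κ) * eigenvector v - (∑[ x ∈ indices ] qRow _≟ᴵ_ κ eigenvector v x (f x)) ≡ defect P * 𝟙 (inj₁ zero ≟ᴵ v)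
    residual≡ v = trans (cong (λ t → (ν + κ) * eigenvector v - t) (trans (∑-edges (qRow _≟ᴵ_ κ eigenvector v))
        (trans (Eigenvector.U-bil r b l′ P _≟ᴵ_ eigenvector (λ u → 𝟙 (u ≟ᴵ v)) layout (List.length-tabulate (rim id)) (List.length-tabulate (inj₂ ∘ inj₁))
            refl refl (Along-tabulate eigenvector y 2 (rim id) (λ _ → refl)) (All.tabulate⁺ (λ _ → refl)) refl)
          (cong (λ t → (ν + κ) * t - 𝟙 (inj₁ zero ≟ᴵ v) * defect P)
            (trans (cong (λ vs → ∑[ u ∈ vs ] 𝟙 (u ≟ᴵ v) * eigenvector u) (sym indices≡))
              (∑-point (_≟ᴵ v) eigenvector (unique indices-enumerates) (complete indices-enumerates v) refl sym))))))
      (eq ((ν + κ) * eigenvector v) (𝟙 (inj₁ zero ≟ᴵ v)) (defect P))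
      where
      eq : ∀ a i d → a - (a - i * d) ≡ d * i
      eq = solve-∀ ℚring

  -- The whole alternating sequence defines one eigenvector, and its ν stays at or above the t-th
  -- lower end from index t on. Its residual vanishes away from the centre and is the null defect
  -- there.
  λ₁-≥-lo : ∀ t σ → Isλ₁ (suc (suc r)) (UC (suc (suc r)) (3 ℕ.+ l′) 2≤m 3≤l (c₁₂ b 1)) σ → fromℚ (s * (loₜ t + fromℕ′ r)) ≤ σ
  λ₁-≥-lo t σ isλ₁ = ≤-from-below σ (s * (loₜ t + fromℕ′ r))
    (ℚ.positive⁻¹ s {{ℚ.normalize-pos 1 (suc r)}} ⟨*⟩⁺ ℚ.+-mono-<-≤ (Point.0<ν (Bracket.lo (brackets t))) (fromℕ′-0≤ r))
    (λ c δ 0≤c 0<δ c+δ≡ → PowerSpectrum.λ₁-> (UC (suc (suc r)) (3 ℕ.+ l′) 2≤m 3≤l (c₁₂ b 1)) graph graph-ends r iso indices indices indices-enumerates indices-enumerates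
      (λ t → Point.ν (points t)) (λ t → Coefficient.κ r (points t)) (λ t → Point.0<ν (points t)) (λ t → Coefficient.κ-eq r (points t))
      ν-cauchy (λ t → eigenvector (points t)) Y-cauchy′ residual→0 (inj₁ zero , λ t → Profile.1≤Y r b l′ (points t) 0) σ isλ₁ c δ 0≤c 0<δ
      (t , λ i t≤i → ℚ.≤-trans (ℚ.≤-reflexive c+δ≡) (*-monoˡ (ℚ.nonNegative⁻¹ s {{ℚ.normalize-nonNeg 1 (suc r)}}) (ℚ.+-monoˡ-≤ (fromℕ′ r) (proj₁ (ν-bounds t i t≤i))))))
    where
    module L = ProfileLimit r b l′ points ν-cauchy
    scaled : ∀ i → IsCauchy (λ t → Profile.p r b l′ (points t) * Profile.Y r b l′ (points t) i)
    scaled i = cauchy (mkℝ (λ t → Profile.p r b l′ (points t)) L.p-cauchy Defs.* mkℝ (λ t → Profile.Y r b l′ (points t) i) (L.Y-cauchy i))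
    Y-cauchy′ : ∀ v → IsCauchy (λ t → eigenvector (points t) v)
    Y-cauchy′ (inj₁ i)        = L.Y-cauchy (toℕ i)
    Y-cauchy′ (inj₂ (inj₁ _)) = scaled 0
    Y-cauchy′ (inj₂ (inj₂ _)) = scaled 1
    residual→0 : ∀ v → Null (λ t → PowerGraph.residual graph graph-ends r indices indices indices-enumerates indices-enumerates
      (Point.ν (points t)) (Coefficient.κ r (points t)) (Point.0<ν (points t)) (Coefficient.κ-eq r (points t)) (eigenvector (points t)) v)
    residual→0 v = Null-cong (λ t → sym (residual≡ (points t) v)) (Null-* (defect→0 L.defect-cauchy) (fromℚ (𝟙 (inj₁ zero ≟ᴵ v))))

-- The estimate by a square root

√-upper : ∀ n i → fromℕ′ n ℚ.≤ (√-seq n i + (+ 1 ℚ./ suc i)) * (√-seq n i + (+ 1 ℚ./ suc i))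
√-upper n i = *-cancelˡ (0<I ⟨*⟩⁺ 0<I) (subst₂ ℚ._≤_ left right (fromℕ′-mono (ℕ.<⇒≤ (isqrt-upper (n ℕ.* (suc i ℕ.* suc i))))))
  where
  q = isqrt (n ℕ.* (suc i ℕ.* suc i))
  I = fromℕ′ (suc i)
  e = + 1 ℚ./ suc i
  0<I = 0<fromℕ′-suc i
  left : fromℕ′ (n ℕ.* (suc i ℕ.* suc i)) ≡ I * I * fromℕ′ n
  left = trans (fromℕ′-* n (suc i ℕ.* suc i)) (trans (cong (_*_ (fromℕ′ n)) (fromℕ′-* (suc i) (suc i))) (ℚ.*-comm (fromℕ′ n) (I * I)))
  root : (√-seq n i + e) * I ≡ fromℕ′ (suc q)
  root = trans (ℚ.*-distribʳ-+ I (√-seq n i) e) (trans (cong₂ _+_ (/-fromℕ′ q i) (1/-fromℕ′ i)) (trans (ℚ.+-comm (fromℕ′ q) 1ℚ) (sym (fromℕ′-suc q))))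
  right : fromℕ′ (suc q ℕ.* suc q) ≡ I * I * ((√-seq n i + e) * (√-seq n i + e))
  right = trans (fromℕ′-* (suc q) (suc q)) (trans (sym (cong₂ _*_ root root)) (eq (√-seq n i + e) I))
    where
    eq : ∀ x y → x * y * (x * y) ≡ y * y * (x * x)
    eq = solve-∀ ℚring

0≤√-seq : ∀ n i → 0ℚ ℚ.≤ √-seq n i
0≤√-seq n i = ℚ.nonNegative⁻¹ (√-seq n i) {{ℚ.normalize-nonNeg (isqrt (n ℕ.* (suc i ℕ.* suc i))) (suc i)}}

recip-* : ∀ k → 0 ℕ.< k → ∀ i → seq (recip k) i * fromℕ′ k ≡ 1ℚ
recip-* (suc k) _ i = 1/-fromℕ′ k

-- From x² + 2 ≤ n one gets √n ≥ x + η with η = 1 / (x + 1), because η (2 x + η) ≤ 2.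
<√ : ∀ n x → 0ℚ ℚ.≤ x → x * x + 2ℚ ℚ.≤ fromℕ′ n → fromℚ x < √ n
<√ n x 0≤x h = half , ½ε>0 0<η , proj₁ arch , λ i N≤i → ≤-by ((√-seq n i + (+ 1 ℚ./ suc i) - (x + η)) + (half - (+ 1 ℚ./ suc i)))
    (trans (eq (√-seq n i) x half (+ 1 ℚ./ suc i)) (cong (λ h → x + half + ((√-seq n i + (+ 1 ℚ./ suc i) - (x + h)) + (half - (+ 1 ℚ./ suc i)))) (½+½ η)))
    (≤⇒0≤- (above i) ⟨+⟩ ≤⇒0≤- (proj₂ arch i N≤i))
  where
  0<x+1 : 0ℚ ℚ.< x + 1ℚ
  0<x+1 = ℚ.+-mono-≤-< 0≤x 0<1
  η = inv (x + 1ℚ) 0<x+1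
  0<η = 0<inv (x + 1ℚ) 0<x+1
  half = η * ℚ.½
  arch = archimedean half (½ε>0 0<η)
  eq : ∀ q x h e → q ≡ x + h + ((q + e - (x + (h + h))) + (h - e))
  eq = solve-∀ ℚring
  η≤1 : η ℚ.≤ 1ℚ
  η≤1 = subst₂ ℚ._≤_ (ℚ.*-identityʳ η) (inv-* (x + 1ℚ) 0<x+1) (*-monoˡ (ℚ.<⇒≤ 0<η) (≤-by x (ℚ.+-comm x 1ℚ) 0≤x))
  square : (x + η) * (x + η) ℚ.≤ x * x + 2ℚ
  square = ≤-by (η * (1ℚ - η) + η) (trans (cong (λ t → x * x + 2ℚ * t) (sym (inv-* (x + 1ℚ) 0<x+1))) (eq′ x η)) (ℚ.<⇒≤ 0<η ⟨*⟩ ≤⇒0≤- η≤1 ⟨+⟩ ℚ.<⇒≤ 0<η)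
    where
    eq′ : ∀ x e → x * x + 2ℚ * (e * (x + 1ℚ)) ≡ (x + e) * (x + e) + (e * (1ℚ - e) + e)
    eq′ = solve-∀ ℚring
  above : ∀ i → x + η ℚ.≤ √-seq n i + (+ 1 ℚ./ suc i)
  above i = by-cases (x + η ℚ.≤? z)
    where
    z = √-seq n i + (+ 1 ℚ./ suc i)
    0≤z : 0ℚ ℚ.≤ z
    0≤z = 0≤√-seq n i ⟨+⟩ ℚ.nonNegative⁻¹ (+ 1 ℚ./ suc i) {{ℚ.normalize-nonNeg 1 (suc i)}}
    0<x+η : 0ℚ ℚ.< x + η
    0<x+η = ℚ.+-mono-≤-< 0≤x 0<η
    by-cases : Dec (x + η ℚ.≤ z) → x + η ℚ.≤ z
    by-cases (yes p) = p
    by-cases (no ¬p) = contradiction (ℚ.≤-<-trans (*-monoʳ 0≤z (ℚ.<⇒≤ (ℚ.≰⇒> ¬p))) (ℚ.*-monoʳ-<-pos (x + η) {{ℚ.positive 0<x+η}} (ℚ.≰⇒> ¬p)))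
      (λ z²< → ℚ.<-irrefl refl (ℚ.<-≤-trans z²< (ℚ.≤-trans square (ℚ.≤-trans h (√-upper n i)))))

≤-<-trans : ∀ x y z → x ≤ y → y < z → x < z
≤-<-trans x y z x≤y (ε , 0<ε , y<z) = ε * ℚ.½ , ½ε>0 0<ε , Eventually-map₂
  (λ {i} p q → ℚ.≤-trans (ℚ.+-monoˡ-≤ (ε * ℚ.½) p) (ℚ.≤-trans (ℚ.≤-reflexive (trans (ℚ.+-assoc (seq y i) (ε * ℚ.½) (ε * ℚ.½)) (cong (_+_ (seq y i)) (½+½ ε)))) q))
  (≤⇒eventually x y x≤y (ε * ℚ.½) (½ε>0 0<ε)) y<z

module _ (r b l′ : ℕ) (2≤m : 2 ℕ.≤ suc (suc r)) (3≤l : 3 ℕ.≤ 3 ℕ.+ l′)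
  (20≤ : 5ℚ * 4ℚ ℚ.≤ (fromℕ′ b - 5ℚ) * (1ℚ + fromℕ′ r)) where
  open ModelSpectrum r b l′ 2≤m 3≤l 20≤
  open Bisection r b l′ 20≤

  private
    n = fromℕ′ r
    β = fromℕ′ b
    s : ℚ
    s = + 1 ℚ./ suc r

  -- For c = hi + m - 2 and the radicand D, the inequality s c < (m + √D) s/2 says x < √D with x = 2
  -- c - m.
  λ₁<bound : ∀ k l → k ∸ l ≡ suc b → ∀ σ → Isλ₁ (suc (suc r)) (UC (suc (suc r)) (3 ℕ.+ l′) 2≤m 3≤l (c₁₂ b 1)) σ → σ < bound (suc (suc r)) k l
  λ₁<bound k l k∸l≡ σ isλ₁ = ≤-<-trans σ (fromℚ (s * c)) (bound (suc (suc r)) k l)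
      (λ₁-≤-point (Bracket.hi (brackets t)) (Bracket.0≤hi (brackets t)) σ isλ₁)
      (below (<√ D x 0≤x x²+2≤D))
    where
    D = suc (suc r) ℕ.* suc (suc r) ℕ.+ 4 ℕ.* (k ∸ l ℕ.+ 1) ℕ.* suc r
    M = 1ℚ + (1ℚ + n)
    -- The margin 1 in `lo-small` is worth 4 in x². A bracket of width at most 1/W spends at most 2
    -- of it on passing from lo to hi, and the other 2 are what `<√` asks for.
    W = 2ℚ * (2ℚ * (β + 4ℚ) + n)
    0<W : 0ℚ ℚ.< W
    0<W = 0<2 ⟨*⟩⁺ ℚ.+-mono-<-≤ (0<2 ⟨*⟩⁺ ℚ.+-mono-≤-< (fromℕ′-0≤ b) (ℚ.positive⁻¹ 4ℚ)) (fromℕ′-0≤ r)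
    t = proj₁ (narrow (inv W 0<W) (0<inv W 0<W))
    lo = loₜ t
    hi = hiₜ t
    c = hi + n
    x = 2ℚ * c - M
    hi≤ : hi ℚ.≤ β + 4ℚ
    hi≤ = subst (λ i → hiₜ i ℚ.≤ β + 4ℚ) (ℕ.+-identityʳ t) (hi-mono 0 t)
    lo≤ : lo ℚ.≤ hi
    lo≤ = Bracket.lo≤hi (brackets t)
    M≡ : fromℕ′ (suc (suc r)) ≡ M
    M≡ = trans (fromℕ′-suc (suc r)) (cong (_+_ 1ℚ) (fromℕ′-suc r))
    D≡ : fromℕ′ D ≡ M * M + 4ℚ * (β + 2ℚ) * (1ℚ + n)
    D≡ = trans (fromℕ′-+ (suc (suc r) ℕ.* suc (suc r)) _) (cong₂ _+_ (trans (fromℕ′-* (suc (suc r)) (suc (suc r))) (cong₂ _*_ M≡ M≡))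
      (trans (fromℕ′-* (4 ℕ.* (k ∸ l ℕ.+ 1)) (suc r)) (cong₂ _*_ (trans (fromℕ′-* 4 (k ∸ l ℕ.+ 1)) (cong₂ _*_ (fromℕ′-def 4)
        (trans (cong (λ a → fromℕ′ (a ℕ.+ 1)) k∸l≡) (trans (fromℕ′-+ (suc b) 1) (trans (cong₂ _+_ (fromℕ′-suc b) fromℕ′-1) (eq β)))))) (fromℕ′-suc r))))
      where
      eq : ∀ b → 1ℚ + b + 1ℚ ≡ b + 2ℚ
      eq = solve-∀ ℚring
    lo-small : (lo - 2ℚ) * (lo + n) ℚ.≤ (β + 2ℚ) * (1ℚ + n) - 1ℚ
    lo-small = ℚ.<⇒≤ (ℚ.≰⇒> (λ h → ℚ.<-irrefl refl (ℚ.<-≤-trans (Bracket.lo<0 (brackets t)) (Sign.positive-defect r b l′ (Bracket.lo (brackets t)) h))))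
    width-small : (hi - lo) * W ℚ.≤ 1ℚ
    width-small = subst ((hi - lo) * W ℚ.≤_) (inv-* W 0<W) (*-monoʳ (ℚ.<⇒≤ 0<W) (proj₂ (narrow (inv W 0<W) (0<inv W 0<W))))
    0≤x : 0ℚ ℚ.≤ x
    0≤x = subst (0ℚ ℚ.≤_) (eq hi n) (0≤2 ⟨*⟩ ≤⇒0≤- (Point.5≤ν (Bracket.hi (brackets t))) ⟨+⟩ fromℕ′-0≤ r ⟨+⟩ ℚ.nonNegative⁻¹ (4ℚ * 2ℚ))
      where
      eq : ∀ h r → 2ℚ * (h - 5ℚ) + r + 4ℚ * 2ℚ ≡ 2ℚ * (h + r) - (1ℚ + (1ℚ + r))
      eq = solve-∀ ℚring
    -- x² = M² + 4 c (c − M), where c − M = hi − 2.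
    x²+2≤D : x * x + 2ℚ ℚ.≤ fromℕ′ D
    x²+2≤D = subst (x * x + 2ℚ ℚ.≤_) (sym D≡) (≤-by
      (4ℚ * ((β + 2ℚ) * (1ℚ + n) - 1ℚ - (lo - 2ℚ) * (lo + n)) + 2ℚ * (1ℚ - (hi - lo) * W) + 4ℚ * ((hi - lo) * (((β + 4ℚ) - hi) + ((β + 4ℚ) - hi) + (hi - lo) + 2ℚ)))
      (eq hi lo n β)
      (ℚ.nonNegative⁻¹ 4ℚ ⟨*⟩ ≤⇒0≤- lo-small ⟨+⟩ 0≤2 ⟨*⟩ ≤⇒0≤- width-small
        ⟨+⟩ ℚ.nonNegative⁻¹ 4ℚ ⟨*⟩ (≤⇒0≤- lo≤ ⟨*⟩ (≤⇒0≤- hi≤ ⟨+⟩ ≤⇒0≤- hi≤ ⟨+⟩ ≤⇒0≤- lo≤ ⟨+⟩ 0≤2))))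
      where
      eq : ∀ h l r b → (1ℚ + (1ℚ + r)) * (1ℚ + (1ℚ + r)) + 4ℚ * (b + 2ℚ) * (1ℚ + r)
        ≡ (2ℚ * (h + r) - (1ℚ + (1ℚ + r))) * (2ℚ * (h + r) - (1ℚ + (1ℚ + r))) + 2ℚ
          + (4ℚ * ((b + 2ℚ) * (1ℚ + r) - 1ℚ - (l - 2ℚ) * (l + r)) + 2ℚ * (1ℚ - (h - l) * (2ℚ * (2ℚ * (b + 4ℚ) + r))) + 4ℚ * ((h - l) * (((b + 4ℚ) - h) + ((b + 4ℚ) - h) + (h - l) + 2ℚ)))
      eq = solve-∀ ℚring
    ρ : ℕ → ℚ
    ρ = seq (recip (2 ℕ.* suc (suc r) ∸ 2))
    s* : s * (1ℚ + n) ≡ 1ℚ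
    s* = trans (cong (_*_ s) (sym (fromℕ′-suc r))) (1/-fromℕ′ r)
    ρ≡ : ∀ i → ρ i ≡ s * ℚ.½
    ρ≡ i = trans (sym (ℚ.*-identityʳ (ρ i))) (trans (cong (_*_ (ρ i)) (sym s*)) (trans (eq (ρ i) s (1ℚ + n)) (trans (cong (_*_ (s * ℚ.½)) ρ*) (ℚ.*-identityʳ (s * ℚ.½)))))
      where
      K≡ : 2 ℕ.* suc r ≡ 2 ℕ.* suc (suc r) ∸ 2
      K≡ = ℕ.*-distribˡ-∸ 2 (suc (suc r)) 1
      ρ* : ρ i * (2ℚ * (1ℚ + n)) ≡ 1ℚ
      ρ* = trans (cong (_*_ (ρ i)) (trans (sym (trans (fromℕ′-* 2 (suc r)) (cong₂ _*_ (fromℕ′-def 2) (fromℕ′-suc r)))) (cong fromℕ′ K≡)))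
        (recip-* (2 ℕ.* suc (suc r) ∸ 2) (subst (0 ℕ.<_) K≡ (s≤s z≤n)) i)
      eq : ∀ p s n → p * (s * n) ≡ s * ℚ.½ * (p * (2ℚ * n))
      eq = solve-∀ ℚring
    0<s/2 : 0ℚ ℚ.< s * ℚ.½
    0<s/2 = ½ε>0 (ℚ.positive⁻¹ s {{ℚ.normalize-pos 1 (suc r)}})
    below : fromℚ x < √ D → fromℚ (s * c) < bound (suc (suc r)) k l
    below (δ , 0<δ , N , h) = δ * (s * ℚ.½) , 0<δ ⟨*⟩⁺ 0<s/2 , N , λ i N≤i →
      subst₂ (λ m p → s * c + δ * (s * ℚ.½) ℚ.≤ (m + √-seq D i) * p) (trans (sym M≡) (fromℕ′-def (suc (suc r)))) (sym (ρ≡ i))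
        (≤-by ((√-seq D i - (x + δ)) * (s * ℚ.½)) (eq (√-seq D i) s c M δ) (≤⇒0≤- (h i N≤i) ⟨*⟩ ℚ.<⇒≤ 0<s/2))
      where
      eq : ∀ q s c m d → (m + q) * (s * ℚ.½) ≡ s * c + d * (s * ℚ.½) + (q - (2ℚ * c - m + d)) * (s * ℚ.½)
      eq = solve-∀ ℚring

-- Comparison of spectral radii

module GraphOf (H G : Hypergraph) (uniform : Hypergraph.Uniform G 2) (m : ℕ) (iso : H ≅ power m G) where
  open Hypergraph G
  open _≅_ iso

  G-ends : Ends G
  G-ends = uniform-ends G uniform

  open Ends G-ends
  open Listed G G-ends

  -- The ends may coincide: when a walk of H is projected to the graph, sending a new vertex to an
  -- end of its edge, a step may stay in place.
  Touching : V → V → Set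
  Touching u v = ∃ λ e → u ∈ e × v ∈ e

  anchor : Hypergraph.V (power m G) → V
  anchor (inj₁ v)       = v
  anchor (inj₂ (e , _)) = src e

  anchor∈ : ∀ x {e} → Hypergraph._∈_ (power m G) x e → anchor x ∈ e
  anchor∈ (inj₁ _)       v∈e  = v∈e
  anchor∈ (inj₂ (e , _)) refl = src∈ e

  graph-connected : Hypergraph.Connected H → ∀ u v → Star Touching u v
  graph-connected connected u v = subst₂ (Star Touching) (anchored u) (anchored v)
    (Star.gmap (anchor ∘ Inverse.to onV)
      (λ {x} {y} (_ , e , p , q) → Inverse.to onE e , anchor∈ (Inverse.to onV x) (Equivalence.to (incident x e) p) , anchor∈ (Inverse.to onV y) (Equivalence.to (incident y e) q))
      (connected (Inverse.from onV (inj₁ u)) (Inverse.from onV (inj₁ v))))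
    where
    anchored : ∀ v → anchor (Inverse.to onV (Inverse.from onV (inj₁ v))) ≡ v
    anchored v = cong anchor (Inverse.strictlyInverseˡ onV (inj₁ v))

  graph-normal : ∀ {l₁} → 3 ℕ.≤ suc l₁ → Hypergraph.Connected H → UnicyclicOfLength H (suc l₁) → Normal G G-ends (suc l₁)
  graph-normal {l₁} 3≤l connected unicyclic with unicyclic-transport iso unicyclic
  ... | C , only with cycle-in-graph G G-ends m C
  ...   | c , c-injective , joins = normal G G-ends (graph-connected connected) l₁ 3≤l c c-injective (LooseCycleIn.edge C ∘ next) joins m on-cycle
    where
    on-cycle : ∀ {l′} (D : LooseCycleIn (power m G) l′) i → LooseCycleIn.edge D i ∈ˡ List.tabulate (LooseCycleIn.edge C ∘ next)
    on-cycle D i with Equivalence.from (only D (LooseCycleIn.edge D i)) (i , refl)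
    ... | j , Cj≡Di with next-prev j
    ...   | j′ , refl = subst (_∈ˡ List.tabulate (LooseCycleIn.edge C ∘ next)) Cj≡Di (∈ˡ.∈-tabulate⁺ {f = LooseCycleIn.edge C ∘ next} j′)

  length-edges : ∀ {es} → Enumerates es → length es ≡ Hypergraph.#edges H
  length-edges ES = trans (↭.↭-length (enumerations-↭ ES (map-enumerates onE (elements-enumerates (Hypergraph.E-finite H)))))
    (trans (List.length-map (Inverse.to onE) (elements (Hypergraph.E-finite H))) (length-elements (Hypergraph.E-finite H)))

  linked : ∀ {L} → (∀ e → Covers L e) → ∀ {u v} → Touching u v → u ≡ v ⊎ (u , v) ∈ˡ L ⊎ (v , u) ∈ˡ L
  linked covers (e , u∈ , v∈) with Equivalence.to (ends e _) u∈ | Equivalence.to (ends e _) v∈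
  ... | inj₁ refl | inj₁ refl = inj₁ refl
  ... | inj₂ refl | inj₂ refl = inj₁ refl
  ... | inj₁ refl | inj₂ refl = inj₂ (covers e)
  ... | inj₂ refl | inj₁ refl = inj₂ ([ inj₂ , inj₁ ]′ (covers e))

  linked-star : ∀ {L} → (∀ e → Covers L e) → ∀ {u v} → Star Touching u v → Star (λ u v → (u , v) ∈ˡ L ⊎ (v , u) ∈ˡ L) u v
  linked-star covers stop     = stop
  linked-star covers (t ◅ ts) = [ (λ { refl → linked-star covers ts }) , (λ p → p ◅ linked-star covers ts) ]′ (linked covers t)

  Covers-⊆ : ∀ {L L′ e} → (∀ {p} → p ∈ˡ L → p ∈ˡ L′) → Covers L e → Covers L′ e
  Covers-⊆ L⊆ = [ inj₁ ∘ L⊆ , inj₂ ∘ L⊆ ]′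

module _ {G : Hypergraph} (G-ends : Ends G) where
  open Listed G G-ends

  power≅UC′ : ∀ {M c z rim os fs l′ a b} r (2≤m : 2 ℕ.≤ suc (suc r)) (3≤l : 3 ℕ.≤ 3 ℕ.+ l′) → Enumerates (vertsUC M c (z ∷ rim) os fs) →
    All Joined (edgesUC M c (z ∷ rim) os fs) → (∀ e → Covers (edgesUC M c (z ∷ rim) os fs) e) → length rim ≡ l′ → length os ≡ a → length fs ≡ b →
    power (suc (suc r)) G ≅ UC (suc (suc r)) (3 ℕ.+ l′) 2≤m 3≤l (c₁₂ a b)
  power≅UC′ {M} {c} {z} {rim} {os} {fs} r 2≤m 3≤l vs joined covers refl refl refl =
    ≅-trans {power (suc (suc r)) G} {power (suc (suc r)) graph} {UC (suc (suc r)) (3 ℕ.+ length rim) 2≤m 3≤l (c₁₂ (length os) (length fs))}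
      (≅-sym {power (suc (suc r)) graph} {power (suc (suc r)) G} (power-cong (suc (suc r)) {graph} {G} (listed≅ M c z rim os fs vs joined covers))) (power-model≅ r 2≤m 3≤l)
    where open Model (length rim) (length os) (length fs)

  power≅UC : ∀ {M c rim os fs l′ a b} r (2≤m : 2 ℕ.≤ suc (suc r)) (3≤l : 3 ℕ.≤ 3 ℕ.+ l′) → Enumerates (vertsUC M c rim os fs) →
    All Joined (edgesUC M c rim os fs) → (∀ e → Covers (edgesUC M c rim os fs) e) → length rim ≡ suc l′ → length os ≡ a → length fs ≡ b →
    power (suc (suc r)) G ≅ UC (suc (suc r)) (3 ℕ.+ l′) 2≤m 3≤l (c₁₂ a b)
  power≅UC {M} {c} {z ∷ rim} {os} {fs} r 2≤m 3≤l vs joined covers eq = power≅UC′ {M} {c} {z} {rim} {os} {fs} r 2≤m 3≤l vs joined covers (ℕ.suc-injective eq)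

module UnicyclicPower (r b l′ : ℕ) (2≤m : 2 ℕ.≤ suc (suc r)) (3≤l : 3 ℕ.≤ 3 ℕ.+ l′)
  (20≤ : 5ℚ * 4ℚ ℚ.≤ (fromℕ′ b - 5ℚ) * (1ℚ + fromℕ′ r))
  (H G : Hypergraph) (uniform : Hypergraph.Uniform G 2) (iso : H ≅ power (suc (suc r)) G) (connected : Hypergraph.Connected H)
  (normal-form : Normal G (uniform-ends G uniform) (3 ℕ.+ l′)) (ts≡ : length (Normal.ts normal-form) ≡ suc b) where

  open GraphOf H G uniform (suc (suc r)) iso
  open Hypergraph G
  open Ends G-ends
  open Listed G G-ends
  open Normal normal-form
  open ModelSpectrum r b l′ 2≤m 3≤l 20≤ using (λ₁-≥-lo)
  open Bisection r b l′ 20≤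

  private
    cs≡ : length cs₀ ≡ 2 ℕ.+ l′
    cs≡ = ℕ.suc-injective cycle-l

  open Extremal V (decEq V-finite) c₀ cs₀ ts forest (subst (2 ℕ.≤_) (sym cs≡) (s≤s (s≤s z≤n))) uniq full r b l′ cs≡ ts≡

  star⇒≅U₁ : UnicyclicStar → H ≅ UC (suc (suc r)) (3 ℕ.+ l′) 2≤m 3≤l (c₁₂ (suc b) 0)
  star⇒≅U₁ (M , cs , os , L↭ , vs↭ , len) = go cs L↭ vs↭ (trans len cs≡)
    where
    go : ∀ cs → L₀ ↭ pathE M cs M ++ map (_, M) os → M ∷ cs ++ os ↭ vs₀ → length cs ≡ 2 ℕ.+ l′ → H ≅ UC (suc (suc r)) (3 ℕ.+ l′) 2≤m 3≤l (c₁₂ (suc b) 0)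
    go (c ∷ cs) L↭ vs↭ len = ≅-trans {H} {power (suc (suc r)) G} iso (power≅UC G-ends {M} {c} {cs} {os} {[]} r 2≤m 3≤l
        (Enumerates-↭ (↭-trans (↭-sym vs↭) (↭.↭-reflexive (cong (λ os → M ∷ c ∷ cs ++ os) (sym (List.++-identityʳ os))))) vs₀-enumerates)
        (↭.All-resp-↭ L↭′ joined) (λ e → Covers-⊆ (↭.∈-resp-↭ L↭′) (covers e)) (ℕ.suc-injective len) os≡ refl)
      where
      L↭′ : L₀ ↭ edgesUC M c cs os []
      L↭′ = ↭-trans L↭ (↭.↭-reflexive (cong (pathE M (c ∷ cs) M ++_) (sym (List.++-identityʳ (map (_, M) os)))))
      os≡ : length os ≡ suc b
      os≡ = ℕ.+-cancelˡ-≡ (3 ℕ.+ l′) (length os) (suc b) (trans (cong (ℕ._+ length os) (cong suc (sym len)))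
        (trans (cong suc (sym (List.length-++ (c ∷ cs)))) (trans (↭.↭-length vs↭) length-vs₀)))

  first⇒≅U₂ : ∀ {M s cs os t} → L₀ ↭ edgesX M (s ∷ cs) os t s → vertsX′ M (s ∷ cs) os t ↭ vs₀ → length (s ∷ cs) ≡ length cs₀ →
    power (suc (suc r)) G ≅ UC (suc (suc r)) (3 ℕ.+ l′) 2≤m 3≤l (c₁₂ b 1)
  first⇒≅U₂ {M} {s} {cs} {os} {t} L↭ vs↭ len = power≅UC G-ends {M} {s} {cs} {os} {[ t ]} {l′} {b} {1} r 2≤m 3≤l
    (Enumerates-↭ (↭-sym vs↭) vs₀-enumerates) (↭.All-resp-↭ L↭ joined) (λ e → Covers-⊆ (↭.∈-resp-↭ L↭) (covers e))
    rim≡ (leaves-length (labelled M s cs os t) vs↭ rim≡) refl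
    where
    rim≡ : length cs ≡ suc l′
    rim≡ = ℕ.suc-injective (trans len cs≡)

  -- Reading the cycle backwards makes s the head. Membership in an edge does not see the
  -- orientation of a pair, so `joined` and `covers` carry over.
  last⇒≅U₂ : ∀ {M s cs os t} → L₀ ↭ edgesX M (cs ++ [ s ]) os t s → vertsX′ M (cs ++ [ s ]) os t ↭ vs₀ → length (cs ++ [ s ]) ≡ length cs₀ →
    power (suc (suc r)) G ≅ UC (suc (suc r)) (3 ℕ.+ l′) 2≤m 3≤l (c₁₂ b 1)
  last⇒≅U₂ {M} {s} {cs} {os} {t} L↭ vs↭ len = power≅UC G-ends {M} {s} {reverse cs} {os} {[ t ]} {l′} {b} {1} r 2≤m 3≤l
      (Enumerates-↭ (↭-trans (↭-sym vs↭) (↭-sym reversed)) vs₀-enumerates)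
      (All.++⁺ (↭.All-resp-↭ (↭-sym path↭) (All.map⁺ (All.map (λ (e , p , q) → e , q , p) (All.++⁻ˡ path joined′)))) (All.++⁻ʳ path joined′))
      (λ e → turn (Covers-⊆ (↭.∈-resp-↭ L↭) (covers e)))
      rim≡ (leaves-length (labelled M s (reverse cs) os t) (↭-trans reversed vs↭) rim≡) refl
    where
    path = pathE M (cs ++ [ s ]) M
    rest = map (_, M) os ++ [ (t , s) ]
    joined′ : All Joined (path ++ rest)
    joined′ = ↭.All-resp-↭ L↭ joined
    reverse≡ : reverse (cs ++ [ s ]) ≡ s ∷ reverse cs
    reverse≡ = List.reverse-++ cs [ s ]
    turned = pathE M (s ∷ reverse cs) M
    path↭ : turned ↭ map swap path
    path↭ = subst (λ xs → pathE M xs M ↭ map swap path) reverse≡ (pathE-reverse M (cs ++ [ s ]) M)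
    reversed : M ∷ (s ∷ reverse cs) ++ os ++ [ t ] ↭ M ∷ (cs ++ [ s ]) ++ os ++ [ t ]
    reversed = ↭-prep M (↭.++⁺ʳ (os ++ [ t ]) (subst (_↭ cs ++ [ s ]) reverse≡ (↭.↭-reverse (cs ++ [ s ]))))
    rim≡ : length (reverse cs) ≡ suc l′
    rim≡ = trans (List.length-reverse cs) (ℕ.suc-injective (trans (ℕ.+-comm 1 (length cs)) (trans (sym (List.length-++ cs)) (trans len cs≡))))
    turn : ∀ {e} → Covers (path ++ rest) e → Covers (turned ++ rest) e
    turn = [ (λ p → [ inj₂ ∘ back , inj₁ ∘ ∈ˡ.∈-++⁺ʳ turned ]′ (∈ˡ.∈-++⁻ path p))
           , (λ p → [ inj₁ ∘ back , inj₂ ∘ ∈ˡ.∈-++⁺ʳ turned ]′ (∈ˡ.∈-++⁻ path p)) ]′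
      where
      back : ∀ {x y} → (x , y) ∈ˡ path → (y , x) ∈ˡ turned ++ rest
      back p = ∈ˡ.∈-++⁺ˡ {xs = turned} (↭.∈-resp-↭ (↭-sym path↭) (∈ˡ.∈-map⁺ swap p))

  near⇒≅U₂ : ∀ {M} (C : Class M) → near C ≡ true → H ≅ UC (suc (suc r)) (3 ℕ.+ l′) 2≤m 3≤l (c₁₂ b 1)
  near⇒≅U₂ {M} (isX _ os t s L↭ vs↭ len _ (first {cs})) _ = ≅-trans iso (first⇒≅U₂ {M} {s} {cs} {os} {t} L↭ vs↭ len)
  near⇒≅U₂ {M} (isX _ os t s L↭ vs↭ len _ (last {c} {cs})) _ = ≅-trans iso (last⇒≅U₂ {M} {s} {c ∷ cs} {os} {t} L↭ vs↭ len)

  private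
    n = fromℕ′ r
    s : ℚ
    s = + 1 ℚ./ suc r
    0<s : 0ℚ ℚ.< s
    0<s = ℚ.positive⁻¹ s {{ℚ.normalize-pos 1 (suc r)}}
    s≤1 : s ℚ.≤ 1ℚ
    s≤1 = subst (s ℚ.≤_) (trans (cong (_*_ s) (sym (fromℕ′-suc r))) (1/-fromℕ′ r))
      (≤-by (s * n) (eq s n) (ℚ.<⇒≤ 0<s ⟨*⟩ fromℕ′-0≤ r))
      where
      eq : ∀ s n → s * (1ℚ + n) ≡ s + s * n
      eq = solve-∀ ℚring

  λ₁-≤-at : ∀ P → (∀ w → NonNeg w → Bound (AtPoint.κ P) (AtPoint.N P) L₀ w) → ∀ ρ → Isλ₁ (suc (suc r)) H ρ → ρ ≤ fromℚ (s * (Point.ν P + n))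
  λ₁-≤-at P form = λ₁-≤-form H G G-ends r iso vs₀-enumerates ES P
    (λ w 0≤w → subst (ℚ._≤ AtPoint.N P * norm² w) (sym (sum (qAt (AtPoint.κ P) w) (Weights.q-sym V (decEq V-finite) (AtPoint.κ P) (AtPoint.0≤κ P) w 0≤w))) (form w 0≤w))

  module _ (H≇U₁ : ¬ H ≅ UC (suc (suc r)) (3 ℕ.+ l′) 2≤m 3≤l (c₁₂ (suc b) 0)) (ρ σ : ℝ) (ρ-λ₁ : Isλ₁ (suc (suc r)) H ρ) (σ-λ₁ : Isλ₁ (suc (suc r)) (UC (suc (suc r)) (3 ℕ.+ l′) 2≤m 3≤l (c₁₂ b 1)) σ) where

    private
      no-star : ¬ UnicyclicStar
      no-star = H≇U₁ ∘ star⇒≅U₁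

    λ₁-≤-U₂ : ρ ≤ σ
    λ₁-≤-U₂ = squeezed ρ σ between
      where
      between : ∀ ε → 0ℚ ℚ.< ε → ∃₂ λ a b → a ℚ.≤ b + ε × ρ ≤ fromℚ a × fromℚ b ≤ σ
      between ε 0<ε = s * (hiₜ t + n) , s * (loₜ t + n)
        , ≤-by ((1ℚ - s) * (hiₜ t - loₜ t) + (ε - (hiₜ t - loₜ t))) (eq s (hiₜ t) (loₜ t) n ε) (≤⇒0≤- s≤1 ⟨*⟩ ≤⇒0≤- (Bracket.lo≤hi (brackets t)) ⟨+⟩ ≤⇒0≤- (proj₂ (narrow ε 0<ε)))
        , λ₁-≤-at (Bracket.hi (brackets t)) (AtPoint.form-bound (Bracket.hi (brackets t)) no-star (Bracket.0≤hi (brackets t))) ρ ρ-λ₁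
        , λ₁-≥-lo t σ σ-λ₁
        where
        t = proj₁ (narrow ε 0<ε)
        eq : ∀ s h l n e → s * (l + n) + e ≡ s * (h + n) + ((1ℚ - s) * (h - l) + (e - (h - l)))
        eq = solve-∀ ℚring

    -- H is bounded above at hi - ζ and U₂ below at lo. Brackets of width at most ζ/2 leave a
    -- difference of at least s ζ/2, four times the ε = s ζ/8 given to `separated`.
    λ₁-<-U₂ : (∀ M → near (classify M) ≡ false) → ρ < σ
    λ₁-<-U₂ far = separated ρ σ (s * (Point.ν (shifted 20≤ at-hi) + n)) (s * (loₜ t + n)) (s * (ζ 20≤ * (+ 1 ℚ./ 8))) (0<s ⟨*⟩⁺ (0<ζ 20≤ ⟨*⟩⁺ ℚ.positive⁻¹ (+ 1 ℚ./ 8)))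
        (≤-by (s * (ζ 20≤ * ℚ.½ - (hiₜ t - loₜ t))) (eq s (hiₜ t) (loₜ t) n (ζ 20≤)) (ℚ.<⇒≤ 0<s ⟨*⟩ ≤⇒0≤- (proj₂ narrowed)))
        (λ₁-≤-at (shifted 20≤ at-hi) (shift-bound 20≤ at-hi far) ρ ρ-λ₁) (λ₁-≥-lo t σ σ-λ₁)
      where
      open Strict no-star (λ u v → linked-star covers (graph-connected connected u v))
      narrowed = narrow (ζ 20≤ * ℚ.½) (½ε>0 (0<ζ 20≤))
      t = proj₁ narrowed
      at-hi : Admissible (Bracket.hi (brackets t))
      at-hi = record { 0≤defect = Bracket.0≤hi (brackets t) ; ν≤ = subst (λ i → hiₜ i ℚ.≤ fromℕ′ b + 4ℚ) (ℕ.+-identityʳ t) (hi-mono 0 t) }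
      eq : ∀ s h l n z → s * (l + n) ≡ s * (h - z + n) + ((s * (z * (+ 1 ℚ./ 8)) + s * (z * (+ 1 ℚ./ 8))) + (s * (z * (+ 1 ℚ./ 8)) + s * (z * (+ 1 ℚ./ 8)))) + s * (z * ℚ.½ - (h - l))
      eq = solve-∀ ℚring

    -- `classify` depends on the vertex M and not on the weights, so the alternative is settled by a
    -- finite search: either some vertex exhibits H as U₂, or every candidate for a maximal vertex
    -- is far and the inequality is strict.
    ≃⇒≅U₂ : ρ ≃ σ → H ≅ UC (suc (suc r)) (3 ℕ.+ l′) 2≤m 3≤l (c₁₂ b 1)
    ≃⇒≅U₂ ρ≃σ = by-cases (search V-finite (λ M → near (classify M) Bool.≟ true))
      where
      by-cases : Dec (∃ λ M → near (classify M) ≡ true) → H ≅ UC (suc (suc r)) (3 ℕ.+ l′) 2≤m 3≤l (c₁₂ b 1)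
      by-cases (yes (M , close)) = near⇒≅U₂ (classify M) close
      by-cases (no ¬close)       = contradiction ρ≃σ (<⇒≄ ρ σ (λ₁-<-U₂ (λ M → Bool.¬-not (λ close → ¬close (M , close)))))

-- The truncated difference is a true one: for b < 5 the product would be 0.
numeric-condition : ∀ b r → 20 ℕ.≤ (b ∸ 5) ℕ.* suc r → 5ℚ * 4ℚ ℚ.≤ (fromℕ′ b - 5ℚ) * (1ℚ + fromℕ′ r)
numeric-condition b r 20≤ = subst₂ ℚ._≤_ (fromℕ′-def 20) (trans (fromℕ′-* (b ∸ 5) (suc r)) (cong₂ _*_ b-5 (fromℕ′-suc r))) (fromℕ′-mono 20≤)
  where
  5≤b : 5 ℕ.≤ b
  5≤b = ℕ.≮⇒≥ (λ b<5 → ℕ.<⇒≱ (s≤s z≤n) (subst (λ a → 20 ℕ.≤ a ℕ.* suc r) (ℕ.m≤n⇒m∸n≡0 (ℕ.<⇒≤ b<5)) 20≤))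
  eq : ∀ a c → a ≡ c + a - c
  eq = solve-∀ ℚring
  b-5 : fromℕ′ (b ∸ 5) ≡ fromℕ′ b - 5ℚ
  b-5 = trans (eq (fromℕ′ (b ∸ 5)) 5ℚ) (cong (_- 5ℚ) (trans (cong (_+ fromℕ′ (b ∸ 5)) (sym (fromℕ′-def 5)))
    (trans (sym (fromℕ′-+ 5 (b ∸ 5))) (cong fromℕ′ (ℕ.m+[n∸m]≡n 5≤b)))))

module _ (r k b l′ : ℕ) (2≤m : 2 ℕ.≤ suc (suc r)) (3≤l : 3 ℕ.≤ 3 ℕ.+ l′) (H : Hypergraph) (H-power : IsPower (suc (suc r)) H)
  (connected : Hypergraph.Connected H) (unicyclic : UnicyclicOfLength H (3 ℕ.+ l′)) (#edges≡ : Hypergraph.#edges H ≡ k)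
  (k∸l≡ : k ∸ (3 ℕ.+ l′) ≡ suc b) (20≤ : 20 ℕ.≤ (b ∸ 5) ℕ.* suc r) where

  private
    G = proj₁ H-power
    uniform = proj₁ (proj₂ H-power)
    iso = proj₂ (proj₂ H-power)
    open GraphOf H G uniform (suc (suc r)) iso
    N : Normal G G-ends (3 ℕ.+ l′)
    N = graph-normal 3≤l connected unicyclic
    ts≡ : length (Normal.ts N) ≡ suc b
    ts≡ = trans (sym (ℕ.m+n∸n≡m (length (Normal.ts N)) (3 ℕ.+ l′)))
      (trans (cong (_∸ (3 ℕ.+ l′)) (trans (sym (Normal.es-l N)) (trans (length-edges (Normal.ES N)) #edges≡))) k∸l≡)

  comparison : (¬ H ≅ UC (suc (suc r)) (3 ℕ.+ l′) 2≤m 3≤l (c₁₂ (suc b) 0) →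
      (ρ σ : ℝ) → Isλ₁ (suc (suc r)) H ρ → Isλ₁ (suc (suc r)) (UC (suc (suc r)) (3 ℕ.+ l′) 2≤m 3≤l (c₁₂ b 1)) σ →
      ρ ≤ σ × (ρ ≃ σ → H ≅ UC (suc (suc r)) (3 ℕ.+ l′) 2≤m 3≤l (c₁₂ b 1)))
    × ((σ : ℝ) → Isλ₁ (suc (suc r)) (UC (suc (suc r)) (3 ℕ.+ l′) 2≤m 3≤l (c₁₂ b 1)) σ → σ < bound (suc (suc r)) k (3 ℕ.+ l′))
  comparison =
      (λ H≇U₁ ρ σ ρ-λ₁ σ-λ₁ → UP.λ₁-≤-U₂ H≇U₁ ρ σ ρ-λ₁ σ-λ₁ , UP.≃⇒≅U₂ H≇U₁ ρ σ ρ-λ₁ σ-λ₁)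
    , λ₁<bound r b l′ 2≤m 3≤l cond k (3 ℕ.+ l′) k∸l≡
    where
    cond = numeric-condition b r 20≤
    module UP = UnicyclicPower r b l′ 2≤m 3≤l cond H G uniform iso connected N ts≡

theorem3p2p1 :
    (m k l : ℕ) (2≤m : 2 ℕ.≤ m) (3≤l : 3 ℕ.≤ l) (H : Hypergraph) →
    Hypergraph.Uniform H m → Hypergraph.Linear H → IsPower m H →
    Hypergraph.Connected H → UnicyclicOfLength H l →
    Hypergraph.#edges H ≡ k →
    20 ℕ.≤ (k ∸ l ∸ 6) ℕ.* (m ∸ 1) →
    let U₁ = UC m l 2≤m 3≤l (c₁₂ (k ∸ l) 0)
        U₂ = UC m l 2≤m 3≤l (c₁₂ (k ∸ l ∸ 1) 1)
    in
    (¬ (H ≅ U₁) →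
       (ρ σ : ℝ) → Isλ₁ m H ρ → Isλ₁ m U₂ σ → ρ ≤ σ × (ρ ≃ σ → H ≅ U₂))
    ×
    ((σ : ℝ) → Isλ₁ m U₂ σ → σ < bound m k l)
theorem3p2p1 (suc zero) _ _ (s≤s ()) _
theorem3p2p1 (suc (suc r)) k l 2≤m 3≤l H _ _ H-power connected unicyclic #edges≡ 20≤ = by-size (k ∸ l) refl 20≤
  where
  Goal : (a a′ l : ℕ) → 3 ℕ.≤ l → Set
  Goal a a′ l 3≤l = (¬ H ≅ UC (suc (suc r)) l 2≤m 3≤l (c₁₂ a 0) →
      (ρ σ : ℝ) → Isλ₁ (suc (suc r)) H ρ → Isλ₁ (suc (suc r)) (UC (suc (suc r)) l 2≤m 3≤l (c₁₂ a′ 1)) σ →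
      ρ ≤ σ × (ρ ≃ σ → H ≅ UC (suc (suc r)) l 2≤m 3≤l (c₁₂ a′ 1)))
    × ((σ : ℝ) → Isλ₁ (suc (suc r)) (UC (suc (suc r)) l 2≤m 3≤l (c₁₂ a′ 1)) σ → σ < bound (suc (suc r)) k l)
  by-size : ∀ a → k ∸ l ≡ a → 20 ℕ.≤ (a ∸ 6) ℕ.* suc r → Goal (k ∸ l) (k ∸ l ∸ 1) l 3≤l
  -- The size 0 is excluded by the numerical hypothesis, whose left factor would be 0. Moreover l is
  -- rewritten as 3 + (l ∸ 3), the form in which cycle lengths are indexed.
  by-size (suc b) k∸l≡ 20≤ = subst₂ (λ a a′ → Goal a a′ l 3≤l) (sym k∸l≡) (sym k∸l∸1≡)
    (subst (λ l → (3≤l : 3 ℕ.≤ l) → UnicyclicOfLength H l → k ∸ l ≡ suc b → Goal (suc b) b l 3≤l) (ℕ.m+[n∸m]≡n 3≤l)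
      (λ 3≤l unicyclic k∸l≡ → comparison r k b (l ∸ 3) 2≤m 3≤l H H-power connected unicyclic #edges≡ k∸l≡ 20≤)
      3≤l unicyclic k∸l≡)
    where
    k∸l∸1≡ : k ∸ l ∸ 1 ≡ b
    k∸l∸1≡ = cong (_∸ 1) k∸l≡
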